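{- As power series (Laurent series where negative powers appear) in $q$, $|q|<1$: (1) \begin{align*} \sum_{n\ge0}N^{0}(0,8;2n+1)q^n=&-q^{21}g(-q^{32};q^{64})+q^5\frac{J_{32}^8J_{128}^2}{J_{16}^4J_{64}^5}+\frac{1}{4}\frac{J_{2}^8J_{8}^2}{J_{1}^4J_{4}^5}+\frac{1}{4}\frac{J_{4}^3}{J_{2}^2}+\frac{1}{2}\frac{J_{2}^5J_{16}}{J_{1}^2J_{4}^2J_{8}}-\frac{1}{2}q\frac{J_{8}^8J_{32}^2}{J_{4}^4J_{16}^5}-\frac{1}{2}q\frac{J_{16}^3}{J_{8}^2},\\ \sum_{n\ge0}N^{0}(0,8;4n+1)q^n=&\frac{1}{4}\left(\frac{J_{2}^9}{J_{1}^6J_{4}^2} +\frac{J_{2}^3}{J_{1}^2}+2\frac{J_{4}^4}{J_{8}J_{2}^2}\right),\\ \sum_{n\ge0}N^{0}(0,8;4n+3)q^n=&-q^{10}g(-q^{16};q^{32})+q^2\frac{J_{16}^8J_{64}^2}{J_{8}^4J_{32}^5}+\frac{1}{2}\frac{J_{8}^3}{J_{4}^2}+\frac{J_{4}^6}{J_{1}^2J_{2}^3}-\frac{1}{2}\frac{J_{4}^8J_{16}^2}{J_{2}^4J_{8}^5},\\ \sum_{n\ge0}N^{0}(0,8;8n+1)q^n=&\frac{1}{2}\frac{J_{2}^4}{J_{1}^2J_4}+\frac{1}{4}\frac{J_{4}^5}{J_{1}^2J_{8}^2}+\frac{1}{4}\frac{J_{2}^{12}J_{4}}{J_{1}^{10}J_{8}^2}+2q\frac{J_{2}^2J_{4}^3J_{8}^2}{J_{1}^6},\\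 \sum_{n\ge0}N^{0}(0,8;8n+3)q^n=&-q^5g(-q^8;q^{16})+q\frac{J_{8}^8J_{32}^2}{J_{4}^4J_{16}^5}+\frac{1}{2}\frac{J_{4}^3}{J_{2}^2}-\frac{1}{2}\frac{J_{2}^8J_{8}^2}{J_{1}^4J_{4}^5}+\frac{J_{2}^6J_{4}^5}{J_{1}^8J_{8}^2},\\ \sum_{n\ge0}N^{0}(0,8;8n+5)q^n=&2\frac{J_{4}^9}{J_{1}^6J_{8}^2},\qquad \sum_{n\ge0}N^{0}(0,8;8n+7)q^n=2\frac{J_{2}^8J_{8}^2}{J_{1}^8J_{4}}. \end{align*} (2) \begin{align*} \sum_{n\ge0}N^{0}(1,8;2n)q^n=&-\frac{1}{4}+\frac{1}{4}g(-1;q^4)+\frac{1}{2}q^4g(q^4;q^{16})+\frac{1}{8}\frac{J_{2}^6J_{4}}{J_{1}^4J_{8}^2}-\frac{1}{4}\frac{J_{8}^7}{J_{4}^3J_{16}^3}+\frac{1}{4}\frac{J_{2}^5J_{8}^2}{J_{1}^2J_{4}^3J_{16}},\\ \sum_{n\ge0}N^{0}(1,8;4n)q^n=&-\frac{1}{4}+\frac{1}{4}g(-1;q^2)+\frac{1}{2}q^2g(q^2;q^8)+\frac{1}{8}\frac{J_{2}^{15}}{J_{1}^8J_{4}^6},\qquad \sum_{n\ge0}N^{0}(1,8;4n+2)q^n=\frac{1}{2}\left(\frac{J_{2}^3J_{4}^2}{J_{1}^4}+\frac{J_4J_8}{J_2} \right),\\ \sum_{n\ge0}N^{0}(1,8;8n)q^n=&-\frac{1}{4}+\frac{1}{4}g(-1;q)+\frac{1}{2}qg(q;q^4)+\frac{1}{8}\frac{J_{2}^{22}}{J_{1}^{13}J_{4}^8}+2q\frac{J_{4}^8}{J_{1}^5J_{2}^2},\\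 \sum_{n\ge0}N^{0}(1,8;8n+2)q^n=&\frac{1}{2}\left(\frac{J_{2}^{16}}{J_{1}^{11}J_{4}^4}+\frac{J_2J_4}{J_1} \right),\qquad \sum_{n\ge0}N^{0}(1,8;8n+4)q^n=\frac{J_{2}^{10}}{J_{1}^9},\qquad \sum_{n\ge0}N^{0}(1,8;8n+6)q^n=2\frac{J_{2}^4J_{4}^4}{J_{1}^7}. \end{align*} (3) \begin{align*} \sum_{n\ge0}N^{0}(2,8;2n+1)q^n=&-\frac{1}{2}q^{ -1}+\frac{1}{2}q^{ -1}g(-1;q^{16})+\frac{1}{4}q^{ -1}\frac{J_{8}^{6}J_{16}}{J_{4}^4J_{32}^2}+\frac{1}{4}\frac{J_{2}^8J_{8}^2}{J_{4}^5J_{1}^4}-\frac{1}{4}\frac{J_{4}^3}{J_{2}^2},\\ \sum_{n\ge0}N^{0}(2,8;4n+1)q^n=&q\frac{J_{2}^4J_{16}^2}{J_{1}^4J_{8}},\qquad \sum_{n\ge0}N^{0}(2,8;4n+3)q^n=-\frac{1}{2}q^{ -1}+\frac{1}{2}q^{ -1}g(-1;q^8)+\frac{1}{4}q^{ -1}\frac{J_{4}^6J_{8}}{J_{2}^4J_{16}^2}+\frac{J_{4}^6}{J_{1}^2J_{2}^3},\\ \sum_{n\ge0}N^{0}(2,8;8n+1)q^n=&4q\frac{J_{2}^2J_{4}^3J_{8}^2}{J_{1}^6},\qquad \sum_{n\ge0}N^{0}(2,8;8n+3)q^n=\frac{J_{2}^6J_{4}^5}{J_{1}^8J_{8}^2},\qquad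 \sum_{n\ge0}N^{0}(2,8;8n+5)q^n=\frac{J_{2}^{14}J_{8}^2}{J_{1}^{10}J_{4}^5},\\ \sum_{n\ge0}N^{0}(2,8;8n+7)q^n=&-\frac{1}{2}q^{ -1}+\frac{1}{2}q^{ -1}g(-1;q^4)+\frac{1}{4}q^{ -1}\frac{J_{2}^6J_{4}}{J_{1}^4J_{8}^2}+2\frac{J_{2}^8J_{8}^2}{J_{1}^8J_{4}}. \end{align*} (4) \begin{align*} \sum_{n\ge0}N^{0}(3,8;2n)q^n=&-\frac{1}{4}+\frac{1}{4}g(-1;q^4)-\frac{1}{2}q^4g(q^4;q^{16})+\frac{1}{4}\frac{J_{8}^7}{J_{4}^3J_{16}^3}-\frac{1}{4}\frac{J_{2}^5J_{8}^2}{J_{1}^2J_{4}^3J_{16}}+\frac{1}{8}\frac{J_{2}^6J_{4}}{J_{1}^4J_{8}^2},\\ \sum_{n\ge0}N^{0}(3,8;4n)q^n=&-\frac{1}{4}+\frac{1}{4}g(-1;q^2)-\frac{1}{2}q^2g(q^2;q^8)+\frac{1}{4}\frac{J_{4}^7}{J_{2}^3J_{8}^3}-\frac{1}{4}\frac{J_{4}^7}{J_{2}^3J_{8}^3}+\frac{1}{8}\frac{J_{2}^{15}}{J_{4}^6J_{1}^8},\\ \sum_{n\ge0}N^{0}(3,8;4n+2)q^n=&\frac{1}{2}\left(\frac{J_{2}^3J_{4}^2}{J_{1}^4}-\frac{J_4J_8}{J_2} \right),\qquad \sum_{n\ge0}N^{0}(3,8;8n)q^n=-\frac{1}{4}+\frac{1}{4}g(-1;q)-\frac{1}{2}qg(q;q^4)+\frac{1}{8}\frac{J_{2}^{22}}{J_{1}^{13}J_{4}^8}+2q\frac{J_{4}^8}{J_{1}^5J_{2}^2},\\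 \sum_{n\ge0}N^{0}(3,8;8n+2)q^n=&\frac{1}{2}\left(\frac{J_{2}^{16}}{J_{1}^{11}J_{4}^4}-\frac{J_2J_4}{J_1} \right),\qquad \sum_{n\ge0}N^{0}(3,8;8n+4)q^n=\frac{J_{2}^{10}}{J_{1}^9},\qquad \sum_{n\ge0}N^{0}(3,8;8n+6)q^n=2\frac{J_{2}^4J_{4}^4}{J_{1}^7}. \end{align*} (5) \begin{align*} \sum_{n\ge0}N^{0}(4,8;2n+1)q^n=&q^{ -3}-q^{ -3}g(-1;q^{64})-\frac{1}{2}q^{ -3}\frac{J_{32}^6J_{64}}{J_{16}^4J_{128}^2}+\frac{1}{4}\left(\frac{J_{2}^8J_{8}^2}{J_{1}^4J_{4}^5}-2\frac{J_{2}^5J_{16}}{J_{1}^2J_{4}^2J_{8}}+\frac{J_{4}^3}{J_{2}^2} \right)+\frac{1}{2}q\left( \frac{J_{16}^3}{J_{8}^2}-\frac{J_{8}^8J_{32}^2}{J_{4}^4J_{16}^5}\right),\\ \sum_{n\ge0}N^{0}(4,8;4n+1)q^n=&\frac{1}{4}\left(\frac{J_{2}^9}{J_{1}^6J_{4}^2}-2\frac{J_{4}^4}{J_{2}^2J_{8}}+\frac{J_{2}^3}{J_{1}^2} \right),\\ \sum_{n\ge0}N^{0}(4,8;4n+3)q^n=&q^{ -2}-q^{ -2}g(-1;q^{32})-\frac{1}{2}q^{ -2}\frac{J_{16}^6J_{32}}{J_{8}^4J_{64}^2}-\frac{1}{2}\frac{J_{8}^3}{J_{4}^2}-\frac{1}{2}\frac{J_{4}^8J_{16}^2}{J_{2}^4J_{8}^5}+\frac{J_{4}^6}{J_{2}^3J_{1}^2},\\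 \sum_{n\ge0}N^{0}(4,8;8n+1)q^n=&\frac{1}{4}\frac{J_{2}^{12}J_{4}}{J_{1}^{10}J_{8}^2}+2q\frac{J_{2}^2J_{4}^3J_{8}^2}{J_{1}^6}-\frac{1}{2}\frac{J_{2}^4}{J_{1}^2J_{4}}+\frac{1}{4}\frac{J_{4}^5}{J_{1}^2J_{8}^2},\\ \sum_{n\ge0}N^{0}(4,8;8n+3)q^n=&q^{ -1}-q^{ -1}g(-1;q^{16})-\frac{1}{2}q^{ -1}\frac{J_{8}^6J_{16}}{J_{4}^4J_{32}^2}-\frac{1}{2}\frac{J_{4}^3}{J_{2}^2}-\frac{1}{2}\frac{J_{2}^8J_{8}^2}{J_{1}^4J_{4}^5}+\frac{J_{2}^6J_{4}^5}{J_{1}^8J_{8}^2},\\ \sum_{n\ge0}N^{0}(4,8;8n+5)q^n=&2\frac{J_{4}^9}{J_{1}^6J_{8}^2},\qquad \sum_{n\ge0}N^{0}(4,8;8n+7)q^n=2\frac{J_{2}^8J_{8}^2}{J_{1}^8J_{4}}. \end{align*}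
   Context: For $|q|<1$: $(a;q)_n=\prod_{k=0}^{n-1}(1-aq^k)$, $(a;q)_\infty=\prod_{k\ge0}(1-aq^k)$, $J_m=(q^m;q^m)_\infty$, and for $x$ not an integer power of $q$, \[g(x;q)=x^{ -1}\Big(-1+\sum_{n=0}^{\infty}\frac{q^{n^2}}{(x;q)_{n+1}(q/x;q)_{n}}\Big)\] (expressions such as $g(-q^{32};q^{64})$ mean this function with $x=-q^{32}$ and $q$ replaced by $q^{64}$). An odd Durfee symbol of a positive integer $n$ consists of a nonnegative integer $D$ together with two (possibly empty) non-increasing sequences of odd positive integers $a_1\ge\cdots\ge a_s$ (top row) and $b_1\ge\cdots\ge b_t$ (bottom row), all entries at most $2D+1$, with $n=\sum a_i+\sum b_j+2D^2+2D+1$; its odd rank is $s-t$. $N^{0}(a,M;n)$ is the number of odd Durfee symbols of $n$ with odd rank congruent to $a$ modulo $M$, and $N^0(a,M;0)=0$. -}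

module Defs where

open import Data.Bool using (Bool; true; false; if_then_else_)
open import Data.Nat as ℕ using (ℕ; zero; suc; _∸_; _≤ᵇ_; _<ᵇ_; _≡ᵇ_; _%_; NonZero)
open import Data.Integer as ℤ using (ℤ; +_)
open import Data.Rational as ℚ using (ℚ; 0ℚ; 1ℚ; _/_; 1/_; ≢-nonZero)
open import Data.Rational.Properties using (_≟_)
open import Data.List using (List; []; _∷_; map; concatMap; filterᵇ; length; foldr; upTo; zipWith)
open import Data.Product using (_×_; _,_)
open import Relation.Nullary using (yes; no)
open import Relation.Binary.PropositionalEquality using (_≡_)

-- parts fuel mx t : all non-increasing lists of odd positive integers,
-- each ≤ mx, summing to t  (fuel = t suffices, every part is ≥ 1)
parts : ℕ → ℕ → ℕ → List (List ℕ)
parts _ _ zero = [] ∷ []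
parts zero _ (suc _) = []
parts (suc f) mx t =
  concatMap (λ p → map (p ∷_) (parts f p (t ∸ p)))
    (filterᵇ (λ p → (p % 2 ≡ᵇ 1) Data.Bool.∧ (p ≤ᵇ t)) (upTo (suc mx)))

oddPartitionsBounded : ℕ → ℕ → List (List ℕ)
oddPartitionsBounded mx t = parts t mx t

record OddDurfee : Set where
  constructor odsym
  field
    D      : ℕ
    top    : List ℕ     -- a₁ ≥ … ≥ aₛ
    bottom : List ℕ     -- b₁ ≥ … ≥ bₜ

core : ℕ → ℕ
core D = 2 ℕ.* D ℕ.* D ℕ.+ 2 ℕ.* D ℕ.+ 1

oddDurfeeSymbols : ℕ → List OddDurfee
oddDurfeeSymbols n =
  concatMap (λ D →
    if core D ≤ᵇ n
    then (let r = n ∸ core D ; b = 2 ℕ.* D ℕ.+ 1 in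
          concatMap (λ k →
            concatMap (λ tp → map (λ bt → odsym D tp bt)
                                   (oddPartitionsBounded b (r ∸ k)))
                      (oddPartitionsBounded b k))
            (upTo (suc r)))
    else [])
    (upTo (suc n))

oddRank : OddDurfee → ℤ
oddRank s = + length (OddDurfee.top s) ℤ.- + length (OddDurfee.bottom s)

N⁰ : ℤ → (M : ℕ) → .{{NonZero M}} → ℕ → ℕ
N⁰ a M n = length (filterᵇ (λ s → ((oddRank s ℤ.- a) ℤ.%ℕ M) ≡ᵇ 0) (oddDurfeeSymbols n))

PS : Set
PS = ℕ → ℚ

sumℚ : List ℚ → ℚ
sumℚ = foldr ℚ._+_ 0ℚ

zeroₚ oneₚ : PS
zeroₚ _ = 0ℚ
oneₚ zero = 1ℚ
oneₚ (suc _) = 0ℚ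

mono : ℕ → PS
mono k n = if k ≡ᵇ n then 1ℚ else 0ℚ

_+ₚ_ _-ₚ_ _*ₚ_ : PS → PS → PS
(f +ₚ g) n = f n ℚ.+ g n
(f -ₚ g) n = f n ℚ.- g n
(f *ₚ g) n = sumℚ (map (λ k → f k ℚ.* g (n ∸ k)) (upTo (suc n)))

scaleₚ : ℚ → PS → PS
scaleₚ c f n = c ℚ.* f n

shift : ℕ → PS → PS
shift k f n = if n <ᵇ k then 0ℚ else f (n ∸ k)

recip : ℚ → ℚ
recip p with p ≟ 0ℚ
... | yes _ = 0ℚ
... | no ne = 1/_ p {{≢-nonZero ne}}

-- coefficients bₙ, …, b₀ of 1/f (meaningful when f 0 ≠ 0)
invAux : PS → ℕ → List ℚ
invAux f zero = recip (f 0) ∷ []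
invAux f (suc n) =
  let bs = invAux f n in
  (ℚ.- (recip (f 0) ℚ.* sumℚ (zipWith (λ j b → f (suc j) ℚ.* b) (upTo (suc n)) bs))) ∷ bs

invₚ : PS → PS
invₚ f n with invAux f n
... | [] = 0ℚ
... | b ∷ _ = b

prodₚ : List PS → PS
prodₚ = foldr _*ₚ_ oneₚ

-- Formal Laurent series with finitely many negative powers:
-- ⟨ v , f ⟩ stands for q^(-v) · f

record LS : Set where
  constructor ⟨_,_⟩
  field
    off : ℕ
    ser : PS

infix  4 _≈_
infixl 6 _⊕_ _⊖_
infixl 7 _⊗_ _⊘_
infixr 8 _^_

_≈_ : LS → LS → Set
⟨ u , f ⟩ ≈ ⟨ v , g ⟩ = ∀ n → shift v f n ≡ shift u g n

_⊕_ _⊖_ _⊗_ : LS → LS → LS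
⟨ u , f ⟩ ⊕ ⟨ v , g ⟩ = ⟨ u ℕ.+ v , shift v f +ₚ shift u g ⟩
⟨ u , f ⟩ ⊖ ⟨ v , g ⟩ = ⟨ u ℕ.+ v , shift v f -ₚ shift u g ⟩
⟨ u , f ⟩ ⊗ ⟨ v , g ⟩ = ⟨ u ℕ.+ v , f *ₚ g ⟩

-- division; used only with denominators having nonzero constant term
_⊘_ : LS → LS → LS
⟨ u , f ⟩ ⊘ ⟨ v , g ⟩ = ⟨ u , shift v (f *ₚ invₚ g) ⟩

↑ : PS → LS
↑ f = ⟨ 0 , f ⟩

ℓ : ℚ → LS
ℓ c = ↑ (scaleₚ c oneₚ)

q^ : ℕ → LS
q^ k = ↑ (mono k)

q⁻ : ℕ → LS
q⁻ k = ⟨ k , oneₚ ⟩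

_^_ : LS → ℕ → LS
x ^ zero = ↑ oneₚ
x ^ suc k = x ⊗ (x ^ k)

¼ ⅛ 𝟚 : ℚ
¼ = + 1 / 4
⅛ = + 1 / 8
𝟚 = + 2 / 1

-- J_m = (q^m;q^m)_∞ : coefficient of q^n is that of the finite product
-- ∏_{k=1}^{n} (1 - q^{mk}) (later factors do not affect it for m ≥ 1)

Jfin : ℕ → ℕ → PS
Jfin m K = prodₚ (map (λ k → oneₚ -ₚ mono (m ℕ.* suc k)) (upTo K))

J : ℕ → LS
J m = ↑ (λ n → Jfin m n n)

-- g(x; q^m) for x = ε q^a (ε = ±1, 0 ≤ a ≤ m):
--   g(x;q^m) = x⁻¹ ( -1 + Σ_{n≥0} q^{m n²} / ((x;q^m)_{n+1} (q^m/x;q^m)_n) )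
-- with q^m/x = ε q^{m-a} and x⁻¹ = ε q^{-a}.

poch : ℚ → ℕ → ℕ → ℕ → PS
poch ε a m N = prodₚ (map (λ k → oneₚ -ₚ scaleₚ ε (mono (a ℕ.+ m ℕ.* k))) (upTo N))

gTerm : ℚ → ℕ → ℕ → ℕ → PS
gTerm ε a m n = shift (m ℕ.* n ℕ.* n) (invₚ (poch ε a m (suc n) *ₚ poch ε (m ∸ a) m n))

-- Σ_{n ≥ 0} gTerm n : only n ≤ N contributes to the coefficient of q^N (m ≥ 1)
gSum : ℚ → ℕ → ℕ → PS
gSum ε a m N = sumℚ (map (λ n → gTerm ε a m n N) (upTo (suc N)))

gε : ℚ → ℕ → ℕ → LS
gε ε a m = ⟨ a , scaleₚ ε (gSum ε a m -ₚ oneₚ) ⟩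

-- g⁻ a m = g(-q^a ; q^m)      (so g(-1;q^m) = g⁻ 0 m)
-- g⁺ a m = g( q^a ; q^m)
g⁻ g⁺ : ℕ → ℕ → LS
g⁻ = gε (ℚ.- 1ℚ)
g⁺ = gε 1ℚ

GF : ℤ → ℕ → ℕ → LS
GF a A B = ↑ (λ n → + N⁰ a 8 (A ℕ.* n ℕ.+ B) / 1)

neg : LS → LS
neg x = ℓ (ℚ.- 1ℚ) ⊗ x

{-# OPTIONS --safe #-}
-- Put p = zq, p' = q/z and w = pp' = q².  The odd rank series, multiplied by the products in its denominators, is one of three
-- series r, s, t (to the bases q², q⁸, q⁸) that the substitution σ : z ↦ zq² permutes up to explicit products.  A suitable
-- combination H of them is invariant under σ.  As a double power series in p and p', an invariant series contains only powers
-- of w, because σ moves every other coefficient away from the diagonal; hence the value of H does not depend on z.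
-- The choice z = i evaluates H by Cauchy's identity, and z = 1, -1, ζ₈ then express the odd rank series at the eighth roots of
-- unity by mock theta functions and eta quotients.  Solving for the residue classes modulo 8 gives the formulas for
-- 2n and 2n + 1; the others follow by repeated 2-dissection with φ(q) = φ(q⁴) + 2qψ(q⁸) and φ(q)² = φ(q²)² + 4qψ(q⁴)².
--
-- The identities between q-series rest on one principle: a family U_k = a_k + b_k U_{k+1} in which every b_k has
-- positive order is determined by its coefficients.
module Submission where

open import Level using (0ℓ)
open import Algebra.Bundles using (CommutativeRing)
import Algebra.Properties.Ring as RingProperties
import Algebra.Properties.AbelianGroup as AbelianGroupProperties
import Algebra.Properties.Semiring.Mult as SemiringMult
import Relation.Binary.Reasoning.Setoid as SetoidReasoning
open import Data.Bool.Base as Bool using (Bool; true; false; if_then_else_)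
open import Data.Nat.Base as ℕ using (ℕ; zero; suc)
import Data.Nat.Properties as ℕₚ
open import Data.Integer.Base as ℤ using (ℤ; +_; -[1+_])
import Data.Integer.Properties as ℤₚ
open import Data.Fin.Base using (Fin; zero; suc)
import Data.Fin.Properties as Finₚ
open import Data.List.Base as List using (List; []; _∷_)
open import Data.Vec.Base as Vec using (Vec; []; _∷_)
open import Data.Vec.N-ary using (N-ary; _$ⁿ_)
import Data.Vec.Properties as Vecₚ
open import Data.Product.Base using (_×_; _,_; proj₁; proj₂; ∃)
open import Data.Sum.Base using (_⊎_; inj₁; inj₂)
open import Data.Empty using (⊥; ⊥-elim)
open import Data.Unit.Base using (⊤; tt)
open import Function.Base using (_∘_; id)
open import Relation.Nullary using (Dec; yes; no)
open import Relation.Binary.Definitions using (tri<; tri≈; tri>)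
open import Relation.Binary.PropositionalEquality as ≡ using (_≡_)
import Data.Nat.DivMod as DivMod
import Data.Integer.DivMod as ℤDivMod
import Defs as 𝔻
open import Data.Rational.Base as ℚ using (ℚ; mkℚ; 0ℚ; 1ℚ; ½)
import Data.Rational.Properties as ℚₚ
open import Data.Fin.Base using (inject₁)
open import Data.Nat.Tactic.RingSolver using (solve-∀)
open import Data.Integer.Tactic.RingSolver using () renaming (solve-∀ to solveℤ)
import Data.Rational.Unnormalised.Properties as ℚᵘₚ
open import Data.Rational.Unnormalised.Base using (mkℚᵘ; *≡*)

-- The substitution σ sends p' to p'/w, so it is not defined on all double power series. It is
-- replaced by a relation between a series and w^k times its image, and only the series that occur
-- in H are shown to satisfy it. Keeping p and p' as independent variables makes the diagonal
-- argument a statement about single coefficients: after p = zq, p' = q/z a diagonal monomial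
-- carries (zz')^a = 1, so the value of H forgets z. The factor p + p' in H vanishes at z = i and
-- leaves a single summand, a Durfee square sum. The roots of unity are adjoined formally, with 1,
-- ζ, i, ζi independent over the base ring: one identity at ζ splits into four with coefficients in
-- that ring, and these can be solved for the class counts. No analysis enters. Every series is the
-- solution of a recursion in a complete filtered ring, and most identities come down to a
-- polynomial identity, with explicit multipliers of the hypotheses, that is decided by normal
-- forms. The final dissections are decided in the same way, on expressions in q, eta products and
-- three mock theta symbols.

module RingTools (R : CommutativeRing 0ℓ 0ℓ) where
  open CommutativeRing R
  open RingProperties ring using (-‿distribˡ-*; -0#≈0#)
  open AbelianGroupProperties +-abelianGroup using (⁻¹-involutive; ⁻¹-∙-comm)
  open SemiringMult semiring using (×-homo-+; ×1-homo-*) renaming (_×_ to _·_)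
  open SetoidReasoning setoid

  infixr 8 _^_
  _^_ : Carrier → ℕ → Carrier
  x ^ zero = 1#
  x ^ suc n = x * x ^ n

  nat : ℕ → Carrier
  nat zero = 0#
  nat (suc k) = 1# + nat k

  ^-cong : ∀ {x y} n → x ≈ y → x ^ n ≈ y ^ n
  ^-cong zero e = refl
  ^-cong (suc n) e = *-cong e (^-cong n e)

  interchange-+ : ∀ a b c d → (a + b) + (c + d) ≈ (a + c) + (b + d)
  interchange-+ a b c d = begin
    (a + b) + (c + d) ≈⟨ +-assoc a b (c + d) ⟩
    a + (b + (c + d)) ≈⟨ +-congˡ (sym (+-assoc b c d)) ⟩
    a + ((b + c) + d) ≈⟨ +-congˡ (+-congʳ (+-comm b c)) ⟩
    a + ((c + b) + d) ≈⟨ +-congˡ (+-assoc c b d) ⟩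
    a + (c + (b + d)) ≈⟨ +-assoc a c (b + d) ⟨
    (a + c) + (b + d) ∎

  interchange-* : ∀ a b c d → (a * b) * (c * d) ≈ (a * c) * (b * d)
  interchange-* a b c d = begin
    (a * b) * (c * d) ≈⟨ *-assoc a b (c * d) ⟩
    a * (b * (c * d)) ≈⟨ *-congˡ (sym (*-assoc b c d)) ⟩
    a * ((b * c) * d) ≈⟨ *-congˡ (*-congʳ (*-comm b c)) ⟩
    a * ((c * b) * d) ≈⟨ *-congˡ (*-assoc c b d) ⟩
    a * (c * (b * d)) ≈⟨ *-assoc a c (b * d) ⟨
    (a * c) * (b * d) ∎

  ^-+ : ∀ x m n → x ^ (m ℕ.+ n) ≈ x ^ m * x ^ n
  ^-+ x zero n = sym (*-identityˡ _)
  ^-+ x (suc m) n = trans (*-congˡ (^-+ x m n)) (sym (*-assoc _ _ _))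

  minus-self : ∀ {x y} → x ≈ y → x - y ≈ 0#
  minus-self {x} {y} e = trans (+-congʳ e) (-‿inverseʳ y)

  minus-zero : ∀ {x y} → x - y ≈ 0# → x ≈ y
  minus-zero {x} {y} e = begin
    x ≈⟨ +-identityʳ x ⟨
    x + 0# ≈⟨ +-congˡ (-‿inverseˡ y) ⟨
    x + (- y + y) ≈⟨ +-assoc x (- y) y ⟨
    (x - y) + y ≈⟨ +-congʳ e ⟩
    0# + y ≈⟨ +-identityˡ y ⟩
    y ∎

  -- A linear combination of hypotheses: c₁ ⊙ h₁ ⊞ c₂ ⊙ h₂ ⊞ … vanishes.
  infixr 7 _⊙_
  infixr 6 _⊞_
  _⊙_ : ∀ c {x y} → x ≈ y → c * (x - y) ≈ 0#
  c ⊙ e = trans (*-congˡ (minus-self e)) (zeroʳ c)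

  _⊞_ : ∀ {x y} → x ≈ 0# → y ≈ 0# → x + y ≈ 0#
  a ⊞ b = trans (+-cong a b) (+-identityˡ 0#)

  -- The certificate form used throughout: once the difference is exhibited as a combination of
  -- hypotheses, only a polynomial identity free of hypotheses remains for the solver.
  linear : ∀ {x y z} → z ≈ 0# → x - y ≈ z → x ≈ y
  linear e d = minus-zero (trans d e)

  fromℤ : ℤ → Carrier
  fromℤ (+ n) = n · 1#
  fromℤ -[1+ n ] = - (suc n · 1#)

  fromℤ-⊖ : ∀ m n → fromℤ (m ℤ.⊖ n) ≈ m · 1# - n · 1#
  fromℤ-⊖ m zero = sym (trans (+-congˡ -0#≈0#) (+-identityʳ _))
  fromℤ-⊖ zero (suc n) = sym (+-identityˡ _)
  fromℤ-⊖ (suc m) (suc n) = begin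
    fromℤ (suc m ℤ.⊖ suc n) ≡⟨ ≡.cong fromℤ (ℤₚ.[1+m]⊖[1+n]≡m⊖n m n) ⟩
    fromℤ (m ℤ.⊖ n) ≈⟨ fromℤ-⊖ m n ⟩
    m · 1# - n · 1# ≈⟨ +-identityˡ _ ⟨
    0# + (m · 1# - n · 1#) ≈⟨ +-congʳ (-‿inverseʳ 1#) ⟨
    (1# - 1#) + (m · 1# - n · 1#) ≈⟨ interchange-+ 1# (- 1#) (m · 1#) (- (n · 1#)) ⟩
    suc m · 1# + (- 1# - n · 1#) ≈⟨ +-congˡ (⁻¹-∙-comm 1# (n · 1#)) ⟩
    suc m · 1# - suc n · 1# ∎

  fromℤ-+ : ∀ i j → fromℤ (i ℤ.+ j) ≈ fromℤ i + fromℤ j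
  fromℤ-+ (+ m) (+ n) = ×-homo-+ 1# m n
  fromℤ-+ (+ m) -[1+ n ] = fromℤ-⊖ m (suc n)
  fromℤ-+ -[1+ m ] (+ n) = trans (fromℤ-⊖ n (suc m)) (+-comm _ _)
  fromℤ-+ -[1+ m ] -[1+ n ] = begin
    - (suc (suc (m ℕ.+ n)) · 1#) ≡⟨ ≡.cong (λ k → - (suc k · 1#)) (≡.sym (ℕₚ.+-suc m n)) ⟩
    - ((suc m ℕ.+ suc n) · 1#) ≈⟨ -‿cong (×-homo-+ 1# (suc m) (suc n)) ⟩
    - (suc m · 1# + suc n · 1#) ≈⟨ ⁻¹-∙-comm _ _ ⟨
    - (suc m · 1#) - suc n · 1# ∎

  fromℤ-neg : ∀ i → fromℤ (ℤ.- i) ≈ - fromℤ i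
  fromℤ-neg (+ zero) = sym -0#≈0#
  fromℤ-neg (+ suc n) = refl
  fromℤ-neg -[1+ n ] = sym (⁻¹-involutive _)

  fromℤ-*⁺ : ∀ m j → fromℤ (+ m ℤ.* j) ≈ m · 1# * fromℤ j
  fromℤ-*⁺ m (+ n) = trans (reflexive (≡.cong fromℤ (≡.sym (ℤₚ.pos-* m n)))) (×1-homo-* m n)
  fromℤ-*⁺ m -[1+ n ] = begin
    fromℤ (+ m ℤ.* -[1+ n ]) ≡⟨ ≡.cong fromℤ (≡.sym (ℤₚ.neg-distribʳ-* (+ m) (+ suc n))) ⟩
    fromℤ (ℤ.- (+ m ℤ.* + suc n)) ≈⟨ fromℤ-neg (+ m ℤ.* + suc n) ⟩
    - fromℤ (+ m ℤ.* + suc n) ≈⟨ -‿cong (fromℤ-*⁺ m (+ suc n)) ⟩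
    - (m · 1# * suc n · 1#) ≈⟨ -‿cong (*-comm _ _) ⟩
    - (suc n · 1# * m · 1#) ≈⟨ -‿distribˡ-* _ _ ⟩
    - (suc n · 1#) * m · 1# ≈⟨ *-comm _ _ ⟩
    m · 1# * - (suc n · 1#) ∎

  fromℤ-* : ∀ i j → fromℤ (i ℤ.* j) ≈ fromℤ i * fromℤ j
  fromℤ-* (+ m) j = fromℤ-*⁺ m j
  fromℤ-* -[1+ m ] j = begin
    fromℤ (-[1+ m ] ℤ.* j) ≡⟨ ≡.cong fromℤ (≡.sym (ℤₚ.neg-distribˡ-* (+ suc m) j)) ⟩
    fromℤ (ℤ.- (+ suc m ℤ.* j)) ≈⟨ fromℤ-neg (+ suc m ℤ.* j) ⟩
    - fromℤ (+ suc m ℤ.* j) ≈⟨ -‿cong (fromℤ-*⁺ (suc m) j) ⟩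
    - (suc m · 1# * fromℤ j) ≈⟨ -‿distribˡ-* _ _ ⟩
    - (suc m · 1#) * fromℤ j ∎

-- Normal forms of Laurent polynomials over a commutative ring.

record Coefficients (R : CommutativeRing 0ℓ 0ℓ) : Set₁ where
  open CommutativeRing R
  field
    C : Set
    _+ᶜ_ _*ᶜ_ : C → C → C
    -ᶜ_ : C → C
    1ᶜ : C
    isZero : C → Bool
    ι : C → Carrier
    ι-+ : ∀ a b → ι (a +ᶜ b) ≈ ι a + ι b
    ι-* : ∀ a b → ι (a *ᶜ b) ≈ ι a * ι b
    ι-neg : ∀ a → ι (-ᶜ a) ≈ - ι a
    ι-1 : ι 1ᶜ ≈ 1#
    -- A zero coefficient that is missed lengthens a normal form but does not falsify it.
    isZero-sound : ∀ a → Bool.T (isZero a) → ι a ≈ 0#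

integers : (R : CommutativeRing 0ℓ 0ℓ) → Coefficients R
integers R = record
  { C = ℤ ; _+ᶜ_ = ℤ._+_ ; _*ᶜ_ = ℤ._*_ ; -ᶜ_ = ℤ.-_ ; 1ᶜ = + 1
  ; isZero = isZeroℤ ; ι = fromℤ ; ι-+ = fromℤ-+ ; ι-* = fromℤ-* ; ι-neg = fromℤ-neg
  ; ι-1 = +-identityʳ 1# ; isZero-sound = sound }
  where
  open CommutativeRing R
  open RingTools R
  isZeroℤ : ℤ → Bool
  isZeroℤ (+ zero) = true
  isZeroℤ _ = false
  sound : ∀ a → Bool.T (isZeroℤ a) → fromℤ a ≈ 0#
  sound (+ zero) _ = refl

-- Laurent polynomials in normal form: sorted lists of terms, with natural
-- exponents for the n plain variables and integer exponents for the m units.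
module Polynomials (R : CommutativeRing 0ℓ 0ℓ) (K : Coefficients R) where
  open CommutativeRing R
  open RingTools R
  open Coefficients K
  open RingProperties ring using (-‿distribˡ-*)
  open SetoidReasoning setoid

  -- Negative exponents are read as powers of the stored inverse, so that eta quotients become
  -- Laurent monomials.
  record Unit : Set where
    constructor _⟂_by_
    field
      elt inv : Carrier
      elt*inv : elt * inv ≈ 1#

  infix 3 _:=_
  infixl 6 _:+_ _:-_
  infixl 7 _:*_
  infixr 8 _:^_
  data Expr (n m : ℕ) : Set where
    nil one : Expr n m
    con : C → Expr n m
    var : Fin n → Expr n m
    unit : Fin m → ℤ → Expr n m
    _:+_ _:*_ _:-_ : Expr n m → Expr n m → Expr n m
    :-_ : Expr n m → Expr n m
    _:^_ : Expr n m → ℕ → Expr n m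

  _:=_ : ∀ {n m} → Expr n m → Expr n m → Expr n m × Expr n m
  _:=_ = _,_

  zpow : Unit → ℤ → Carrier
  zpow (x ⟂ y by _) (+ n) = x ^ n
  zpow (x ⟂ y by _) -[1+ n ] = y ^ suc n

  zpow-⊖ : ∀ u m n → zpow u (m ℤ.⊖ n) ≈ Unit.elt u ^ m * Unit.inv u ^ n
  zpow-⊖ u m zero = sym (*-identityʳ _)
  zpow-⊖ u zero (suc n) = sym (*-identityˡ _)
  zpow-⊖ u@(x ⟂ y by e) (suc m) (suc n) = begin
    zpow u (suc m ℤ.⊖ suc n) ≡⟨ ≡.cong (zpow u) (ℤₚ.[1+m]⊖[1+n]≡m⊖n m n) ⟩
    zpow u (m ℤ.⊖ n) ≈⟨ zpow-⊖ u m n ⟩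
    x ^ m * y ^ n ≈⟨ *-identityˡ _ ⟨
    1# * (x ^ m * y ^ n) ≈⟨ *-congʳ e ⟨
    (x * y) * (x ^ m * y ^ n) ≈⟨ interchange-* x y _ _ ⟩
    x ^ suc m * y ^ suc n ∎

  zpow-+ : ∀ u i j → zpow u (i ℤ.+ j) ≈ zpow u i * zpow u j
  zpow-+ (x ⟂ y by _) (+ m) (+ n) = ^-+ x m n
  zpow-+ u (+ m) -[1+ n ] = zpow-⊖ u m (suc n)
  zpow-+ u -[1+ m ] (+ n) = trans (zpow-⊖ u n (suc m)) (*-comm _ _)
  zpow-+ (x ⟂ y by _) -[1+ m ] -[1+ n ] =
    trans (reflexive (≡.cong (λ k → y ^ suc k) (≡.sym (ℕₚ.+-suc m n)))) (^-+ y (suc m) (suc n))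

  Mono : ℕ → ℕ → Set
  Mono n m = Vec ℕ n × Vec ℤ m

  Poly : ℕ → ℕ → Set
  Poly n m = List (C × Mono n m)

  ⟦_⟧ᵛ : ∀ {n} → Vec ℕ n → Vec Carrier n → Carrier
  ⟦ [] ⟧ᵛ [] = 1#
  ⟦ e ∷ es ⟧ᵛ (x ∷ xs) = x ^ e * ⟦ es ⟧ᵛ xs

  ⟦_⟧ᵘ : ∀ {m} → Vec ℤ m → Vec Unit m → Carrier
  ⟦ [] ⟧ᵘ [] = 1#
  ⟦ e ∷ es ⟧ᵘ (x ∷ xs) = zpow x e * ⟦ es ⟧ᵘ xs

  module _ {n m : ℕ} where
    1ᵐ : Mono n m
    1ᵐ = Vec.replicate n 0 , Vec.replicate m (+ 0)

    _*ᵐ_ : Mono n m → Mono n m → Mono n m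
    (a , b) *ᵐ (c , d) = Vec.zipWith ℕ._+_ a c , Vec.zipWith ℤ._+_ b d

    _≟ᵐ_ : (a b : Mono n m) → Dec (a ≡ b)
    (a , b) ≟ᵐ (c , d) with Vecₚ.≡-dec ℕₚ._≟_ a c | Vecₚ.≡-dec ℤₚ._≟_ b d
    ... | yes ≡.refl | yes ≡.refl = yes ≡.refl
    ... | no ne | _ = no (λ { ≡.refl → ne ≡.refl })
    ... | yes _ | no ne = no (λ { ≡.refl → ne ≡.refl })

  ltℕ : ∀ {k} → Vec ℕ k → Vec ℕ k → Bool → Bool
  ltℕ [] [] d = d
  ltℕ (x ∷ xs) (y ∷ ys) d = if x ℕ.<ᵇ y then true else if y ℕ.<ᵇ x then false else ltℕ xs ys d

  ltℤ : ∀ {k} → Vec ℤ k → Vec ℤ k → Bool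
  ltℤ [] [] = false
  ltℤ (x ∷ xs) (y ∷ ys) = go (x ℤ.- y) (ltℤ xs ys)
    where
    go : ℤ → Bool → Bool
    go (+ zero) d = d
    go (+ suc _) _ = false
    go -[1+ _ ] _ = true

  module _ {n m : ℕ} where
    insert : C → Mono n m → Poly n m → Poly n m
    insert c a [] = (c , a) ∷ []
    insert c a ((d , b) ∷ p) with a ≟ᵐ b
    ... | yes _ = if isZero (c +ᶜ d) then p else (c +ᶜ d , b) ∷ p
    ... | no _ = if ltℕ (proj₁ a) (proj₁ b) (ltℤ (proj₂ a) (proj₂ b))
                 then (c , a) ∷ (d , b) ∷ p else (d , b) ∷ insert c a p

    _+ᵖ_ : Poly n m → Poly n m → Poly n m
    [] +ᵖ q = q
    ((c , a) ∷ p) +ᵖ q = insert c a (p +ᵖ q)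

    scaleAdd : C → Mono n m → Poly n m → Poly n m → Poly n m
    scaleAdd c a [] q = q
    scaleAdd c a ((d , b) ∷ p) q = insert (c *ᶜ d) (a *ᵐ b) (scaleAdd c a p q)

    _*ᵖ_ : Poly n m → Poly n m → Poly n m
    [] *ᵖ q = []
    ((c , a) ∷ p) *ᵖ q = scaleAdd c a q (p *ᵖ q)

    negᵖ : Poly n m → Poly n m
    negᵖ [] = []
    negᵖ ((c , a) ∷ p) = (-ᶜ c , a) ∷ negᵖ p

    conᵖ : C → Poly n m
    conᵖ c = if isZero c then [] else (c , 1ᵐ) ∷ []

    nf : Expr n m → Poly n m
    nf nil = []
    nf one = conᵖ 1ᶜ
    nf (con c) = conᵖ c
    nf (var i) = (1ᶜ , (Vec.updateAt (Vec.replicate n 0) i (λ _ → 1) , Vec.replicate m (+ 0))) ∷ []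
    nf (unit i z) = (1ᶜ , (Vec.replicate n 0 , Vec.updateAt (Vec.replicate m (+ 0)) i (λ _ → z))) ∷ []
    nf (e :+ f) = nf e +ᵖ nf f
    nf (e :* f) = nf e *ᵖ nf f
    nf (e :- f) = nf e +ᵖ negᵖ (nf f)
    nf (:- e) = negᵖ (nf e)
    nf (e :^ zero) = conᵖ 1ᶜ
    nf (e :^ suc k) = nf e *ᵖ nf (e :^ k)

  ⟦0⟧ᵛ : ∀ {n} (xs : Vec Carrier n) → ⟦ Vec.replicate n 0 ⟧ᵛ xs ≈ 1#
  ⟦0⟧ᵛ [] = refl
  ⟦0⟧ᵛ (x ∷ xs) = trans (*-identityˡ _) (⟦0⟧ᵛ xs)

  ⟦0⟧ᵘ : ∀ {m} (us : Vec Unit m) → ⟦ Vec.replicate m (+ 0) ⟧ᵘ us ≈ 1#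
  ⟦0⟧ᵘ [] = refl
  ⟦0⟧ᵘ (u ∷ us) = trans (*-identityˡ _) (⟦0⟧ᵘ us)

  ⟦1⟧ᵛ : ∀ {n} i (xs : Vec Carrier n) →
         ⟦ Vec.updateAt (Vec.replicate n 0) i (λ _ → 1) ⟧ᵛ xs ≈ Vec.lookup xs i
  ⟦1⟧ᵛ zero (x ∷ xs) = trans (*-cong (*-identityʳ x) (⟦0⟧ᵛ xs)) (*-identityʳ x)
  ⟦1⟧ᵛ (suc i) (x ∷ xs) = trans (*-identityˡ _) (⟦1⟧ᵛ i xs)

  ⟦1⟧ᵘ : ∀ {m} i z (us : Vec Unit m) →
         ⟦ Vec.updateAt (Vec.replicate m (+ 0)) i (λ _ → z) ⟧ᵘ us ≈ zpow (Vec.lookup us i) z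
  ⟦1⟧ᵘ zero z (u ∷ us) = trans (*-congˡ (⟦0⟧ᵘ us)) (*-identityʳ _)
  ⟦1⟧ᵘ (suc i) z (u ∷ us) = trans (*-identityˡ _) (⟦1⟧ᵘ i z us)

  ⟦+⟧ᵛ : ∀ {n} (a b : Vec ℕ n) xs → ⟦ Vec.zipWith ℕ._+_ a b ⟧ᵛ xs ≈ ⟦ a ⟧ᵛ xs * ⟦ b ⟧ᵛ xs
  ⟦+⟧ᵛ [] [] [] = sym (*-identityˡ 1#)
  ⟦+⟧ᵛ (a ∷ as) (b ∷ bs) (x ∷ xs) =
    trans (*-cong (^-+ x a b) (⟦+⟧ᵛ as bs xs)) (interchange-* _ _ _ _)

  ⟦+⟧ᵘ : ∀ {m} (a b : Vec ℤ m) us → ⟦ Vec.zipWith ℤ._+_ a b ⟧ᵘ us ≈ ⟦ a ⟧ᵘ us * ⟦ b ⟧ᵘ us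
  ⟦+⟧ᵘ [] [] [] = sym (*-identityˡ 1#)
  ⟦+⟧ᵘ (a ∷ as) (b ∷ bs) (u ∷ us) =
    trans (*-cong (zpow-+ u a b) (⟦+⟧ᵘ as bs us)) (interchange-* _ _ _ _)

  module Semantics {n m : ℕ} (us : Vec Unit m) (xs : Vec Carrier n) where
    ⟦_⟧ : Expr n m → Carrier
    ⟦ nil ⟧ = 0#
    ⟦ one ⟧ = 1#
    ⟦ con c ⟧ = ι c
    ⟦ var i ⟧ = Vec.lookup xs i
    ⟦ unit i z ⟧ = zpow (Vec.lookup us i) z
    ⟦ e :+ f ⟧ = ⟦ e ⟧ + ⟦ f ⟧
    ⟦ e :* f ⟧ = ⟦ e ⟧ * ⟦ f ⟧
    ⟦ e :- f ⟧ = ⟦ e ⟧ - ⟦ f ⟧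
    ⟦ :- e ⟧ = - ⟦ e ⟧
    ⟦ e :^ k ⟧ = ⟦ e ⟧ ^ k

    ⟦_⟧ᵐ : Mono n m → Carrier
    ⟦ a , b ⟧ᵐ = ⟦ a ⟧ᵛ xs * ⟦ b ⟧ᵘ us

    ⟦_⟧ᵖ : Poly n m → Carrier
    ⟦ [] ⟧ᵖ = 0#
    ⟦ (c , a) ∷ p ⟧ᵖ = ι c * ⟦ a ⟧ᵐ + ⟦ p ⟧ᵖ

    1ᵐ-sound : ⟦ 1ᵐ ⟧ᵐ ≈ 1#
    1ᵐ-sound = trans (*-cong (⟦0⟧ᵛ xs) (⟦0⟧ᵘ us)) (*-identityˡ 1#)

    *ᵐ-sound : ∀ a b → ⟦ a *ᵐ b ⟧ᵐ ≈ ⟦ a ⟧ᵐ * ⟦ b ⟧ᵐ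
    *ᵐ-sound (a , b) (c , d) = trans (*-cong (⟦+⟧ᵛ a c xs) (⟦+⟧ᵘ b d us)) (interchange-* _ _ _ _)

    drop-zero : ∀ c (x : Carrier) (p q : Poly n m) → (Bool.T (isZero c) → ⟦ p ⟧ᵖ ≈ x) → ⟦ q ⟧ᵖ ≈ x →
                ⟦ if isZero c then p else q ⟧ᵖ ≈ x
    drop-zero c x p q hp hq with isZero c
    ... | true = hp tt
    ... | false = hq

    swap-terms : ∀ a b d → a + (b + d) ≈ b + (a + d)
    swap-terms a b d = trans (sym (+-assoc a b d)) (trans (+-congʳ (+-comm a b)) (+-assoc b a d))

    insert-sound : ∀ c a p → ⟦ insert c a p ⟧ᵖ ≈ ι c * ⟦ a ⟧ᵐ + ⟦ p ⟧ᵖ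
    insert-sound c a [] = refl
    insert-sound c a ((d , b) ∷ p) with a ≟ᵐ b
    ... | yes ≡.refl = drop-zero (c +ᶜ d) _ p _
            (λ z → begin
               ⟦ p ⟧ᵖ ≈⟨ +-identityˡ _ ⟨
               0# + ⟦ p ⟧ᵖ ≈⟨ +-congʳ (trans (*-congʳ (isZero-sound _ z)) (zeroˡ _)) ⟨
               ι (c +ᶜ d) * ⟦ a ⟧ᵐ + ⟦ p ⟧ᵖ ≈⟨ merged ⟩
               ι c * ⟦ a ⟧ᵐ + (ι d * ⟦ a ⟧ᵐ + ⟦ p ⟧ᵖ) ∎)
            merged
      where
      merged : ι (c +ᶜ d) * ⟦ a ⟧ᵐ + ⟦ p ⟧ᵖ ≈ ι c * ⟦ a ⟧ᵐ + (ι d * ⟦ a ⟧ᵐ + ⟦ p ⟧ᵖ)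
      merged = trans (+-congʳ (trans (*-congʳ (ι-+ c d)) (distribʳ _ _ _))) (+-assoc _ _ _)
    ... | no _ with ltℕ (proj₁ a) (proj₁ b) (ltℤ (proj₂ a) (proj₂ b))
    ...   | true = refl
    ...   | false = trans (+-congˡ (insert-sound c a p)) (swap-terms _ _ _)

    +ᵖ-sound : ∀ p q → ⟦ p +ᵖ q ⟧ᵖ ≈ ⟦ p ⟧ᵖ + ⟦ q ⟧ᵖ
    +ᵖ-sound [] q = sym (+-identityˡ _)
    +ᵖ-sound ((c , a) ∷ p) q = begin
      ⟦ insert c a (p +ᵖ q) ⟧ᵖ ≈⟨ insert-sound c a (p +ᵖ q) ⟩
      ι c * ⟦ a ⟧ᵐ + ⟦ p +ᵖ q ⟧ᵖ ≈⟨ +-congˡ (+ᵖ-sound p q) ⟩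
      ι c * ⟦ a ⟧ᵐ + (⟦ p ⟧ᵖ + ⟦ q ⟧ᵖ) ≈⟨ +-assoc _ _ _ ⟨
      (ι c * ⟦ a ⟧ᵐ + ⟦ p ⟧ᵖ) + ⟦ q ⟧ᵖ ∎

    scaleAdd-sound : ∀ c a p q → ⟦ scaleAdd c a p q ⟧ᵖ ≈ ι c * ⟦ a ⟧ᵐ * ⟦ p ⟧ᵖ + ⟦ q ⟧ᵖ
    scaleAdd-sound c a [] q = sym (trans (+-congʳ (zeroʳ _)) (+-identityˡ _))
    scaleAdd-sound c a ((d , b) ∷ p) q = begin
      ⟦ insert (c *ᶜ d) (a *ᵐ b) (scaleAdd c a p q) ⟧ᵖ ≈⟨ insert-sound _ _ (scaleAdd c a p q) ⟩
      ι (c *ᶜ d) * ⟦ a *ᵐ b ⟧ᵐ + ⟦ scaleAdd c a p q ⟧ᵖ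
        ≈⟨ +-cong (*-cong (ι-* c d) (*ᵐ-sound a b)) (scaleAdd-sound c a p q) ⟩
      (ι c * ι d) * (⟦ a ⟧ᵐ * ⟦ b ⟧ᵐ) + (ι c * ⟦ a ⟧ᵐ * ⟦ p ⟧ᵖ + ⟦ q ⟧ᵖ)
        ≈⟨ +-congʳ (interchange-* _ _ _ _) ⟩
      (ι c * ⟦ a ⟧ᵐ) * (ι d * ⟦ b ⟧ᵐ) + (ι c * ⟦ a ⟧ᵐ * ⟦ p ⟧ᵖ + ⟦ q ⟧ᵖ) ≈⟨ +-assoc _ _ _ ⟨
      ((ι c * ⟦ a ⟧ᵐ) * (ι d * ⟦ b ⟧ᵐ) + ι c * ⟦ a ⟧ᵐ * ⟦ p ⟧ᵖ) + ⟦ q ⟧ᵖ ≈⟨ +-congʳ (distribˡ _ _ _) ⟨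
      ι c * ⟦ a ⟧ᵐ * (ι d * ⟦ b ⟧ᵐ + ⟦ p ⟧ᵖ) + ⟦ q ⟧ᵖ ∎

    *ᵖ-sound : ∀ p q → ⟦ p *ᵖ q ⟧ᵖ ≈ ⟦ p ⟧ᵖ * ⟦ q ⟧ᵖ
    *ᵖ-sound [] q = sym (zeroˡ _)
    *ᵖ-sound ((c , a) ∷ p) q = begin
      ⟦ scaleAdd c a q (p *ᵖ q) ⟧ᵖ ≈⟨ scaleAdd-sound c a q (p *ᵖ q) ⟩
      ι c * ⟦ a ⟧ᵐ * ⟦ q ⟧ᵖ + ⟦ p *ᵖ q ⟧ᵖ ≈⟨ +-congˡ (*ᵖ-sound p q) ⟩
      ι c * ⟦ a ⟧ᵐ * ⟦ q ⟧ᵖ + ⟦ p ⟧ᵖ * ⟦ q ⟧ᵖ ≈⟨ distribʳ _ _ _ ⟨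
      (ι c * ⟦ a ⟧ᵐ + ⟦ p ⟧ᵖ) * ⟦ q ⟧ᵖ ∎

    negᵖ-sound : ∀ p → ⟦ negᵖ p ⟧ᵖ ≈ - ⟦ p ⟧ᵖ
    negᵖ-sound [] = sym (RingProperties.-0#≈0# ring)
    negᵖ-sound ((c , a) ∷ p) = begin
      ι (-ᶜ c) * ⟦ a ⟧ᵐ + ⟦ negᵖ p ⟧ᵖ ≈⟨ +-cong (*-congʳ (ι-neg c)) (negᵖ-sound p) ⟩
      - ι c * ⟦ a ⟧ᵐ - ⟦ p ⟧ᵖ ≈⟨ +-congʳ (-‿distribˡ-* _ _) ⟨
      - (ι c * ⟦ a ⟧ᵐ) - ⟦ p ⟧ᵖ ≈⟨ AbelianGroupProperties.⁻¹-∙-comm +-abelianGroup _ _ ⟩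
      - (ι c * ⟦ a ⟧ᵐ + ⟦ p ⟧ᵖ) ∎

    conᵖ-sound : ∀ c → ⟦ conᵖ c ⟧ᵖ ≈ ι c
    conᵖ-sound c = drop-zero c _ [] _ (λ z → sym (isZero-sound c z))
      (trans (+-identityʳ _) (trans (*-congˡ 1ᵐ-sound) (*-identityʳ _)))

    nf-sound : ∀ e → ⟦ nf e ⟧ᵖ ≈ ⟦ e ⟧
    nf-sound nil = refl
    nf-sound one = trans (conᵖ-sound 1ᶜ) ι-1
    nf-sound (con c) = conᵖ-sound c
    nf-sound (var i) = trans (+-identityʳ _) (trans (*-cong ι-1
      (trans (*-cong (⟦1⟧ᵛ i xs) (⟦0⟧ᵘ us)) (*-identityʳ _))) (*-identityˡ _))
    nf-sound (unit i z) = trans (+-identityʳ _) (trans (*-cong ι-1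
      (trans (*-cong (⟦0⟧ᵛ xs) (⟦1⟧ᵘ i z us)) (*-identityˡ _))) (*-identityˡ _))
    nf-sound (e :+ f) = trans (+ᵖ-sound (nf e) (nf f)) (+-cong (nf-sound e) (nf-sound f))
    nf-sound (e :* f) = trans (*ᵖ-sound (nf e) (nf f)) (*-cong (nf-sound e) (nf-sound f))
    nf-sound (e :- f) = trans (+ᵖ-sound (nf e) (negᵖ (nf f)))
      (+-cong (nf-sound e) (trans (negᵖ-sound (nf f)) (-‿cong (nf-sound f))))
    nf-sound (:- e) = trans (negᵖ-sound (nf e)) (-‿cong (nf-sound e))
    nf-sound (e :^ zero) = trans (conᵖ-sound 1ᶜ) ι-1
    nf-sound (e :^ suc k) = trans (*ᵖ-sound (nf e) (nf (e :^ k))) (*-cong (nf-sound e) (nf-sound (e :^ k)))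

  equation : ∀ n m → N-ary n (Expr n m) (Expr n m × Expr n m) → Expr n m × Expr n m
  equation n m f = f $ⁿ Vec.map var (Vec.allFin n)

  -- Proof by computation: the premise holds by reflexivity as soon as both normal forms evaluate to
  -- the same list of terms.
  solveᵘ : ∀ {n m} (us : Vec Unit m) (xs : Vec Carrier n) (f : N-ary n (Expr n m) (Expr n m × Expr n m)) →
           nf (proj₁ (equation n m f)) ≡ nf (proj₂ (equation n m f)) →
           Semantics.⟦_⟧ us xs (proj₁ (equation n m f)) ≈ Semantics.⟦_⟧ us xs (proj₂ (equation n m f))
  solveᵘ {n} {m} us xs f eq =
    trans (sym (nf-sound (proj₁ (equation n m f))))
          (trans (reflexive (≡.cong ⟦_⟧ᵖ eq)) (nf-sound (proj₂ (equation n m f))))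
    where open Semantics us xs

  solve : ∀ {n} (xs : Vec Carrier n) (f : N-ary n (Expr n 0) (Expr n 0 × Expr n 0)) →
          nf (proj₁ (equation n 0 f)) ≡ nf (proj₂ (equation n 0 f)) →
          Semantics.⟦_⟧ [] xs (proj₁ (equation n 0 f)) ≈ Semantics.⟦_⟧ [] xs (proj₂ (equation n 0 f))
  solve = solveᵘ []

  infix 4 _⇒_
  _⇒_ : ∀ {n m} → Expr n m → Expr n m → Expr n m × Expr n m
  _⇒_ = _,_

  Rules : ℕ → ℕ → Set
  Rules n m = List (Expr n m × Expr n m)

  replace : ∀ {n m} → Fin n → Expr n m → Expr n m → Expr n m
  replace i r (var j) with i Finₚ.≟ j
  ... | yes _ = r
  ... | no _ = var j
  replace i r (e :+ f) = replace i r e :+ replace i r f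
  replace i r (e :* f) = replace i r e :* replace i r f
  replace i r (e :- f) = replace i r e :- replace i r f
  replace i r (:- e) = :- replace i r e
  replace i r (e :^ k) = replace i r e :^ k
  replace i r e = e

  -- Only a rule whose left side is a variable acts, as a substitution. A later rule also reaches
  -- the variables brought in by an earlier one, so the order of the rules is an elimination order.
  rewrites : ∀ {n m} → Rules n m → Expr n m → Expr n m
  rewrites [] e = e
  rewrites ((var i , r) ∷ rs) e = rewrites rs (replace i r e)
  rewrites (_ ∷ rs) e = rewrites rs e

  module _ {n m : ℕ} (us : Vec Unit m) (xs : Vec Carrier n) where
    open Semantics us xs

    Hypotheses : Rules n m → Set
    Hypotheses [] = ⊤
    Hypotheses ((l , r) ∷ rs) = ⟦ l ⟧ ≈ ⟦ r ⟧ × Hypotheses rs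

    replace-sound : ∀ i r → ⟦ var i ⟧ ≈ ⟦ r ⟧ → ∀ e → ⟦ e ⟧ ≈ ⟦ replace i r e ⟧
    replace-sound i r h (var j) with i Finₚ.≟ j
    ... | yes ≡.refl = h
    ... | no _ = refl
    replace-sound i r h (e :+ f) = +-cong (replace-sound i r h e) (replace-sound i r h f)
    replace-sound i r h (e :* f) = *-cong (replace-sound i r h e) (replace-sound i r h f)
    replace-sound i r h (e :- f) = +-cong (replace-sound i r h e) (-‿cong (replace-sound i r h f))
    replace-sound i r h (:- e) = -‿cong (replace-sound i r h e)
    replace-sound i r h (e :^ k) = ^-cong k (replace-sound i r h e)
    replace-sound i r h nil = refl
    replace-sound i r h one = refl
    replace-sound i r h (con c) = refl
    replace-sound i r h (unit j z) = refl

    rewrites-sound : ∀ rs → Hypotheses rs → ∀ e → ⟦ e ⟧ ≈ ⟦ rewrites rs e ⟧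
    rewrites-sound [] _ e = refl
    rewrites-sound ((var i , r) ∷ rs) (h , hs) e =
      trans (replace-sound i r h e) (rewrites-sound rs hs (replace i r e))
    rewrites-sound ((nil , r) ∷ rs) (h , hs) e = rewrites-sound rs hs e
    rewrites-sound ((one , r) ∷ rs) (h , hs) e = rewrites-sound rs hs e
    rewrites-sound ((con _ , r) ∷ rs) (h , hs) e = rewrites-sound rs hs e
    rewrites-sound ((unit _ _ , r) ∷ rs) (h , hs) e = rewrites-sound rs hs e
    rewrites-sound ((_ :+ _ , r) ∷ rs) (h , hs) e = rewrites-sound rs hs e
    rewrites-sound ((_ :* _ , r) ∷ rs) (h , hs) e = rewrites-sound rs hs e
    rewrites-sound ((_ :- _ , r) ∷ rs) (h , hs) e = rewrites-sound rs hs e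
    rewrites-sound ((:- _ , r) ∷ rs) (h , hs) e = rewrites-sound rs hs e
    rewrites-sound ((_ :^ _ , r) ∷ rs) (h , hs) e = rewrites-sound rs hs e

  problem : ∀ n m → N-ary n (Expr n m) (Rules n m × Expr n m × Expr n m) → Rules n m × Expr n m × Expr n m
  problem n m f = f $ⁿ Vec.map var (Vec.allFin n)

  -- Proves an equation after applying the rules  variable ⇒ expression  in the order given.
  elimᵘ : ∀ {n m} (us : Vec Unit m) (xs : Vec Carrier n)
          (f : N-ary n (Expr n m) (Rules n m × Expr n m × Expr n m)) →
          let rs , l , r = problem n m f in
          Hypotheses us xs rs → nf (rewrites rs l) ≡ nf (rewrites rs r) →
          Semantics.⟦_⟧ us xs l ≈ Semantics.⟦_⟧ us xs r
  elimᵘ {n} {m} us xs f hs eq = begin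
      ⟦ l ⟧ ≈⟨ rewrites-sound us xs rs hs l ⟩
      ⟦ rewrites rs l ⟧ ≈⟨ nf-sound (rewrites rs l) ⟨
      ⟦ nf (rewrites rs l) ⟧ᵖ ≡⟨ ≡.cong ⟦_⟧ᵖ eq ⟩
      ⟦ nf (rewrites rs r) ⟧ᵖ ≈⟨ nf-sound (rewrites rs r) ⟩
      ⟦ rewrites rs r ⟧ ≈⟨ rewrites-sound us xs rs hs r ⟨
      ⟦ r ⟧ ∎
    where
    open Semantics us xs
    rs = proj₁ (problem n m f)
    l = proj₁ (proj₂ (problem n m f))
    r = proj₂ (proj₂ (problem n m f))

  elim : ∀ {n} (xs : Vec Carrier n) (f : N-ary n (Expr n 0) (Rules n 0 × Expr n 0 × Expr n 0)) →
         let rs , l , r = problem n 0 f in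
         Hypotheses [] xs rs → nf (rewrites rs l) ≡ nf (rewrites rs r) →
         Semantics.⟦_⟧ [] xs l ≈ Semantics.⟦_⟧ [] xs r
  elim = elimᵘ []

module IntegerSolver (R : CommutativeRing 0ℓ 0ℓ) where
  open Polynomials R (integers R) public
    using (solve; elim; _⇒_; nil; one; con; _:+_; _:*_; _:-_; :-_; _:^_; _:=_)

-- Complete filtered rings, recursive families and infinite products.

record CompleteRing : Set₁ where
  field
    commutativeRing : CommutativeRing 0ℓ 0ℓ
  open CommutativeRing commutativeRing public hiding (zero)
  field
    -- `Ord n x` reads: x lies in the n-th ideal of a decreasing filtration.
    Ord : ℕ → Carrier → Set
    ord-resp : ∀ {n x y} → x ≈ y → Ord n x → Ord n y
    ord-0# : ∀ n → Ord n 0#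
    ord-zero : ∀ x → Ord 0 x
    ord-+ : ∀ {n x y} → Ord n x → Ord n y → Ord n (x + y)
    ord-* : ∀ {m n x y} → Ord m x → Ord n y → Ord (m ℕ.+ n) (x * y)
    ord-≤ : ∀ {m n x} → m ℕ.≤ n → Ord n x → Ord m x
    separated : ∀ {x} → (∀ n → Ord n x) → x ≈ 0#
    -- A junk value unless the sequence converges.
    lim : (ℕ → Carrier) → Carrier
    lim-law : ∀ f → (∀ n → Ord n (f (suc n) - f n)) → ∀ n → Ord n (lim f - f n)

module Series (S : CompleteRing) where
  open CompleteRing S public
  open RingTools commutativeRing public
  open IntegerSolver commutativeRing public

  ord-*ʳ : ∀ {n} x {y} → Ord n y → Ord n (x * y)
  ord-*ʳ x o = ord-* (ord-zero x) o

  ord-*ˡ : ∀ {n x} y → Ord n x → Ord n (x * y)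
  ord-*ˡ {x = x} y o = ord-resp (*-comm y x) (ord-*ʳ y o)

  ord-neg : ∀ {n x} → Ord n x → Ord n (- x)
  ord-neg {x = x} o = ord-resp (solve (x ∷ []) (λ x → (:- one) :* x := :- x) ≡.refl) (ord-*ʳ _ o)

  ord-sub : ∀ {n x y} → Ord n x → Ord n y → Ord n (x - y)
  ord-sub o o' = ord-+ o (ord-neg o')

  ord-≈0 : ∀ {x} n → x ≈ 0# → Ord n x
  ord-≈0 n e = ord-resp (sym e) (ord-0# n)

  ord-swap : ∀ {n x y} → Ord n (x - y) → Ord n (y - x)
  ord-swap {x = x} {y} o = ord-resp (solve (x ∷ y ∷ []) (λ x y → :- (x :- y) := y :- x) ≡.refl) (ord-neg o)

  ord-join : ∀ {n x} y {z} → Ord n (x - y) → Ord n (y - z) → Ord n (x - z)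
  ord-join {x = x} y {z} o o' =
    ord-resp (solve (x ∷ y ∷ z ∷ []) (λ x y z → (x :- y) :+ (y :- z) := x :- z) ≡.refl) (ord-+ o o')

  ord-^ : ∀ {Q} n → Ord 1 Q → Ord n (Q ^ n)
  ord-^ zero o = ord-zero _
  ord-^ (suc n) o = ord-* o (ord-^ n o)

  ord-geo : ∀ {Q} x n → Ord 1 Q → Ord n (x * Q ^ n)
  ord-geo x n o = ord-*ʳ x (ord-^ n o)

  -- Unfolding the recursion n times produces a factor of order n, and an element of every order is
  -- 0.
  contract : ∀ (b V : ℕ → Carrier) → (∀ k → Ord 1 (b k)) → (∀ k → V k ≈ b k * V (suc k)) →
             ∀ k → V k ≈ 0#
  contract b V ob e k = separated (λ n → go n k)
    where
    go : ∀ n k → Ord n (V k)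
    go zero k = ord-zero _
    go (suc n) k = ord-resp (sym (e k)) (ord-* (ob k) (go n (suc k)))

  -- Here smallness comes from the tail: after n unfoldings `V k` is a multiple of `V (n + k)`,
  -- which has order n + k. The multipliers may have order 0.
  persist : ∀ (c V : ℕ → Carrier) → (∀ k → Ord k (V k)) → (∀ k → V k ≈ c k * V (suc k)) →
            ∀ k → V k ≈ 0#
  persist c V ov e k = separated (λ n → ord-≤ (ℕₚ.m≤m+n n k) (go n k))
    where
    go : ∀ n k → Ord (n ℕ.+ k) (V k)
    go zero k = ov k
    go (suc n) k = ord-resp (sym (e k))
      (ord-*ʳ (c k) (≡.subst (λ i → Ord i (V (suc k))) (ℕₚ.+-suc n k) (go n (suc k))))

  stationary : ∀ (U : ℕ → Carrier) L → (∀ k → U k ≈ U (suc k)) → (∀ k → Ord k (U k - L)) → U 0 ≈ L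
  stationary U L e o = minus-zero (separated (λ n → ord-resp (+-congʳ (sym (go n))) (o n)))
    where
    go : ∀ n → U 0 ≈ U n
    go zero = refl
    go (suc n) = trans (go n) (e n)

  -- No inverse is formed: the difference d = x - y satisfies d = z d, a contraction.
  cancel-unit : ∀ {x y z} → Ord 1 z → (1# - z) * x ≈ (1# - z) * y → x ≈ y
  cancel-unit {x} {y} {z} o e = minus-zero (contract (λ _ → z) (λ _ → x - y) (λ _ → o)
    (λ _ → linear (1# ⊙ e) (solve (x ∷ y ∷ z ∷ []) (λ x y z →
      (x :- y) :- z :* (x :- y) := one :* ((one :- z) :* x :- (one :- z) :* y)) ≡.refl)) 0)

  -- Serves to divide by the squared denominators of the mock theta series ω and f.
  cancel-square : ∀ {x y d} → Ord 1 (1# - d) → d * d * x ≈ d * d * y → x ≈ y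
  cancel-square {x} {y} {d} o e = cancel-unit o (cancel-unit o (trans (shape x) (trans e (sym (shape y)))))
    where
    shape : ∀ t → (1# - (1# - d)) * ((1# - (1# - d)) * t) ≈ d * d * t
    shape t = solve (d ∷ t ∷ []) (λ d t → (one :- (one :- d)) :* ((one :- (one :- d)) :* t) := d :* d :* t) ≡.refl

  unique : ∀ (a b U V : ℕ → Carrier) → (∀ k → Ord 1 (b k)) → (∀ k → U k ≈ a k + b k * U (suc k)) →
           (∀ k → V k ≈ a k + b k * V (suc k)) → ∀ k → U k ≈ V k
  unique a b U V ob eU eV k = minus-zero (contract b (λ k → U k - V k) ob step k)
    where
    step : ∀ k → U k - V k ≈ b k * (U (suc k) - V (suc k))
    step k = linear (1# ⊙ eU k ⊞ (- 1#) ⊙ eV k)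
      (solve (a k ∷ b k ∷ U k ∷ V k ∷ U (suc k) ∷ V (suc k) ∷ []) (λ a b u v u' v' →
        (u :- v) :- b :* (u' :- v') := one :* (u :- (a :+ b :* u')) :+ (:- one) :* (v :- (a :+ b :* v'))) ≡.refl)

  -- sol a b is the family with U k = a k + b k · U (k+1), provided every b k has positive order.
  partial : (a b : ℕ → Carrier) → ℕ → ℕ → Carrier
  partial a b zero k = 0#
  partial a b (suc N) k = a k + b k * partial a b N (suc k)

  sol : (a b : ℕ → Carrier) → ℕ → Carrier
  sol a b k = lim (λ N → partial a b N k)

  sol-approx : ∀ a b → (∀ k → Ord 1 (b k)) → ∀ k N → Ord N (sol a b k - partial a b N k)
  sol-approx a b ob k N = lim-law (λ N → partial a b N k) (λ N → diff N k) N
    where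
    diff : ∀ N k → Ord N (partial a b (suc N) k - partial a b N k)
    diff zero k = ord-zero _
    diff (suc N) k = ord-resp
      (solve (a k ∷ b k ∷ partial a b (suc N) (suc k) ∷ partial a b N (suc k) ∷ []) (λ a b u v →
        b :* (u :- v) := (a :+ b :* u) :- (a :+ b :* v)) ≡.refl)
      (ord-* (ob k) (diff N (suc k)))

  sol-step : ∀ a b → (∀ k → Ord 1 (b k)) → ∀ k → sol a b k ≈ a k + b k * sol a b (suc k)
  sol-step a b ob k = minus-zero (separated (λ N → ord-resp
    (solve (a k ∷ b k ∷ sol a b k ∷ sol a b (suc k) ∷ partial a b N (suc k) ∷ []) (λ a b u v w →
       (u :- (a :+ b :* w)) :- b :* (v :- w) := u :- (a :+ b :* v)) ≡.refl)
    (ord-sub (ord-≤ (ℕₚ.n≤1+n N) (sol-approx a b ob k (suc N)))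
             (ord-*ʳ (b k) (sol-approx a b ob (suc k) N)))))

  sol-unique : ∀ a b (U : ℕ → Carrier) → (∀ k → Ord 1 (b k)) → (∀ k → U k ≈ a k + b k * U (suc k)) →
               ∀ k → U k ≈ sol a b k
  sol-unique a b U ob e = unique a b U (sol a b) ob e (sol-step a b ob)

  -- Prod y k is the product of 1 - y l over l ≥ k, provided y l has order at least l.
  partialProd : (y : ℕ → Carrier) → ℕ → ℕ → Carrier
  partialProd y zero k = 1#
  partialProd y (suc N) k = (1# - y k) * partialProd y N (suc k)

  Prod : (y : ℕ → Carrier) → ℕ → Carrier
  Prod y k = lim (λ N → partialProd y N k)

  Small : (ℕ → Carrier) → Set
  Small y = ∀ l → Ord l (y l)

  Prod-approx : ∀ y → Small y → ∀ k N → Ord N (Prod y k - partialProd y N k)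
  Prod-approx y oy k N = lim-law (λ N → partialProd y N k)
    (λ N → ord-≤ (ℕₚ.m≤m+n N k) (diff N k)) N
    where
    diff : ∀ N k → Ord (N ℕ.+ k) (partialProd y (suc N) k - partialProd y N k)
    diff zero k = ord-resp (solve (y k ∷ []) (λ y → :- y := (one :- y) :* one :- one) ≡.refl) (ord-neg (oy k))
    diff (suc N) k = ord-resp
      (solve (y k ∷ partialProd y (suc N) (suc k) ∷ partialProd y N (suc k) ∷ []) (λ y u v →
        (one :- y) :* (u :- v) := (one :- y) :* u :- (one :- y) :* v) ≡.refl)
      (ord-*ʳ (1# - y k) (≡.subst (λ i → Ord i (partialProd y (suc N) (suc k) - partialProd y N (suc k)))
                                   (ℕₚ.+-suc N k) (diff N (suc k))))

  Prod-step : ∀ y → Small y → ∀ k → Prod y k ≈ (1# - y k) * Prod y (suc k)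
  Prod-step y oy k = minus-zero (separated (λ N → ord-resp
    (solve (y k ∷ Prod y k ∷ Prod y (suc k) ∷ partialProd y N (suc k) ∷ []) (λ y u v w →
       (u :- (one :- y) :* w) :- (one :- y) :* (v :- w) := u :- (one :- y) :* v) ≡.refl)
    (ord-sub (ord-≤ (ℕₚ.n≤1+n N) (Prod-approx y oy k (suc N)))
             (ord-*ʳ (1# - y k) (Prod-approx y oy (suc k) N)))))

  Prod-one : ∀ y → Small y → ∀ k → Ord k (Prod y k - 1#)
  Prod-one y oy k = ord-join (partialProd y k k) (Prod-approx y oy k k) (go k k ℕₚ.≤-refl)
    where
    go : ∀ N j → k ℕ.≤ j → Ord k (partialProd y N j - 1#)
    go zero j le = ord-≈0 k (minus-self refl)
    go (suc N) j le = ord-resp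
      (solve (y j ∷ partialProd y N (suc j) ∷ []) (λ y u → (u :- one) :- y :* u := (one :- y) :* u :- one) ≡.refl)
      (ord-sub (go N (suc j) (ℕₚ.m≤n⇒m≤1+n le)) (ord-*ˡ _ (ord-≤ le (oy j))))

  -- The factors 1 - y k do not contract, so the recursion alone leaves a constant undetermined; the
  -- condition that `F k` tends to 1 fixes it.
  Prod-unique : ∀ y (F : ℕ → Carrier) → Small y → (∀ k → Ord k (F k - 1#)) → (∀ k → F k ≈ (1# - y k) * F (suc k)) →
                ∀ k → F k ≈ Prod y k
  Prod-unique y F oy oF e k = minus-zero (persist (λ k → 1# - y k) (λ k → F k - Prod y k)
    (λ k → ord-join 1# (oF k) (ord-swap (Prod-one y oy k)))
    (λ k → linear (1# ⊙ e k ⊞ (- 1#) ⊙ Prod-step y oy k)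
      (solve (y k ∷ F k ∷ Prod y k ∷ F (suc k) ∷ Prod y (suc k) ∷ []) (λ y u v u' v' →
        (u :- v) :- (one :- y) :* (u' :- v')
          := one :* (u :- (one :- y) :* u') :+ (:- one) :* (v :- (one :- y) :* v')) ≡.refl)) k)

  ord-one-* : ∀ {n x y} → Ord n (x - 1#) → Ord n (y - 1#) → Ord n (x * y - 1#)
  ord-one-* {x = x} {y} o o' = ord-resp
    (solve (x ∷ y ∷ []) (λ x y → (x :- one) :* y :+ (y :- one) := x :* y :- one) ≡.refl)
    (ord-+ (ord-*ˡ y o) o')

  psum : (ℕ → Carrier) → ℕ → Carrier
  psum t zero = 0#
  psum t (suc N) = t 0 + psum (t ∘ suc) N

  sum∞ : (ℕ → Carrier) → Carrier
  sum∞ t = lim (psum t)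

  -- Telescoping: the terms c t k are the differences of a sequence U that tends to 0. This is the
  -- passage from a recursion for cleared tails to an actual infinite sum.
  *-sum∞ : ∀ c (U t : ℕ → Carrier) → Small t → Small U → (∀ k → U k ≈ c * t k + U (suc k)) →
           c * sum∞ t ≈ U 0
  *-sum∞ c U t ot oU e = minus-zero (separated (λ N → ord-resp
    (linear (1# ⊙ tele N U t e)
      (solve (c ∷ sum∞ t ∷ psum t N ∷ U 0 ∷ U N ∷ []) (λ c s p u v →
        (c :* (s :- p) :- v) :- (c :* s :- u) := one :* (u :- (c :* p :+ v))) ≡.refl))
    (ord-sub (ord-*ʳ c (lim-law (psum t) (λ N → ord-resp (sym (last N t)) (ot N)) N)) (oU N))))
    where
    last : ∀ N t → psum t (suc N) - psum t N ≈ t N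
    last zero t = solve (t 0 ∷ []) (λ x → (x :+ nil) :- nil := x) ≡.refl
    last (suc N) t = trans
      (solve (t 0 ∷ psum (t ∘ suc) (suc N) ∷ psum (t ∘ suc) N ∷ []) (λ x u v →
        (x :+ u) :- (x :+ v) := u :- v) ≡.refl) (last N (t ∘ suc))
    tele : ∀ N U t → (∀ k → U k ≈ c * t k + U (suc k)) → U 0 ≈ c * psum t N + U N
    tele zero U t e = solve (c ∷ U 0 ∷ []) (λ c u → u := c :* nil :+ u) ≡.refl
    tele (suc N) U t e = linear (1# ⊙ e 0 ⊞ 1# ⊙ tele N (U ∘ suc) (t ∘ suc) (e ∘ suc))
      (solve (c ∷ U 0 ∷ U 1 ∷ U (suc N) ∷ t 0 ∷ psum (t ∘ suc) N ∷ []) (λ c u₀ u₁ u x p →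
        u₀ :- (c :* (x :+ p) :+ u)
          := one :* (u₀ :- (c :* x :+ u₁)) :+ one :* (u₁ :- (c :* p :+ u))) ≡.refl)

  -- The inverse of an element u with Ord 1 (1# - u).
  recip₁ : Carrier → Carrier
  recip₁ u = sol (λ _ → 1#) (λ _ → 1# - u) 0

  -- The recursion has constant coefficients, so its solution takes the same value at every index;
  -- with U 0 = U 1 the recursion itself reads u U = 1.
  recip₁-law : ∀ {u} → Ord 1 (1# - u) → u * recip₁ u ≈ 1#
  recip₁-law {u} o = linear (1# ⊙ sol-step (λ _ → 1#) (λ _ → 1# - u) (λ _ → o) 0 ⊞ (u - 1#) ⊙ same)
    (solve (u ∷ U 0 ∷ U 1 ∷ []) (λ u x y →
      u :* x :- one := one :* (x :- (one :+ (one :- u) :* y)) :+ (u :- one) :* (x :- y)) ≡.refl)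
    where
    U = sol (λ _ → 1#) (λ _ → 1# - u)
    same : U 0 ≈ U 1
    same = sym (sol-unique (λ _ → 1#) (λ _ → 1# - u) (U ∘ suc) (λ _ → o) (λ k → sol-step _ _ (λ _ → o) (suc k)) 0)

  -- A perturbed contraction: an error of order N in every step leaves an error of order N in the
  -- solution. It serves to pass to limits inside recursive families.
  contract-ord : ∀ N (e b V : ℕ → Carrier) → (∀ k → Ord N (e k)) → (∀ k → Ord 1 (b k)) →
                 (∀ k → V k ≈ e k + b k * V (suc k)) → ∀ k → Ord N (V k)
  contract-ord N e b V oe ob eq k = go N k ℕₚ.≤-refl
    where
    go : ∀ n k → n ℕ.≤ N → Ord n (V k)
    go zero k le = ord-zero _
    go (suc n) k le = ord-resp (sym (eq k))
      (ord-+ (ord-≤ le (oe k)) (ord-* (ob k) (go n (suc k) (ℕₚ.≤-trans (ℕₚ.n≤1+n n) le))))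

  -- The tail (x Q^k; Q)_∞. Finite Pochhammer symbols in denominators are always replaced by tails
  -- of the infinite product in the numerator.
  Pr : Carrier → Carrier → ℕ → Carrier
  Pr x Q = Prod (λ l → x * Q ^ l)

  Pr-step : ∀ x {Q} → Ord 1 Q → ∀ k → Pr x Q k ≈ (1# - x * Q ^ k) * Pr x Q (suc k)
  Pr-step x o = Prod-step _ (λ l → ord-geo x l o)

  Pr-one : ∀ x {Q} → Ord 1 Q → ∀ k → Ord k (Pr x Q k - 1#)
  Pr-one x o = Prod-one _ (λ l → ord-geo x l o)

  Pr-cong : ∀ {x y Q Q'} → Ord 1 Q → x ≈ y → Q ≈ Q' → ∀ k → Pr x Q k ≈ Pr y Q' k
  Pr-cong {x} {y} {Q} {Q'} o ex eQ = Prod-unique _ (Pr x Q) (λ l → ord-geo y l (ord-resp eQ o)) (Pr-one x o)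
    (λ k → trans (Pr-step x o k) (*-congʳ (+-congˡ (-‿cong (*-cong ex (^-cong k eQ))))))

  sol-cong : ∀ {a b a' b'} → (∀ k → Ord 1 (b k)) → (∀ k → a k ≈ a' k) → (∀ k → b k ≈ b' k) →
             ∀ k → sol a b k ≈ sol a' b' k
  sol-cong ob ea eb = sol-unique _ _ _ (λ k → ord-resp (eb k) (ob k))
    (λ k → trans (sol-step _ _ ob k) (+-cong (ea k) (*-congʳ (eb k))))

  -- twin c X Y Q k = Σ_{j ≥ 0} Q^{j² + (c+2k) j} X_{k+j} Y_{k+j}
  twin : ℕ → (X Y : ℕ → Carrier) → Carrier → ℕ → Carrier
  twin c X Y Q = sol (λ k → X k * Y k) (λ k → Q ^ suc c * (Q ^ k) ^ 2)

  ord-twin : ∀ c {Q} → Ord 1 Q → ∀ k → Ord 1 (Q ^ suc c * (Q ^ k) ^ 2)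
  ord-twin c o k = ord-*ˡ _ (ord-*ˡ _ o)

  twin-step : ∀ c X Y {Q} → Ord 1 Q → ∀ k →
              twin c X Y Q k ≈ X k * Y k + Q ^ suc c * (Q ^ k) ^ 2 * twin c X Y Q (suc k)
  twin-step c X Y o = sol-step _ _ (ord-twin c o)

  twin-unique : ∀ c X Y {Q} U → Ord 1 Q →
                (∀ k → U k ≈ X k * Y k + Q ^ suc c * (Q ^ k) ^ 2 * U (suc k)) → ∀ k → U k ≈ twin c X Y Q k
  twin-unique c X Y U o = sol-unique _ _ U (ord-twin c o)

  twin-cong : ∀ c {X Y X' Y' Q Q'} → Ord 1 Q → (∀ k → X k ≈ X' k) → (∀ k → Y k ≈ Y' k) → Q ≈ Q' →
              ∀ k → twin c X Y Q k ≈ twin c X' Y' Q' k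
  twin-cong c o eX eY eQ = sol-cong (ord-twin c o) (λ k → *-cong (eX k) (eY k))
    (λ k → *-cong (^-cong (suc c) eQ) (^-cong 2 (^-cong k eQ)))

  -- The offset is moved by recursion, so that `shifted f (suc m) k` and `shifted f m (suc k)` agree
  -- by computation; an index m + k would not reduce when its second summand is a successor.
  shifted : (ℕ → Carrier) → ℕ → ℕ → Carrier
  shifted f zero = f
  shifted f (suc m) k = shifted f m (suc k)

  shifted-≡ : ∀ f m k → shifted f m k ≡ f (k ℕ.+ m)
  shifted-≡ f zero k = ≡.cong f (≡.sym (ℕₚ.+-identityʳ k))
  shifted-≡ f (suc m) k = ≡.trans (shifted-≡ f m (suc k)) (≡.cong f (≡.sym (ℕₚ.+-suc k m)))

  shifted-Pr-step : ∀ x {Q} → Ord 1 Q → ∀ m k →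
                    shifted (Pr x Q) m k ≈ (1# - x * (Q ^ m * Q ^ k)) * shifted (Pr x Q) m (suc k)
  shifted-Pr-step x {Q} o zero k = trans (Pr-step x o k)
    (solve (x ∷ Q ^ k ∷ Pr x Q (suc k) ∷ []) (λ x K P → (one :- x :* K) :* P := (one :- x :* (one :* K)) :* P) ≡.refl)
  shifted-Pr-step x {Q} o (suc m) k = trans (shifted-Pr-step x o m (suc k))
    (solve (x ∷ Q ∷ Q ^ m ∷ Q ^ k ∷ shifted (Pr x Q) m (suc (suc k)) ∷ []) (λ x Q M K P →
      (one :- x :* (M :* (Q :* K))) :* P := (one :- x :* ((Q :* M) :* K)) :* P) ≡.refl)

  shifted-Pr-one : ∀ x {Q} → Ord 1 Q → ∀ m k → Ord m (shifted (Pr x Q) m k - 1#)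
  shifted-Pr-one x {Q} o m k = ord-resp (+-congʳ (reflexive (≡.sym (shifted-≡ (Pr x Q) m k))))
    (ord-≤ (ℕₚ.m≤n+m m k) (Pr-one x o (k ℕ.+ m)))

  -- The partial theta series Σ_{j ≥ 0} y^j Q^{j(j-1)/2 + jk}.
  θ⁺ : Carrier → Carrier → ℕ → Carrier
  θ⁺ y Q = sol (λ _ → 1#) (λ k → y * Q ^ k)

  θ⁺-step : ∀ {y Q} → Ord 1 y → ∀ k → θ⁺ y Q k ≈ 1# + y * Q ^ k * θ⁺ y Q (suc k)
  θ⁺-step o = sol-step _ _ (λ k → ord-*ˡ _ o)

  θ⁺-cong : ∀ {y Q y' Q'} → Ord 1 y → y ≈ y' → Q ≈ Q' → ∀ k → θ⁺ y Q k ≈ θ⁺ y' Q' k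
  θ⁺-cong o ey eQ = sol-cong (λ k → ord-*ˡ _ o) (λ _ → refl) (λ k → *-cong ey (^-cong k eQ))

  -- For y y' = Q this is the two-sided theta series of y in base Q; both halves contain the term of
  -- index 0, hence the subtraction.
  theta : Carrier → Carrier → Carrier → Carrier
  theta y y' Q = θ⁺ y Q 0 + θ⁺ y' Q 0 - 1#

module TwinShift (S : CompleteRing) where
  open Series S

  -- Since Q = P P', the right side obeys the recursion that defines the left one. The identity
  -- exchanges the exponents j² and j² + j; it serves for `hₛ-shift` and, at P = P' = -q, for the
  -- value of g(-q; q²).
  twin-shift : ∀ P P' Q → Q ≈ P * P' → Ord 1 Q → ∀ N →
    twin 0 (Pr P Q ∘ suc) (Pr P' Q) Q N
      ≈ Pr P Q N * Pr P' Q N + P * Q ^ N * twin 1 (Pr P Q ∘ suc) (Pr P' Q ∘ suc) Q N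
  twin-shift P P' Q eQ o N = sym (twin-unique 0 _ _ U o step N)
    where
    X = Pr P Q
    Y = Pr P' Q
    t = twin 1 (X ∘ suc) (Y ∘ suc) Q
    U : ℕ → Carrier
    U N = X N * Y N + P * Q ^ N * t N
    step : ∀ k → U k ≈ X (suc k) * Y k + Q ^ 1 * (Q ^ k) ^ 2 * U (suc k)
    step k = elim (P ∷ P' ∷ Q ∷ Q ^ k ∷ X k ∷ X (suc k) ∷ Y k ∷ Y (suc k) ∷ t k ∷ t (suc k) ∷ [])
      (λ P P' Q K X X₁ Y Y₁ t t₁ →
        (t ⇒ X₁ :* Y₁ :+ Q :^ 2 :* K :^ 2 :* t₁) ∷ (X ⇒ (one :- P :* K) :* X₁) ∷ (Y ⇒ (one :- P' :* K) :* Y₁)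
          ∷ (Q ⇒ P :* P') ∷ [] ,
        (X :* Y :+ P :* K :* t := X₁ :* Y :+ Q :^ 1 :* K :^ 2 :* (X₁ :* Y₁ :+ P :* (Q :* K) :* t₁)))
      (twin-step 1 _ _ o k , Pr-step P o k , Pr-step P' o k , eQ , tt) ≡.refl

-- The universal identity in p and p'.

-- p and p' stand for zq and q/z, so that w = q².  The series hᵣ, hₛ, hₜ are the three odd-rank type
-- series (bases q², q⁸, q⁸) cleared of denominators; the superscript σ marks their images under z ↦ zq².
module Universal (S : CompleteRing) (p p' : CompleteRing.Carrier S)
                 (ow : CompleteRing.Ord S 1 (CompleteRing._*_ S p p')) where
  open Series S
  open TwinShift S

  w Q : Carrier
  w = p * p'
  Q = w ^ 4

  oQ : Ord 1 Q
  oQ = ord-*ˡ _ ow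

  al be γ γ' δ δ' : ℕ → Carrier
  al = Pr p w
  be = Pr p' w
  γ = Pr (- (p ^ 2 * w ^ 3)) Q
  γ' = Pr (- (p' ^ 2 * w ^ 3)) Q
  δ = Pr (- (p ^ 2 * w)) Q
  δ' = Pr (- (p' ^ 2 * w)) Q

  hᵣ hₛ hₜ hᵣσ hₛσ hₜσ : ℕ → Carrier
  hᵣ = twin 1 (al ∘ suc) (be ∘ suc) w
  hₛ = twin 0 γ γ' Q
  hₜ = twin 1 (δ ∘ suc) (δ' ∘ suc) Q
  hᵣσ = twin 1 (λ k → al (suc (suc k))) be w
  hₛσ = twin 0 (δ ∘ suc) δ' Q
  hₜσ = twin 1 (γ ∘ suc) γ' Q

  -- Once w is written as p p', the right side satisfies the recursion of `hᵣσ`. The product that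
  -- appears beside p² `hᵣ` is one of those that have to cancel in `H`.
  hᵣ-shift : ∀ D → hᵣσ D ≈ p ^ 2 * hᵣ D + (1# - p ^ 2) * (al (suc D) * be D)
  hᵣ-shift D = sym (twin-unique 1 _ _ U ow step D)
    where
    U : ℕ → Carrier
    U D = p ^ 2 * hᵣ D + (1# - p ^ 2) * (al (suc D) * be D)
    step : ∀ D → U D ≈ al (suc (suc D)) * be D + w ^ 2 * (w ^ D) ^ 2 * U (suc D)
    step D = elim (p ∷ p' ∷ w ^ D ∷ al (suc D) ∷ al (suc (suc D)) ∷ be D ∷ be (suc D) ∷ hᵣ D ∷ hᵣ (suc D) ∷ [])
      (λ p p' W A₁ A₂ B₀ B₁ r r₁ → let w = p :* p' in
        (r ⇒ A₁ :* B₁ :+ w :^ 2 :* W :^ 2 :* r₁) ∷ (A₁ ⇒ (one :- p :* (w :* W)) :* A₂)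
          ∷ (B₀ ⇒ (one :- p' :* W) :* B₁) ∷ [] ,
        (p :^ 2 :* r :+ (one :- p :^ 2) :* (A₁ :* B₀)
          := A₂ :* B₀ :+ w :^ 2 :* W :^ 2 :* (p :^ 2 :* r₁ :+ (one :- p :^ 2) :* (A₂ :* B₁))))
      (twin-step 1 _ _ ow D , Pr-step p ow (suc D) , Pr-step p' ow D , tt) ≡.refl

  hₛ-shift : hₛσ 0 ≈ δ 0 * δ' 0 - p ^ 2 * w * hₜ 0
  hₛ-shift = trans (twin-shift (- (p ^ 2 * w)) (- (p' ^ 2 * w)) Q
      (solve (p ∷ p' ∷ []) (λ p p' → let w = p :* p' in
        w :^ 4 := (:- (p :^ 2 :* w)) :* (:- (p' :^ 2 :* w))) ≡.refl) oQ 0)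
    (solve (p ^ 2 * w ∷ δ 0 ∷ δ' 0 ∷ hₜ 0 ∷ []) (λ x d d' t →
      d :* d' :+ (:- x) :* one :* t := d :* d' :- x :* t) ≡.refl)

  -- Stated with the factor w Q^D to avoid dividing by it. The defect of the equation at k is
  -- Q^(2k+1) times the defect at k + 1, so it vanishes.
  hₜ-shift : ∀ D → w * Q ^ D * hₜσ D ≈ (p ^ 2 + w * Q ^ D) * (γ D * γ' D) - p ^ 2 * hₛ D
  hₜ-shift D = minus-zero (contract (λ k → Q ^ 1 * (Q ^ k) ^ 2) V (ord-twin 0 oQ) step D)
    where
    V : ℕ → Carrier
    V D = w * Q ^ D * hₜσ D - ((p ^ 2 + w * Q ^ D) * (γ D * γ' D) - p ^ 2 * hₛ D)
    step : ∀ k → V k ≈ Q ^ 1 * (Q ^ k) ^ 2 * V (suc k)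
    step k = elim (p ∷ p' ∷ Q ^ k ∷ γ k ∷ γ (suc k) ∷ γ' k ∷ γ' (suc k) ∷ hₛ k ∷ hₛ (suc k) ∷ hₜσ k ∷ hₜσ (suc k) ∷ [])
      (λ p p' K g g₁ g' g₁' s s₁ t t₁ → let w = p :* p' ; Q = w :^ 4 in
        (t ⇒ g₁ :* g' :+ Q :^ 2 :* K :^ 2 :* t₁) ∷ (s ⇒ g :* g' :+ Q :^ 1 :* K :^ 2 :* s₁)
          ∷ (g ⇒ (one :- (:- (p :^ 2 :* w :^ 3)) :* K) :* g₁)
          ∷ (g' ⇒ (one :- (:- (p' :^ 2 :* w :^ 3)) :* K) :* g₁') ∷ [] ,
        (w :* K :* t :- ((p :^ 2 :+ w :* K) :* (g :* g') :- p :^ 2 :* s)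
          := Q :^ 1 :* K :^ 2 :* (w :* (Q :* K) :* t₁ :- ((p :^ 2 :+ w :* (Q :* K)) :* (g₁ :* g₁') :- p :^ 2 :* s₁))))
      (twin-step 1 _ _ oQ k , twin-step 0 _ _ oQ k , Pr-step _ oQ k , Pr-step _ oQ k , tt) ≡.refl

  -- Divided by its six infinite products, `H` is (p + p') times the odd rank series, plus a series
  -- of the type of Dyson's rank in base q⁸, plus w (p + p') times an odd rank series in base q⁸.
  -- `Hσ` is w² times the image of `H`: the images of p + p', of `be 0` and of `δ' 0` contain p'/w,
  -- 1 - p'/w and 1 + p'²/w, and each summand has exactly two of these three as factors, so w²
  -- clears the denominators.
  H Hσ : Carrier
  H = (p + p') * hᵣ 0 * (γ 0 * γ' 0) * (δ 0 * δ' 0)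
    + hₛ 0 * (δ 0 * δ' 0) * (al 0 * be 0)
    + (p + p') * (w * hₜ 0) * (γ 0 * γ' 0) * (al 0 * be 0)
  Hσ = (p * w * w + p') * hᵣσ 0 * (δ 1 * δ' 0) * (γ 0 * ((w + p' * p') * γ' 0))
     + hₛσ 0 * (γ 0 * ((w + p' * p') * γ' 0)) * (al 1 * ((w - p') * be 0))
     + (p * w * w + p') * (w * hₜσ 0) * (δ 1 * δ' 0) * (al 1 * ((w - p') * be 0))

  -- After the three shift relations are substituted, the explicit products that contain no series
  -- cancel and the rest is a polynomial identity.
  H-shift : Hσ ≈ w ^ 2 * H
  H-shift = elim (p ∷ p' ∷ al 0 ∷ al 1 ∷ be 0 ∷ γ 0 ∷ γ' 0 ∷ δ 0 ∷ δ 1 ∷ δ' 0 ∷ hᵣ 0 ∷ hₛ 0 ∷ hₜ 0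
                   ∷ hᵣσ 0 ∷ hₛσ 0 ∷ w * hₜσ 0 ∷ [])
    (λ p p' A A₁ B g g' d d₁ d' r s t rσ sσ tσ → let w = p :* p' in
      (rσ ⇒ p :^ 2 :* r :+ (one :- p :^ 2) :* (A₁ :* B)) ∷ (sσ ⇒ d :* d' :- p :^ 2 :* w :* t)
        ∷ (tσ ⇒ (p :^ 2 :+ w) :* (g :* g') :- p :^ 2 :* s)
        ∷ (A ⇒ (one :- p :* one) :* A₁) ∷ (d ⇒ (one :- (:- (p :^ 2 :* w)) :* one) :* d₁) ∷ [] ,
      ((p :* w :* w :+ p') :* rσ :* (d₁ :* d') :* (g :* ((w :+ p' :* p') :* g'))
        :+ sσ :* (g :* ((w :+ p' :* p') :* g')) :* (A₁ :* ((w :- p') :* B))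
        :+ (p :* w :* w :+ p') :* tσ :* (d₁ :* d') :* (A₁ :* ((w :- p') :* B))
      := w :^ 2 :* ((p :+ p') :* r :* (g :* g') :* (d :* d')
        :+ s :* (d :* d') :* (A :* B) :+ (p :+ p') :* (w :* t) :* (g :* g') :* (A :* B))))
    (hᵣ-shift 0 , hₛ-shift , t₀ , Pr-step p ow 0 , Pr-step _ oQ 0 , tt) ≡.refl
    where
    t₀ : w * hₜσ 0 ≈ (p ^ 2 + w) * (γ 0 * γ' 0) - p ^ 2 * hₛ 0
    t₀ = linear (1# ⊙ hₜ-shift 0) (solve (p ^ 2 ∷ w ∷ hₜσ 0 ∷ γ 0 * γ' 0 ∷ hₛ 0 ∷ []) (λ a w t g s →
      w :* t :- ((a :+ w) :* g :- a :* s)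
        := one :* (w :* one :* t :- ((a :+ w :* one) :* g :- a :* s))) ≡.refl)

-- Classical q-series identities.

-- The bilateral series Σ_{n ∈ ℤ} (-x)^n Q^{n(n-1)/2} (cxQ^n; Q)_∞ as a function of c: it is multiplied by
-- 1 - c under c ↦ cQ, and c → 0 gives the theta series.  Here β is the part n ≥ 0 and η the part n < 0.
module Bilateral (S : CompleteRing) (x x' c Q : CompleteRing.Carrier S)
    (eQ : CompleteRing._≈_ S Q (CompleteRing._*_ S x x'))
    (ox : CompleteRing.Ord S 1 x) (ox' : CompleteRing.Ord S 1 x') (oc : CompleteRing.Ord S 1 c) where
  open Series S

  oQ : Ord 1 Q
  oQ = ord-resp (sym eQ) (ord-*ˡ x' ox)

  Γ : ℕ → ℕ → Carrier
  Γ = shifted (Pr (c * x) Q)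

  C : ℕ → Carrier
  C m = c * Q ^ m

  y : ℕ → Carrier
  y j = x' * Q ^ j

  b : ℕ → Carrier
  b k = - (x * Q ^ k)

  ob : ∀ k → Ord 1 (b k)
  ob k = ord-neg (ord-*ˡ _ ox)

  oη : ∀ m j → Ord 1 (C m - y j)
  oη m j = ord-sub (ord-*ˡ _ oc) (ord-*ˡ _ ox')

  β η : ℕ → ℕ → Carrier
  β m = sol (Γ m) b
  η m = sol (λ j → C m - y j) (λ j → C m - y j)

  β-step : ∀ m k → β m k ≈ Γ m k + b k * β m (suc k)
  β-step m = sol-step _ _ ob

  η-step : ∀ m j → η m j ≈ (C m - y j) + (C m - y j) * η m (suc j)
  η-step m = sol-step _ _ (oη m)

  β-shift : ∀ m k → (1# - C m) * β m k ≈ β (suc m) k - C m * Γ m k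
  β-shift m k = minus-zero (contract b V ob step k)
    where
    V : ℕ → Carrier
    V k = (1# - C m) * β m k - (β (suc m) k - C m * Γ m k)
    step : ∀ k → V k ≈ b k * V (suc k)
    step k = elim (c ∷ x ∷ Q ^ m ∷ Q ^ k ∷ Γ m k ∷ Γ m (suc k) ∷ β m k ∷ β m (suc k) ∷ β (suc m) k ∷ β (suc m) (suc k) ∷ [])
      (λ c x M K g g₁ u u₁ v v₁ →
        (u ⇒ g :+ (:- (x :* K)) :* u₁) ∷ (v ⇒ g₁ :+ (:- (x :* K)) :* v₁) ∷ (g ⇒ (one :- c :* x :* (M :* K)) :* g₁) ∷ [] ,
        ((one :- c :* M) :* u :- (v :- c :* M :* g)
          := (:- (x :* K)) :* ((one :- c :* M) :* u₁ :- (v₁ :- c :* M :* g₁))))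
      (β-step m k , β-step (suc m) k , shifted-Pr-step (c * x) oQ m k , tt) ≡.refl

  η-shift : ∀ m → y 0 * η (suc m) 1 + (1# - C m) * (C m - y 0) * η m 1 - C m * (C m - y 0) ≈ 0#
  η-shift m = contract (λ j → C m - y j) V (oη m) step 0
    where
    V : ℕ → Carrier
    V j = y j * η (suc m) (suc j) + (1# - C m) * (C m - y j) * η m (suc j) - C m * (C m - y j)
    step : ∀ j → V j ≈ (C m - y j) * V (suc j)
    step j = elim (c ∷ x' ∷ Q ∷ Q ^ m ∷ Q ^ j ∷ η m (suc j) ∷ η m (suc (suc j)) ∷ η (suc m) (suc j) ∷ η (suc m) (suc (suc j)) ∷ [])
      (λ c x' Q M J h h₁ k k₁ → let D = c :* M :- x' :* (Q :* J) ; E = c :* (Q :* M) :- x' :* (Q :* J) in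
        (h ⇒ D :+ D :* h₁) ∷ (k ⇒ E :+ E :* k₁) ∷ [] ,
        (x' :* J :* k :+ (one :- c :* M) :* (c :* M :- x' :* J) :* h :- c :* M :* (c :* M :- x' :* J)
          := (c :* M :- x' :* J) :* (x' :* (Q :* J) :* k₁ :+ (one :- c :* M) :* (c :* M :- x' :* (Q :* J)) :* h₁
               :- c :* M :* (c :* M :- x' :* (Q :* J)))))
      (η-step m (suc j) , η-step (suc m) (suc j) , tt) ≡.refl

  B : ℕ → Carrier
  B m = β m 0 + Γ m 0 * η m 0

  -- Each half of the series picks up a boundary term at n = 0; `β-shift` and `η-shift` isolate
  -- these terms, and here they cancel.
  B-step : ∀ m → (1# - C m) * B m ≈ B (suc m)
  B-step m = linear (1# ⊙ β-shift m 0 ⊞ (Γ m 1 * (1# - C m * x)) ⊙ η-shift m)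
    (elim (c ∷ x ∷ x' ∷ Q ∷ Q ^ m ∷ Γ m 0 ∷ Γ m 1 ∷ β m 0 ∷ β (suc m) 0 ∷ η m 0 ∷ η m 1 ∷ η (suc m) 0 ∷ η (suc m) 1 ∷ [])
      (λ c x x' Q M g g₁ u v h h₁ k k₁ → let D = c :* M :- x' :* one ; E = c :* (Q :* M) :- x' :* one in
        (g ⇒ (one :- c :* x :* (M :* one)) :* g₁) ∷ (h ⇒ D :+ D :* h₁) ∷ (k ⇒ E :+ E :* k₁) ∷ (Q ⇒ x :* x') ∷ [] ,
        ((one :- c :* M) :* (u :+ g :* h) :- (v :+ g₁ :* k)
          := one :* ((one :- c :* M) :* u :- (v :- c :* M :* g))
             :+ g₁ :* (one :- c :* M :* x) :* ((x' :* one :* k₁ :+ (one :- c :* M) :* D :* h₁ :- c :* M :* D) :- nil)))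
      (shifted-Pr-step (c * x) oQ m 0 , η-step m 0 , η-step (suc m) 0 , eQ , tt) ≡.refl)

  -- As c Q^m tends to 0 the products tend to 1, and both halves turn into partial theta series.
  B-limit : ∀ m → Ord m (B m - theta (- x) (- x') Q)
  B-limit m = ord-resp
    (solve (β m 0 ∷ θ⁺ (- x) Q 0 ∷ Γ m 0 ∷ η m 0 ∷ θ⁺ (- x') Q 0 ∷ []) (λ u s g h t →
      (u :- s) :+ ((g :- one) :* h :+ ((one :+ h) :- t)) := (u :+ g :* h) :- (s :+ t :- one)) ≡.refl)
    (ord-+ (contract-ord m (λ k → Γ m k - 1#) b (λ k → β m k - θ⁺ (- x) Q k) (shifted-Pr-one (c * x) oQ m) ob
             (λ k → elim (x ∷ Q ^ k ∷ Γ m k ∷ β m k ∷ β m (suc k) ∷ θ⁺ (- x) Q k ∷ θ⁺ (- x) Q (suc k) ∷ [])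
               (λ x K g u u₁ s s₁ → (u ⇒ g :+ (:- (x :* K)) :* u₁) ∷ (s ⇒ one :+ (:- x) :* K :* s₁) ∷ [] ,
                 (u :- s := (g :- one) :+ (:- (x :* K)) :* (u₁ :- s₁)))
               (β-step m k , θ⁺-step (ord-neg ox) k , tt) ≡.refl) 0)
    (ord-+ (ord-*ˡ _ (shifted-Pr-one (c * x) oQ m 0))
           (contract-ord m (λ j → C m * (1# + η m (suc j))) (λ j → - y j) (λ j → (1# + η m j) - θ⁺ (- x') Q j)
             (λ j → ord-*ˡ _ (ord-geo c m oQ)) (λ j → ord-neg (ord-*ˡ _ ox'))
             (λ j → elim (c ∷ Q ^ m ∷ x' ∷ Q ^ j ∷ η m j ∷ η m (suc j) ∷ θ⁺ (- x') Q j ∷ θ⁺ (- x') Q (suc j) ∷ [])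
               (λ c M x' J h h₁ t t₁ → let D = c :* M :- x' :* J in
                 (h ⇒ D :+ D :* h₁) ∷ (t ⇒ one :+ (:- x') :* J :* t₁) ∷ [] ,
                 ((one :+ h) :- t := c :* M :* (one :+ h₁) :+ (:- (x' :* J)) :* ((one :+ h₁) :- t₁)))
               (η-step m j , θ⁺-step (ord-neg ox') j , tt) ≡.refl) 0)))

  -- The tails of (c; Q)_∞ absorb the factors 1 - c Q^k, so the product is constant along c ↦ cQ and
  -- equals its limit.
  bilateral : Pr c Q 0 * (β 0 0 + Pr (c * x) Q 0 * η 0 0) ≈ theta (- x) (- x') Q
  bilateral = stationary (λ k → Pr c Q k * B k) _
    (λ k → linear (1# ⊙ Pr-step-B k) (solve (Pr c Q k * B k ∷ Pr c Q (suc k) * B (suc k) ∷ []) (λ a b →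
      a :- b := one :* (a :- b)) ≡.refl))
    (λ k → ord-resp (solve (Pr c Q k ∷ B k ∷ theta (- x) (- x') Q ∷ []) (λ p u t →
        (p :- one) :* u :+ (u :- t) := p :* u :- t) ≡.refl)
      (ord-+ (ord-*ˡ _ (Pr-one c oQ k)) (B-limit k)))
    where
    Pr-step-B : ∀ k → Pr c Q k * B k ≈ Pr c Q (suc k) * B (suc k)
    Pr-step-B k = linear (B k ⊙ Pr-step c oQ k ⊞ Pr c Q (suc k) ⊙ B-step k)
      (solve (C k ∷ Pr c Q k ∷ Pr c Q (suc k) ∷ B k ∷ B (suc k) ∷ []) (λ C p p₁ u u₁ →
        p :* u :- p₁ :* u₁ := u :* (p :- (one :- C) :* p₁) :+ p₁ :* ((one :- C) :* u :- u₁)) ≡.refl)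

module Classical (S : CompleteRing) where
  open Series S

  module Euler (x Q : Carrier) (ox : Ord 1 x) (oQ : Ord 1 Q) where
    P : ℕ → Carrier
    P = Pr Q Q

    e : ℕ → ℕ → Carrier
    e m = sol P (λ k → - (x * Q ^ m * Q ^ k))

    oe : ∀ m k → Ord 1 (- (x * Q ^ m * Q ^ k))
    oe m k = ord-neg (ord-*ˡ _ (ord-*ˡ _ ox))

    e-step : ∀ m k → e m k ≈ P k + - (x * Q ^ m * Q ^ k) * e m (suc k)
    e-step m = sol-step _ _ (oe m)

    e-shift : ∀ m k → e m k ≈ (1# - Q ^ k) * P k + (Q ^ k - x * Q ^ m * Q ^ k) * e (suc m) k
    e-shift m k = sym (sol-unique P _ U (oe m) step k)
      where
      U : ℕ → Carrier
      U k = (1# - Q ^ k) * P k + (Q ^ k - x * Q ^ m * Q ^ k) * e (suc m) k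
      step : ∀ k → U k ≈ P k + - (x * Q ^ m * Q ^ k) * U (suc k)
      step k = elim (x ∷ Q ∷ Q ^ m ∷ Q ^ k ∷ P k ∷ P (suc k) ∷ e (suc m) k ∷ e (suc m) (suc k) ∷ [])
        (λ x Q M K P P₁ e e₁ →
          (e ⇒ P :+ (:- (x :* (Q :* M) :* K)) :* e₁) ∷ (P ⇒ (one :- Q :* K) :* P₁) ∷ [] ,
          ((one :- K) :* P :+ (K :- x :* M :* K) :* e
            := P :+ (:- (x :* M :* K)) :* ((one :- Q :* K) :* P₁ :+ (Q :* K :- x :* M :* (Q :* K)) :* e₁)))
        (e-step (suc m) k , Pr-step Q oQ k , tt) ≡.refl

    -- Euler's expansion of (x; Q)_∞, multiplied by (Q; Q)_∞. The parameter m replaces x by x Q^m;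
    -- both sides have the factor 1 - x Q^m in common with their successors, and both tend to (Q;
    -- Q)_∞.
    euler : e 0 0 ≈ P 0 * Pr x Q 0
    euler = minus-zero (persist (λ m → 1# - x * Q ^ m) (λ m → e m 0 - P 0 * Pr x Q m) small step 0)
      where
      small : ∀ m → Ord m (e m 0 - P 0 * Pr x Q m)
      small m = ord-resp
        (elim (x ∷ Q ^ m ∷ P 0 ∷ e m 0 ∷ e m 1 ∷ Pr x Q m ∷ []) (λ x M P e e₁ X →
          (e ⇒ P :+ (:- (x :* M :* one)) :* e₁) ∷ [] ,
          ((:- (x :* M)) :* e₁ :- P :* (X :- one) := e :- P :* X)) (e-step m 0 , tt) ≡.refl)
        (ord-sub (ord-*ˡ _ (ord-neg (ord-geo x m oQ))) (ord-*ʳ _ (Pr-one x oQ m)))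
      step : ∀ m → e m 0 - P 0 * Pr x Q m ≈ (1# - x * Q ^ m) * (e (suc m) 0 - P 0 * Pr x Q (suc m))
      step m = elim (x ∷ Q ^ m ∷ P 0 ∷ e m 0 ∷ e (suc m) 0 ∷ Pr x Q m ∷ Pr x Q (suc m) ∷ []) (λ x M P e f X X₁ →
          (e ⇒ (one :- one) :* P :+ (one :- x :* M :* one) :* f) ∷ (X ⇒ (one :- x :* M) :* X₁) ∷ [] ,
          (e :- P :* X := (one :- x :* M) :* (f :- P :* X₁)))
        (e-shift m 0 , Pr-step x oQ m , tt) ≡.refl

  -- The bilateral identity at c = x': the part n < 0 has the factor c - x' and disappears, and
  -- since c x = Q the part n ≥ 0 is Euler's series.
  jacobi : ∀ x x' Q → Q ≈ x * x' → Ord 1 x → Ord 1 x' →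
           theta (- x) (- x') Q ≈ Pr Q Q 0 * Pr x Q 0 * Pr x' Q 0
  jacobi x x' Q eQ ox ox' = trans (sym bilateral)
    (elim (x' ∷ Pr x' Q 0 ∷ β 0 0 ∷ Pr (x' * x) Q 0 ∷ η 0 0 ∷ η 0 1 ∷ Pr Q Q 0 ∷ Pr x Q 0 ∷ [])
      (λ x' X' b g h h₁ P X → let D = x' :* one :- x' :* one in
        (h ⇒ D :+ D :* h₁) ∷ (b ⇒ P :* X) ∷ [] , (X' :* (b :+ g :* h) := P :* X :* X'))
      (η-step 0 0 , trans β≈e euler , tt) ≡.refl)
    where
    open Bilateral S x x' x' Q eQ ox ox' ox'
    open Euler x Q ox oQ
    β≈e : β 0 0 ≈ e 0 0
    β≈e = sol-cong ob (Pr-cong oQ (trans (*-comm x' x) (sym eQ)) refl)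
      (λ k → solve (x ∷ Q ^ k ∷ []) (λ x K → :- (x :* K) := :- (x :* one :* K)) ≡.refl) 0

  -- Durfee: Σ Q^{k²} / (Q;Q)_k² = 1 / (Q;Q)_∞.
  module Cauchy (Q : Carrier) (oQ : Ord 1 Q) where
    P : ℕ → Carrier
    P = Pr Q Q

    Ps : ℕ → ℕ → Carrier
    Ps = shifted P

    b : ℕ → ℕ → Carrier
    b m k = Q * Q ^ m * (Q ^ k) ^ 2

    ob : ∀ m k → Ord 1 (b m k)
    ob m k = ord-*ˡ _ (ord-*ˡ _ oQ)

    c : ℕ → ℕ → Carrier
    c m = sol (λ k → P k * Ps m k) (b m)

    c-step : ∀ m k → c m k ≈ P k * Ps m k + b m k * c m (suc k)
    c-step m = sol-step _ _ (ob m)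

    D : ℕ → ℕ → Carrier
    D m k = c m k - Q ^ k * c (suc m) k

    D-step : ∀ m k → D m k ≈ (P k * Ps m k - Q ^ k * (P k * Ps m (suc k))) + b m k * D m (suc k)
    D-step m k = elim (Q ∷ Q ^ m ∷ Q ^ k ∷ P k ∷ Ps m k ∷ Ps m (suc k) ∷ c m k ∷ c m (suc k) ∷ c (suc m) k ∷ c (suc m) (suc k) ∷ [])
      (λ Q M K P Z Z₁ c c₁ d d₁ →
        (c ⇒ P :* Z :+ Q :* M :* K :^ 2 :* c₁) ∷ (d ⇒ P :* Z₁ :+ Q :* (Q :* M) :* K :^ 2 :* d₁) ∷ [] ,
        (c :- K :* d := (P :* Z :- K :* (P :* Z₁)) :+ Q :* M :* K :^ 2 :* (c₁ :- Q :* K :* d₁)))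
      (c-step m k , c-step (suc m) k , tt) ≡.refl

    D-shift : ∀ m k → D m k ≈ (1# - Q ^ k) * (P k * Ps m (suc k)) - Q * Q ^ m * Q ^ k * D (suc m) k
    D-shift m = unique _ (b m) (D m) U (ob m) (D-step m) step
      where
      U : ℕ → Carrier
      U k = (1# - Q ^ k) * (P k * Ps m (suc k)) - Q * Q ^ m * Q ^ k * D (suc m) k
      step : ∀ k → U k ≈ (P k * Ps m k - Q ^ k * (P k * Ps m (suc k))) + b m k * U (suc k)
      step k = elim (Q ∷ Q ^ m ∷ Q ^ k ∷ P k ∷ P (suc k) ∷ Ps m k ∷ Ps m (suc k) ∷ Ps m (suc (suc k)) ∷ D (suc m) k ∷ D (suc m) (suc k) ∷ [])
        (λ Q M K P P₁ Z Z₁ Z₂ d d₁ →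
          (d ⇒ (P :* Z₁ :- K :* (P :* Z₂)) :+ Q :* (Q :* M) :* K :^ 2 :* d₁) ∷ (P ⇒ (one :- Q :* K) :* P₁)
            ∷ (Z ⇒ (one :- Q :* (M :* K)) :* Z₁) ∷ [] ,
          ((one :- K) :* (P :* Z₁) :- Q :* M :* K :* d
            := (P :* Z :- K :* (P :* Z₁))
               :+ Q :* M :* K :^ 2 :* ((one :- Q :* K) :* (P₁ :* Z₂) :- Q :* M :* (Q :* K) :* d₁)))
        (D-step (suc m) k , Pr-step Q oQ k , shifted-Pr-step Q oQ m k , tt) ≡.refl

    -- The square is one of the Durfee rectangles of sides j and j + m. `D m 0` is the difference of
    -- two consecutive rectangle sums, and it is -Q^(m+1) times the next such difference, so all
    -- rectangle sums agree; for m → ∞ only the term j = 0 survives.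
    cauchy : twin 0 P P Q 0 ≈ P 0
    cauchy = trans (sol-cong (ord-twin 0 oQ) (λ _ → refl)
        (λ k → solve (Q ∷ Q ^ k ∷ []) (λ Q K → Q :^ 1 :* K :^ 2 := Q :* one :* K :^ 2) ≡.refl) 0)
      (stationary (λ m → c m 0) (P 0)
        (λ m → linear (1# ⊙ D≈0 m) (solve (c m 0 ∷ c (suc m) 0 ∷ []) (λ c d →
           c :- d := one :* ((c :- one :* d) :- nil)) ≡.refl))
        (λ m → ord-resp
          (elim (Q ∷ Q ^ m ∷ P 0 ∷ Ps m 0 ∷ c m 0 ∷ c m 1 ∷ []) (λ Q M P Z c c₁ →
            (c ⇒ P :* Z :+ Q :* M :* one :^ 2 :* c₁) ∷ [] , (P :* (Z :- one) :+ Q :* M :* c₁ := c :- P)) (c-step m 0 , tt) ≡.refl)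
          (ord-+ (ord-*ʳ _ (shifted-Pr-one Q oQ m 0)) (ord-*ˡ _ (ord-geo Q m oQ)))))
      where
      D≈0 : ∀ m → D m 0 ≈ 0#
      D≈0 = contract (λ m → - (Q * Q ^ m)) (λ m → D m 0) (λ m → ord-neg (ord-*ˡ _ oQ))
        (λ m → trans (D-shift m 0) (solve (Q * Q ^ m ∷ P 0 * Ps m 1 ∷ D (suc m) 0 ∷ []) (λ N X d →
          (one :- one) :* X :- N :* one :* d := (:- N) :* d) ≡.refl))

  -- The Rogers–Fine identity for Σ pⁿ / (p'; w)_{n+1} when p p' = w.
  module Fine (p p' w : Carrier) (ew : w ≈ p * p') (op : Ord 1 p) where
    ow : Ord 1 w
    ow = ord-resp (sym ew) (ord-*ˡ p' op)

    al be : ℕ → Carrier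
    al = Pr p w
    be = Pr p' w

    bs : ℕ → ℕ → Carrier
    bs = shifted be

    φ : ℕ → ℕ → Carrier
    φ D = sol (λ n → bs D (suc n)) (λ _ → p * w ^ D)

    oφ : ∀ D (n : ℕ) → Ord 1 (p * w ^ D)
    oφ D n = ord-*ˡ _ op

    φ-step : ∀ D n → φ D n ≈ bs D (suc n) + p * w ^ D * φ D (suc n)
    φ-step D = sol-step _ _ (oφ D)

    φ-shift : ∀ D n → (1# - p * w ^ D) * φ D n ≈ bs D (suc n) + p * p' * w ^ D * (w ^ D * w ^ suc n) * φ (suc D) n
    φ-shift D n = minus-zero (contract (λ _ → p * w ^ D) V (oφ D) step n)
      where
      V : ℕ → Carrier
      V n = (1# - p * w ^ D) * φ D n - (bs D (suc n) + p * p' * w ^ D * (w ^ D * w ^ suc n) * φ (suc D) n)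
      step : ∀ n → V n ≈ p * w ^ D * V (suc n)
      step n = elim (p ∷ p' ∷ w ∷ w ^ D ∷ w ^ n ∷ bs D (suc n) ∷ bs D (suc (suc n)) ∷ φ D n ∷ φ D (suc n) ∷ φ (suc D) n ∷ φ (suc D) (suc n) ∷ [])
        (λ p p' w W N B₁ B₂ f f₁ g g₁ →
          (f ⇒ B₁ :+ p :* W :* f₁) ∷ (g ⇒ B₂ :+ p :* (w :* W) :* g₁) ∷ (B₁ ⇒ (one :- p' :* (W :* (w :* N))) :* B₂) ∷ [] ,
          ((one :- p :* W) :* f :- (B₁ :+ p :* p' :* W :* (W :* (w :* N)) :* g)
            := p :* W :* ((one :- p :* W) :* f₁ :- (B₂ :+ p :* p' :* W :* (W :* (w :* (w :* N))) :* g₁))))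
        (φ-step D n , φ-step (suc D) n , shifted-Pr-step p' ow D (suc n) , tt) ≡.refl

    -- The tail of `al` times the power series in p w^D obeys the recursion of the twin series in D;
    -- `φ-shift` is one step of it.
    fine : twin 1 (al ∘ suc) (be ∘ suc) w 0 ≈ al 0 * φ 0 0
    fine = sym (twin-unique 1 _ _ (λ D → al D * φ D 0) ow step 0)
      where
      step : ∀ D → al D * φ D 0 ≈ al (suc D) * be (suc D) + w ^ 2 * (w ^ D) ^ 2 * (al (suc D) * φ (suc D) 0)
      step D = linear (φ D 0 ⊙ Pr-step p ow D ⊞ al (suc D) ⊙ φ-shift D 0)
        (elim (p ∷ p' ∷ w ∷ w ^ D ∷ al D ∷ al (suc D) ∷ be (suc D) ∷ bs D 1 ∷ φ D 0 ∷ φ (suc D) 0 ∷ [])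
          (λ p p' w W A A₁ B₁ b₁ f g → (b₁ ⇒ B₁) ∷ (w ⇒ p :* p') ∷ [] ,
            (A :* f :- (A₁ :* B₁ :+ w :^ 2 :* W :^ 2 :* (A₁ :* g))
              := f :* (A :- (one :- p :* W) :* A₁)
                 :+ A₁ :* ((one :- p :* W) :* f :- (b₁ :+ p :* p' :* W :* (W :* (w :* one)) :* g))))
          (reflexive (shifted-≡ be D 1) , ew , tt) ≡.refl)

  module Nu (q Q : Carrier) (oq : Ord 1 q) (oQ : Ord 1 Q) where
    la mu : ℕ → Carrier
    la = Pr (- q) Q
    mu = Pr q Q

    las : ℕ → ℕ → Carrier
    las = shifted la

    ob : ∀ k → Ord 1 (Q * Q ^ k)
    ob k = ord-*ˡ _ oQ

    n : ℕ → ℕ → Carrier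
    n j = sol (λ k → las j (suc k)) (λ k → Q * Q ^ k)

    n-step : ∀ j k → n j k ≈ las j (suc k) + Q * Q ^ k * n j (suc k)
    n-step j = sol-step _ _ ob

    o : ℕ → Carrier
    o = sol (λ j → la (suc j) * mu (suc j)) (λ _ → Q)

    n-shift : ∀ j k → (1# - q * Q ^ j) * n j k ≈ n (suc j) k - q * Q ^ j * las j (suc k)
    n-shift j k = minus-zero (contract (λ k → Q * Q ^ k) V ob step k)
      where
      V : ℕ → Carrier
      V k = (1# - q * Q ^ j) * n j k - (n (suc j) k - q * Q ^ j * las j (suc k))
      step : ∀ k → V k ≈ Q * Q ^ k * V (suc k)
      step k = elim (q ∷ Q ∷ Q ^ j ∷ Q ^ k ∷ las j (suc k) ∷ las j (suc (suc k)) ∷ n j k ∷ n j (suc k) ∷ n (suc j) k ∷ n (suc j) (suc k) ∷ [])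
        (λ q Q J K L₁ L₂ u u₁ v v₁ →
          (u ⇒ L₁ :+ Q :* K :* u₁) ∷ (v ⇒ L₂ :+ Q :* K :* v₁) ∷ (L₁ ⇒ (one :- (:- q) :* (J :* (Q :* K))) :* L₂) ∷ [] ,
          ((one :- q :* J) :* u :- (v :- q :* J :* L₁)
            := Q :* K :* ((one :- q :* J) :* u₁ :- (v₁ :- q :* J :* L₂))))
        (n-step j k , n-step (suc j) k , shifted-Pr-step (- q) oQ j (suc k) , tt) ≡.refl

    -- The expression `mu j * n j 0 + q * Q ^ j * o j` does not depend on j, and for j → ∞ its
    -- products tend to 1. Together with the Rogers-Fine identity this relates ν(q) to q ω(q²).
    nu : mu 0 * n 0 0 + q * o 0 ≈ θ⁺ Q Q 0
    nu = trans (solve (mu 0 * n 0 0 ∷ q ∷ o 0 ∷ []) (λ a q o → a :+ q :* o := a :+ q :* one :* o) ≡.refl)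
      (stationary (λ j → mu j * n j 0 + q * Q ^ j * o j) (θ⁺ Q Q 0) step limit)
      where
      step : ∀ j → mu j * n j 0 + q * Q ^ j * o j ≈ mu (suc j) * n (suc j) 0 + q * (Q * Q ^ j) * o (suc j)
      step j = linear (mu (suc j) ⊙ n-shift j 0)
        (elim (q ∷ Q ∷ Q ^ j ∷ la (suc j) ∷ las j 1 ∷ mu j ∷ mu (suc j) ∷ n j 0 ∷ n (suc j) 0 ∷ o j ∷ o (suc j) ∷ [])
          (λ q Q J L₁ l₁ u u₁ v v₁ o o₁ →
            (u ⇒ (one :- q :* J) :* u₁) ∷ (o ⇒ L₁ :* u₁ :+ Q :* o₁) ∷ (l₁ ⇒ L₁) ∷ [] ,
            ((u :* v :+ q :* J :* o) :- (u₁ :* v₁ :+ q :* (Q :* J) :* o₁)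
              := u₁ :* ((one :- q :* J) :* v :- (v₁ :- q :* J :* l₁))))
          (Pr-step q oQ j , sol-step _ _ (λ _ → oQ) j , reflexive (shifted-≡ la j 1) , tt) ≡.refl)
      limit : ∀ j → Ord j ((mu j * n j 0 + q * Q ^ j * o j) - θ⁺ Q Q 0)
      limit j = ord-resp
        (solve (mu j ∷ n j 0 ∷ q * Q ^ j ∷ o j ∷ θ⁺ Q Q 0 ∷ []) (λ u v x o t →
          ((u :- one) :* v :+ x :* o) :+ (v :- t) := (u :* v :+ x :* o) :- t) ≡.refl)
        (ord-+ (ord-+ (ord-*ˡ _ (Pr-one q oQ j)) (ord-*ˡ _ (ord-geo q j oQ)))
          (contract-ord j (λ k → las j (suc k) - 1#) (λ k → Q * Q ^ k) (λ k → n j k - θ⁺ Q Q k)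
            (λ k → shifted-Pr-one (- q) oQ j (suc k)) ob
            (λ k → elim (Q * Q ^ k ∷ las j (suc k) ∷ n j k ∷ n j (suc k) ∷ θ⁺ Q Q k ∷ θ⁺ Q Q (suc k) ∷ [])
              (λ B l u u₁ t t₁ → (u ⇒ l :+ B :* u₁) ∷ (t ⇒ one :+ B :* t₁) ∷ [] ,
                (u :- t := (l :- one) :+ B :* (u₁ :- t₁)))
              (n-step j k , θ⁺-step oQ k , tt) ≡.refl) 0))

  dbl : ℕ → ℕ
  dbl zero = zero
  dbl (suc k) = suc (suc (dbl k))

  k≤dbl : ∀ k → k ℕ.≤ dbl k
  k≤dbl zero = ℕ.z≤n
  k≤dbl (suc k) = ℕ.s≤s (ℕₚ.m≤n⇒m≤1+n (k≤dbl k))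

  ^-dbl : ∀ Q k → Q ^ dbl k ≈ (Q * Q) ^ k
  ^-dbl Q zero = refl
  ^-dbl Q (suc k) = trans (*-congˡ (*-congˡ (^-dbl Q k))) (sym (*-assoc _ _ _))

  Pr-split : ∀ x {Q} → Ord 1 Q → ∀ k → Pr x Q (dbl k) ≈ Pr x (Q * Q) k * Pr (x * Q) (Q * Q) k
  Pr-split x {Q} o k = minus-zero (persist
      (λ k → (1# - x * (Q * Q) ^ k) * (1# - x * Q * (Q * Q) ^ k)) (λ k → Pr x Q (dbl k) - X k * Y k)
      (λ k → ord-join 1# (ord-≤ (k≤dbl k) (Pr-one x o (dbl k))) (ord-swap (ord-one-* (Pr-one x oo k) (Pr-one (x * Q) oo k))))
      (λ k → elim (x ∷ Q ∷ Q ^ dbl k ∷ (Q * Q) ^ k ∷ Pr x Q (dbl k) ∷ Pr x Q (suc (dbl k)) ∷ Pr x Q (dbl (suc k)) ∷ X k ∷ X (suc k) ∷ Y k ∷ Y (suc k) ∷ [])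
        (λ x Q K L p p₁ p₂ X X₁ Y Y₁ →
          (p ⇒ (one :- x :* K) :* p₁) ∷ (p₁ ⇒ (one :- x :* (Q :* K)) :* p₂) ∷ (X ⇒ (one :- x :* L) :* X₁)
            ∷ (Y ⇒ (one :- x :* Q :* L) :* Y₁) ∷ (K ⇒ L) ∷ [] ,
          (p :- X :* Y := (one :- x :* L) :* (one :- x :* Q :* L) :* (p₂ :- X₁ :* Y₁)))
        (Pr-step x o (dbl k) , Pr-step x o (suc (dbl k)) , Pr-step x oo k , Pr-step (x * Q) oo k , ^-dbl Q k , tt) ≡.refl) k)
    where
    oo : Ord 1 (Q * Q)
    oo = ord-*ˡ Q o
    X = Pr x (Q * Q)
    Y = Pr (x * Q) (Q * Q)

  -- Both sides count partitions into distinct parts, read by their largest part.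
  module Distinct (q Q : Carrier) (oq : Ord 1 q) (oQ : Ord 1 Q) where
    m : ℕ → Carrier
    m = Pr q Q

    h : ℕ → Carrier
    h = sol m (λ k → q * Q ^ k)

    oh : ∀ k → Ord 1 (q * Q ^ k)
    oh k = ord-*ˡ _ oq

    e : ℕ → ℕ → Carrier
    e j = sol (λ _ → 1#) (λ n → q * Q ^ j * (1# + Q * Q ^ n))

    oe : ∀ j n → Ord 1 (q * Q ^ j * (1# + Q * Q ^ n))
    oe j n = ord-*ˡ _ (ord-*ˡ _ oq)

    e-step : ∀ j n → e j n ≈ 1# + q * Q ^ j * (1# + Q * Q ^ n) * e j (suc n)
    e-step j = sol-step _ _ (oe j)

    e-shift : ∀ j n → (1# - q * Q ^ j) * e j n ≈ 1# + q * Q ^ j * (Q * Q ^ n) * e (suc j) n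
    e-shift j n = minus-zero (contract (λ n → q * Q ^ j * (1# + Q * Q ^ n)) V (oe j) step n)
      where
      V : ℕ → Carrier
      V n = (1# - q * Q ^ j) * e j n - (1# + q * Q ^ j * (Q * Q ^ n) * e (suc j) n)
      step : ∀ n → V n ≈ q * Q ^ j * (1# + Q * Q ^ n) * V (suc n)
      step n = elim (q ∷ Q ∷ Q ^ j ∷ Q ^ n ∷ e j n ∷ e j (suc n) ∷ e (suc j) n ∷ e (suc j) (suc n) ∷ [])
        (λ q Q J N u u₁ v v₁ →
          (u ⇒ one :+ q :* J :* (one :+ Q :* N) :* u₁) ∷ (v ⇒ one :+ q :* (Q :* J) :* (one :+ Q :* N) :* v₁) ∷ [] ,
          ((one :- q :* J) :* u :- (one :+ q :* J :* (Q :* N) :* v)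
            := q :* J :* (one :+ Q :* N) :* ((one :- q :* J) :* u₁ :- (one :+ q :* J :* (Q :* (Q :* N)) :* v₁))))
        (e-step j n , e-step (suc j) n , tt) ≡.refl

    h≈e : h 0 ≈ m 0 * (1# + q * e 0 0)
    h≈e = trans (sym (sol-unique m _ U oh step 0))
      (solve (m 0 ∷ q ∷ e 0 0 ∷ []) (λ m q e → m :* (one :+ q :* one :* e) := m :* (one :+ q :* e)) ≡.refl)
      where
      U : ℕ → Carrier
      U j = m j * (1# + q * Q ^ j * e j 0)
      step : ∀ j → U j ≈ m j + q * Q ^ j * U (suc j)
      step j = linear ((q * Q ^ j * m (suc j)) ⊙ e-shift j 0)
        (elim (q ∷ Q ∷ Q ^ j ∷ m j ∷ m (suc j) ∷ e j 0 ∷ e (suc j) 0 ∷ []) (λ q Q J m m₁ u v →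
          (m ⇒ (one :- q :* J) :* m₁) ∷ [] ,
          (m :* (one :+ q :* J :* u) :- (m :+ q :* J :* (m₁ :* (one :+ q :* (Q :* J) :* v)))
            := q :* J :* m₁ :* ((one :- q :* J) :* u :- (one :+ q :* J :* (Q :* one) :* v))))
          (Pr-step q oQ j , tt) ≡.refl)

    oQQ : Ord 1 (Q * Q)
    oQQ = ord-*ˡ Q oQ

    m-odd : ∀ k → m (suc (dbl k)) ≈ Pr q (Q * Q) (suc k) * Pr (q * Q) (Q * Q) k
    m-odd k = cancel-unit (ord-*ˡ ((Q * Q) ^ k) oq)
      (linear ((- 1#) ⊙ Pr-step q oQ (dbl k) ⊞ 1# ⊙ Pr-split q oQ k ⊞ Pr (q * Q) (Q * Q) k ⊙ Pr-step q oQQ k)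
         (elim (q ∷ Q ^ dbl k ∷ (Q * Q) ^ k ∷ m (dbl k) ∷ m (suc (dbl k)) ∷ Pr q (Q * Q) k ∷ Pr q (Q * Q) (suc k) ∷ Pr (q * Q) (Q * Q) k ∷ [])
           (λ q K L m m₁ X X₁ Y → (K ⇒ L) ∷ [] ,
             ((one :- q :* L) :* m₁ :- (one :- q :* L) :* (X₁ :* Y)
               := (:- one) :* (m :- (one :- q :* K) :* m₁) :+ (one :* (m :- X :* Y) :+ Y :* (X :- (one :- q :* L) :* X₁))))
           (^-dbl Q k , tt) ≡.refl))

    g : ℕ → Carrier
    g = twin 0 (Pr q (Q * Q) ∘ suc) (Pr (q * Q) (Q * Q)) (Q * Q)

    -- Two steps of the recursion of `h` make one step of the recursion of `g`. With Q = q², h 0 is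
    -- (q; q²)_∞ (1 + ψ(q)) for the third order mock theta function ψ, while `g` is the numerator of
    -- a series in base q⁴; this is where g(q; q⁴) enters.
    g≈h : Q ≈ q * q → g 0 ≈ h 0
    g≈h eQ = sym (twin-unique 0 _ _ (h ∘ dbl) oQQ step 0)
      where
      step : ∀ k → h (dbl k) ≈ Pr q (Q * Q) (suc k) * Pr (q * Q) (Q * Q) k
                               + (Q * Q) ^ 1 * ((Q * Q) ^ k) ^ 2 * h (dbl (suc k))
      step k = elim (q ∷ Q ∷ Q ^ dbl k ∷ (Q * Q) ^ k ∷ m (dbl k) ∷ m (suc (dbl k)) ∷ h (dbl k) ∷ h (suc (dbl k)) ∷ h (dbl (suc k))
                      ∷ Pr q (Q * Q) (suc k) * Pr (q * Q) (Q * Q) k ∷ [])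
        (λ q Q K L m m₁ h h₁ h₂ X →
          (h ⇒ m :+ q :* K :* h₁) ∷ (h₁ ⇒ m₁ :+ q :* (Q :* K) :* h₂) ∷ (m ⇒ (one :- q :* K) :* m₁) ∷ (m₁ ⇒ X) ∷ (L ⇒ K) ∷ (Q ⇒ q :* q) ∷ [] ,
          (h := X :+ (Q :* Q) :^ 1 :* L :^ 2 :* h₂))
        (sol-step _ _ oh (dbl k) , sol-step _ _ oh (suc (dbl k)) , Pr-step q oQ (dbl k) , m-odd k , sym (^-dbl Q k) , eQ , tt) ≡.refl

  θ⁺-shift : ∀ {y Q} → Ord 1 y → θ⁺ y Q 0 ≈ 1# + y * θ⁺ (y * Q) Q 0
  θ⁺-shift {y} {Q} o = trans (θ⁺-step o 0) (+-congˡ (trans (*-congʳ (*-identityʳ y)) (*-congˡ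
    (sol-unique _ _ (θ⁺ y Q ∘ suc) (λ k → ord-*ˡ _ (ord-*ˡ _ o))
      (λ k → trans (θ⁺-step o (suc k)) (+-congˡ (*-congʳ (sym (*-assoc _ _ _))))) 0))))

  -- Terms of even and of odd index are collected: two steps of the recursion on the left are one
  -- step of the recursion on the right.
  θ⁺-split : ∀ {y Q} → Ord 1 y →
             θ⁺ y Q 0 ≈ θ⁺ (y ^ 2 * Q) (Q ^ 4) 0 + y * θ⁺ (y ^ 2 * Q ^ 3) (Q ^ 4) 0
  θ⁺-split {y} {Q} o = trans
    (unique (λ k → 1# + y * Q ^ dbl k) (λ k → y ^ 2 * Q * (Q ^ dbl k) ^ 2) (θ⁺ y Q ∘ dbl) U (λ k → ord-*ˡ _ (ord-*ˡ _ (ord-*ˡ _ o))) stepL stepU 0)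
    (+-congˡ (*-congʳ (*-identityʳ y)))
    where
    E = θ⁺ (y ^ 2 * Q) (Q ^ 4)
    O = θ⁺ (y ^ 2 * Q ^ 3) (Q ^ 4)
    U : ℕ → Carrier
    U k = E k + y * Q ^ dbl k * O k
    pow : ∀ k → (Q ^ 4) ^ k ≈ (Q ^ dbl k) ^ 2
    pow zero = solve [] (one := one :^ 2) ≡.refl
    pow (suc k) = elim (Q ∷ (Q ^ 4) ^ k ∷ Q ^ dbl k ∷ []) (λ Q L K → (L ⇒ K :^ 2) ∷ [] ,
      (Q :^ 4 :* L := (Q :* (Q :* K)) :^ 2)) (pow k , tt) ≡.refl
    stepL : ∀ k → θ⁺ y Q (dbl k) ≈ (1# + y * Q ^ dbl k) + y ^ 2 * Q * (Q ^ dbl k) ^ 2 * θ⁺ y Q (dbl (suc k))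
    stepL k = elim (y ∷ Q ∷ Q ^ dbl k ∷ θ⁺ y Q (dbl k) ∷ θ⁺ y Q (suc (dbl k)) ∷ θ⁺ y Q (dbl (suc k)) ∷ [])
      (λ y Q K t t₁ t₂ → (t ⇒ one :+ y :* K :* t₁) ∷ (t₁ ⇒ one :+ y :* (Q :* K) :* t₂) ∷ [] ,
        (t := (one :+ y :* K) :+ y :^ 2 :* Q :* K :^ 2 :* t₂))
      (θ⁺-step o (dbl k) , θ⁺-step o (suc (dbl k)) , tt) ≡.refl
    stepU : ∀ k → U k ≈ (1# + y * Q ^ dbl k) + y ^ 2 * Q * (Q ^ dbl k) ^ 2 * U (suc k)
    stepU k = elim (y ∷ Q ∷ Q ^ dbl k ∷ (Q ^ 4) ^ k ∷ E k ∷ E (suc k) ∷ O k ∷ O (suc k) ∷ [])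
      (λ y Q K L e e₁ o o₁ →
        (e ⇒ one :+ y :^ 2 :* Q :* L :* e₁) ∷ (o ⇒ one :+ y :^ 2 :* Q :^ 3 :* L :* o₁) ∷ (L ⇒ K :^ 2) ∷ [] ,
        (e :+ y :* K :* o := (one :+ y :* K) :+ y :^ 2 :* Q :* K :^ 2 :* (e₁ :+ y :* (Q :* (Q :* K)) :* o₁)))
      (θ⁺-step (ord-*ˡ _ (ord-*ˡ _ o)) k , θ⁺-step (ord-*ˡ _ (ord-*ˡ _ o)) k , pow k , tt) ≡.refl

-- Formal power series as a complete ring.

module PowerSeries (R : CommutativeRing 0ℓ 0ℓ) where
  open CommutativeRing R hiding (zero)
  open RingTools R using (minus-zero)
  open IntegerSolver R

  Ser : Set
  Ser = ℕ → Carrier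

  infix 4 _≋_
  record _≋_ (f g : Ser) : Set where
    constructor pointwise
    field at : ∀ n → f n ≈ g n
  open _≋_ public

  tl : Ser → Ser
  tl f n = f (suc n)

  0ˢ 1ˢ X : Ser
  0ˢ _ = 0#
  1ˢ zero = 1#
  1ˢ (suc _) = 0#
  X zero = 0#
  X (suc n) = 1ˢ n

  const : Carrier → Ser
  const c zero = c
  const c (suc _) = 0#

  infixl 6 _+ˢ_
  infixl 7 _*ˢ_ _·ˢ_
  _+ˢ_ : Ser → Ser → Ser
  (f +ˢ g) n = f n + g n

  -ˢ_ : Ser → Ser
  (-ˢ f) n = - f n

  _·ˢ_ : Carrier → Ser → Ser
  (c ·ˢ f) n = c * f n

  opaque
    _*ˢ_ : Ser → Ser → Ser
    (f *ˢ g) zero = f 0 * g 0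
    (f *ˢ g) (suc n) = f 0 * g (suc n) + (tl f *ˢ g) n

    *ˢ-head : ∀ f g → (f *ˢ g) 0 ≈ f 0 * g 0
    *ˢ-head f g = refl

    *ˢ-tail : ∀ f g n → (f *ˢ g) (suc n) ≈ f 0 * g (suc n) + (tl f *ˢ g) n
    *ˢ-tail f g n = refl

    *ˢ-cong : ∀ n {f f' g g'} → (∀ i → f i ≈ f' i) → (∀ i → g i ≈ g' i) → (f *ˢ g) n ≈ (f' *ˢ g') n
    *ˢ-cong zero e e' = *-cong (e 0) (e' 0)
    *ˢ-cong (suc n) e e' = +-cong (*-cong (e 0) (e' (suc n))) (*ˢ-cong n (e ∘ suc) e')

    *ˢ-distribʳ : ∀ n f g h → ((f +ˢ g) *ˢ h) n ≈ (f *ˢ h) n + (g *ˢ h) n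
    *ˢ-distribʳ zero f g h = distribʳ _ _ _
    *ˢ-distribʳ (suc n) f g h = trans (+-congˡ (*ˢ-distribʳ n (tl f) (tl g) h))
      (solve (f 0 ∷ g 0 ∷ h (suc n) ∷ (tl f *ˢ h) n ∷ (tl g *ˢ h) n ∷ []) (λ a b c d e →
        (a :+ b) :* c :+ (d :+ e) := (a :* c :+ d) :+ (b :* c :+ e)) ≡.refl)

    *ˢ-scale : ∀ n c f g → ((c ·ˢ f) *ˢ g) n ≈ c * (f *ˢ g) n
    *ˢ-scale zero c f g = *-assoc _ _ _
    *ˢ-scale (suc n) c f g = trans (+-congˡ (*ˢ-scale n c (tl f) g))
      (solve (c ∷ f 0 ∷ g (suc n) ∷ (tl f *ˢ g) n ∷ []) (λ c a b d →
        c :* a :* b :+ c :* d := c :* (a :* b :+ d)) ≡.refl)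

    -- The product peels the first coefficient of the left factor; this is the same recursion from
    -- the other end, and commutativity rests on it.
    *ˢ-last : ∀ n f g → (f *ˢ g) (suc n) ≈ (f *ˢ tl g) n + f (suc n) * g 0
    *ˢ-last zero f g = refl
    *ˢ-last (suc n) f g = trans (+-congˡ (*ˢ-last n (tl f) g)) (sym (+-assoc _ _ _))

    *ˢ-comm : ∀ n f g → (f *ˢ g) n ≈ (g *ˢ f) n
    *ˢ-comm zero f g = *-comm _ _
    *ˢ-comm (suc n) f g = trans (+-cong (*-comm _ _) (*ˢ-comm n (tl f) g))
      (trans (+-comm _ _) (sym (*ˢ-last n g f)))

    *ˢ-assoc : ∀ n f g h → ((f *ˢ g) *ˢ h) n ≈ (f *ˢ (g *ˢ h)) n
    *ˢ-assoc zero f g h = *-assoc _ _ _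
    *ˢ-assoc (suc n) f g h = trans (+-congˡ (trans (*ˢ-distribʳ n (f 0 ·ˢ tl g) (tl f *ˢ g) h)
        (+-cong (*ˢ-scale n (f 0) (tl g) h) (*ˢ-assoc n (tl f) g h))))
      (solve (f 0 ∷ g 0 ∷ h (suc n) ∷ (tl g *ˢ h) n ∷ (tl f *ˢ (g *ˢ h)) n ∷ []) (λ a b c d e →
        a :* b :* c :+ (a :* d :+ e) := a :* (b :* c :+ d) :+ e) ≡.refl)

    0*ˢ : ∀ n f → (0ˢ *ˢ f) n ≈ 0#
    0*ˢ zero f = zeroˡ _
    0*ˢ (suc n) f = trans (+-cong (zeroˡ _) (0*ˢ n f)) (+-identityˡ 0#)

    const-* : ∀ c f n → (const c *ˢ f) n ≈ c * f n
    const-* c f zero = refl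
    const-* c f (suc n) = trans (+-congˡ (0*ˢ n f)) (+-identityʳ _)

    1*ˢ : ∀ n f → (1ˢ *ˢ f) n ≈ f n
    1*ˢ zero f = *-identityˡ _
    1*ˢ (suc n) f = trans (+-cong (*-identityˡ _) (0*ˢ n f)) (+-identityʳ _)

    X*-zero : ∀ f → (X *ˢ f) 0 ≈ 0#
    X*-zero f = zeroˡ _

    X*-suc : ∀ f n → (X *ˢ f) (suc n) ≈ f n
    X*-suc f n = trans (+-cong (zeroˡ _) (1*ˢ n f)) (+-identityˡ _)

  seriesRing : CommutativeRing 0ℓ 0ℓ
  seriesRing = record
    { Carrier = Ser ; _≈_ = _≋_ ; _+_ = _+ˢ_ ; _*_ = _*ˢ_ ; -_ = -ˢ_ ; 0# = 0ˢ ; 1# = 1ˢ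
    ; isCommutativeRing = record
      { isRing = record
        { +-isAbelianGroup = record
          { isGroup = record
            { isMonoid = record
              { isSemigroup = record
                { isMagma = record
                  { isEquivalence = record
                    { refl = pointwise λ _ → refl
                    ; sym = λ e → pointwise λ n → sym (at e n)
                    ; trans = λ e e' → pointwise λ n → trans (at e n) (at e' n) }
                  ; ∙-cong = λ e e' → pointwise λ n → +-cong (at e n) (at e' n) }
                ; assoc = λ f g h → pointwise λ n → +-assoc _ _ _ }
              ; identity = (λ f → pointwise λ n → +-identityˡ _) , (λ f → pointwise λ n → +-identityʳ _) }
            ; inverse = (λ f → pointwise λ n → -‿inverseˡ _) , (λ f → pointwise λ n → -‿inverseʳ _)
            ; ⁻¹-cong = λ e → pointwise λ n → -‿cong (at e n) }
          ; comm = λ f g → pointwise λ n → +-comm _ _ }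
        ; *-cong = λ e e' → pointwise λ n → *ˢ-cong n (at e) (at e')
        ; *-assoc = λ f g h → pointwise λ n → *ˢ-assoc n f g h
        ; *-identity = (λ f → pointwise λ n → 1*ˢ n f)
                     , (λ f → pointwise λ n → trans (*ˢ-comm n f 1ˢ) (1*ˢ n f))
        ; distrib = (λ f g h → pointwise λ n → trans (*ˢ-comm n f (g +ˢ h))
                       (trans (*ˢ-distribʳ n g h f) (+-cong (*ˢ-comm n g f) (*ˢ-comm n h f))))
                  , (λ h f g → pointwise λ n → *ˢ-distribʳ n f g h) }
      ; *-comm = λ f g → pointwise λ n → *ˢ-comm n f g } }

  record Vanish (n : ℕ) (f : Ser) : Set where
    constructor vanish
    field below : ∀ i → i ℕ.< n → f i ≈ 0#
  open Vanish public

  opaque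
    unfolding _*ˢ_

    vanish-*ʳ : ∀ n i f g → Vanish n g → i ℕ.< n → (f *ˢ g) i ≈ 0#
    vanish-*ʳ n zero f g v lt = trans (*-congˡ (below v 0 lt)) (zeroʳ _)
    vanish-*ʳ n (suc i) f g v lt = trans (+-cong (trans (*-congˡ (below v (suc i) lt)) (zeroʳ _))
      (vanish-*ʳ n i (tl f) g v (ℕₚ.<-trans (ℕₚ.n<1+n i) lt))) (+-identityˡ 0#)

    vanish-* : ∀ m n i f g → Vanish m f → Vanish n g → i ℕ.< m ℕ.+ n → (f *ˢ g) i ≈ 0#
    vanish-* zero n i f g u v lt = vanish-*ʳ n i f g v lt
    vanish-* (suc m) n zero f g u v lt = trans (*-congʳ (below u 0 (ℕ.s≤s ℕ.z≤n))) (zeroˡ _)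
    vanish-* (suc m) n (suc i) f g u v lt = trans
      (+-cong (trans (*-congʳ (below u 0 (ℕ.s≤s ℕ.z≤n))) (zeroˡ _))
              (vanish-* m n i (tl f) g (vanish λ j l → below u (suc j) (ℕ.s≤s l)) v (ℕ.s≤s⁻¹ lt)))
      (+-identityˡ 0#)

  series : CompleteRing
  series = record
    { commutativeRing = seriesRing
    ; Ord = Vanish
    ; ord-resp = λ e v → vanish λ i l → trans (sym (at e i)) (below v i l)
    ; ord-0# = λ n → vanish λ _ _ → refl
    ; ord-zero = λ f → vanish λ _ ()
    ; ord-+ = λ u v → vanish λ i l → trans (+-cong (below u i l) (below v i l)) (+-identityˡ 0#)
    ; ord-* = λ {m} {n} {f} {g} u v → vanish λ i l → vanish-* m n i f g u v l
    ; ord-≤ = λ le v → vanish λ i l → below v i (ℕₚ.≤-trans l le)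
    ; separated = λ v → pointwise λ n → below (v (suc n)) n (ℕₚ.n<1+n n)
    -- The terms with indices m and m + 1 agree below degree m, so coefficient n is settled from
    -- index n + 1 on.
    ; lim = λ f n → f (suc n) n
    ; lim-law = λ f c n → vanish λ i l → trans (+-congʳ (settled f c l)) (-‿inverseʳ _) }
    where
    settled' : ∀ (f : ℕ → Ser) → (∀ n → Vanish n (f (suc n) +ˢ -ˢ f n)) → ∀ d i → f (suc i) i ≈ f (d ℕ.+ suc i) i
    settled' f c zero i = refl
    settled' f c (suc d) i = trans (settled' f c d i)
      (sym (minus-zero (below (c (d ℕ.+ suc i)) i (ℕₚ.m≤n+m (suc i) d))))
    settled : ∀ (f : ℕ → Ser) → (∀ n → Vanish n (f (suc n) +ˢ -ˢ f n)) → ∀ {i n} → i ℕ.< n → f (suc i) i ≈ f n i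
    settled f c {i} {n} l = ≡.subst (λ k → f (suc i) i ≈ f k i) (ℕₚ.m∸n+n≡m l) (settled' f c (n ℕ.∸ suc i) i)

  vanish-X : Vanish 1 X
  vanish-X = vanish λ { zero _ → refl ; (suc _) (ℕ.s≤s ()) }

-- Substitutions described by relations.

-- T is a family of additive relations closed under limits; M k f g says that multiplying by f and g
-- respects T up to an index shift by k.  Closure of M under the series constructions replaces the
-- continuity of ring homomorphisms that are only partially defined.
module Multipliers (A B : CompleteRing) where
  module A = Series A
  module B = Series B

  record Relation : Set₁ where
    field
      T : ℕ → A.Carrier → B.Carrier → Set
      T-resp : ∀ {k F F' G G'} → F A.≈ F' → G B.≈ G' → T k F G → T k F' G'
      T-zero : ∀ {k} → T k A.0# B.0#
      T-+ : ∀ {k F F' G G'} → T k F G → T k F' G' → T k (F A.+ F') (G B.+ G')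
      T-neg : ∀ {k F G} → T k F G → T k (A.- F) (B.- G)
      T-lim : ∀ {k F G} (f : ℕ → A.Carrier) (g : ℕ → B.Carrier) → (∀ N → T k (f N) (g N)) →
              (∀ N → A.Ord N (F A.- f N)) → (∀ N → B.Ord N (G B.- g N)) → T k F G

  module Closure (Rel : Relation) where
    open Relation Rel

    M : ℕ → A.Carrier → B.Carrier → Set
    M k f g = ∀ j F G → T j F G → T (k ℕ.+ j) (f A.* F) (g B.* G)

    M-resp : ∀ {k f f' g g'} → f A.≈ f' → g B.≈ g' → M k f g → M k f' g'
    M-resp e e' m j F G t = T-resp (A.*-congʳ e) (B.*-congʳ e') (m j F G t)

    M-one : M 0 A.1# B.1#
    M-one j F G t = T-resp (A.sym (A.*-identityˡ F)) (B.sym (B.*-identityˡ G)) t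

    M-zero : ∀ {k} → M k A.0# B.0#
    M-zero j F G t = T-resp (A.sym (A.zeroˡ F)) (B.sym (B.zeroˡ G)) T-zero

    M-+ : ∀ {k f f' g g'} → M k f g → M k f' g' → M k (f A.+ f') (g B.+ g')
    M-+ m m' j F G t = T-resp (A.sym (A.distribʳ F _ _)) (B.sym (B.distribʳ G _ _)) (T-+ (m j F G t) (m' j F G t))

    M-neg : ∀ {k f g} → M k f g → M k (A.- f) (B.- g)
    M-neg {f = f} {g} m j F G t = T-resp
      (A.solve (f ∷ F ∷ []) (λ f F → A.:- (f A.:* F) A.:= (A.:- f) A.:* F) ≡.refl)
      (B.solve (g ∷ G ∷ []) (λ f F → B.:- (f B.:* F) B.:= (B.:- f) B.:* F) ≡.refl) (T-neg (m j F G t))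

    M-* : ∀ {k l f f' g g'} → M k f g → M l f' g' → M (k ℕ.+ l) (f A.* f') (g B.* g')
    M-* {k} {l} {f} {f'} {g} {g'} m m' j F G t =
      ≡.subst (λ i → T i ((f A.* f') A.* F) ((g B.* g') B.* G)) (≡.sym (ℕₚ.+-assoc k l j))
        (T-resp (A.sym (A.*-assoc f f' F)) (B.sym (B.*-assoc g g' G)) (m (l ℕ.+ j) _ _ (m' j F G t)))

    M-^ : ∀ {f g} n → M 0 f g → M 0 (f A.^ n) (g B.^ n)
    M-^ zero m = M-one
    M-^ (suc n) m = M-* m (M-^ n m)

    M-lim : ∀ {k f g} (f' : ℕ → A.Carrier) (g' : ℕ → B.Carrier) → (∀ N → M k (f' N) (g' N)) →
            (∀ N → A.Ord N (f A.- f' N)) → (∀ N → B.Ord N (g B.- g' N)) → M k f g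
    M-lim {f = f} {g} f' g' m of og j F G t = T-lim (λ N → f' N A.* F) (λ N → g' N B.* G) (λ N → m N j F G t)
      (λ N → A.ord-resp (A.solve (f ∷ f' N ∷ F ∷ []) (λ f f' F → (f A.:- f') A.:* F A.:= f A.:* F A.:- f' A.:* F) ≡.refl)
                        (A.ord-*ˡ F (of N)))
      (λ N → B.ord-resp (B.solve (g ∷ g' N ∷ G ∷ []) (λ f f' F → (f B.:- f') B.:* F B.:= f B.:* F B.:- f' B.:* F) ≡.refl)
                        (B.ord-*ˡ G (og N)))

    M-sol : ∀ {d a b a' b'} → (∀ k → M d (a k) (a' k)) → (∀ k → M 0 (b k) (b' k)) →
            (∀ k → A.Ord 1 (b k)) → (∀ k → B.Ord 1 (b' k)) → ∀ k → M d (A.sol a b k) (B.sol a' b' k)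
    M-sol {d} {a} {b} {a'} {b'} ma mb ob ob' k =
      M-lim (λ N → A.partial a b N k) (λ N → B.partial a' b' N k) (λ N → go N k)
        (A.sol-approx a b ob k) (B.sol-approx a' b' ob' k)
      where
      go : ∀ N k → M d (A.partial a b N k) (B.partial a' b' N k)
      go zero k = M-zero
      go (suc N) k = M-+ (ma k) (M-* (mb k) (go N (suc k)))

    M-twin : ∀ c {X Y X' Y' Q Q'} → (∀ k → M 0 (X k) (X' k)) → (∀ k → M 0 (Y k) (Y' k)) → M 0 Q Q' →
             A.Ord 1 Q → B.Ord 1 Q' → ∀ k → M 0 (A.twin c X Y Q k) (B.twin c X' Y' Q' k)
    M-twin c mX mY mQ o o' = M-sol (λ k → M-* (mX k) (mY k)) (λ k → M-* (M-^ (suc c) mQ) (M-^ 2 (M-^ k mQ)))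
      (A.ord-twin c o) (B.ord-twin c o')

    -- The index maps are the identity or the successor, which allows the two products to be offset.
    M-Prod : ∀ {y y'} (i i' : ℕ → ℕ) → (∀ k → i (suc k) ≡ suc (i k)) → (∀ k → i' (suc k) ≡ suc (i' k)) →
             A.Small y → B.Small y' → (∀ k → M 0 (y (i k)) (y' (i' k))) →
             ∀ k → M 0 (A.Prod y (i k)) (B.Prod y' (i' k))
    M-Prod {y} {y'} i i' e e' oy oy' my k =
      M-lim (λ N → A.partialProd y N (i k)) (λ N → B.partialProd y' N (i' k)) (λ N → go N k)
        (A.Prod-approx y oy (i k)) (B.Prod-approx y' oy' (i' k))
      where
      go : ∀ N k → M 0 (A.partialProd y N (i k)) (B.partialProd y' N (i' k))
      go zero k = M-one
      go (suc N) k = M-* (M-+ M-one (M-neg (my k)))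
        (≡.subst₂ (λ a b → M 0 (A.partialProd y N a) (B.partialProd y' N b)) (e k) (e' k) (go N (suc k)))

-- The substitution σ on coefficients and the invariance of H.

-- Double series: the outer variable is p', the inner one p, so F b a is the coefficient of pᵃ p'ᵇ.
module DoubleSeries (K : CommutativeRing 0ℓ 0ℓ) where
  module K = CommutativeRing K
  module P₁ = PowerSeries K
  module P₂ = PowerSeries P₁.seriesRing
  module S₁ = Series P₁.series
  module S₂ = Series P₂.series

  p p' : S₂.Carrier
  p = P₂.const P₁.X
  p' = P₂.X

  op' : S₂.Ord 1 p'
  op' = P₂.vanish-X

  -- The filtration sees only the degree in p', so p itself is not small. The products and twin
  -- series nevertheless converge, because their bases are w and w⁴, which contain p'.
  ow : S₂.Ord 1 (p S₂.* p')
  ow = S₂.ord-*ʳ p op'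

  p-zero : ∀ F b → (p S₂.* F) b 0 K.≈ K.0#
  p-zero F b = K.trans (P₁.at (P₂.const-* P₁.X F b) 0) (P₁.X*-zero (F b))

  p-suc : ∀ F b a → (p S₂.* F) b (suc a) K.≈ F b a
  p-suc F b a = K.trans (P₁.at (P₂.const-* P₁.X F b) (suc a)) (P₁.X*-suc (F b) a)

  p'-zero : ∀ F a → (p' S₂.* F) 0 a K.≈ K.0#
  p'-zero F a = P₁.at (P₂.X*-zero F) a

  p'-suc : ∀ F b a → (p' S₂.* F) (suc b) a K.≈ F b a
  p'-suc F b a = P₁.at (P₂.X*-suc F b) a

  at₂ : ∀ {F G} → F S₂.≈ G → ∀ b a → F b a K.≈ G b a
  at₂ e b a = P₁.at (P₂.at e b) a

  agree : ∀ {N} (F G : S₂.Carrier) → S₂.Ord N (F S₂.- G) → ∀ {b} → b ℕ.< N → ∀ a → F b a K.≈ G b a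
  agree F G o {b} l a = RingTools.minus-zero K (P₁.at (P₂.below o b l) a)

  open Universal P₂.series p p' ow public

  w-zero : ∀ F a → (w S₂.* F) 0 a K.≈ K.0#
  w-zero F a = K.trans (at₂ (S₂.trans (S₂.*-congʳ (S₂.*-comm p p')) (S₂.*-assoc p' p F)) 0 a) (p'-zero _ a)

  w-suc-zero : ∀ F b → (w S₂.* F) b 0 K.≈ K.0#
  w-suc-zero F b = K.trans (at₂ (S₂.*-assoc p p' F) b 0) (p-zero _ b)

  w-suc : ∀ F b a → (w S₂.* F) (suc b) (suc a) K.≈ F b a
  w-suc F b a = K.trans (at₂ (S₂.*-assoc p p' F) (suc b) (suc a)) (K.trans (p-suc _ (suc b) a) (p'-suc F b a))

  -- Shift k F G says that G = wᵏ σ(F) for the substitution σ : p ↦ pw, p' ↦ p'/w,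
  -- which sends pᵃ p'ᵇ to p²ᵃ⁻ᵇ p'ᵃ.
  record Shift (k : ℕ) (F G : S₂.Carrier) : Set where
    field
      moved : ∀ a b c → c ℕ.+ b ≡ k ℕ.+ (a ℕ.+ a) → G (k ℕ.+ a) c K.≈ F b a
      lost : ∀ a b → k ℕ.+ (a ℕ.+ a) ℕ.< b → F b a K.≈ K.0#
      high : ∀ a c → k ℕ.+ (a ℕ.+ a) ℕ.< c → G (k ℕ.+ a) c K.≈ K.0#
      low : ∀ d c → d ℕ.< k → G d c K.≈ K.0#

  open Shift
  open Multipliers P₂.series P₂.series using (Relation; module Closure)

  shiftRelation : Relation
  shiftRelation = record
    { T = Shift
    ; T-resp = λ e e' t → record
      { moved = λ a b c l → K.trans (K.sym (at₂ e' _ c)) (K.trans (moved t a b c l) (at₂ e b a))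
      ; lost = λ a b l → K.trans (K.sym (at₂ e b a)) (lost t a b l)
      ; high = λ a c l → K.trans (K.sym (at₂ e' _ c)) (high t a c l)
      ; low = λ d c l → K.trans (K.sym (at₂ e' d c)) (low t d c l) }
    ; T-zero = record { moved = λ _ _ _ _ → K.refl ; lost = λ _ _ _ → K.refl
                      ; high = λ _ _ _ → K.refl ; low = λ _ _ _ → K.refl }
    ; T-+ = λ t u → record
      { moved = λ a b c l → K.+-cong (moved t a b c l) (moved u a b c l)
      ; lost = λ a b l → K.trans (K.+-cong (lost t a b l) (lost u a b l)) (K.+-identityˡ _)
      ; high = λ a b l → K.trans (K.+-cong (high t a b l) (high u a b l)) (K.+-identityˡ _)
      ; low = λ a b l → K.trans (K.+-cong (low t a b l) (low u a b l)) (K.+-identityˡ _) }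
    ; T-neg = λ t → record
      { moved = λ a b c l → K.-‿cong (moved t a b c l)
      ; lost = λ a b l → K.trans (K.-‿cong (lost t a b l)) neg0
      ; high = λ a b l → K.trans (K.-‿cong (high t a b l)) neg0
      ; low = λ a b l → K.trans (K.-‿cong (low t a b l)) neg0 }
    ; T-lim = λ {k} {F} {G} f g t of og → record
      { moved = λ a b c l →
          let N = suc (b ℕ.+ (k ℕ.+ a)) in
          K.trans (agree G (g N) (og N) (ℕ.s≤s (ℕₚ.m≤n+m _ b)) c)
            (K.trans (moved (t N) a b c l) (K.sym (agree F (f N) (of N) (ℕ.s≤s (ℕₚ.m≤m+n b _)) a)))
      ; lost = λ a b l → K.trans (agree F (f (suc b)) (of (suc b)) (ℕₚ.n<1+n b) a) (lost (t (suc b)) a b l)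
      ; high = λ a c l → K.trans (agree G (g (suc (k ℕ.+ a))) (og _) (ℕₚ.n<1+n _) c) (high (t _) a c l)
      ; low = λ d c l → K.trans (agree G (g (suc d)) (og _) (ℕₚ.n<1+n d) c) (low (t _) d c l) } }
    where
    neg0 = RingProperties.-0#≈0# K.ring

  module Sh = Closure shiftRelation
  open Sh

  -- The rule σ(p) = p w on coefficients. Multiplication by p w moves an entry by one in the degree
  -- of p' and by two in the degree of p; the case distinctions treat the entries near the edges,
  -- where nothing arrives.
  M-p : M 0 p (p S₂.* w)
  M-p k F G t = Relation.T-resp shiftRelation S₂.refl
      (S₂.solve (p ∷ p' ∷ G ∷ []) (λ p p' G → p :* (p :* (p' :* G)) := p :* (p :* p') :* G) ≡.refl)
      (record { moved = mv ; lost = ls ; high = hi ; low = lw })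
    where
    open S₂ using (_:*_; _:=_)
    G₃ = p S₂.* (p S₂.* (p' S₂.* G))
    dbl-suc : ∀ a → k ℕ.+ (suc a ℕ.+ suc a) ≡ suc (suc (k ℕ.+ (a ℕ.+ a)))
    dbl-suc a = ≡.trans (ℕₚ.+-suc k _) (≡.cong suc (≡.trans (≡.cong (k ℕ.+_) (ℕₚ.+-suc a a)) (ℕₚ.+-suc k _)))
    G₃-0 : ∀ c → G₃ 0 c K.≈ K.0#
    G₃-0 zero = p-zero _ 0
    G₃-0 (suc zero) = K.trans (p-suc _ 0 0) (p-zero _ 0)
    G₃-0 (suc (suc c)) = K.trans (p-suc _ 0 (suc c)) (K.trans (p-suc _ 0 c) (p'-zero G c))
    G₃-c0 : ∀ d → G₃ d 0 K.≈ K.0#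
    G₃-c0 d = p-zero _ d
    G₃-c1 : ∀ d → G₃ d 1 K.≈ K.0#
    G₃-c1 d = K.trans (p-suc _ d 0) (p-zero _ d)
    G₃-s : ∀ d c → G₃ (suc d) (suc (suc c)) K.≈ G d c
    G₃-s d c = K.trans (p-suc _ _ (suc c)) (K.trans (p-suc _ _ c) (p'-suc G d c))
    lw : ∀ d c → d ℕ.< k → G₃ d c K.≈ K.0#
    lw zero c l = G₃-0 c
    lw (suc d) zero l = G₃-c0 _
    lw (suc d) (suc zero) l = G₃-c1 _
    lw (suc d) (suc (suc c)) l = K.trans (G₃-s d c) (low t d c (ℕₚ.<-trans (ℕₚ.n<1+n d) l))
    edge : ∀ k' c → k' ℕ.< suc k → G₃ k' c K.≈ K.0#
    edge zero c l = G₃-0 c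
    edge (suc k') zero l = G₃-c0 _
    edge (suc k') (suc zero) l = G₃-c1 _
    edge (suc k') (suc (suc c)) l = K.trans (G₃-s k' c) (low t k' c (ℕ.s≤s⁻¹ l))
    k+0<1+k : k ℕ.+ 0 ℕ.< suc k
    k+0<1+k = ℕ.s≤s (ℕₚ.≤-reflexive (ℕₚ.+-identityʳ k))
    mv : ∀ a b c → c ℕ.+ b ≡ k ℕ.+ (a ℕ.+ a) → G₃ (k ℕ.+ a) c K.≈ (p S₂.* F) b a
    mv zero b c l = K.trans (edge _ c k+0<1+k) (K.sym (p-zero F b))
    mv (suc a) b c l rewrite ℕₚ.+-suc k a = go c (≡.trans l (dbl-suc a))
      where
      go : ∀ c → c ℕ.+ b ≡ suc (suc (k ℕ.+ (a ℕ.+ a))) → G₃ (suc (k ℕ.+ a)) c K.≈ (p S₂.* F) b (suc a)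
      go zero e = K.trans (G₃-c0 _) (K.sym (K.trans (p-suc F b a)
        (lost t a b (ℕₚ.≤-trans (ℕₚ.n≤1+n _) (ℕₚ.≤-reflexive (≡.sym e))))))
      go (suc zero) e = K.trans (G₃-c1 _) (K.sym (K.trans (p-suc F b a)
        (lost t a b (ℕₚ.≤-reflexive (≡.sym (ℕₚ.suc-injective e))))))
      go (suc (suc c)) e = K.trans (G₃-s _ c) (K.trans
        (moved t a b c (ℕₚ.suc-injective (ℕₚ.suc-injective e))) (K.sym (p-suc F b a)))
    ls : ∀ a b → k ℕ.+ (a ℕ.+ a) ℕ.< b → (p S₂.* F) b a K.≈ K.0#
    ls zero b l = p-zero F b
    ls (suc a) b l = K.trans (p-suc F b a) (lost t a b
      (ℕₚ.≤-trans (ℕₚ.m≤n+m _ 2) (≡.subst (ℕ._< b) (dbl-suc a) l)))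
    hi : ∀ a c → k ℕ.+ (a ℕ.+ a) ℕ.< c → G₃ (k ℕ.+ a) c K.≈ K.0#
    hi zero c l = edge _ c k+0<1+k
    hi (suc a) c l rewrite ℕₚ.+-suc k a = go c (≡.subst (ℕ._< c) (dbl-suc a) l)
      where
      go : ∀ c → suc (suc (k ℕ.+ (a ℕ.+ a))) ℕ.< c → G₃ (suc (k ℕ.+ a)) c K.≈ K.0#
      go (suc zero) (ℕ.s≤s ())
      go (suc (suc c)) (ℕ.s≤s (ℕ.s≤s l)) = K.trans (G₃-s _ c) (high t a c l)

  -- σ(p') = p'/w is not a power series, so one factor w is charged to the index.
  M-p' : M 1 p' p'
  M-p' k F G t = record { moved = mv ; lost = ls ; high = λ a c l → K.trans (p'-suc G _ c) (high t a c (ℕₚ.<-trans (ℕₚ.n<1+n _) l)) ; low = lw }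
    where
    mv : ∀ a b c → c ℕ.+ b ≡ suc (k ℕ.+ (a ℕ.+ a)) → (p' S₂.* G) (suc (k ℕ.+ a)) c K.≈ (p' S₂.* F) b a
    mv a zero c e = K.trans (p'-suc G _ c) (K.trans (high t a c (ℕₚ.≤-reflexive (≡.sym (≡.trans (≡.sym (ℕₚ.+-identityʳ c)) e))))
      (K.sym (p'-zero F a)))
    mv a (suc b) c e = K.trans (p'-suc G _ c) (K.trans
      (moved t a b c (ℕₚ.suc-injective (≡.trans (≡.sym (ℕₚ.+-suc c b)) e))) (K.sym (p'-suc F b a)))
    ls : ∀ a b → suc (k ℕ.+ (a ℕ.+ a)) ℕ.< b → (p' S₂.* F) b a K.≈ K.0#
    ls a (suc b) (ℕ.s≤s l) = K.trans (p'-suc F b a) (lost t a b l)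
    lw : ∀ d c → d ℕ.< suc k → (p' S₂.* G) d c K.≈ K.0#
    lw zero c l = p'-zero G c
    lw (suc d) c (ℕ.s≤s l) = K.trans (p'-suc G d c) (low t d c l)

  -- Raises the index of a summand, so that terms whose images need different powers of w can be
  -- added.
  M-1 : M 1 S₂.1# w
  M-1 k F G t = Relation.T-resp shiftRelation (S₂.sym (S₂.*-identityˡ F)) S₂.refl
      (record { moved = mv ; lost = λ a b l → lost t a b (ℕₚ.<-trans (ℕₚ.n<1+n _) l) ; high = hi ; low = lw })
    where
    mv : ∀ a b c → c ℕ.+ b ≡ suc (k ℕ.+ (a ℕ.+ a)) → (w S₂.* G) (suc (k ℕ.+ a)) c K.≈ F b a
    mv a b zero e = K.trans (w-suc-zero G _) (K.sym (lost t a b (ℕₚ.≤-reflexive (≡.sym e))))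
    mv a b (suc c) e = K.trans (w-suc G _ c) (moved t a b c (ℕₚ.suc-injective e))
    hi : ∀ a c → suc (k ℕ.+ (a ℕ.+ a)) ℕ.< c → (w S₂.* G) (suc (k ℕ.+ a)) c K.≈ K.0#
    hi a (suc c) (ℕ.s≤s l) = K.trans (w-suc G _ c) (high t a c l)
    lw : ∀ d c → d ℕ.< suc k → (w S₂.* G) d c K.≈ K.0#
    lw zero c l = w-zero G c
    lw (suc d) zero l = w-suc-zero G _
    lw (suc d) (suc c) (ℕ.s≤s l) = K.trans (w-suc G d c) (low t d c l)

  -- A factor w in the image pays back one unit of the index. The condition `lost` gains the case b
  -- = k + 2a + 1; such a coefficient would be carried to degree 0 in p, where a multiple of w is 0.
  M-cancel : ∀ {f g} → M 1 f (w S₂.* g) → M 0 f g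
  M-cancel {f} {g} m k F G t = record
    { moved = λ a b c e → K.trans (K.sym (w-suc gG _ c)) (moved u a b (suc c) (≡.cong suc e))
    ; lost = ls
    ; high = λ a c l → K.trans (K.sym (w-suc gG _ c)) (high u a (suc c) (ℕ.s≤s l))
    ; low = λ d c l → K.trans (K.sym (w-suc gG d c)) (low u (suc d) (suc c) (ℕ.s≤s l)) }
    where
    gG = g S₂.* G
    u : Shift (suc k) (f S₂.* F) (w S₂.* gG)
    u = Relation.T-resp shiftRelation S₂.refl (S₂.*-assoc w g G) (m k F G t)
    ls : ∀ a b → k ℕ.+ (a ℕ.+ a) ℕ.< b → (f S₂.* F) b a K.≈ K.0#
    ls a b l with ℕₚ.m≤n⇒m<n∨m≡n l
    ... | inj₁ l' = lost u a b l'
    ... | inj₂ e = K.trans (K.sym (moved u a b 0 (≡.sym e))) (w-suc-zero gG _)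

  M-w : M 0 w w
  M-w = M-cancel (M-resp S₂.refl (S₂.solve (p ∷ p' ∷ []) (λ p p' → (p :* (p :* p')) :* p' := (p :* p') :* (p :* p')) ≡.refl)
    (M-* M-p M-p'))
    where open S₂ using (_:*_; _:=_)

  M-p'w : M 0 (p' S₂.* w) p'
  M-p'w = M-cancel (M-resp S₂.refl (S₂.*-comm p' w) (M-* M-p' M-w))

  open S₂ using (_:*_; _:=_; _:^_; :-_; one; _:-_)

  M-Q : M 0 Q Q
  M-Q = M-^ 4 M-w

  smallGeo : ∀ x {q} → S₂.Ord 1 q → S₂.Small (λ l → x S₂.* q S₂.^ l)
  smallGeo x o l = S₂.ord-geo x l o

  M-al : ∀ k → M 0 (al k) (al (suc k))
  M-al = M-Prod (λ k → k) suc (λ _ → ≡.refl) (λ _ → ≡.refl) (smallGeo p ow) (smallGeo p ow)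
    (λ k → M-resp S₂.refl (S₂.*-assoc p w _) (M-* M-p (M-^ k M-w)))

  M-be : ∀ k → M 0 (be (suc k)) (be k)
  M-be = M-Prod suc (λ k → k) (λ _ → ≡.refl) (λ _ → ≡.refl) (smallGeo p' ow) (smallGeo p' ow)
    (λ k → M-resp (S₂.*-assoc p' w _) S₂.refl (M-* M-p'w (M-^ k M-w)))

  M-γ : ∀ k → M 0 (γ k) (δ (suc k))
  M-γ = M-Prod (λ k → k) suc (λ _ → ≡.refl) (λ _ → ≡.refl) (smallGeo _ oQ) (smallGeo _ oQ)
    (λ k → M-resp S₂.refl (S₂.solve (p ∷ p' ∷ Q S₂.^ k ∷ []) (λ p p' K → let w = p :* p' in
        (:- ((p :* w) :^ 2 :* w :^ 3)) :* K := (:- (p :^ 2 :* w)) :* (w :^ 4 :* K)) ≡.refl)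
      (M-* (M-neg (M-* (M-^ 2 M-p) (M-^ 3 M-w))) (M-^ k M-Q)))

  M-δ : ∀ k → M 0 (δ k) (γ k)
  M-δ = M-Prod (λ k → k) (λ k → k) (λ _ → ≡.refl) (λ _ → ≡.refl) (smallGeo _ oQ) (smallGeo _ oQ)
    (λ k → M-resp S₂.refl (S₂.solve (p ∷ p' ∷ Q S₂.^ k ∷ []) (λ p p' K → let w = p :* p' in
        (:- ((p :* w) :^ 2 :* w)) :* K := (:- (p :^ 2 :* w :^ 3)) :* K) ≡.refl)
      (M-* (M-neg (M-* (M-^ 2 M-p) M-w)) (M-^ k M-Q)))

  M-γ' : ∀ k → M 0 (γ' k) (δ' k)
  M-γ' = M-Prod (λ k → k) (λ k → k) (λ _ → ≡.refl) (λ _ → ≡.refl) (smallGeo _ oQ) (smallGeo _ oQ)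
    (λ k → M-resp (S₂.solve (p ∷ p' ∷ Q S₂.^ k ∷ []) (λ p p' K → let w = p :* p' in
        (:- ((p' :* w) :^ 2 :* w)) :* K := (:- (p' :^ 2 :* w :^ 3)) :* K) ≡.refl) S₂.refl
      (M-* (M-neg (M-* (M-^ 2 M-p'w) M-w)) (M-^ k M-Q)))

  M-δ' : ∀ k → M 0 (δ' (suc k)) (γ' k)
  M-δ' = M-Prod suc (λ k → k) (λ _ → ≡.refl) (λ _ → ≡.refl) (smallGeo _ oQ) (smallGeo _ oQ)
    (λ k → M-resp (S₂.solve (p ∷ p' ∷ Q S₂.^ k ∷ []) (λ p p' K → let w = p :* p' in
        (:- ((p' :* w) :^ 2 :* w :^ 3)) :* K := (:- (p' :^ 2 :* w)) :* (w :^ 4 :* K)) ≡.refl) S₂.refl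
      (M-* (M-neg (M-* (M-^ 2 M-p'w) (M-^ 3 M-w))) (M-^ k M-Q)))

  M-be₀ : M 1 (be 0) ((w S₂.- p') S₂.* be 0)
  M-be₀ = M-resp (S₂.elim (p' ∷ be 0 ∷ be 1 ∷ []) (λ p' B B₁ → (B S₂.⇒ (one :- p' :* one) :* B₁) ∷ [] ,
      ((one :- p') :* B₁ := B)) (S₂.Pr-step p' ow 0 , tt) ≡.refl) S₂.refl
    (M-* (M-+ M-1 (M-neg M-p')) (M-be 0))

  M-δ'₀ : M 1 (δ' 0) ((w S₂.+ p' S₂.* p') S₂.* γ' 0)
  M-δ'₀ = M-resp (S₂.elim (p ∷ p' ∷ δ' 0 ∷ δ' 1 ∷ []) (λ p p' B B₁ → let w = p :* p' in
      (B S₂.⇒ (one :- (:- (p' :^ 2 :* w)) :* one) :* B₁) ∷ [] ,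
      ((one S₂.:+ p' :* (p' :* w)) :* B₁ := B)) (S₂.Pr-step _ oQ 0 , tt) ≡.refl) S₂.refl
    (M-* (M-+ M-1 (M-* M-p' M-p'w)) (M-δ' 0))

  M-H : M 2 H Hσ
  M-H = M-+ (M-+ (M-* (M-* (M-* pp' r) γγ') δδ') (M-* (M-* s δδ') αβ)) (M-* (M-* (M-* pp' t) γγ') αβ)
    where
    pp' : M 1 (p S₂.+ p') (p S₂.* w S₂.* w S₂.+ p')
    pp' = M-+ (M-resp (S₂.*-identityʳ p) S₂.refl (M-* M-p M-1)) M-p'
    r : M 0 (hᵣ 0) (hᵣσ 0)
    r = M-twin 1 (λ k → M-al (suc k)) M-be M-w ow ow 0
    s : M 0 (hₛ 0) (hₛσ 0)
    s = M-twin 0 M-γ M-γ' M-Q oQ oQ 0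
    t : M 0 (w S₂.* hₜ 0) (w S₂.* hₜσ 0)
    t = M-* M-w (M-twin 1 (λ k → M-δ (suc k)) M-δ' M-Q oQ oQ 0)
    γγ' : M 0 (γ 0 S₂.* γ' 0) (δ 1 S₂.* δ' 0)
    γγ' = M-* (M-γ 0) (M-γ' 0)
    δδ' : M 1 (δ 0 S₂.* δ' 0) (γ 0 S₂.* ((w S₂.+ p' S₂.* p') S₂.* γ' 0))
    δδ' = M-* (M-δ 0) M-δ'₀
    αβ : M 1 (al 0 S₂.* be 0) (al 1 S₂.* ((w S₂.- p') S₂.* be 0))
    αβ = M-* (M-al 0) M-be₀

  -- Reads w² σ(H) = w² H, the invariance of `H` without a division.
  shift-H : Shift 2 H (w S₂.^ 2 S₂.* H)
  shift-H = Relation.T-resp shiftRelation (S₂.*-identityʳ H) (S₂.trans (S₂.*-identityʳ Hσ) H-shift) (M-H 0 _ _ shift-1)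
    where
    shift-1 : Shift 0 S₂.1# S₂.1#
    shift-1 = record { moved = mv ; lost = ls ; high = hi ; low = λ _ _ () }
      where
      hi : ∀ a c → a ℕ.+ a ℕ.< c → S₂.1# a c K.≈ K.0#
      hi zero (suc c) l = K.refl
      hi (suc a) c l = K.refl
      ls : ∀ a b → a ℕ.+ a ℕ.< b → S₂.1# b a K.≈ K.0#
      ls a (suc b) l = K.refl
      mv : ∀ a b c → c ℕ.+ b ≡ a ℕ.+ a → S₂.1# a c K.≈ S₂.1# b a
      mv zero zero zero e = K.refl
      mv (suc a) (suc b) c e = K.refl
      mv (suc a) zero c e = K.refl

  -- σ moves coefficients along the lines a - b = const away from the diagonal, and H is fixed by σ.
  H-diagonal : ∀ a b → (a ≡ b → ⊥) → H b a K.≈ K.0#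
  H-diagonal a b = go (suc (a ℕ.+ b)) a b (ℕₚ.n<1+n _)
    where
    G = w S₂.^ 2 S₂.* H
    G≈ww : G S₂.≈ w S₂.* (w S₂.* H)
    G≈ww = S₂.solve (w ∷ H ∷ []) (λ w H → w :^ 2 :* H := w :* (w :* H)) ≡.refl
    G-0 : ∀ d → G d 0 K.≈ K.0#
    G-0 d = K.trans (at₂ G≈ww d 0) (w-suc-zero _ d)
    G-1 : ∀ d → G (suc d) 1 K.≈ K.0#
    G-1 d = K.trans (at₂ G≈ww (suc d) 1) (K.trans (w-suc _ d 0) (w-suc-zero _ d))
    G-s : ∀ d c → G (suc (suc d)) (suc (suc c)) K.≈ H d c
    G-s d c = K.trans (at₂ G≈ww _ _) (K.trans (w-suc _ (suc d) (suc c)) (w-suc _ d c))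
    go : ∀ N a b → a ℕ.+ b ℕ.< N → (a ≡ b → ⊥) → H b a K.≈ K.0#
    go (suc N) a b lN ne with ℕₚ.<-cmp a b
    ... | tri≈ _ e _ = ⊥-elim (ne e)
    ... | tri< l _ _ with b ℕₚ.≤? suc (suc (a ℕ.+ a))
    ...   | no g = lost shift-H a b (ℕₚ.≰⇒> g)
    ...   | yes g = step (suc (suc (a ℕ.+ a)) ℕ.∸ b) (ℕₚ.m∸n+n≡m g)
      where
      step : ∀ c → c ℕ.+ b ≡ suc (suc (a ℕ.+ a)) → H b a K.≈ K.0#
      step zero e = K.trans (K.sym (moved shift-H a b 0 e)) (G-0 _)
      step (suc zero) e = K.trans (K.sym (moved shift-H a b 1 e)) (G-1 _)
      -- Here c = 2a - b: the entry (a, b) is carried to (c, a), which has the same difference and a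
      -- smaller sum, so the induction on a + b applies.
      step (suc (suc c)) e = K.trans (K.sym (moved shift-H a b _ e)) (K.trans (G-s a c)
          (go N c a (ℕₚ.≤-trans (ℕₚ.+-mono-<-≤ c<a ℕₚ.≤-refl) (ℕₚ.≤-trans (ℕₚ.+-monoʳ-≤ a (ℕₚ.<⇒≤ l)) (ℕ.s≤s⁻¹ lN)))
            (λ eq → ℕₚ.<-irrefl eq c<a)))
        where
        e' : c ℕ.+ b ≡ a ℕ.+ a
        e' = ℕₚ.suc-injective (ℕₚ.suc-injective e)
        c<a : c ℕ.< a
        c<a = ℕₚ.+-cancelʳ-< a c a (ℕₚ.<-≤-trans (ℕₚ.+-monoʳ-< c l) (ℕₚ.≤-reflexive e'))
    -- Below the diagonal the relation is read backwards: (a, b) is the image of (b, c) with c = 2b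
    -- - a, again an entry with a smaller sum.
    go (suc N) a b lN ne | tri> _ _ l with a ℕₚ.≤? b ℕ.+ b
    ...   | no g = K.trans (K.sym (G-s b a)) (high shift-H b (suc (suc a)) (ℕ.s≤s (ℕ.s≤s (ℕₚ.≰⇒> g))))
    ...   | yes g = K.trans (K.sym (G-s b a)) (K.trans
              (moved shift-H b c (suc (suc a)) (≡.cong (λ i → suc (suc i)) (≡.trans (ℕₚ.+-comm a c) e)))
              (go N b c (ℕₚ.≤-trans (ℕₚ.+-monoʳ-< b c<b) (ℕₚ.≤-trans (ℕₚ.+-monoˡ-≤ b (ℕₚ.<⇒≤ l)) (ℕ.s≤s⁻¹ lN)))
                (λ eq → ℕₚ.<-irrefl (≡.sym eq) c<b)))
      where
      c = b ℕ.+ b ℕ.∸ a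
      e : c ℕ.+ a ≡ b ℕ.+ b
      e = ℕₚ.m∸n+n≡m g
      c<b : c ℕ.< b
      c<b = ℕₚ.+-cancelʳ-< b c b (ℕₚ.<-≤-trans (ℕₚ.+-monoʳ-< c l) (ℕₚ.≤-reflexive e))

-- Evaluation at p = zq, p' = z'q with z z' = 1.
module Evaluation (K : CommutativeRing 0ℓ 0ℓ) (z z' : CommutativeRing.Carrier K)
                  (zz' : CommutativeRing._≈_ K (CommutativeRing._*_ K z z') (CommutativeRing.1# K)) where
  open DoubleSeries K
  open RingTools K using (_^_; interchange-*)
  open K using (_≈_; _*_; _+_; 1#; 0#; -_)
  open IntegerSolver K

  -- Runs along an antidiagonal, from p^a p'^b to p^0 p'^(a+b); `ev` starts it at b = 0 and so
  -- collects the coefficient of q^n.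
  ev' : S₂.Carrier → ℕ → ℕ → K.Carrier
  ev' F zero b = z' ^ b * F b 0
  ev' F (suc a) b = z ^ suc a * z' ^ b * F b (suc a) + ev' F a (suc b)

  ev : S₂.Carrier → S₁.Carrier
  ev F n = ev' F n 0

  ev'-cong : ∀ F G a b → (∀ i → i ℕ.≤ a ℕ.+ b → ∀ j → F i j ≈ G i j) → ev' F a b ≈ ev' G a b
  ev'-cong F G zero b e = K.*-congˡ (e b ℕₚ.≤-refl 0)
  ev'-cong F G (suc a) b e = K.+-cong (K.*-congˡ (e b (ℕₚ.m≤n+m b (suc a)) (suc a)))
    (ev'-cong F G a (suc b) (λ i l → e i (ℕₚ.≤-trans l (ℕₚ.≤-reflexive (ℕₚ.+-suc a b)))))

  ev'-+ : ∀ F G a b → ev' (F S₂.+ G) a b ≈ ev' F a b + ev' G a b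
  ev'-+ F G zero b = K.distribˡ _ _ _
  ev'-+ F G (suc a) b = K.trans (K.+-congˡ (ev'-+ F G a (suc b)))
    (solve (z ^ suc a * z' ^ b ∷ F b (suc a) ∷ G b (suc a) ∷ ev' F a (suc b) ∷ ev' G a (suc b) ∷ []) (λ c x y u v →
      c :* (x :+ y) :+ (u :+ v) := (c :* x :+ u) :+ (c :* y :+ v)) ≡.refl)

  ev'-neg : ∀ F a b → ev' (S₂.- F) a b ≈ - ev' F a b
  ev'-neg F zero b = solve (z' ^ b ∷ F b 0 ∷ []) (λ c x → c :* (:- x) := :- (c :* x)) ≡.refl
  ev'-neg F (suc a) b = K.trans (K.+-congˡ (ev'-neg F a (suc b)))
    (solve (z ^ suc a * z' ^ b ∷ F b (suc a) ∷ ev' F a (suc b) ∷ []) (λ c x u →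
      c :* (:- x) :+ (:- u) := :- (c :* x :+ u)) ≡.refl)

  ev'-0 : ∀ a b → ev' S₂.0# a b ≈ 0#
  ev'-0 zero b = K.zeroʳ _
  ev'-0 (suc a) b = K.trans (K.+-cong (K.zeroʳ _) (ev'-0 a (suc b))) (K.+-identityˡ 0#)

  ev'-p0 : ∀ F b → ev' (p S₂.* F) 0 b ≈ 0#
  ev'-p0 F b = K.trans (K.*-congˡ (p-zero F b)) (K.zeroʳ _)

  ev'-p : ∀ F a b → ev' (p S₂.* F) (suc a) b ≈ z * ev' F a b
  ev'-p F zero b = K.trans (K.+-cong (K.*-congˡ (p-suc F b 0)) (ev'-p0 F (suc b)))
    (solve (z ∷ z' ^ b ∷ F b 0 ∷ []) (λ z c x → z :* one :* c :* x :+ nil := z :* (c :* x)) ≡.refl)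
  ev'-p F (suc a) b = K.trans (K.+-cong (K.*-congˡ (p-suc F b (suc a))) (ev'-p F a (suc b)))
    (solve (z ∷ z ^ suc a ∷ z' ^ b ∷ F b (suc a) ∷ ev' F a (suc b) ∷ []) (λ z a c x u →
      z :* a :* c :* x :+ z :* u := z :* (a :* c :* x :+ u)) ≡.refl)

  ev'-p' : ∀ F a b → ev' (p' S₂.* F) a (suc b) ≈ z' * ev' F a b
  ev'-p' F zero b = K.trans (K.*-congˡ (p'-suc F b 0)) (K.*-assoc _ _ _)
  ev'-p' F (suc a) b = K.trans (K.+-cong (K.*-congˡ (p'-suc F b (suc a))) (ev'-p' F a (suc b)))
    (solve (z' ∷ z ^ suc a ∷ z' ^ b ∷ F b (suc a) ∷ ev' F a (suc b) ∷ []) (λ z a c x u →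
      a :* (z :* c) :* x :+ z :* u := z :* (a :* c :* x :+ u)) ≡.refl)

  open Multipliers P₂.series P₁.series using (Relation; module Closure)

  record EvRel (k : ℕ) (F : S₂.Carrier) (G : S₁.Carrier) : Set where
    constructor evRel
    field value : ev F S₁.≈ G
  open EvRel

  evRelation : Relation
  evRelation = record
    { T = EvRel
    ; T-resp = λ {k} {F} {F'} e e' t → evRel (S₁.trans (P₁.pointwise λ n → ev'-cong F' F n 0 (λ i _ j → K.sym (at₂ e i j))) (S₁.trans (value t) e'))
    ; T-zero = evRel (P₁.pointwise λ n → ev'-0 n 0)
    ; T-+ = λ {k} {F} {F'} t t' → evRel (S₁.trans (P₁.pointwise λ n → ev'-+ F F' n 0) (S₁.+-cong (value t) (value t')))
    ; T-neg = λ {k} {F} t → evRel (S₁.trans (P₁.pointwise λ n → ev'-neg F n 0) (S₁.-‿cong (value t)))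
    ; T-lim = λ {k} {F} {G} f g t of og → evRel (P₁.pointwise λ n →
        let N = suc (n ℕ.+ 0) in
        K.trans (ev'-cong F (f N) n 0 (λ i l j → agree F (f N) (of N) (ℕ.s≤s l) j))
          (K.trans (P₁.at (value (t N)) n) (K.sym (RingTools.minus-zero K (P₁.below (og N) n (ℕ.s≤s (ℕₚ.≤-reflexive (≡.sym (ℕₚ.+-identityʳ n))))))))) }

  module Ev = Closure evRelation
  open Ev

  x x' : S₁.Carrier
  x = P₁.const z S₁.* P₁.X
  x' = P₁.const z' S₁.* P₁.X

  ox : S₁.Ord 1 x
  ox = S₁.ord-*ʳ _ P₁.vanish-X

  ox' : S₁.Ord 1 x'
  ox' = S₁.ord-*ʳ _ P₁.vanish-X

  oxx' : S₁.Ord 1 (x S₁.* x')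
  oxx' = S₁.ord-*ˡ _ ox

  X-mult : ∀ c G n → (P₁.const c S₁.* P₁.X S₁.* G) (suc n) ≈ c * G n
  X-mult c G n = K.trans (P₁.at (S₁.*-assoc (P₁.const c) P₁.X G) (suc n))
    (K.trans (P₁.const-* c _ (suc n)) (K.*-congˡ (P₁.X*-suc G n)))

  X-mult-0 : ∀ c G → (P₁.const c S₁.* P₁.X S₁.* G) 0 ≈ 0#
  X-mult-0 c G = K.trans (P₁.*ˢ-head (P₁.const c S₁.* P₁.X) G)
    (K.trans (K.*-congʳ (K.trans (P₁.*ˢ-head (P₁.const c) P₁.X) (K.zeroʳ c))) (K.zeroˡ _))

  M-p-ev : M 0 p x
  M-p-ev j F G t = evRel (S₁.trans (P₁.pointwise go) (S₁.*-congˡ (value t)))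
    where
    go : ∀ n → ev (p S₂.* F) n ≈ (x S₁.* ev F) n
    go zero = K.trans (ev'-p0 F 0) (K.sym (X-mult-0 z (ev F)))
    go (suc n) = K.trans (ev'-p F n 0) (K.sym (X-mult z (ev F) n))

  M-p'-ev : M 0 p' x'
  M-p'-ev j F G t = evRel (S₁.trans (P₁.pointwise go) (S₁.*-congˡ (value t)))
    where
    go : ∀ n → ev (p' S₂.* F) n ≈ (x' S₁.* ev F) n
    go zero = K.trans (K.*-congˡ (p'-zero F 0)) (K.trans (K.zeroʳ _) (K.sym (X-mult-0 z' (ev F))))
    go (suc n) = K.trans (K.+-congʳ (K.trans (K.*-congˡ (p'-zero F (suc n))) (K.zeroʳ _)))
      (K.trans (K.+-identityˡ _) (K.trans (ev'-p' F n 0) (K.sym (X-mult z' (ev F) n))))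

  module U = Universal P₁.series x x' oxx'

  ev-H : ev H S₁.≈ U.H
  ev-H = S₁.trans (P₁.pointwise λ n → ev'-cong H (H S₂.* S₂.1#) n 0 (λ i _ j → at₂ (S₂.sym (S₂.*-identityʳ H)) i j))
      (S₁.trans (value (mH 0 S₂.1# S₁.1# (evRel ev-1))) (S₁.*-identityʳ _))
    where
    ev-1' : ∀ a b → ev' S₂.1# a (suc b) ≈ 0#
    ev-1' zero b = K.zeroʳ _
    ev-1' (suc a) b = K.trans (K.+-cong (K.zeroʳ _) (ev-1' a (suc b))) (K.+-identityˡ 0#)
    ev-1 : ev S₂.1# S₁.≈ S₁.1#
    ev-1 = P₁.pointwise λ { zero → K.*-identityˡ 1#
                          ; (suc n) → K.trans (K.+-cong (K.zeroʳ _) (ev-1' n 0)) (K.+-identityˡ 0#) }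
    mw : M 0 w (x S₁.* x')
    mw = M-* M-p-ev M-p'-ev
    mPr : ∀ {a a' q q'} → M 0 a a' → M 0 q q' → S₂.Ord 1 q → S₁.Ord 1 q' → ∀ k → M 0 (S₂.Pr a q k) (S₁.Pr a' q' k)
    mPr {a} {a'} ma mq o o' = M-Prod (λ k → k) (λ k → k) (λ _ → ≡.refl) (λ _ → ≡.refl)
      (λ l → S₂.ord-geo a l o) (λ l → S₁.ord-geo a' l o') (λ k → M-* ma (M-^ k mq))
    mal = mPr M-p-ev mw ow oxx'
    mbe = mPr M-p'-ev mw ow oxx'
    mQ = M-^ 4 mw
    mγ = mPr (M-neg (M-* (M-^ 2 M-p-ev) (M-^ 3 mw))) mQ oQ U.oQ
    mγ' = mPr (M-neg (M-* (M-^ 2 M-p'-ev) (M-^ 3 mw))) mQ oQ U.oQ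
    mδ = mPr (M-neg (M-* (M-^ 2 M-p-ev) mw)) mQ oQ U.oQ
    mδ' = mPr (M-neg (M-* (M-^ 2 M-p'-ev) mw)) mQ oQ U.oQ
    mpp = M-+ M-p-ev M-p'-ev
    mH : M 0 H U.H
    mH = M-+ (M-+ (M-* (M-* (M-* mpp (M-twin 1 (λ k → mal (suc k)) (λ k → mbe (suc k)) mw ow oxx' 0)) (M-* (mγ 0) (mγ' 0))) (M-* (mδ 0) (mδ' 0)))
                  (M-* (M-* (M-twin 0 mγ mγ' mQ oQ U.oQ 0) (M-* (mδ 0) (mδ' 0))) (M-* (mal 0) (mbe 0))))
             (M-* (M-* (M-* mpp (M-* mw (M-twin 1 (λ k → mδ (suc k)) (λ k → mδ' (suc k)) mQ oQ U.oQ 0))) (M-* (mγ 0) (mγ' 0))) (M-* (mal 0) (mbe 0)))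

  unit-pow : ∀ a → z ^ a * z' ^ a ≈ 1#
  unit-pow zero = K.*-identityˡ 1#
  unit-pow (suc a) = K.trans (interchange-* z (z ^ a) z' (z' ^ a)) (K.trans (K.*-cong zz' (unit-pow a)) (K.*-identityˡ 1#))

module Constancy (K : CommutativeRing 0ℓ 0ℓ) where
  open DoubleSeries K
  open K using (_≈_; _*_; 1#)
  open RingTools K using (_^_)

  -- Off the diagonal the coefficients of `H` vanish, and on it both weights are 1 because z z' = u
  -- u' = 1; so the two evaluations agree term by term.
  evaluations-agree : ∀ z z' (e : z * z' ≈ 1#) u u' (d : u * u' ≈ 1#) →
                      Evaluation.U.H K z z' e S₁.≈ Evaluation.U.H K u u' d
  evaluations-agree z z' e u u' d = S₁.trans (S₁.sym Z.ev-H) (S₁.trans (P₁.pointwise λ n → same n 0) V.ev-H)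
    where
    module Z = Evaluation K z z' e
    module V = Evaluation K u u' d
    term : ∀ a b → z ^ a * z' ^ b * H b a ≈ u ^ a * u' ^ b * H b a
    term a b with a ℕₚ.≟ b
    ... | yes ≡.refl = K.*-congʳ (K.trans (Z.unit-pow a) (K.sym (V.unit-pow a)))
    ... | no ne = K.trans (K.trans (K.*-congˡ (H-diagonal a b ne)) (K.zeroʳ _))
                          (K.sym (K.trans (K.*-congˡ (H-diagonal a b ne)) (K.zeroʳ _)))
    same : ∀ a b → Z.ev' H a b ≈ V.ev' H a b
    same zero b = K.trans (K.*-congʳ (K.sym (K.*-identityˡ _))) (K.trans (term 0 b) (K.*-congʳ (K.*-identityˡ _)))
    same (suc a) b = K.+-cong (term (suc a) b) (same a (suc b))

-- Third order mock theta series and the values of H at roots of unity.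

-- The mock theta series ω, f, φ, ν at x are quotients ωS x / ωD x ², fS x / fD x ², φS x / φD x, νS x / νD x.
module MockTheta (S : CompleteRing) where
  open Series S
  open Classical S
  open TwinShift S

  ωS ωD fS fD φS φD νS νD : Carrier → Carrier
  ωS x = twin 1 (Pr x (x * x) ∘ suc) (Pr x (x * x) ∘ suc) (x * x) 0
  ωD x = Pr x (x * x) 0
  fS x = twin 0 (Pr (- x) x) (Pr (- x) x) x 0
  fD x = Pr (- x) x 0
  φS x = sol (Pr (- (x * x)) (x * x)) (λ k → x * (x * x) ^ k) 0
  φD x = Pr (- (x * x)) (x * x) 0
  νS x = sol (λ k → Pr (- x) (x * x) (suc k)) (λ k → x * x * (x * x) ^ k) 0
  νD x = Pr (- x) (x * x) 0

  *-^ : ∀ Q k → (Q * Q) ^ k ≈ Q ^ k * Q ^ k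
  *-^ Q zero = sym (*-identityˡ 1#)
  *-^ Q (suc k) = trans (*-congˡ (*-^ Q k)) (interchange-* _ _ _ _)

  Pr-square : ∀ y {Q} → Ord 1 Q → ∀ k → Pr y Q k * Pr (- y) Q k ≈ Pr (y * y) (Q * Q) k
  Pr-square y {Q} o = Prod-unique _ (λ k → Pr y Q k * Pr (- y) Q k) (λ l → ord-geo _ l (ord-*ˡ Q o))
    (λ k → ord-one-* (Pr-one y o k) (Pr-one (- y) o k))
    (λ k → elim (y ∷ Q ^ k ∷ (Q * Q) ^ k ∷ Pr y Q k ∷ Pr y Q (suc k) ∷ Pr (- y) Q k ∷ Pr (- y) Q (suc k) ∷ [])
      (λ y K L a a₁ b b₁ → (a ⇒ (one :- y :* K) :* a₁) ∷ (b ⇒ (one :- (:- y) :* K) :* b₁) ∷ (L ⇒ K :* K) ∷ [] ,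
        (a :* b := (one :- y :* y :* L) :* (a₁ :* b₁)))
      (Pr-step y o k , Pr-step (- y) o k , *-^ Q k , tt) ≡.refl)

  -- Prepares g(-q; q²), whose sum has the unequal products (-q; q²)_{n+1} and (-q; q²)_n; the shift
  -- makes them equal, which is the shape of ω(-q).
  ω-shift : ∀ q → Ord 1 q →
            twin 0 (Pr (- q) (q * q) ∘ suc) (Pr (- q) (q * q)) (q * q) 0
              ≈ νD q * νD q - q * twin 1 (Pr (- q) (q * q) ∘ suc) (Pr (- q) (q * q) ∘ suc) (q * q) 0
  ω-shift q o = trans (twin-shift (- q) (- q) (q * q)
      (solve (q ∷ []) (λ q → q :* q := (:- q) :* (:- q)) ≡.refl) (ord-*ˡ q o) 0)
    (solve (νD q ∷ q ∷ T ∷ []) (λ n q t → n :* n :+ (:- q) :* one :* t := n :* n :- q :* t) ≡.refl)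
    where T = twin 1 (Pr (- q) (q * q) ∘ suc) (Pr (- q) (q * q) ∘ suc) (q * q) 0

  -- By (q; q²)(-q; q²) = (q²; q⁴) the sum `o` of `nu` is the Rogers-Fine series with p = p' = q²,
  -- that is, the numerator of ω(q²) up to a product.
  ν-ω : ∀ q → Ord 1 q →
        ωD (q * q) * Pr q (q * q) 0 * νS q + q * ωS (q * q) ≈ ωD (q * q) * θ⁺ (q * q) (q * q) 0
  ν-ω q oq = linear (ωD Q ⊙ nu ⊞ q ⊙ ωS≈)
      (solve (ωD Q ∷ Pr q Q 0 ∷ νS q ∷ q ∷ ωS Q ∷ o 0 ∷ θ⁺ Q Q 0 ∷ []) (λ a m n q w o t →
        (a :* m :* n :+ q :* w) :- a :* t := a :* ((m :* n :+ q :* o) :- t) :+ q :* (w :- a :* o)) ≡.refl)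
    where
    Q = q * q
    oQ : Ord 1 Q
    oQ = ord-*ˡ q oq
    open Nu q Q oq oQ
    module F = Fine Q Q (Q * Q) refl oQ
    o≈φ : ∀ k → o k ≈ F.φ 0 k
    o≈φ = sol-cong (λ _ → oQ) (λ k → trans (*-comm _ _) (Pr-square q oQ (suc k))) (λ _ → sym (*-identityʳ Q))
    ωS≈ : ωS Q ≈ ωD Q * o 0
    ωS≈ = trans F.fine (*-congˡ (sym (o≈φ 0)))

  -- The bilateral identity at x = x' = -q, c = q. Its part n ≥ 0 is `φS`; its part n < 0 is 2q Σ
  -- q^n (-q²; q²)_n, which `Distinct` turns into the sum behind g(q; q⁴).
  φ-ψ : ∀ q → Ord 1 q →
        Pr q (q * q) 0 * φS q + (1# + 1#) * φD q * (twin 0 (Pr q (q * q * (q * q)) ∘ suc) (Pr (q * (q * q)) (q * q * (q * q))) (q * q * (q * q)) 0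
           - Pr q (q * q) 0) ≈ theta q q (q * q)
  φ-ψ q oq = trans (sym (elim (q ∷ Pr q Q 0 ∷ φS q ∷ β 0 0 ∷ φD q ∷ Pr (q * - q) Q 0 ∷ η 0 0 ∷ η 0 1 ∷ e 0 0 ∷ g 0 ∷ h 0 ∷ [])
      (λ q m f b d d' n n₁ e g h → let D = q :* one :- (:- q) :* one in
        (g ⇒ h) ∷ (h ⇒ m :* (one :+ q :* e)) ∷ (b ⇒ f) ∷ (d' ⇒ d) ∷ (n ⇒ D :+ D :* n₁) ∷ (e ⇒ one :+ n₁) ∷ [] ,
        (m :* (b :+ d' :* n) := m :* f :+ (one :+ one) :* d :* (g :- m)))
      (g≈h refl , h≈e , sol-cong ob Γ≈ b≈ 0 , Γ≈ 0 , η-step 0 0 , e≈η 0 , tt) ≡.refl))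
    (trans bilateral (+-congʳ (+-cong (θ⁺-cong (ord-neg ox) negneg refl 0) (θ⁺-cong (ord-neg ox) negneg refl 0))))
    where
    Q = q * q
    ox : Ord 1 (- q)
    ox = ord-neg oq
    open Bilateral S (- q) (- q) q Q (solve (q ∷ []) (λ q → q :* q := (:- q) :* (:- q)) ≡.refl) ox ox oq
    open Distinct q Q oq (ord-*ˡ q oq) hiding (oe; oh)
    negneg : - (- q) ≈ q
    negneg = solve (q ∷ []) (λ q → :- (:- q) := q) ≡.refl
    Γ≈ : ∀ k → Pr (q * - q) Q k ≈ Pr (- Q) Q k
    Γ≈ = Pr-cong oQ (solve (q ∷ []) (λ q → q :* (:- q) := :- (q :* q)) ≡.refl) refl
    b≈ : ∀ k → - (- q * Q ^ k) ≈ q * Q ^ k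
    b≈ k = solve (q ∷ Q ^ k ∷ []) (λ q K → :- ((:- q) :* K) := q :* K) ≡.refl
    e≈η : ∀ n → e 0 n ≈ 1# + η 0 (suc n)
    e≈η n = sym (sol-unique _ _ (λ n → 1# + η 0 (suc n)) (λ n → ord-*ˡ _ (ord-*ˡ _ oq))
      (λ n → elim (q ∷ Q ∷ Q ^ n ∷ η 0 (suc n) ∷ η 0 (suc (suc n)) ∷ []) (λ q Q N h h₁ →
        let D = q :* one :- (:- q) :* (Q :* N) in (h ⇒ D :+ D :* h₁) ∷ [] ,
        (one :+ h := one :+ q :* one :* (one :+ Q :* N) :* (one :+ h₁))) (η-step 0 (suc n) , tt) ≡.refl) n)

  -- The squares u and u' are separate parameters because `γ` and `δ` depend on z only through z²;
  -- at z = ±1, i, ζ they become 1, -1, i.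
  module AtRoot (q z z' u u' : Carrier) (oq : Ord 1 q) (zz' : z * z' ≈ 1#) (zz : z * z ≈ u) (z'z' : z' * z' ≈ u') where
    ow : Ord 1 (z * q * (z' * q))
    ow = ord-*ˡ _ (ord-*ʳ z oq)

    open Universal S (z * q) (z' * q) ow public

    w≈ : w ≈ q ^ 2
    w≈ = linear ((q ^ 2) ⊙ zz') (solve (q ∷ z ∷ z' ∷ []) (λ q z z' →
      (z :* q) :* (z' :* q) :- q :^ 2 := q :^ 2 :* (z :* z' :- one)) ≡.refl)

    Q≈ : Q ≈ q ^ 8
    Q≈ = elim (q ∷ w ∷ []) (λ q w → (w ⇒ q :^ 2) ∷ [] , (w :^ 4 := q :^ 8)) (w≈ , tt) ≡.refl

    p²≈ : ∀ k → (z * q) ^ 2 * w ^ suc k ≈ u * q ^ 2 * (q ^ 2) ^ suc k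
    p²≈ k = *-cong (linear ((q ^ 2) ⊙ zz) (solve (z ∷ q ∷ u ∷ []) (λ z q u →
      (z :* q) :^ 2 :- u :* q :^ 2 := q :^ 2 :* (z :* z :- u)) ≡.refl)) (^-cong (suc k) w≈)

    p'²≈ : ∀ k → (z' * q) ^ 2 * w ^ suc k ≈ u' * q ^ 2 * (q ^ 2) ^ suc k
    p'²≈ k = *-cong (linear ((q ^ 2) ⊙ z'z') (solve (z' ∷ q ∷ u' ∷ []) (λ z q u →
      (z :* q) :^ 2 :- u :* q :^ 2 := q :^ 2 :* (z :* z :- u)) ≡.refl)) (^-cong (suc k) w≈)

    al≈ : ∀ k → al k ≈ Pr (z * q) (q ^ 2) k
    al≈ = Pr-cong ow refl w≈

    be≈ : ∀ k → be k ≈ Pr (z' * q) (q ^ 2) k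
    be≈ = Pr-cong ow refl w≈

    γ≈ : ∀ k → γ k ≈ Pr (- (u * q ^ 8)) (q ^ 8) k
    γ≈ = Pr-cong oQ (-‿cong (trans (p²≈ 2) (solve (u ∷ q ∷ []) (λ u q → u :* q :^ 2 :* (q :^ 2) :^ 3 := u :* q :^ 8) ≡.refl))) Q≈

    γ'≈ : ∀ k → γ' k ≈ Pr (- (u' * q ^ 8)) (q ^ 8) k
    γ'≈ = Pr-cong oQ (-‿cong (trans (p'²≈ 2) (solve (u' ∷ q ∷ []) (λ u q → u :* q :^ 2 :* (q :^ 2) :^ 3 := u :* q :^ 8) ≡.refl))) Q≈

    δ≈ : ∀ k → δ k ≈ Pr (- (u * q ^ 4)) (q ^ 8) k
    δ≈ = Pr-cong oQ (-‿cong (trans (*-congˡ (sym (*-identityʳ w))) (trans (p²≈ 0)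
      (solve (u ∷ q ∷ []) (λ u q → u :* q :^ 2 :* (q :^ 2) :^ 1 := u :* q :^ 4) ≡.refl)))) Q≈

    δ'≈ : ∀ k → δ' k ≈ Pr (- (u' * q ^ 4)) (q ^ 8) k
    δ'≈ = Pr-cong oQ (-‿cong (trans (*-congˡ (sym (*-identityʳ w))) (trans (p'²≈ 0)
      (solve (u' ∷ q ∷ []) (λ u q → u :* q :^ 2 :* (q :^ 2) :^ 1 := u :* q :^ 4) ≡.refl)))) Q≈

  module AtSign (q ε : Carrier) (oq : Ord 1 q) (εε : ε * ε ≈ 1#) where
    open AtRoot q ε ε 1# 1# oq εε εε εε public

    at-sign : H ≈ (ε * q + ε * q) * ωS (ε * q) * (fD (q ^ 8) * fD (q ^ 8)) * (ωD (- (q ^ 4)) * ωD (- (q ^ 4)))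
                + fS (q ^ 8) * (ωD (- (q ^ 4)) * ωD (- (q ^ 4))) * (ωD (ε * q) * ωD (ε * q))
                + (ε * q + ε * q) * (q ^ 2 * ωS (- (q ^ 4))) * (fD (q ^ 8) * fD (q ^ 8)) * (ωD (ε * q) * ωD (ε * q))
    at-sign = +-cong (+-cong (*-cong (*-congˡ (*-cong (g≈ 0) (g'≈ 0))) (*-cong (d≈ 0) (d'≈ 0)))
                             (*-congʳ (*-cong (twin-cong 0 oQ g≈ g'≈ Q≈ 0) (*-cong (d≈ 0) (d'≈ 0)))))
                     (*-congʳ (*-cong (*-congˡ (*-cong w≈ (twin-cong 1 oQ (d≈ ∘ suc) (d'≈ ∘ suc) Q≈d 0))) (*-cong (g≈ 0) (g'≈ 0))))
      where
      one* : ∀ x → - (1# * x) ≈ - x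
      one* x = -‿cong (*-identityˡ x)
      o8 : Ord 1 (q ^ 8)
      o8 = ord-*ˡ _ oq
      Q≈d : Q ≈ - (q ^ 4) * - (q ^ 4)
      Q≈d = trans Q≈ (solve (q ∷ []) (λ q → q :^ 8 := (:- (q :^ 4)) :* (:- (q :^ 4))) ≡.refl)
      g≈ : ∀ k → γ k ≈ Pr (- (q ^ 8)) (q ^ 8) k
      g≈ k = trans (γ≈ k) (Pr-cong o8 (one* _) refl k)
      g'≈ : ∀ k → γ' k ≈ Pr (- (q ^ 8)) (q ^ 8) k
      g'≈ k = trans (γ'≈ k) (Pr-cong o8 (one* _) refl k)
      d≈ : ∀ k → δ k ≈ Pr (- (q ^ 4)) (- (q ^ 4) * - (q ^ 4)) k
      d≈ k = trans (δ≈ k) (Pr-cong o8 (one* _) (trans (sym Q≈) Q≈d) k)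
      d'≈ : ∀ k → δ' k ≈ Pr (- (q ^ 4)) (- (q ^ 4) * - (q ^ 4)) k
      d'≈ k = trans (δ'≈ k) (Pr-cong o8 (one* _) (trans (sym Q≈) Q≈d) k)

  module AtI (q i i' : Carrier) (oq : Ord 1 q) (ii' : i * i' ≈ 1#) (ii : i * i ≈ - 1#) (i'≈ : i' ≈ - i) where
    i'i' : i' * i' ≈ - 1#
    i'i' = trans (*-cong i'≈ i'≈) (trans (solve (i ∷ []) (λ i → (:- i) :* (:- i) := i :* i) ≡.refl) ii)

    open AtRoot q i i' (- 1#) (- 1#) oq ii' ii i'i' public

    o2 : Ord 1 (q ^ 2)
    o2 = ord-*ˡ _ oq

    albe : ∀ k → al k * be k ≈ Pr (- (q ^ 2)) (q ^ 2 * q ^ 2) k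
    albe k = trans (*-cong (al≈ k) (trans (be≈ k) (Pr-cong o2 (trans (*-congʳ i'≈) (solve (i ∷ q ∷ []) (λ i q → (:- i) :* q := :- (i :* q)) ≡.refl)) refl k)))
      (trans (Pr-square (i * q) o2 k) (Pr-cong (ord-*ˡ _ o2)
        (linear ((q ^ 2) ⊙ ii) (solve (i ∷ q ∷ []) (λ i q → i :* q :* (i :* q) :- (:- (q :^ 2)) := q :^ 2 :* (i :* i :- (:- one))) ≡.refl)) refl k))

    -- At z = i the factor p + p' is 0, so only the middle summand remains. Since -z² = 1, both `γ`
    -- and `γ'` are tails of (q⁸; q⁸)_∞ and `cauchy` sums the series.
    H-value : H ≈ Pr (q ^ 8) (q ^ 8) 0 * (Pr (q ^ 4) (q ^ 8) 0 * Pr (q ^ 4) (q ^ 8) 0) * νD (q ^ 2)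
    H-value = trans (elim (i ∷ i' ∷ q ∷ hᵣ 0 ∷ γ 0 * γ' 0 ∷ δ 0 * δ' 0 ∷ hₛ 0 ∷ al 0 * be 0 ∷ w * hₜ 0 ∷ [])
        (λ i i' q r g d s a t → (i' ⇒ :- i) ∷ [] ,
          ((i :* q :+ i' :* q) :* r :* g :* d :+ s :* d :* a :+ (i :* q :+ i' :* q) :* t :* g :* a := s :* d :* a))
        (i'≈ , tt) ≡.refl)
      (*-cong (*-cong (trans (twin-cong 0 oQ (λ k → trans (γ≈ k) (Pr-cong o8 (mm _) refl k)) (λ k → trans (γ'≈ k) (Pr-cong o8 (mm _) refl k)) Q≈ 0)
                             (Cauchy.cauchy (q ^ 8) o8))
                      (*-cong (trans (δ≈ 0) (Pr-cong o8 (mm _) refl 0)) (trans (δ'≈ 0) (Pr-cong o8 (mm _) refl 0))))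
              (albe 0))
      where
      o8 : Ord 1 (q ^ 8)
      o8 = ord-*ˡ _ oq
      mm : ∀ x → - (- 1# * x) ≈ x
      mm x = solve (x ∷ []) (λ x → :- ((:- one) :* x) := x) ≡.refl

    r-value : hᵣ 0 ≈ νS (q ^ 2)
    r-value = sol-cong (ord-twin 1 ow) (λ k → albe (suc k))
      (λ k → elim (w ∷ q ∷ w ^ k ∷ (q ^ 2) ^ k ∷ (q ^ 2 * q ^ 2) ^ k ∷ []) (λ w q a b c → (w ⇒ q :^ 2) ∷ (a ⇒ b) ∷ (c ⇒ b :* b) ∷ [] ,
        (w :^ 2 :* a :^ 2 := q :^ 2 :* q :^ 2 :* c)) (w≈ , ^-cong k w≈ , *-^ (q ^ 2) k , tt) ≡.refl) 0

  module AtZeta (q ζ ζ' i i' : Carrier) (oq : Ord 1 q) (ζζ' : ζ * ζ' ≈ 1#) (ζζ : ζ * ζ ≈ i) (ζ'ζ' : ζ' * ζ' ≈ i')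
                (ii : i * i ≈ - 1#) (i'≈ : i' ≈ - i) where
    open AtRoot q ζ ζ' i i' oq ζζ' ζζ ζ'ζ' public

    o2 : Ord 1 (q ^ 2)
    o2 = ord-*ˡ _ oq
    o4 : Ord 1 (q ^ 4)
    o4 = ord-*ˡ _ oq
    o8 : Ord 1 (q ^ 8)
    o8 = ord-*ˡ _ oq

    conjugates : ∀ y {c} → Ord 1 c → ∀ k → Pr (- (i * y)) c k * Pr (- (i' * y)) c k ≈ Pr (- (y * y)) (c * c) k
    conjugates y {c} o k = trans (*-congˡ (Pr-cong o (trans (-‿cong (*-congʳ i'≈))
        (solve (i ∷ y ∷ []) (λ i y → :- ((:- i) :* y) := :- (:- (i :* y))) ≡.refl)) refl k))
      (trans (Pr-square (- (i * y)) o k) (Pr-cong (ord-*ˡ _ o)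
        (linear ((y * y) ⊙ ii) (solve (i ∷ y ∷ []) (λ i y → (:- (i :* y)) :* (:- (i :* y)) :- (:- (y :* y)) := y :* y :* (i :* i :- (:- one))) ≡.refl)) refl k))

    γγ' : ∀ k → γ k * γ' k ≈ Pr (- (q ^ 8 * q ^ 8)) (q ^ 8 * q ^ 8) k
    γγ' k = trans (*-cong (γ≈ k) (γ'≈ k)) (conjugates (q ^ 8) o8 k)

    δδ' : ∀ k → δ k * δ' k ≈ Pr (- (q ^ 8)) (q ^ 8 * q ^ 8) k
    δδ' k = trans (*-cong (δ≈ k) (δ'≈ k)) (trans (conjugates (q ^ 4) o8 k) (Pr-cong (ord-*ˡ _ o8)
      (-‿cong (solve (q ∷ []) (λ q → q :^ 4 :* q :^ 4 := q :^ 8) ≡.refl)) refl k))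

    -- For z² = i the products in base q⁸ pair to (-q¹⁶; q¹⁶) and (-q⁸; q¹⁶), so `hₛ` and `hₜ`
    -- become φ and ν at q⁸.
    at-zeta : H ≈ (ζ * q + ζ' * q) * hᵣ 0 * φD (q ^ 8) * νD (q ^ 8)
                + φS (q ^ 8) * νD (q ^ 8) * (al 0 * be 0)
                + (ζ * q + ζ' * q) * (q ^ 2 * νS (q ^ 8)) * φD (q ^ 8) * (al 0 * be 0)
    at-zeta = +-cong (+-cong (*-cong (*-congˡ (γγ' 0)) (δδ' 0)) (*-congʳ (*-cong s≈ (δδ' 0))))
                     (*-congʳ (*-cong (*-congˡ (*-cong w≈ t≈)) (γγ' 0)))
      where
      s≈ : hₛ 0 ≈ φS (q ^ 8)
      s≈ = sol-cong (ord-twin 0 oQ) γγ' (λ k →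
        elim (Q ∷ q ^ 8 ∷ Q ^ k ∷ (q ^ 8) ^ k ∷ (q ^ 8 * q ^ 8) ^ k ∷ []) (λ Q y a b c → (Q ⇒ y) ∷ (a ⇒ b) ∷ (c ⇒ b :* b) ∷ [] ,
          (Q :^ 1 :* a :^ 2 := y :* c)) (Q≈ , ^-cong k Q≈ , *-^ (q ^ 8) k , tt) ≡.refl) 0
      t≈ : hₜ 0 ≈ νS (q ^ 8)
      t≈ = sol-cong (ord-twin 1 oQ) (δδ' ∘ suc) (λ k →
        elim (Q ∷ q ^ 8 ∷ Q ^ k ∷ (q ^ 8) ^ k ∷ (q ^ 8 * q ^ 8) ^ k ∷ []) (λ Q y a b c → (Q ⇒ y) ∷ (a ⇒ b) ∷ (c ⇒ b :* b) ∷ [] ,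
          (Q :^ 2 :* a :^ 2 := y :* y :* c)) (Q≈ , ^-cong k Q≈ , *-^ (q ^ 8) k , tt) ≡.refl) 0

    -- The companion of `al 0 * be 0` under ζ ↦ -ζ. The product of the two no longer contains ζ, and
    -- `conj` itself is computed by the triple product.
    conj : Carrier
    conj = Pr (- (ζ * q)) (q ^ 2) 0 * Pr (- (ζ' * q)) (q ^ 2) 0

    conj-product : al 0 * be 0 * conj ≈ Pr (- (q ^ 4)) (q ^ 8) 0
    conj-product = trans (*-congʳ (*-cong (al≈ 0) (be≈ 0))) (trans (interchange-* _ _ _ _)
      (trans (*-cong (half ζ i ζζ) (half ζ' i' ζ'ζ')) (trans (conj' 0)
        (Pr-cong (ord-*ˡ _ o4) (-‿cong (solve (q ∷ []) (λ q → q :^ 2 :* q :^ 2 := q :^ 4) ≡.refl))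
          (solve (q ∷ []) (λ q → q :^ 4 :* q :^ 4 := q :^ 8) ≡.refl) 0))))
      where
      negneg : ∀ y → - (- y) ≈ y
      negneg y = solve (y ∷ []) (λ y → :- (:- y) := y) ≡.refl
      half : ∀ c d → c * c ≈ d → Pr (c * q) (q ^ 2) 0 * Pr (- (c * q)) (q ^ 2) 0 ≈ Pr (d * q ^ 2) (q ^ 4) 0
      half c d cc = trans (Pr-square (c * q) o2 0) (Pr-cong (ord-*ˡ _ o2)
        (linear ((q ^ 2) ⊙ cc) (solve (c ∷ d ∷ q ∷ []) (λ c d q → c :* q :* (c :* q) :- d :* q :^ 2 := q :^ 2 :* (c :* c :- d)) ≡.refl))
        (solve (q ∷ []) (λ q → q :^ 2 :* q :^ 2 := q :^ 4) ≡.refl) 0)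
      conj' : ∀ k → Pr (i * q ^ 2) (q ^ 4) k * Pr (i' * q ^ 2) (q ^ 4) k ≈ Pr (- (q ^ 2 * q ^ 2)) (q ^ 4 * q ^ 4) k
      conj' k = trans (*-comm _ _) (trans (*-cong
        (Pr-cong o4 (trans (*-congʳ i'≈) (solve (i ∷ q ^ 2 ∷ []) (λ i y → (:- i) :* y := :- (i :* y)) ≡.refl)) refl k)
        (Pr-cong o4 (trans (*-congʳ (trans (sym (negneg i)) (-‿cong (sym i'≈)))) (solve (i' ∷ q ^ 2 ∷ []) (λ i y → (:- i) :* y := :- (i :* y)) ≡.refl)) refl k))
        (conjugates (q ^ 2) o4 k))

    split₂ : ∀ c d → c * c ≈ d → θ⁺ (c * q) (q ^ 2) 0 ≈ θ⁺ (d * q ^ 4) (q ^ 8) 0 + c * q * θ⁺ (d * q ^ 8) (q ^ 8) 0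
    split₂ c d cc = trans (θ⁺-split (ord-*ʳ c oq)) (+-cong (θ⁺-cong (ord-*ˡ _ (ord-*ˡ _ (ord-*ʳ c oq)))
        (linear ((q ^ 4) ⊙ cc) (solve (c ∷ d ∷ q ∷ []) (λ c d q → (c :* q) :^ 2 :* q :^ 2 :- d :* q :^ 4 := q :^ 4 :* (c :* c :- d)) ≡.refl)) Q' 0)
        (*-congˡ (θ⁺-cong (ord-*ˡ _ (ord-*ˡ _ (ord-*ʳ c oq)))
        (linear ((q ^ 8) ⊙ cc) (solve (c ∷ d ∷ q ∷ []) (λ c d q → (c :* q) :^ 2 :* (q :^ 2) :^ 3 :- d :* q :^ 8 := q :^ 8 :* (c :* c :- d)) ≡.refl)) Q' 0)))
      where
      Q' : (q ^ 2) ^ 4 ≈ q ^ 8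
      Q' = solve (q ∷ []) (λ q → (q :^ 2) :^ 4 := q :^ 8) ≡.refl

    split₄ : ∀ d → d * d ≈ - 1# → θ⁺ (d * q ^ 4) (q ^ 8) 0 ≈ θ⁺ (- (q ^ 16)) (q ^ 32) 0 + d * q ^ 4 * θ⁺ (- (q ^ 32)) (q ^ 32) 0
    split₄ d dd = trans (θ⁺-split (ord-*ʳ d o4)) (+-cong (θ⁺-cong (ord-*ˡ _ (ord-*ˡ _ (ord-*ʳ d o4)))
        (linear ((q ^ 16) ⊙ dd) (solve (d ∷ q ∷ []) (λ d q → (d :* q :^ 4) :^ 2 :* q :^ 8 :- (:- (q :^ 16)) := q :^ 16 :* (d :* d :- (:- one))) ≡.refl)) Q' 0)
        (*-congˡ (θ⁺-cong (ord-*ˡ _ (ord-*ˡ _ (ord-*ʳ d o4)))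
        (linear ((q ^ 32) ⊙ dd) (solve (d ∷ q ∷ []) (λ d q → (d :* q :^ 4) :^ 2 :* (q :^ 8) :^ 3 :- (:- (q :^ 32)) := q :^ 32 :* (d :* d :- (:- one))) ≡.refl)) Q' 0)))
      where
      Q' : (q ^ 8) ^ 4 ≈ q ^ 32
      Q' = solve (q ∷ []) (λ q → (q :^ 8) :^ 4 := q :^ 32) ≡.refl

    split₈ : ∀ d → d * d ≈ - 1# → θ⁺ (d * q ^ 8) (q ^ 8) 0 ≈ θ⁺ (- (q ^ 24)) (q ^ 32) 0 + d * q ^ 8 * θ⁺ (- (q ^ 8) * q ^ 32) (q ^ 32) 0
    split₈ d dd = trans (θ⁺-split (ord-*ʳ d o8)) (+-cong (θ⁺-cong (ord-*ˡ _ (ord-*ˡ _ (ord-*ʳ d o8)))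
        (linear ((q ^ 24) ⊙ dd) (solve (d ∷ q ∷ []) (λ d q → (d :* q :^ 8) :^ 2 :* q :^ 8 :- (:- (q :^ 24)) := q :^ 24 :* (d :* d :- (:- one))) ≡.refl)) Q' 0)
        (*-congˡ (θ⁺-cong (ord-*ˡ _ (ord-*ˡ _ (ord-*ʳ d o8)))
        (linear ((q ^ 40) ⊙ dd) (solve (d ∷ q ∷ []) (λ d q → (d :* q :^ 8) :^ 2 :* (q :^ 8) :^ 3 :- (:- (q :^ 8)) :* q :^ 32 := q :^ 40 :* (d :* d :- (:- one))) ≡.refl)) Q' 0)))
      where
      Q' : (q ^ 8) ^ 4 ≈ q ^ 32
      Q' = solve (q ∷ []) (λ q → (q :^ 8) :^ 4 := q :^ 32) ≡.refl

    -- The triple product gives Σ ζ^n q^(n²) over all integers n. Terms n and -n cancel for n ≡ 2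
    -- mod 4, multiples of 4 give the first theta series, and for odd n the sum ζ^n + ζ^(-n) is ± (ζ
    -- + ζ').
    conj-theta : Pr (q ^ 2) (q ^ 2) 0 * conj
                 ≈ theta (- (q ^ 16)) (- (q ^ 16)) (q ^ 32) + (ζ + ζ') * q * theta (- (q ^ 8)) (- (q ^ 24)) (q ^ 32)
    conj-theta = trans (sym (*-assoc _ _ _)) (trans (sym (jacobi (- (ζ * q)) (- (ζ' * q)) (q ^ 2) eQ (ord-neg oζ) (ord-neg oζ')))
      (trans (+-congʳ (+-cong (θ⁺-cong (ord-neg (ord-neg oζ)) (negneg _) refl 0) (θ⁺-cong (ord-neg (ord-neg oζ')) (negneg _) refl 0)))
        (linear ((q ^ 9 * T₄₀) ⊙ ζi ⊞ (q ^ 9 * T₄₀) ⊙ ζ'i')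
          (elim (q ∷ ζ ∷ ζ' ∷ i ∷ i' ∷ θ⁺ (ζ * q) (q ^ 2) 0 ∷ θ⁺ (ζ' * q) (q ^ 2) 0
              ∷ θ⁺ (i * q ^ 4) (q ^ 8) 0 ∷ θ⁺ (i * q ^ 8) (q ^ 8) 0 ∷ θ⁺ (i' * q ^ 4) (q ^ 8) 0 ∷ θ⁺ (i' * q ^ 8) (q ^ 8) 0
              ∷ θ⁺ (- (q ^ 16)) (q ^ 32) 0 ∷ θ⁺ (- (q ^ 32)) (q ^ 32) 0 ∷ θ⁺ (- (q ^ 24)) (q ^ 32) 0 ∷ T₄₀ ∷ θ⁺ (- (q ^ 8)) (q ^ 32) 0 ∷ [])
            (λ q ζ ζ' i i' a b e₄ e₈ f₄ f₈ t₁₆ t₃₂ t₂₄ t₄₀ t₈ →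
              (a ⇒ e₄ :+ ζ :* q :* e₈) ∷ (b ⇒ f₄ :+ ζ' :* q :* f₈)
                ∷ (e₄ ⇒ t₁₆ :+ i :* q :^ 4 :* t₃₂) ∷ (f₄ ⇒ t₁₆ :+ i' :* q :^ 4 :* t₃₂)
                ∷ (e₈ ⇒ t₂₄ :+ i :* q :^ 8 :* t₄₀) ∷ (f₈ ⇒ t₂₄ :+ i' :* q :^ 8 :* t₄₀)
                ∷ (t₈ ⇒ one :+ (:- (q :^ 8)) :* t₄₀) ∷ (i' ⇒ :- i) ∷ [] ,
              ((a :+ b :- one) :- ((t₁₆ :+ t₁₆ :- one) :+ (ζ :+ ζ') :* q :* (t₈ :+ t₂₄ :- one))
                := q :^ 9 :* t₄₀ :* (ζ :* i :- (:- ζ')) :+ q :^ 9 :* t₄₀ :* (ζ' :* i' :- (:- ζ))))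
            (split₂ ζ i ζζ , split₂ ζ' i' ζ'ζ' , split₄ i ii , split₄ i' i'i' , split₈ i ii , split₈ i' i'i'
              , θ⁺-shift (ord-neg o8) , i'≈ , tt) ≡.refl))))
      where
      T₄₀ = θ⁺ (- (q ^ 8) * q ^ 32) (q ^ 32) 0
      oζ : Ord 1 (ζ * q)
      oζ = ord-*ʳ ζ oq
      oζ' : Ord 1 (ζ' * q)
      oζ' = ord-*ʳ ζ' oq
      negneg : ∀ y → - (- y) ≈ y
      negneg y = solve (y ∷ []) (λ y → :- (:- y) := y) ≡.refl
      eQ : q ^ 2 ≈ - (ζ * q) * - (ζ' * q)
      eQ = sym (linear ((q ^ 2) ⊙ ζζ') (solve (q ∷ ζ ∷ ζ' ∷ []) (λ q z z' →
        (:- (z :* q)) :* (:- (z' :* q)) :- q :^ 2 := q :^ 2 :* (z :* z' :- one)) ≡.refl))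
      i'i' : i' * i' ≈ - 1#
      i'i' = trans (*-cong i'≈ i'≈) (trans (solve (i ∷ []) (λ i → (:- i) :* (:- i) := i :* i) ≡.refl) ii)
      ζi : ζ * i ≈ - ζ'
      ζi = linear (ζ ⊙ ζ'ζ' ⊞ (- ζ') ⊙ ζζ' ⊞ ζ ⊙ i'≈)
        (solve (ζ ∷ ζ' ∷ i ∷ i' ∷ []) (λ z z' i i' → z :* i :- (:- z')
          := z :* (z' :* z' :- i') :+ ((:- z') :* (z :* z' :- one) :+ z :* (i' :- (:- i)))) ≡.refl)
      ζ'i' : ζ' * i' ≈ - ζ
      ζ'i' = linear (ζ' ⊙ i'≈ ⊞ ζ' ⊙ ζζ ⊞ (- ζ) ⊙ ζζ')
        (solve (ζ ∷ ζ' ∷ i ∷ i' ∷ []) (λ z z' i i' → z' :* i' :- (:- z)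
          := z' :* (i' :- (:- i)) :+ (z' :* (z :* z :- i) :+ (:- z) :* (z :* z' :- one))) ≡.refl)

-- Continuous homomorphisms and mock theta quotients.

record ContinuousHom (A B : CompleteRing) : Set where
  module A = Series A
  module B = Series B
  field
    h : A.Carrier → B.Carrier
    h-cong : ∀ {x y} → x A.≈ y → h x B.≈ h y
    h-+ : ∀ x y → h (x A.+ y) B.≈ h x B.+ h y
    h-* : ∀ x y → h (x A.* y) B.≈ h x B.* h y
    h-1 : h A.1# B.≈ B.1#
    h-neg : ∀ x → h (A.- x) B.≈ B.- h x
    h-ord : ∀ {n x} → A.Ord n x → B.Ord n (h x)

  h-sub : ∀ x y → h (x A.- y) B.≈ h x B.- h y
  h-sub x y = B.trans (h-+ x (A.- y)) (B.+-congˡ (h-neg y))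

  h-^ : ∀ x n → h (x A.^ n) B.≈ h x B.^ n
  h-^ x zero = h-1
  h-^ x (suc n) = B.trans (h-* x _) (B.*-congˡ (h-^ x n))

  -- The image family satisfies the image recursion, which determines it; continuity enters through
  -- `h-ord`.
  h-sol : ∀ a b → (∀ k → A.Ord 1 (b k)) → ∀ k → h (A.sol a b k) B.≈ B.sol (h ∘ a) (h ∘ b) k
  h-sol a b o = B.sol-unique _ _ (h ∘ A.sol a b) (λ k → h-ord (o k))
    (λ k → B.trans (h-cong (A.sol-step a b o k)) (B.trans (h-+ _ _) (B.+-congˡ (h-* _ _))))

  h-Prod : ∀ y → A.Small y → ∀ k → h (A.Prod y k) B.≈ B.Prod (h ∘ y) k
  h-Prod y o = B.Prod-unique _ (h ∘ A.Prod y) (λ l → h-ord (o l))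
    (λ k → B.ord-resp (B.trans (h-sub _ _) (B.+-congˡ (B.-‿cong h-1))) (h-ord (A.Prod-one y o k)))
    (λ k → B.trans (h-cong (A.Prod-step y o k)) (B.trans (h-* _ _)
      (B.*-congʳ (B.trans (h-sub _ _) (B.+-congʳ h-1)))))

  h-Pr : ∀ x {Q} → A.Ord 1 Q → ∀ k → h (A.Pr x Q k) B.≈ B.Pr (h x) (h Q) k
  h-Pr x {Q} o k = B.trans (h-Prod _ (λ l → A.ord-geo x l o) k)
    (B.sym (B.Prod-unique _ (B.Pr (h x) (h Q)) (λ l → h-ord (A.ord-geo x l o)) (B.Pr-one (h x) (h-ord o))
      (λ k → B.trans (B.Pr-step (h x) (h-ord o) k) (B.*-congʳ (B.+-congˡ (B.-‿cong
        (B.sym (B.trans (h-* _ _) (B.*-congˡ (h-^ Q k)))))))) k))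

  h-twin : ∀ c {X Y X' Y' Q} → A.Ord 1 Q → (∀ k → h (X k) B.≈ X' k) → (∀ k → h (Y k) B.≈ Y' k) →
           ∀ k → h (A.twin c X Y Q k) B.≈ B.twin c X' Y' (h Q) k
  h-twin c {Q = Q} o eX eY k = B.trans (h-sol _ _ (A.ord-twin c o) k)
    (B.sol-cong (λ k → h-ord (A.ord-twin c o k)) (λ k → B.trans (h-* _ _) (B.*-cong (eX k) (eY k)))
      (λ k → B.trans (h-* _ _) (B.*-cong (h-^ Q (suc c)) (B.trans (h-^ _ 2) (B.^-cong 2 (h-^ Q k))))) k)

  h-recip₁ : ∀ {u} → A.Ord 1 (A.1# A.- u) → h (A.recip₁ u) B.≈ B.recip₁ (h u)
  h-recip₁ o = B.trans (h-sol _ _ (λ _ → o) 0)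
    (B.sol-cong (λ _ → h-ord o) (λ _ → h-1) (λ _ → B.trans (h-sub _ _) (B.+-congʳ h-1)) 0)

module MockQuotients (S : CompleteRing) where
  open Series S
  open MockTheta S public

  ord-Pr₁ : ∀ {x Q} → Ord 1 x → Ord 1 Q → Ord 1 (1# - Pr x Q 0)
  ord-Pr₁ {x} {Q} ox oQ = ord-resp
    (elim (x ∷ Pr x Q 0 ∷ Pr x Q 1 ∷ []) (λ x p p₁ → (p ⇒ (one :- x :* one) :* p₁) ∷ [] ,
      (x :* p₁ :- (p₁ :- one) := one :- p)) (Pr-step x oQ 0 , tt) ≡.refl)
    (ord-sub (ord-*ˡ _ ox) (Pr-one x oQ 1))

  ω f φ ν : Carrier → Carrier
  ω x = ωS x * recip₁ (ωD x) ^ 2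
  f x = fS x * recip₁ (fD x) ^ 2
  φ x = φS x * recip₁ (φD x)
  ν x = νS x * recip₁ (νD x)

  oωD : ∀ {x} → Ord 1 x → Ord 1 (1# - ωD x)
  oωD o = ord-Pr₁ o (ord-*ˡ _ o)

  ofD : ∀ {x} → Ord 1 x → Ord 1 (1# - fD x)
  ofD o = ord-Pr₁ (ord-neg o) o

  oφD : ∀ {x} → Ord 1 x → Ord 1 (1# - φD x)
  oφD o = ofD (ord-*ˡ _ o)

  oνD : ∀ {x} → Ord 1 x → Ord 1 (1# - νD x)
  oνD o = ord-Pr₁ (ord-neg o) (ord-*ˡ _ o)

  quotient : ∀ s {d} → Ord 1 (1# - d) → s * recip₁ d * d ≈ s
  quotient s {d} o = linear (s ⊙ recip₁-law o) (solve (s ∷ d ∷ recip₁ d ∷ []) (λ s d r →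
    s :* r :* d :- s := s :* (d :* r :- one)) ≡.refl)

  quotient² : ∀ s {d} → Ord 1 (1# - d) → s * recip₁ d ^ 2 * (d * d) ≈ s
  quotient² s {d} o = linear ((s * (d * recip₁ d + 1#)) ⊙ recip₁-law o) (solve (s ∷ d ∷ recip₁ d ∷ []) (λ s d r →
    s :* r :^ 2 :* (d :* d) :- s := s :* (d :* r :+ one) :* (d :* r :- one)) ≡.refl)

  ω-law : ∀ {x} → Ord 1 x → ω x * (ωD x * ωD x) ≈ ωS x
  ω-law o = quotient² _ (oωD o)

  f-law : ∀ {x} → Ord 1 x → f x * (fD x * fD x) ≈ fS x
  f-law o = quotient² _ (ofD o)

  φ-law : ∀ {x} → Ord 1 x → φ x * φD x ≈ φS x
  φ-law o = quotient _ (oφD o)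

  ν-law : ∀ {x} → Ord 1 x → ν x * νD x ≈ νS x
  ν-law o = quotient _ (oνD o)

  recip₁-cong : ∀ {u v} → Ord 1 (1# - u) → u ≈ v → recip₁ u ≈ recip₁ v
  recip₁-cong o e = sol-cong (λ _ → o) (λ _ → refl) (λ _ → +-congˡ (-‿cong e)) 0

  ω-cong : ∀ {x y} → Ord 1 x → x ≈ y → ω x ≈ ω y
  ω-cong {x} {y} o e = *-cong (twin-cong 1 oo (λ k → Pr-cong oo e ee (suc k)) (λ k → Pr-cong oo e ee (suc k)) ee 0)
      (^-cong 2 (recip₁-cong (oωD o) (Pr-cong oo e ee 0)))
    where
    oo : Ord 1 (x * x)
    oo = ord-*ˡ _ o
    ee : x * x ≈ y * y
    ee = *-cong e e

  f-cong : ∀ {x y} → Ord 1 x → x ≈ y → f x ≈ f y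
  f-cong o e = *-cong (twin-cong 0 o (Pr-cong o (-‿cong e) e) (Pr-cong o (-‿cong e) e) e 0)
    (^-cong 2 (recip₁-cong (ofD o) (Pr-cong o (-‿cong e) e 0)))

  φ-cong : ∀ {x y} → Ord 1 x → x ≈ y → φ x ≈ φ y
  φ-cong {x} {y} o e = *-cong (sol-cong (λ k → ord-*ˡ _ o) (Pr-cong oo (-‿cong ee) ee) (λ k → *-cong e (^-cong k ee)) 0)
      (recip₁-cong (oφD o) (Pr-cong oo (-‿cong ee) ee 0))
    where
    oo : Ord 1 (x * x)
    oo = ord-*ˡ _ o
    ee : x * x ≈ y * y
    ee = *-cong e e

  ν-cong : ∀ {x y} → Ord 1 x → x ≈ y → ν x ≈ ν y
  ν-cong {x} {y} o e = *-cong (sol-cong (λ k → ord-*ˡ _ oo) (λ k → Pr-cong oo (-‿cong e) ee (suc k)) (λ k → *-cong ee (^-cong k ee)) 0)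
      (recip₁-cong (oνD o) (Pr-cong oo (-‿cong e) ee 0))
    where
    oo : Ord 1 (x * x)
    oo = ord-*ˡ _ o
    ee : x * x ≈ y * y
    ee = *-cong e e

module MockHom {A B : CompleteRing} (hom : ContinuousHom A B) where
  open ContinuousHom hom
  module MA = MockQuotients A
  module MB = MockQuotients B

  h-square : ∀ x → h (x A.* x) B.≈ h x B.* h x
  h-square x = h-* x x

  h-Pr' : ∀ {x Q y R} → A.Ord 1 Q → h x B.≈ y → h Q B.≈ R → ∀ k → h (A.Pr x Q k) B.≈ B.Pr y R k
  h-Pr' o ex eQ k = B.trans (h-Pr _ o k) (B.Pr-cong (h-ord o) ex eQ k)

  h-ω : ∀ {x} → A.Ord 1 x → h (MA.ω x) B.≈ MB.ω (h x)
  h-ω {x} o = B.trans (h-* _ _) (B.*-cong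
      (B.trans (h-twin 1 oo (λ k → step (suc k)) (λ k → step (suc k)) 0)
        (B.twin-cong 1 (h-ord oo) (λ _ → B.refl) (λ _ → B.refl) (h-square x) 0))
      (B.trans (h-^ _ 2) (B.^-cong 2 (B.trans (h-recip₁ (MA.oωD o))
        (MB.recip₁-cong (B.ord-resp (B.trans (h-sub _ _) (B.+-congʳ h-1)) (h-ord (MA.oωD o))) (step 0))))))
    where
    oo : A.Ord 1 (x A.* x)
    oo = A.ord-*ˡ _ o
    step : ∀ k → h (A.Pr x (x A.* x) k) B.≈ B.Pr (h x) (h x B.* h x) k
    step = h-Pr' oo B.refl (h-square x)

  h-f : ∀ {x} → A.Ord 1 x → h (MA.f x) B.≈ MB.f (h x)
  h-f {x} o = B.trans (h-* _ _) (B.*-cong (h-twin 0 o step step 0)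
      (B.trans (h-^ _ 2) (B.^-cong 2 (B.trans (h-recip₁ (MA.ofD o))
        (MB.recip₁-cong (B.ord-resp (B.trans (h-sub _ _) (B.+-congʳ h-1)) (h-ord (MA.ofD o))) (step 0))))))
    where
    step : ∀ k → h (A.Pr (A.- x) x k) B.≈ B.Pr (B.- h x) (h x) k
    step = h-Pr' o (h-neg x) B.refl

  h-φ : ∀ {x} → A.Ord 1 x → h (MA.φ x) B.≈ MB.φ (h x)
  h-φ {x} o = B.trans (h-* _ _) (B.*-cong
      (B.trans (h-sol _ _ (λ k → A.ord-*ˡ _ o) 0) (B.sol-cong (λ k → h-ord (A.ord-*ˡ _ o)) step
        (λ k → B.trans (h-* _ _) (B.*-congˡ (B.trans (h-^ _ k) (B.^-cong k (h-square x))))) 0))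
      (B.trans (h-recip₁ (MA.oφD o))
        (MB.recip₁-cong (B.ord-resp (B.trans (h-sub _ _) (B.+-congʳ h-1)) (h-ord (MA.oφD o))) (step 0))))
    where
    oo : A.Ord 1 (x A.* x)
    oo = A.ord-*ˡ _ o
    step : ∀ k → h (A.Pr (A.- (x A.* x)) (x A.* x) k) B.≈ B.Pr (B.- (h x B.* h x)) (h x B.* h x) k
    step = h-Pr' oo (B.trans (h-neg _) (B.-‿cong (h-square x))) (h-square x)

  h-ν : ∀ {x} → A.Ord 1 x → h (MA.ν x) B.≈ MB.ν (h x)
  h-ν {x} o = B.trans (h-* _ _) (B.*-cong
      (B.trans (h-sol _ _ (λ k → A.ord-*ˡ _ oo) 0) (B.sol-cong (λ k → h-ord (A.ord-*ˡ _ oo)) (λ k → step (suc k))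
        (λ k → B.trans (h-* _ _) (B.*-cong (h-square x) (B.trans (h-^ _ k) (B.^-cong k (h-square x))))) 0))
      (B.trans (h-recip₁ (MA.oνD o))
        (MB.recip₁-cong (B.ord-resp (B.trans (h-sub _ _) (B.+-congʳ h-1)) (h-ord (MA.oνD o))) (step 0))))
    where
    oo : A.Ord 1 (x A.* x)
    oo = A.ord-*ˡ _ o
    step : ∀ k → h (A.Pr (A.- x) (x A.* x) k) B.≈ B.Pr (B.- h x) (h x B.* h x) k
    step = h-Pr' oo (h-neg x) (h-square x)

-- Eta products and theta functions.

-- J i is the eta product (Q; Q)_∞ at Q = q^{2^i}.
module Eta (S : CompleteRing) (q : CompleteRing.Carrier S) (oq : CompleteRing.Ord S 1 q) where
  open Series S
  open Classical S
  open MockQuotients S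

  sq : ℕ → Carrier
  sq zero = q
  sq (suc i) = sq i * sq i

  ord-sq : ∀ i → Ord (suc i) (sq i)
  ord-sq zero = oq
  ord-sq (suc i) = ord-≤ (ℕ.s≤s (ℕₚ.m≤n+m (suc i) i)) (ord-* (ord-sq i) (ord-sq i))

  osq : ∀ i → Ord 1 (sq i)
  osq i = ord-≤ (ℕ.s≤s ℕ.z≤n) (ord-sq i)

  J : ℕ → Carrier
  J i = Pr (sq i) (sq i) 0

  oJ : ∀ i → Ord 1 (1# - J i)
  oJ i = ord-Pr₁ (osq i) (osq i)

  fD-J : ∀ i → fD (sq i) * J i ≈ J (suc i)
  fD-J i = trans (*-comm _ _) (Pr-square (sq i) (osq i) 0)

  ωD-J : ∀ i → ωD (sq i) * J (suc i) ≈ J i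
  ωD-J i = sym (Pr-split (sq i) (osq i) 0)

  νD-fD : ∀ i → fD (sq i) ≈ νD (sq i) * fD (sq (suc i))
  νD-fD i = trans (Pr-split (- sq i) (osq i) 0) (*-congˡ (Pr-cong (osq (suc i))
    (solve (sq i ∷ []) (λ y → (:- y) :* y := :- (y :* y)) ≡.refl) refl 0))

  νD-J : ∀ i → νD (sq i) * (J i * J (suc (suc i))) ≈ J (suc i) * J (suc i)
  νD-J i = linear ((- (νD (sq i) * J i)) ⊙ fD-J (suc i) ⊞ (- (J i * J (suc i))) ⊙ νD-fD i ⊞ J (suc i) ⊙ fD-J i)
    (solve (νD (sq i) ∷ fD (sq i) ∷ fD (sq (suc i)) ∷ J i ∷ J (suc i) ∷ J (suc (suc i)) ∷ []) (λ n f f₁ j j₁ j₂ →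
      n :* (j :* j₂) :- j₁ :* j₁ := (:- (n :* j)) :* (f₁ :* j₁ :- j₂) :+ ((:- (j :* j₁)) :* (f :- n :* f₁) :+ j₁ :* (f :* j :- j₁))) ≡.refl)

  νD-ωD : ∀ i → ωD (sq i) * νD (sq i) ≈ ωD (sq (suc i))
  νD-ωD i = Pr-square (sq i) (osq (suc i)) 0

  -- Ramanujan's φ(x), φ(-x), ψ(x), ψ(-x) at x = q^(2^i). The third is entered as the one-sided sum
  -- over triangular exponents, the fourth as the two-sided theta series of -x and -x³ in base x⁴.
  Φ Φ⁻ Ψ Ψ⁻ : ℕ → Carrier
  Φ i = theta (sq i) (sq i) (sq (suc i))
  Φ⁻ i = theta (- sq i) (- sq i) (sq (suc i))
  Ψ i = θ⁺ (sq i) (sq i) 0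
  Ψ⁻ i = theta (- sq i) (- (sq i * sq (suc i))) (sq (suc (suc i)))

  negneg : ∀ y → - (- y) ≈ y
  negneg y = solve (y ∷ []) (λ y → :- (:- y) := y) ≡.refl

  Φ-J : ∀ i → Φ i ≈ J (suc i) * νD (sq i) * νD (sq i)
  Φ-J i = trans (+-congʳ (+-cong (θ⁺-cong (osq i) (sym (negneg _)) refl 0) (θ⁺-cong (osq i) (sym (negneg _)) refl 0)))
    (jacobi (- sq i) (- sq i) _ (solve (sq i ∷ []) (λ y → y :* y := (:- y) :* (:- y)) ≡.refl) (ord-neg (osq i)) (ord-neg (osq i)))

  Φ⁻-J : ∀ i → Φ⁻ i ≈ J (suc i) * ωD (sq i) * ωD (sq i)
  Φ⁻-J i = jacobi (sq i) (sq i) _ refl (osq i) (osq i)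

  -- Splitting the one-sided series by the parity of the index gives the two-sided theta series of x
  -- and x³ in base x⁴, to which the triple product applies.
  Ψ-J : ∀ i → Ψ i ≈ J (suc (suc i)) * νD (sq i)
  Ψ-J i = trans split (trans (jacobi (- y) (- (y * Y)) (Y * Y) (solve (y ∷ []) (λ y → y :* y :* (y :* y) := (:- y) :* (:- (y :* (y :* y)))) ≡.refl)
        (ord-neg (osq i)) (ord-neg (ord-*ˡ _ (osq i))))
      (trans (*-assoc _ _ _) (*-congˡ (sym (trans (Pr-split (- y) (osq (suc i)) 0)
        (*-congˡ (Pr-cong (osq (suc (suc i))) (solve (y ∷ Y ∷ []) (λ y Y → (:- y) :* Y := :- (y :* Y)) ≡.refl) refl 0)))))))
    where
    y = sq i
    Y = sq (suc i)
    split : Ψ i ≈ theta (- (- y)) (- (- (y * Y))) (Y * Y)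
    split = elim (y ∷ Ψ i ∷ θ⁺ (y ^ 2 * y) (y ^ 4) 0 ∷ θ⁺ (y ^ 2 * y ^ 3) (y ^ 4) 0 ∷ θ⁺ (- (- y)) (Y * Y) 0 ∷ θ⁺ (- (- (y * Y))) (Y * Y) 0 ∷ [])
      (λ y p a b c d → (p ⇒ a :+ y :* b) ∷ (c ⇒ one :+ y :* b) ∷ (d ⇒ a) ∷ [] , (p := c :+ d :- one))
      (θ⁺-split (osq i)
        , trans (θ⁺-cong (ord-neg (ord-neg (osq i))) (negneg y) refl 0) (trans (θ⁺-shift (osq i)) (+-congˡ (*-congˡ (θ⁺-cong (ord-*ˡ _ (osq i))
            (solve (y ∷ []) (λ y → y :* (y :* y :* (y :* y)) := y :^ 2 :* y :^ 3) ≡.refl)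
            (solve (y ∷ []) (λ y → y :* y :* (y :* y) := y :^ 4) ≡.refl) 0))))
        , θ⁺-cong (ord-neg (ord-neg (ord-*ˡ _ (osq i)))) (solve (y ∷ []) (λ y → :- (:- (y :* (y :* y))) := y :^ 2 :* y) ≡.refl)
            (solve (y ∷ []) (λ y → y :* y :* (y :* y) := y :^ 4) ≡.refl) 0
        , tt) ≡.refl

  Ψ⁻-J : ∀ i → Ψ⁻ i ≈ J (suc (suc i)) * ωD (sq i)
  Ψ⁻-J i = trans (jacobi y (y * Y) (Y * Y) (solve (y ∷ []) (λ y → y :* y :* (y :* y) := y :* (y :* (y :* y))) ≡.refl) (osq i) (ord-*ˡ _ (osq i)))
      (trans (*-assoc _ _ _) (*-congˡ (sym (Pr-split y (osq (suc i)) 0))))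
    where
    y = sq i
    Y = sq (suc i)

  -- Used for s = q^(2^i) and for its negative: the two new series depend only on s², so φ(x) and
  -- φ(-x) differ by a sign in the second one.
  split-square : ∀ i s → s * s ≈ sq (suc i) → Ord 1 s → θ⁺ s (sq (suc i)) 0 ≈ θ⁺ (sq (suc (suc i))) (sq (suc (suc (suc i)))) 0 + s * Ψ (suc (suc (suc i)))
  split-square i s e o = trans (θ⁺-split o) (+-cong (θ⁺-cong o2
      (trans (*-congʳ sq≈) (solve (sq i ∷ []) (λ y → (y :* y) :* (y :* y) := y :* y :* (y :* y)) ≡.refl)) Q≈ 0)
      (*-congˡ (θ⁺-cong o2 (trans (*-congʳ sq≈) (solve (sq i ∷ []) (λ y → let z = y :* y in z :* z :^ 3 := z :* z :* (z :* z)) ≡.refl)) Q≈ 0)))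
    where
    o2 : ∀ {x} → Ord 1 (s ^ 2 * x)
    o2 = ord-*ˡ _ (ord-*ˡ _ o)
    sq≈ : s ^ 2 ≈ sq (suc i)
    sq≈ = trans (solve (s ∷ []) (λ s → s :^ 2 := s :* s) ≡.refl) e
    Q≈ : sq (suc i) ^ 4 ≈ sq (suc (suc (suc i)))
    Q≈ = solve (sq (suc i) ∷ []) (λ z → z :^ 4 := z :* z :* (z :* z)) ≡.refl

  Φ-split : ∀ i → Φ i ≈ Φ (suc (suc i)) + (1# + 1#) * sq i * Ψ (suc (suc (suc i)))
  Φ-split i = elim (sq i ∷ θ⁺ (sq i) (sq (suc i)) 0 ∷ θ⁺ (sq (suc (suc i))) (sq (suc (suc (suc i)))) 0 ∷ Ψ (suc (suc (suc i))) ∷ [])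
    (λ y a b c → (a ⇒ b :+ y :* c) ∷ [] , (a :+ a :- one := (b :+ b :- one) :+ (one :+ one) :* y :* c))
    (split-square i (sq i) refl (osq i) , tt) ≡.refl

  Φ⁻-split : ∀ i → Φ⁻ i ≈ Φ (suc (suc i)) - (1# + 1#) * sq i * Ψ (suc (suc (suc i)))
  Φ⁻-split i = elim (sq i ∷ θ⁺ (- sq i) (sq (suc i)) 0 ∷ θ⁺ (sq (suc (suc i))) (sq (suc (suc (suc i)))) 0 ∷ Ψ (suc (suc (suc i))) ∷ [])
    (λ y a b c → (a ⇒ b :+ (:- y) :* c) ∷ [] , (a :+ a :- one := (b :+ b :- one) :- (one :+ one) :* y :* c))
    (split-square i (- sq i) (solve (sq i ∷ []) (λ y → (:- y) :* (:- y) := y :* y) ≡.refl) (ord-neg (osq i)) , tt) ≡.refl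

  ΦΦ⁻ : ∀ i → Φ i * Φ⁻ i ≈ Φ⁻ (suc i) * Φ⁻ (suc i)
  ΦΦ⁻ i = linear ((W * W * (J₁ + J₂ * W)) ⊙ sym (ωD-J (suc i)) ⊞ (J₁ * J₁ * (o * n + W)) ⊙ νD-ωD i)
    (elim (Φ i ∷ Φ⁻ i ∷ Φ⁻ (suc i) ∷ J₁ ∷ J₂ ∷ n ∷ o ∷ W ∷ []) (λ a b c j₁ j₂ n o w →
      (a ⇒ j₁ :* n :* n) ∷ (b ⇒ j₁ :* o :* o) ∷ (c ⇒ j₂ :* w :* w) ∷ [] ,
      (a :* b :- c :* c := w :* w :* (j₁ :+ j₂ :* w) :* (j₁ :- w :* j₂) :+ j₁ :* j₁ :* (o :* n :+ w) :* (o :* n :- w)))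
      (Φ-J i , Φ⁻-J i , Φ⁻-J (suc i) , tt) ≡.refl)
    where
    J₁ = J (suc i)
    J₂ = J (suc (suc i))
    n = νD (sq i)
    o = ωD (sq i)
    W = ωD (sq (suc i))

  ΦΨ : ∀ i → Φ i * Ψ (suc i) ≈ Ψ i * Ψ i
  ΦΨ i = linear ((νD (sq i) * νD (sq i)) ⊙ νD-J (suc i))
    (elim (Φ i ∷ Ψ (suc i) ∷ Ψ i ∷ J (suc i) ∷ J (suc (suc i)) ∷ J (suc (suc (suc i))) ∷ νD (sq i) ∷ νD (sq (suc i)) ∷ [])
      (λ a b c j₁ j₂ j₃ n m → (a ⇒ j₁ :* n :* n) ∷ (b ⇒ j₃ :* m) ∷ (c ⇒ j₂ :* n) ∷ [] ,
        (a :* b :- c :* c := n :* n :* (m :* (j₁ :* j₃) :- j₂ :* j₂)))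
      (Φ-J i , Ψ-J (suc i) , Ψ-J i , tt) ≡.refl)

  -- φ(q)² + φ(-q)² - 2φ(q²)² is multiplied by -2 under q² ↦ q, so it vanishes.
  Φ²+Φ⁻² : ∀ i → Φ i * Φ i + Φ⁻ i * Φ⁻ i ≈ (1# + 1#) * (Φ (suc i) * Φ (suc i))
  -- The multiplier -2 has order 0; the decay comes from q^(2^i), whose order grows with i.
  Φ²+Φ⁻² i = minus-zero (persist (λ _ → - (1# + 1#)) V small step i)
    where
    V : ℕ → Carrier
    V i = Φ i * Φ i + Φ⁻ i * Φ⁻ i - (1# + 1#) * (Φ (suc i) * Φ (suc i))
    step : ∀ i → V i ≈ - (1# + 1#) * V (suc i)
    step i = linear ((- (1# + 1#)) ⊙ ΦΦ⁻ i)
      (elim (Φ i ∷ Φ⁻ i ∷ Φ (suc i) ∷ Φ⁻ (suc i) ∷ Φ (suc (suc i)) ∷ sq i ∷ Ψ (suc (suc (suc i))) ∷ [])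
        (λ a b a₁ b₁ a₂ y p → (a ⇒ a₂ :+ (one :+ one) :* y :* p) ∷ (b ⇒ a₂ :- (one :+ one) :* y :* p) ∷ [] ,
          ((a :* a :+ b :* b :- (one :+ one) :* (a₁ :* a₁)) :- (:- (one :+ one)) :* (a₁ :* a₁ :+ b₁ :* b₁ :- (one :+ one) :* (a₂ :* a₂))
            := (:- (one :+ one)) :* (a :* b :- b₁ :* b₁)))
        (Φ-split i , Φ⁻-split i , tt) ≡.refl)
    θ-one : ∀ n {y Q} → Ord n y → Ord 1 y → Ord n (theta y y Q - 1#)
    θ-one n {y} {Q} o o1 = ord-resp
      (elim (y ∷ θ⁺ y Q 0 ∷ θ⁺ y Q 1 ∷ []) (λ y a b → (a ⇒ one :+ y :* one :* b) ∷ [] ,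
        (y :* (b :+ b) := (a :+ a :- one) :- one)) (θ⁺-step o1 0 , tt) ≡.refl) (ord-*ˡ _ o)
    small : ∀ i → Ord i (V i)
    small i = ord-resp (solve (Φ i ∷ Φ⁻ i ∷ Φ (suc i) ∷ []) (λ a b c →
        ((a :* a :- one) :+ (b :* b :- one)) :- (one :+ one) :* (c :* c :- one) := a :* a :+ b :* b :- (one :+ one) :* (c :* c)) ≡.refl)
      (ord-sub (ord-+ (ord-one-* oΦ oΦ) (ord-one-* oΦ⁻ oΦ⁻)) (ord-*ʳ _ (ord-one-* oΦ₁ oΦ₁)))
      where
      oi : Ord i (sq i)
      oi = ord-≤ (ℕₚ.n≤1+n i) (ord-sq i)
      oΦ : Ord i (Φ i - 1#)
      oΦ = θ-one i oi (osq i)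
      oΦ⁻ : Ord i (Φ⁻ i - 1#)
      oΦ⁻ = θ-one i (ord-neg oi) (ord-neg (osq i))
      oΦ₁ : Ord i (Φ (suc i) - 1#)
      oΦ₁ = θ-one i (ord-*ˡ _ oi) (osq (suc i))

  Φ²-Φ⁻² : ∀ i → Φ i * Φ i - Φ⁻ i * Φ⁻ i ≈ (1# + 1#) ^ 3 * sq i * (Ψ (suc (suc i)) * Ψ (suc (suc i)))
  Φ²-Φ⁻² i = linear (((1# + 1#) ^ 3 * sq i) ⊙ ΦΨ (suc (suc i)))
    (elim (Φ i ∷ Φ⁻ i ∷ Φ (suc (suc i)) ∷ sq i ∷ Ψ (suc (suc i)) ∷ Ψ (suc (suc (suc i))) ∷ [])
      (λ a b a₂ y p₂ p → (a ⇒ a₂ :+ (one :+ one) :* y :* p) ∷ (b ⇒ a₂ :- (one :+ one) :* y :* p) ∷ [] ,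
        ((a :* a :- b :* b) :- (one :+ one) :^ 3 :* y :* (p₂ :* p₂) := (one :+ one) :^ 3 :* y :* (a₂ :* p :- p₂ :* p₂)))
      (Φ-split i , Φ⁻-split i , tt) ≡.refl)

-- From odd Durfee symbols to the rank series.

module Sums (K : CommutativeRing 0ℓ 0ℓ) where
  open CommutativeRing K hiding (zero)
  open IntegerSolver K

  sumL : {A : Set} → (A → Carrier) → List A → Carrier
  sumL g [] = 0#
  sumL g (x ∷ xs) = g x + sumL g xs

  sumN : (ℕ → Carrier) → ℕ → Carrier
  sumN h zero = 0#
  sumN h (suc N) = h 0 + sumN (h ∘ suc) N

  sumL-cong : {A : Set} {g h : A → Carrier} → (∀ x → g x ≈ h x) → ∀ xs → sumL g xs ≈ sumL h xs
  sumL-cong e [] = refl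
  sumL-cong e (x ∷ xs) = +-cong (e x) (sumL-cong e xs)

  sumN-cong : ∀ {g h} → (∀ n → g n ≈ h n) → ∀ N → sumN g N ≈ sumN h N
  sumN-cong e zero = refl
  sumN-cong e (suc N) = +-cong (e 0) (sumN-cong (e ∘ suc) N)

  sumL-++ : {A : Set} (g : A → Carrier) → ∀ xs ys → sumL g (xs List.++ ys) ≈ sumL g xs + sumL g ys
  sumL-++ g [] ys = sym (+-identityˡ _)
  sumL-++ g (x ∷ xs) ys = trans (+-congˡ (sumL-++ g xs ys)) (sym (+-assoc _ _ _))

  sumL-concatMap : {A B : Set} (g : B → Carrier) (f : A → List B) → ∀ xs →
                   sumL g (List.concatMap f xs) ≈ sumL (λ x → sumL g (f x)) xs
  sumL-concatMap g f [] = refl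
  sumL-concatMap g f (x ∷ xs) = trans (sumL-++ g (f x) _) (+-congˡ (sumL-concatMap g f xs))

  sumL-map : {A B : Set} (g : B → Carrier) (f : A → B) → ∀ xs → sumL g (List.map f xs) ≈ sumL (g ∘ f) xs
  sumL-map g f [] = refl
  sumL-map g f (x ∷ xs) = +-congˡ (sumL-map g f xs)

  sumL-*ˡ : {A : Set} (g : A → Carrier) → ∀ c xs → sumL (λ x → c * g x) xs ≈ c * sumL g xs
  sumL-*ˡ g c [] = sym (zeroʳ c)
  sumL-*ˡ g c (x ∷ xs) = trans (+-congˡ (sumL-*ˡ g c xs)) (sym (distribˡ _ _ _))

  sumL-*ʳ : {A : Set} (g : A → Carrier) → ∀ c xs → sumL (λ x → g x * c) xs ≈ sumL g xs * c
  sumL-*ʳ g c [] = sym (zeroˡ c)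
  sumL-*ʳ g c (x ∷ xs) = trans (+-congˡ (sumL-*ʳ g c xs)) (sym (distribʳ _ _ _))

  sumL-filter : {A : Set} (g : A → Carrier) (P : A → Bool) → ∀ xs →
                sumL g (List.filterᵇ P xs) ≈ sumL (λ x → if P x then g x else 0#) xs
  sumL-filter g P [] = refl
  sumL-filter g P (x ∷ xs) with P x
  ... | true = +-congˡ (sumL-filter g P xs)
  ... | false = trans (sumL-filter g P xs) (sym (+-identityˡ _))

  sumL-applyUpTo : {A : Set} (g : A → Carrier) (f : ℕ → A) → ∀ N → sumL g (List.applyUpTo f N) ≈ sumN (g ∘ f) N
  sumL-applyUpTo g f zero = refl
  sumL-applyUpTo g f (suc N) = +-congˡ (sumL-applyUpTo g (f ∘ suc) N)

  sumN-last : ∀ h N → sumN h (suc N) ≈ sumN h N + h N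
  sumN-last h zero = +-comm _ _
  sumN-last h (suc N) = trans (+-congˡ (sumN-last (h ∘ suc) N)) (sym (+-assoc _ _ _))

  open PowerSeries K

  opaque
    unfolding _*ˢ_

    *ˢ-sumN : ∀ n f g → (f *ˢ g) n ≈ sumN (λ k → f k * g (n ℕ.∸ k)) (suc n)
    *ˢ-sumN zero f g = sym (+-identityʳ _)
    *ˢ-sumN (suc n) f g = +-congˡ (*ˢ-sumN n (tl f) g)

  module S = Series series

  X^-low : ∀ m f n → n ℕ.< m → (X S.^ m *ˢ f) n ≈ 0#
  X^-low m f n l = below (S.ord-*ˡ f (S.ord-^ m vanish-X)) n l

  X^-high : ∀ m f n → (X S.^ m *ˢ f) (m ℕ.+ n) ≈ f n
  X^-high zero f n = 1*ˢ n f
  X^-high (suc m) f n = trans (at (S.*-assoc X (X S.^ m) f) _) (trans (X*-suc _ _) (X^-high m f n))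

  X^-coeff : ∀ m f n → (X S.^ m *ˢ f) n ≈ (if m ℕ.≤ᵇ n then f (n ℕ.∸ m) else 0#)
  X^-coeff m f n with m ℕ.≤ᵇ n in eq
  ... | true = ≡.subst (λ i → (X S.^ m *ˢ f) i ≈ f (n ℕ.∸ m)) (ℕₚ.m+[n∸m]≡n (ℕₚ.≤ᵇ⇒≤ m n (≡.subst Bool.T (≡.sym eq) tt))) (X^-high m f (n ℕ.∸ m))
  ... | false = X^-low m f n (ℕₚ.≰⇒> (λ l → ≡.subst Bool.T eq (ℕₚ.≤⇒≤ᵇ l)))

  psum-coeff : ∀ t N n → S.psum t N n ≈ sumN (λ k → t k n) N
  psum-coeff t zero n = refl
  psum-coeff t (suc N) n = +-congˡ (psum-coeff (t ∘ suc) N n)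

  sum∞-coeff : ∀ t n → S.sum∞ t n ≈ sumN (λ k → t k n) (suc n)
  sum∞-coeff t n = psum-coeff t (suc n) n

  const-hom : ∀ a b → const a *ˢ const b ≋ const (a * b)
  const-hom a b = pointwise λ { zero → const-* a (const b) 0 ; (suc n) → trans (const-* a (const b) (suc n)) (zeroʳ a) }

  const-one : const 1# ≋ 1ˢ
  const-one = pointwise λ { zero → refl ; (suc n) → refl }

  const-cong : ∀ {a b} → a ≈ b → const a ≋ const b
  const-cong e = pointwise λ { zero → e ; (suc n) → refl }

odd : ∀ D → (2 ℕ.* D ℕ.+ 1) ℕ.% 2 ≡ 1
odd D = ≡.trans (≡.cong (ℕ._% 2) (≡.trans (ℕₚ.+-comm _ 1) (≡.cong (1 ℕ.+_) (ℕₚ.*-comm 2 D)))) (DivMod.[m+kn]%n≡m%n 1 D 2)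

even : ∀ D → suc (2 ℕ.* D ℕ.+ 1) ℕ.% 2 ≡ 0
even D = ≡.trans (≡.cong (λ i → suc i ℕ.% 2) (≡.trans (ℕₚ.+-comm _ 1) (≡.cong (1 ℕ.+_) (ℕₚ.*-comm 2 D)))) (DivMod.[m+kn]%n≡m%n 2 D 2)

step-odd : ∀ D → 2 ℕ.* suc D ℕ.+ 1 ≡ suc (suc (2 ℕ.* D ℕ.+ 1))
step-odd D = ≡.cong (ℕ._+ 1) (≡.cong suc (ℕₚ.+-suc D (D ℕ.+ 0)))

-- Partitions into odd parts at most mx, weighted by z^(number of parts).
module OddPartitions (K : CommutativeRing 0ℓ 0ℓ) (z : CommutativeRing.Carrier K) where
  open CommutativeRing K hiding (zero)
  open RingTools K using (_^_)
  open Sums K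
  open PowerSeries K using (Ser; X; const; 1ˢ; pointwise; at; _≋_; vanish-X; const-*)

  weight : List ℕ → Carrier
  weight l = z ^ List.length l

  W : ℕ → ℕ → ℕ → Carrier
  W f mx t = sumL weight (𝔻.parts f mx t)

  isPart : ℕ → ℕ → Bool
  isPart t p = (p ℕ.% 2 ℕ.≡ᵇ 1) Bool.∧ (p ℕ.≤ᵇ t)

  largest : ℕ → ℕ → ℕ → Carrier
  largest f t p = if isPart t p then z * W f p (t ℕ.∸ p) else 0#

  W-sum : ∀ f mx t → W (suc f) mx (suc t) ≈ sumN (largest f (suc t)) (suc mx)
  W-sum f mx t = trans (sumL-concatMap weight _ (List.filterᵇ (isPart (suc t)) (List.upTo (suc mx))))
    (trans (sumL-cong (λ p → trans (sumL-map weight (p ∷_) (𝔻.parts f p (suc t ℕ.∸ p))) (sumL-*ˡ weight z (𝔻.parts f p (suc t ℕ.∸ p))))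
              (List.filterᵇ (isPart (suc t)) (List.upTo (suc mx))))
    (trans (sumL-filter _ (isPart (suc t)) (List.upTo (suc mx))) (sumL-applyUpTo _ id (suc mx))))

  if-cong : ∀ b {x y : Carrier} → (b ≡ true → x ≈ y) → (if b then x else 0#) ≈ (if b then y else 0#)
  if-cong true e = e ≡.refl
  if-cong false e = refl

  -- Every part is at least 1, so the total that remains falls at least as fast as the fuel.
  W-fuel : ∀ f f' mx t → t ℕ.≤ f → t ℕ.≤ f' → W f mx t ≈ W f' mx t
  W-fuel zero zero mx zero l l' = refl
  W-fuel zero (suc f') mx zero l l' = refl
  W-fuel (suc f) zero mx zero l l' = refl
  W-fuel (suc f) (suc f') mx zero l l' = refl
  W-fuel (suc f) (suc f') mx (suc t) (ℕ.s≤s l) (ℕ.s≤s l') = trans (W-sum f mx t)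
    (trans (sumN-cong same (suc mx)) (sym (W-sum f' mx t)))
    where
    same : ∀ p → largest f (suc t) p ≈ largest f' (suc t) p
    same zero = refl
    same (suc p) = if-cong (isPart (suc t) (suc p)) (λ _ → *-congˡ (W-fuel f f' (suc p) (t ℕ.∸ p)
      (ℕₚ.≤-trans (ℕₚ.m∸n≤m t p) l) (ℕₚ.≤-trans (ℕₚ.m∸n≤m t p) l')))

  T : ℕ → Ser
  T mx t = sumL weight (𝔻.oddPartitionsBounded mx t)

  T-zero : T 0 ≋ 1ˢ
  T-zero = pointwise λ { zero → +-identityʳ _ ; (suc t) → trans (W-sum t 0 t) (+-identityʳ _) }

  -- Sorting by the largest part: the last summand of `W-sum` is the case of largest part mx + 1,
  -- and the other summands make up `T mx`.
  T-step : ∀ mx t → T (suc mx) t ≈ T mx t + (if isPart t (suc mx) then z * T (suc mx) (t ℕ.∸ suc mx) else 0#)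
  T-step mx zero with suc mx ℕ.% 2 ℕ.≡ᵇ 1
  ... | true = sym (+-identityʳ _)
  ... | false = sym (+-identityʳ _)
  T-step mx (suc t) = trans (W-sum t (suc mx) t) (trans (sumN-last (largest t (suc t)) (suc mx))
    (+-cong (sym (W-sum t mx t)) (if-cong (isPart (suc t) (suc mx))
      (λ _ → *-congˡ (W-fuel t (t ℕ.∸ mx) (suc mx) (t ℕ.∸ mx) (ℕₚ.m∸n≤m t mx) ℕₚ.≤-refl)))))

  T-even : ∀ mx → suc mx ℕ.% 2 ≡ 0 → T (suc mx) ≋ T mx
  T-even mx e = pointwise λ t → trans (T-step mx t)
    (trans (+-congˡ (reflexive (≡.cong (λ b → if (b ℕ.≡ᵇ 1) Bool.∧ (suc mx ℕ.≤ᵇ t) then z * T (suc mx) (t ℕ.∸ suc mx) else 0#) e))) (+-identityʳ _))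

  T-odd : ∀ mx → suc mx ℕ.% 2 ≡ 1 → T (suc mx) ≋ T mx S.+ const z S.* X S.^ suc mx S.* T (suc mx)
  T-odd mx e = pointwise λ t → trans (T-step mx t) (+-congˡ (trans
      (reflexive (≡.cong (λ b → if (b ℕ.≡ᵇ 1) Bool.∧ (suc mx ℕ.≤ᵇ t) then z * T (suc mx) (t ℕ.∸ suc mx) else 0#) e))
      (sym (trans (at (S.*-assoc (const z) (X S.^ suc mx) (T (suc mx))) t) (trans (const-* z _ t)
        (trans (*-congˡ (X^-coeff (suc mx) (T (suc mx)) t)) (dist (suc mx ℕ.≤ᵇ t))))))))
    where
    dist : ∀ b {x} → z * (if b then x else 0#) ≈ (if b then z * x else 0#)
    dist true = refl
    dist false = zeroʳ z

  p : Ser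
  p = const z S.* X

  op : S.Ord 1 p
  op = S.ord-*ʳ _ vanish-X

  o2 : S.Ord 1 (X S.^ 2)
  o2 = S.ord-*ˡ _ vanish-X

  power : ∀ D → p S.* (X S.^ 2) S.^ D S.≈ const z S.* X S.^ (2 ℕ.* D ℕ.+ 1)
  power zero = S.solve (const z ∷ X ∷ []) (λ z x → z S.:* x S.:* S.one S.:= z S.:* x S.:^ 1) ≡.refl
  power (suc D) = S.trans
    (S.linear ((X S.^ 2) S.⊙ power D) (S.solve (const z ∷ X ∷ (X S.^ 2) S.^ D ∷ X S.^ (2 ℕ.* D ℕ.+ 1) ∷ []) (λ z x a b →
      z S.:* x S.:* (x S.:^ 2 S.:* a) S.:- z S.:* (x S.:* (x S.:* b)) S.:= x S.:^ 2 S.:* (z S.:* x S.:* a S.:- z S.:* b)) ≡.refl))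
    (S.reflexive (≡.cong (λ i → const z S.* X S.^ i) (≡.sym (step-odd D))))

  T-odd' : ∀ D m → m ≡ 2 ℕ.* D → (S.1# S.- p S.* (X S.^ 2) S.^ D) S.* T (suc m) S.≈ T m
  T-odd' D m e = S.linear (S.1# S.⊙ T-odd m od S.⊞ (S.- T (suc m)) S.⊙ pw)
    (S.solve (p S.* (X S.^ 2) S.^ D ∷ const z S.* X S.^ suc m ∷ T (suc m) ∷ T m ∷ []) (λ a b t u →
      (S.one S.:- a) S.:* t S.:- u S.:= S.one S.:* (t S.:- (u S.:+ b S.:* t)) S.:+ (S.:- t) S.:* (a S.:- b)) ≡.refl)
    where
    sm : suc m ≡ 2 ℕ.* D ℕ.+ 1
    sm = ≡.trans (≡.cong suc e) (ℕₚ.+-comm 1 (2 ℕ.* D))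
    od : suc m ℕ.% 2 ≡ 1
    od = ≡.trans (≡.cong (ℕ._% 2) sm) (odd D)
    pw : p S.* (X S.^ 2) S.^ D S.≈ const z S.* X S.^ suc m
    pw = S.trans (power D) (S.reflexive (≡.cong (λ i → const z S.* X S.^ i) (≡.sym sm)))

  -- This is `T (2 D + 1)` = 1 / (p; q²)_{D+1}, with tails of the infinite product in place of the
  -- inverse. Each step of D passes one even bound, where nothing changes, and one odd bound, which
  -- contributes a factor.
  T-product : ∀ D → T (2 ℕ.* D ℕ.+ 1) S.* S.Pr p (X S.^ 2) 0 S.≈ S.Pr p (X S.^ 2) (suc D)
  T-product zero = S.linear (T 1 S.⊙ S.Pr-step p o2 0 S.⊞ S.Pr p (X S.^ 2) 1 S.⊙ T-odd' 0 0 ≡.refl S.⊞ S.Pr p (X S.^ 2) 1 S.⊙ T-zero)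
    (S.solve (p ∷ T 1 ∷ T 0 ∷ S.Pr p (X S.^ 2) 0 ∷ S.Pr p (X S.^ 2) 1 ∷ []) (λ p t u a b → let open S in
      t :* a :- b := t :* (a :- (one :- p :* one) :* b) :+ (b :* ((one :- p :* one) :* t :- u) :+ b :* (u :- one))) ≡.refl)
  T-product (suc D) = S.cancel-unit (S.ord-*ˡ ((X S.^ 2) S.^ suc D) op)
    (S.linear (a₀ S.⊙ T-odd' (suc D) m' em S.⊞ a₀ S.⊙ T-even m (even D) S.⊞ S.1# S.⊙ T-product D S.⊞ S.1# S.⊙ S.Pr-step p o2 (suc D) S.⊞ c S.⊙ idx)
      (S.solve (y ∷ T (2 ℕ.* suc D ℕ.+ 1) ∷ T (suc m') ∷ T m' ∷ T m ∷ a₀ ∷ a₁ ∷ a₂ ∷ []) (λ y t t' u v a₀ a₁ a₂ → let open S in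
        (one :- y) :* (t :* a₀) :- (one :- y) :* a₂
          := a₀ :* ((one :- y) :* t' :- u) :+ (a₀ :* (u :- v) :+ (one :* (v :* a₀ :- a₁) :+ (one :* (a₁ :- (one :- y) :* a₂) :+ (one :- y) :* a₀ :* (t :- t'))))) ≡.refl))
    where
    m = 2 ℕ.* D ℕ.+ 1
    m' = suc m
    em : m' ≡ 2 ℕ.* suc D
    em = ≡.sym (ℕₚ.suc-injective (≡.trans (ℕₚ.+-comm 1 (2 ℕ.* suc D)) (step-odd D)))
    y = p S.* (X S.^ 2) S.^ suc D
    a₀ = S.Pr p (X S.^ 2) 0
    a₁ = S.Pr p (X S.^ 2) (suc D)
    a₂ = S.Pr p (X S.^ 2) (suc (suc D))
    c = (S.1# S.- y) S.* a₀
    idx : T (2 ℕ.* suc D ℕ.+ 1) S.≈ T (suc m')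
    idx = S.reflexive (≡.cong T (step-odd D))

module RankSeries (K : CommutativeRing 0ℓ 0ℓ) (z z' : CommutativeRing.Carrier K)
                  (zz' : CommutativeRing._≈_ K (CommutativeRing._*_ K z z') (CommutativeRing.1# K)) where
  open CommutativeRing K hiding (zero)
  open RingTools K using (_^_)
  open Sums K
  open PowerSeries K using (Ser; X; const; pointwise; series; vanish-X)
  module Top = OddPartitions K z
  module Bottom = OddPartitions K z'

  cc' : const z S.* const z' S.≈ S.1#
  cc' = S.trans (const-hom z z') (S.trans (const-cong zz') const-one)

  open MockTheta series using (module AtRoot)
  open AtRoot X (const z) (const z') (const z S.* const z) (const z' S.* const z') vanish-X cc' S.refl S.refl public

  rankWeight : 𝔻.OddDurfee → Carrier
  rankWeight s = Top.weight (𝔻.OddDurfee.top s) * Bottom.weight (𝔻.OddDurfee.bottom s)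

  RS : Ser
  RS n = sumL rankWeight (𝔻.oddDurfeeSymbols n)

  TT : ℕ → Ser
  TT D = Top.T (2 ℕ.* D ℕ.+ 1) S.* Bottom.T (2 ℕ.* D ℕ.+ 1)

  term : ℕ → Ser
  term D = X S.^ 𝔻.core D S.* TT D

  withTop : ℕ → ℕ → ℕ → List ℕ → List 𝔻.OddDurfee
  withTop D r k tp = List.map (λ bt → 𝔻.odsym D tp bt) (𝔻.oddPartitionsBounded (2 ℕ.* D ℕ.+ 1) (r ℕ.∸ k))

  withTopSum : ℕ → ℕ → ℕ → List 𝔻.OddDurfee
  withTopSum D r k = List.concatMap (withTop D r k) (𝔻.oddPartitionsBounded (2 ℕ.* D ℕ.+ 1) k)

  symbols : ℕ → ℕ → List 𝔻.OddDurfee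
  symbols D r = List.concatMap (withTopSum D r) (List.upTo (suc r))

  symbols-of-size : ∀ D r → sumL rankWeight (symbols D r) ≈ TT D r
  symbols-of-size D r = trans (sumL-concatMap rankWeight (withTopSum D r) (List.upTo (suc r)))
    (trans (sumL-cong (λ k → trans (sumL-concatMap rankWeight (withTop D r k) (𝔻.oddPartitionsBounded b k))
        (trans (sumL-cong (λ tp → trans (sumL-map rankWeight (𝔻.odsym D tp) (𝔻.oddPartitionsBounded b (r ℕ.∸ k)))
                                         (sumL-*ˡ Bottom.weight (Top.weight tp) (𝔻.oddPartitionsBounded b (r ℕ.∸ k)))) (𝔻.oddPartitionsBounded b k))
          (sumL-*ʳ Top.weight (Bottom.T b (r ℕ.∸ k)) (𝔻.oddPartitionsBounded b k)))) (List.upTo (suc r)))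
      (trans (sumL-applyUpTo _ id (suc r)) (sym (*ˢ-sumN r (Top.T b) (Bottom.T b)))))
    where b = 2 ℕ.* D ℕ.+ 1

  RS-sum : RS S.≈ S.sum∞ term
  RS-sum = pointwise λ n → trans (sumL-concatMap rankWeight (branch n) (List.upTo (suc n)))
    (trans (sumL-cong (λ D → trans (branch-sum D n) (sym (X^-coeff (𝔻.core D) (TT D) n))) (List.upTo (suc n)))
      (trans (sumL-applyUpTo _ id (suc n)) (sym (sum∞-coeff term n))))
    where
    branch : ℕ → ℕ → List 𝔻.OddDurfee
    branch n D = if 𝔻.core D ℕ.≤ᵇ n then symbols D (n ℕ.∸ 𝔻.core D) else []
    branch-sum : ∀ D n → sumL rankWeight (branch n D) ≈ (if 𝔻.core D ℕ.≤ᵇ n then TT D (n ℕ.∸ 𝔻.core D) else 0#)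
    branch-sum D n with 𝔻.core D ℕ.≤ᵇ n
    ... | true = symbols-of-size D (n ℕ.∸ 𝔻.core D)
    ... | false = refl

  core-step : ∀ k → 𝔻.core (suc k) ≡ 𝔻.core k ℕ.+ (4 ℕ.+ (2 ℕ.* k ℕ.+ 2 ℕ.* k))
  core-step k = expanded k
    where
    expanded : ∀ k → 2 ℕ.* suc k ℕ.* suc k ℕ.+ 2 ℕ.* suc k ℕ.+ 1 ≡ 2 ℕ.* k ℕ.* k ℕ.+ 2 ℕ.* k ℕ.+ 1 ℕ.+ (4 ℕ.+ (2 ℕ.* k ℕ.+ 2 ℕ.* k))
    expanded = solve-∀

  core-large : ∀ k → k ℕ.≤ 𝔻.core k
  core-large k = ℕₚ.≤-trans (ℕₚ.m≤m+n k (k ℕ.+ 0)) (ℕₚ.≤-trans (ℕₚ.m≤n+m (2 ℕ.* k) (2 ℕ.* k ℕ.* k)) (ℕₚ.m≤m+n _ 1))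

  X^-square : ∀ k → X S.^ (4 ℕ.+ (2 ℕ.* k ℕ.+ 2 ℕ.* k)) S.≈ w S.^ 2 S.* (w S.^ k) S.^ 2
  X^-square k = S.trans (S.trans (S.^-+ X 4 (2 ℕ.* k ℕ.+ 2 ℕ.* k)) (S.*-congˡ (S.^-+ X (2 ℕ.* k) (2 ℕ.* k))))
    (S.elim (X ∷ w ∷ X S.^ (2 ℕ.* k) ∷ w S.^ k ∷ []) (λ x w a b → let open S in (w ⇒ x :^ 2) ∷ (a ⇒ b) ∷ [] ,
      (x :^ 4 :* (a :* a) := w :^ 2 :* b :^ 2)) (w≈ , S.trans (dbl k) (S.sym (S.^-cong k w≈)) , tt) ≡.refl)
    where
    dbl : ∀ k → X S.^ (2 ℕ.* k) S.≈ (X S.^ 2) S.^ k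
    dbl zero = S.refl
    dbl (suc k) = S.trans (S.reflexive (≡.cong (λ i → X S.* X S.^ i) (ℕₚ.+-suc k (k ℕ.+ 0))))
      (S.elim (X ∷ X S.^ (2 ℕ.* k) ∷ (X S.^ 2) S.^ k ∷ []) (λ x a b → let open S in (a ⇒ b) ∷ [] , (x :* (x :* a) := x :^ 2 :* b)) (dbl k , tt) ≡.refl)

  -- Telescoping with U_k = q^(core k) `hᵣ k`: the factor w^(2k+2) in the recursion of `hᵣ` is
  -- q^(core (k+1) - core k), and the X on the right is q^(core 0).
  rank-series : al 0 S.* be 0 S.* RS S.≈ X S.* hᵣ 0
  rank-series = S.trans (S.*-congˡ RS-sum) (S.trans
      (S.*-sum∞ (al 0 S.* be 0) U term (λ k → S.ord-*ˡ _ (oX k)) (λ k → S.ord-*ˡ _ (oX k)) step)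
      (S.*-congʳ (S.*-identityʳ X)))
    where
    U : ℕ → Ser
    U k = X S.^ 𝔻.core k S.* hᵣ k
    oX : ∀ k → S.Ord k (X S.^ 𝔻.core k)
    oX k = S.ord-≤ (core-large k) (S.ord-^ (𝔻.core k) vanish-X)
    step : ∀ k → U k S.≈ al 0 S.* be 0 S.* term k S.+ U (suc k)
    step k = S.elim (X S.^ 𝔻.core k ∷ X S.^ 𝔻.core (suc k) ∷ hᵣ k ∷ hᵣ (suc k) ∷ w ∷ w S.^ k ∷ Top.T b S.* al 0 ∷ Bottom.T b S.* be 0
                      ∷ al (suc k) ∷ be (suc k) ∷ al 0 S.* be 0 S.* term k ∷ [])
      (λ c c₁ h h₁ w W t t' a b' s → let open S in
        (s ⇒ c :* (t :* t')) ∷ (h ⇒ a :* b' :+ w :^ 2 :* W :^ 2 :* h₁) ∷ (c₁ ⇒ c :* (w :^ 2 :* W :^ 2)) ∷ (t ⇒ a) ∷ (t' ⇒ b') ∷ [] ,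
        (c :* h := s :+ c₁ :* h₁))
      ( S.solve (al 0 ∷ be 0 ∷ X S.^ 𝔻.core k ∷ Top.T b ∷ Bottom.T b ∷ []) (λ a b c t t' → let open S in
          a :* b :* (c :* (t :* t')) := c :* (t :* a :* (t' :* b))) ≡.refl
      , S.twin-step 1 _ _ ow k
      , S.trans (S.trans (S.reflexive (≡.cong (X S.^_) (core-step k))) (S.^-+ X (𝔻.core k) _)) (S.*-congˡ (X^-square k))
      , S.trans (S.*-congˡ (al≈ 0)) (S.trans (Top.T-product k) (S.sym (al≈ (suc k))))
      , S.trans (S.*-congˡ (be≈ 0)) (S.trans (Bottom.T-product k) (S.sym (be≈ (suc k))))
      , tt) ≡.refl
      where b = 2 ℕ.* k ℕ.+ 1

-- The residue of the rank: s - t ≡ s + 7t mod 8.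
module Residues where
  private
    rearrange₁ : ∀ r r' k k' → (+ r ℤ.- + r') ≡ ((+ r ℤ.+ k ℤ.* + 8) ℤ.- (+ r' ℤ.+ k' ℤ.* + 8)) ℤ.+ (k' ℤ.- k) ℤ.* + 8
    rearrange₁ r r' = go (+ r) (+ r')
      where
      go : ∀ a b k k' → (a ℤ.- b) ≡ ((a ℤ.+ k ℤ.* + 8) ℤ.- (b ℤ.+ k' ℤ.* + 8)) ℤ.+ (k' ℤ.- k) ℤ.* + 8
      go = solveℤ

    rearrange₂ : ∀ s t a c Q → (s ℤ.- t) ℤ.- a ≡ ((s ℤ.+ + 7 ℤ.* t) ℤ.- (c ℤ.+ Q ℤ.* + 8)) ℤ.+ ((c ℤ.- a) ℤ.+ (Q ℤ.- t) ℤ.* + 8)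
    rearrange₂ = solveℤ

    rearrange₃ : ∀ c a k → c ℤ.+ k ℤ.* + 8 ≡ a ℤ.+ ((c ℤ.- a) ℤ.+ k ℤ.* + 8)
    rearrange₃ = solveℤ

  -- The difference of the two residues is a multiple of 8 of absolute value below 8.
  unique-residue : ∀ r r' k k' → r ℕ.< 8 → r' ℕ.< 8 → + r ℤ.+ k ℤ.* + 8 ≡ + r' ℤ.+ k' ℤ.* + 8 → r ≡ r'
  unique-residue r r' k k' l l' e = ℤₚ.+-injective (ℤₚ.i-j≡0⇒i≡j (+ r) (+ r') (≡.trans diff (≡.cong (ℤ._* + 8) k≡0)))
    where
    diff : + r ℤ.- + r' ≡ (k' ℤ.- k) ℤ.* + 8
    diff = ≡.trans (rearrange₁ r r' k k') (≡.trans (≡.cong (λ x → (x ℤ.- (+ r' ℤ.+ k' ℤ.* + 8)) ℤ.+ (k' ℤ.- k) ℤ.* + 8) e)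
      (≡.trans (≡.cong (ℤ._+ (k' ℤ.- k) ℤ.* + 8) (ℤₚ.+-inverseʳ (+ r' ℤ.+ k' ℤ.* + 8))) (ℤₚ.+-identityˡ _)))
    small : ℤ.∣ k' ℤ.- k ∣ ℕ.* 8 ℕ.< 8
    small = ℕₚ.≤-<-trans (ℕₚ.≤-reflexive (≡.trans (≡.sym (ℤₚ.abs-* (k' ℤ.- k) (+ 8))) (≡.cong ℤ.∣_∣ (≡.trans (≡.sym diff) (ℤₚ.m-n≡m⊖n r r')))))
      (ℕₚ.≤-<-trans (ℤₚ.∣m⊝n∣≤m⊔n r r') (ℕₚ.⊔-lub l l'))
    k≡0 : k' ℤ.- k ≡ + 0
    k≡0 = ℤₚ.∣i∣≡0⇒i≡0 (zero-of (ℤ.∣ k' ℤ.- k ∣) small)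
      where
      zero-of : ∀ m → m ℕ.* 8 ℕ.< 8 → m ≡ 0
      zero-of zero _ = ≡.refl
      zero-of (suc m) h = ⊥-elim (ℕₚ.<⇒≱ h (ℕₚ.m≤m+n 8 (m ℕ.* 8)))

  residue : ℕ → ℕ → ℕ
  residue s t = (s ℕ.+ 7 ℕ.* t) ℕ.% 8

  residue<8 : ∀ s t → residue s t ℕ.< 8
  residue<8 s t = DivMod.m%n<n (s ℕ.+ 7 ℕ.* t) 8

  rank-residue : ∀ s t a → (+ s ℤ.- + t) ℤ.- + a
                           ≡ (+ residue s t ℤ.- + a) ℤ.+ (+ ((s ℕ.+ 7 ℕ.* t) ℕ./ 8) ℤ.- + t) ℤ.* + 8
  rank-residue s t a = ≡.trans (rearrange₂ (+ s) (+ t) (+ a) (+ residue s t) Q)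
      (≡.trans (≡.cong (λ y → (y ℤ.- (+ residue s t ℤ.+ Q ℤ.* + 8)) ℤ.+ ((+ residue s t ℤ.- + a) ℤ.+ (Q ℤ.- + t) ℤ.* + 8)) n≡)
      (≡.trans (≡.cong (ℤ._+ ((+ residue s t ℤ.- + a) ℤ.+ (Q ℤ.- + t) ℤ.* + 8)) (ℤₚ.+-inverseʳ (+ residue s t ℤ.+ Q ℤ.* + 8))) (ℤₚ.+-identityˡ _)))
    where
    Q = + ((s ℕ.+ 7 ℕ.* t) ℕ./ 8)
    n≡ : + s ℤ.+ + 7 ℤ.* + t ≡ + residue s t ℤ.+ Q ℤ.* + 8
    n≡ = ≡.trans (≡.cong (ℤ._+_ (+ s)) (≡.sym (ℤₚ.pos-* 7 t))) (≡.trans (≡.sym (ℤₚ.pos-+ s (7 ℕ.* t))) (≡.trans (≡.cong +_ (DivMod.m≡m%n+[m/n]*n (s ℕ.+ 7 ℕ.* t) 8))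
      (≡.trans (ℤₚ.pos-+ (residue s t) _) (≡.cong (ℤ._+_ (+ residue s t)) (ℤₚ.pos-* ((s ℕ.+ 7 ℕ.* t) ℕ./ 8) 8)))))

  ≡ᵇ-refl : ∀ n → (n ℕ.≡ᵇ n) ≡ true
  ≡ᵇ-refl zero = ≡.refl
  ≡ᵇ-refl (suc n) = ≡ᵇ-refl n

  ≢⇒≡ᵇ-false : ∀ m n → (m ≡ n → ⊥) → (m ℕ.≡ᵇ n) ≡ false
  ≢⇒≡ᵇ-false zero zero h = ⊥-elim (h ≡.refl)
  ≢⇒≡ᵇ-false zero (suc n) h = ≡.refl
  ≢⇒≡ᵇ-false (suc m) zero h = ≡.refl
  ≢⇒≡ᵇ-false (suc m) (suc n) h = ≢⇒≡ᵇ-false m n (λ e → h (≡.cong suc e))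

  rank-class : ∀ s t a → a ℕ.< 8 → ((((+ s ℤ.- + t) ℤ.- + a) ℤ.%ℕ 8) ℕ.≡ᵇ 0) ≡ (a ℕ.≡ᵇ residue s t)
  rank-class s t a l = go (a ℕₚ.≟ residue s t)
    where
    x = (+ s ℤ.- + t) ℤ.- + a
    k = + ((s ℕ.+ 7 ℕ.* t) ℕ./ 8) ℤ.- + t
    go : Dec (a ≡ residue s t) → ((x ℤ.%ℕ 8) ℕ.≡ᵇ 0) ≡ (a ℕ.≡ᵇ residue s t)
    go (yes e) = ≡.trans (≡.cong (ℕ._≡ᵇ 0) (unique-residue _ 0 (x ℤ./ℕ 8) k (ℤDivMod.n%ℕd<d x 8) (ℕ.s≤s ℕ.z≤n)
        (≡.trans (≡.sym (ℤDivMod.a≡a%ℕn+[a/ℕn]*n x 8)) (≡.trans (rank-residue s t a) (≡.cong (ℤ._+ k ℤ.* + 8)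
          (≡.trans (≡.cong (λ i → + residue s t ℤ.- + i) e) (ℤₚ.+-inverseʳ (+ residue s t))))))))
      (≡.sym (≡.trans (≡.cong (a ℕ.≡ᵇ_) (≡.sym e)) (≡ᵇ-refl a)))
    go (no ne) = ≡.trans (≢⇒≡ᵇ-false (x ℤ.%ℕ 8) 0 (λ r≡0 → ne (≡.sym (unique-residue (residue s t) a k (x ℤ./ℕ 8) (residue<8 s t) l
        (≡.trans (rearrange₃ (+ residue s t) (+ a) k) (≡.cong (ℤ._+_ (+ a)) (≡.trans (≡.sym (rank-residue s t a))
          (≡.trans (ℤDivMod.a≡a%ℕn+[a/ℕn]*n x 8) (≡.trans (≡.cong (λ i → + i ℤ.+ (x ℤ./ℕ 8) ℤ.* + 8) r≡0) (ℤₚ.+-identityˡ ((x ℤ./ℕ 8) ℤ.* + 8)))))))))))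
      (≡.sym (≢⇒≡ᵇ-false a (residue s t) ne))

module RankClasses (K : CommutativeRing 0ℓ 0ℓ) (z z' : CommutativeRing.Carrier K)
                   (zz' : CommutativeRing._≈_ K (CommutativeRing._*_ K z z') (CommutativeRing.1# K))
                   (z⁸ : CommutativeRing._≈_ K (RingTools._^_ K z 8) (CommutativeRing.1# K)) where
  open CommutativeRing K hiding (zero)
  open RingTools K
  open IntegerSolver K
  open Sums K
  open Residues
  open RankSeries K z z' zz'

  z'≈z⁷ : z' ≈ z ^ 7
  z'≈z⁷ = linear ((- z') ⊙ z⁸ ⊞ (z ^ 7) ⊙ zz') (solve (z ∷ z' ∷ []) (λ z z' →
    z' :- z :^ 7 := (:- z') :* (z :^ 8 :- one) :+ z :^ 7 :* (z :* z' :- one)) ≡.refl)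

  z'^ : ∀ t → z' ^ t ≈ z ^ (7 ℕ.* t)
  z'^ zero = refl
  z'^ (suc t) = trans (*-cong z'≈z⁷ (z'^ t)) (trans (sym (^-+ z 7 (7 ℕ.* t))) (reflexive (≡.cong (z ^_) (≡.sym (ℕₚ.*-suc 7 t)))))

  z^8k : ∀ k → z ^ (k ℕ.* 8) ≈ 1#
  z^8k zero = refl
  z^8k (suc k) = trans (^-+ z 8 (k ℕ.* 8)) (trans (*-cong z⁸ (z^8k k)) (*-identityˡ 1#))

  weight-residue : ∀ s t → z ^ s * z' ^ t ≈ z ^ residue s t
  weight-residue s t = trans (*-congˡ (z'^ t)) (trans (sym (^-+ z s (7 ℕ.* t)))
    (trans (reflexive (≡.cong (z ^_) (DivMod.m≡m%n+[m/n]*n (s ℕ.+ 7 ℕ.* t) 8)))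
      (trans (^-+ z (residue s t) _) (trans (*-congˡ (z^8k ((s ℕ.+ 7 ℕ.* t) ℕ./ 8))) (*-identityʳ _)))))

  sumN-cong< : ∀ {g h} N → (∀ n → n ℕ.< N → g n ≈ h n) → sumN g N ≈ sumN h N
  sumN-cong< zero e = refl
  sumN-cong< (suc N) e = +-cong (e 0 (ℕ.s≤s ℕ.z≤n)) (sumN-cong< N (λ n l → e (suc n) (ℕ.s≤s l)))

  sumN-insert : ∀ (k : ℕ → ℕ) (e : ℕ → Carrier) N c → c ℕ.< N →
                sumN (λ a → nat (if a ℕ.≡ᵇ c then suc (k a) else k a) * e a) N ≈ e c + sumN (λ a → nat (k a) * e a) N
  sumN-insert k e (suc N) zero l = solve (nat (k 0) ∷ e 0 ∷ sumN (λ a → nat (k (suc a)) * e (suc a)) N ∷ [])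
    (λ n e s → (one :+ n) :* e :+ s := e :+ (n :* e :+ s)) ≡.refl
  sumN-insert k e (suc N) (suc c) (ℕ.s≤s l) = trans (+-congˡ (sumN-insert (k ∘ suc) (e ∘ suc) N c l))
    (solve (nat (k 0) * e 0 ∷ e (suc c) ∷ sumN (λ a → nat (k (suc a)) * e (suc a)) N ∷ []) (λ x e s → x :+ (e :+ s) := e :+ (x :+ s)) ≡.refl)

  inClass : ℕ → 𝔻.OddDurfee → Bool
  inClass a s = ((𝔻.oddRank s ℤ.- + a) ℤ.%ℕ 8) ℕ.≡ᵇ 0

  count : ℕ → List 𝔻.OddDurfee → ℕ
  count a L = List.length (List.filterᵇ (inClass a) L)

  -- Since z⁸ = 1, the weight z^s z'^t depends only on the residue r of s + 7t; a further symbol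
  -- adds z^r to the sum and 1 to the class r alone.
  classes-of : ∀ L → sumL rankWeight L ≈ sumN (λ a → nat (count a L) * z ^ a) 8
  classes-of [] = sym (trans (sumN-cong< 8 (λ a _ → zeroˡ (z ^ a))) (solve [] (nil :+ (nil :+ (nil :+ (nil :+ (nil :+ (nil :+ (nil :+ (nil :+ nil))))))) := nil) ≡.refl))
  classes-of (s ∷ L) = trans (+-cong (weight-residue (len 𝔻.OddDurfee.top) (len 𝔻.OddDurfee.bottom)) (classes-of L))
    (trans (sym (sumN-insert (λ a → count a L) (z ^_) 8 c (residue<8 (len 𝔻.OddDurfee.top) (len 𝔻.OddDurfee.bottom))))
      (sumN-cong< 8 (λ a l → *-congʳ {z ^ a} (reflexive (≡.cong nat (≡.trans
        (≡.cong (λ b → if b then suc (count a L) else count a L) (≡.sym (rank-class (len 𝔻.OddDurfee.top) (len 𝔻.OddDurfee.bottom) a l)))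
        (count-∷ a)))))))
    where
    len : (𝔻.OddDurfee → List ℕ) → ℕ
    len row = List.length (row s)
    c = residue (len 𝔻.OddDurfee.top) (len 𝔻.OddDurfee.bottom)
    count-∷ : ∀ a → (if inClass a s then suc (count a L) else count a L) ≡ count a (s ∷ L)
    count-∷ a with inClass a s
    ... | true = ≡.refl
    ... | false = ≡.refl

  RS-classes : ∀ n → RS n ≈ sumN (λ a → nat (𝔻.N⁰ (+ a) 8 n) * z ^ a) 8
  RS-classes n = classes-of (𝔻.oddDurfeeSymbols n)

-- Adjunction of the eighth roots of unity.

-- R[√d]
module Quadratic (R : CommutativeRing 0ℓ 0ℓ) (d : CommutativeRing.Carrier R) where
  open CommutativeRing R hiding (zero)
  open IntegerSolver R

  infix 4 _≈²_
  record _≈²_ (x y : Carrier × Carrier) : Set where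
    constructor _&_
    field
      rational : proj₁ x ≈ proj₁ y
      irrational : proj₂ x ≈ proj₂ y
  open _≈²_ public

  infixl 6 _+²_
  infixl 7 _*²_
  _+²_ _*²_ : Carrier × Carrier → Carrier × Carrier → Carrier × Carrier
  (a , b) +² (a' , b') = a + a' , b + b'
  (a , b) *² (a' , b') = a * a' + d * (b * b') , a * b' + b * a'

  quadraticRing : CommutativeRing 0ℓ 0ℓ
  quadraticRing = record
    { Carrier = Carrier × Carrier ; _≈_ = _≈²_ ; _+_ = _+²_ ; _*_ = _*²_ ; -_ = λ (a , b) → - a , - b ; 0# = 0# , 0# ; 1# = 1# , 0#
    ; isCommutativeRing = record
      { isRing = record
        { +-isAbelianGroup = record
          { isGroup = record
            { isMonoid = record
              { isSemigroup = record
                { isMagma = record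
                  { isEquivalence = record
                    { refl = refl & refl
                    ; sym = λ (e & e') → sym e & sym e'
                    ; trans = λ (e & e') (f & f') → trans e f & trans e' f' }
                  ; ∙-cong = λ (e & e') (f & f') → +-cong e f & +-cong e' f' }
                ; assoc = λ _ _ _ → +-assoc _ _ _ & +-assoc _ _ _ }
              ; identity = (λ _ → +-identityˡ _ & +-identityˡ _) , (λ _ → +-identityʳ _ & +-identityʳ _) }
            ; inverse = (λ _ → -‿inverseˡ _ & -‿inverseˡ _) , (λ _ → -‿inverseʳ _ & -‿inverseʳ _)
            ; ⁻¹-cong = λ (e & e') → -‿cong e & -‿cong e' }
          ; comm = λ _ _ → +-comm _ _ & +-comm _ _ }
        ; *-cong = λ (e & e') (f & f') → +-cong (*-cong e f) (*-congˡ (*-cong e' f')) & +-cong (*-cong e f') (*-cong e' f)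
        ; *-assoc = λ (a , b) (a' , b') (a'' , b'') →
            solve (a ∷ b ∷ a' ∷ b' ∷ a'' ∷ b'' ∷ d ∷ []) (λ a b a' b' a'' b'' d →
              (a :* a' :+ d :* (b :* b')) :* a'' :+ d :* ((a :* b' :+ b :* a') :* b'')
                := a :* (a' :* a'' :+ d :* (b' :* b'')) :+ d :* (b :* (a' :* b'' :+ b' :* a''))) ≡.refl
            & solve (a ∷ b ∷ a' ∷ b' ∷ a'' ∷ b'' ∷ d ∷ []) (λ a b a' b' a'' b'' d →
              (a :* a' :+ d :* (b :* b')) :* b'' :+ (a :* b' :+ b :* a') :* a''
                := a :* (a' :* b'' :+ b' :* a'') :+ b :* (a' :* a'' :+ d :* (b' :* b''))) ≡.refl
        ; *-identity = (λ (a , b) → solve (a ∷ b ∷ d ∷ []) (λ a b d → one :* a :+ d :* (nil :* b) := a) ≡.refl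
                                  & solve (a ∷ b ∷ []) (λ a b → one :* b :+ nil :* a := b) ≡.refl)
                     , (λ (a , b) → solve (a ∷ b ∷ d ∷ []) (λ a b d → a :* one :+ d :* (b :* nil) := a) ≡.refl
                                  & solve (a ∷ b ∷ []) (λ a b → a :* nil :+ b :* one := b) ≡.refl)
        ; distrib = (λ (x , y) (a , b) (a' , b') →
                      solve (x ∷ y ∷ a ∷ b ∷ a' ∷ b' ∷ d ∷ []) (λ x y a b a' b' d →
                        x :* (a :+ a') :+ d :* (y :* (b :+ b')) := (x :* a :+ d :* (y :* b)) :+ (x :* a' :+ d :* (y :* b'))) ≡.refl
                      & solve (x ∷ y ∷ a ∷ b ∷ a' ∷ b' ∷ []) (λ x y a b a' b' →
                        x :* (b :+ b') :+ y :* (a :+ a') := (x :* b :+ y :* a) :+ (x :* b' :+ y :* a')) ≡.refl)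
                  , (λ (x , y) (a , b) (a' , b') →
                      solve (x ∷ y ∷ a ∷ b ∷ a' ∷ b' ∷ d ∷ []) (λ x y a b a' b' d →
                        (a :+ a') :* x :+ d :* ((b :+ b') :* y) := (a :* x :+ d :* (b :* y)) :+ (a' :* x :+ d :* (b' :* y))) ≡.refl
                      & solve (x ∷ y ∷ a ∷ b ∷ a' ∷ b' ∷ []) (λ x y a b a' b' →
                        (a :+ a') :* y :+ (b :+ b') :* x := (a :* y :+ b :* x) :+ (a' :* y :+ b' :* x)) ≡.refl) }
      ; *-comm = λ (a , b) (a' , b') →
          solve (a ∷ b ∷ a' ∷ b' ∷ d ∷ []) (λ a b a' b' d → a :* a' :+ d :* (b :* b') := a' :* a :+ d :* (b' :* b)) ≡.refl
          & solve (a ∷ b ∷ a' ∷ b' ∷ []) (λ a b a' b' → a :* b' :+ b :* a' := a' :* b :+ b' :* a) ≡.refl } }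

  lift : Carrier → Carrier × Carrier
  lift a = a , 0#

  √d : Carrier × Carrier
  √d = 0# , 1#

  module Q = CommutativeRing quadraticRing

  √d² : √d Q.* √d Q.≈ lift d
  √d² = solve (d ∷ []) (λ d → nil :* nil :+ d :* (one :* one) := d) ≡.refl & solve [] (nil :* one :+ one :* nil := nil) ≡.refl

  lift-cong : ∀ {a b} → a ≈ b → lift a Q.≈ lift b
  lift-cong e = e & refl

  lift-+ : ∀ a b → lift (a + b) Q.≈ lift a Q.+ lift b
  lift-+ a b = refl & sym (+-identityˡ 0#)

  lift-neg : ∀ a → lift (- a) Q.≈ Q.- lift a
  lift-neg a = refl & solve [] (nil := :- nil) ≡.refl

  lift-* : ∀ a b → lift (a * b) Q.≈ lift a Q.* lift b
  lift-* a b = solve (a ∷ b ∷ d ∷ []) (λ a b d → a :* b := a :* b :+ d :* (nil :* nil)) ≡.refl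
             & solve (a ∷ b ∷ []) (λ a b → nil := a :* nil :+ nil :* b) ≡.refl

  components : ∀ a b → lift a Q.+ √d Q.* lift b Q.≈ (a , b)
  components a b = solve (a ∷ b ∷ d ∷ []) (λ a b d → a :+ (nil :* b :+ d :* (one :* nil)) := a) ≡.refl
                 & solve (b ∷ []) (λ b → nil :+ (nil :* nil :+ one :* b) := b) ≡.refl

record EighthRootExtension (R : CommutativeRing 0ℓ 0ℓ) : Set₁ where
  module R = CommutativeRing R
  field
    K : CommutativeRing 0ℓ 0ℓ
  module K = CommutativeRing K
  field
    emb : R.Carrier → K.Carrier
    emb-cong : ∀ {x y} → x R.≈ y → emb x K.≈ emb y
    emb-+ : ∀ x y → emb (x R.+ y) K.≈ emb x K.+ emb y
    emb-* : ∀ x y → emb (x R.* y) K.≈ emb x K.* emb y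
    emb-neg : ∀ x → emb (R.- x) K.≈ K.- emb x
    emb-0 : emb R.0# K.≈ K.0#
    emb-1 : emb R.1# K.≈ K.1#
    ζ i : K.Carrier
    ζζ : ζ K.* ζ K.≈ i
    ii : i K.* i K.≈ K.- K.1#

  basis : R.Carrier → R.Carrier → R.Carrier → R.Carrier → K.Carrier
  basis x y u v = emb x K.+ ζ K.* emb y K.+ i K.* emb u K.+ ζ K.* i K.* emb v

  field
    independent : ∀ {x y u v x' y' u' v'} → basis x y u v K.≈ basis x' y' u' v' →
                  (x R.≈ x' × y R.≈ y') × (u R.≈ u' × v R.≈ v')

  open RingTools K using (linear; _⊙_; _⊞_)
  open IntegerSolver K

  -- Inverses expressed in the basis: i⁻¹ = -i, and ζ⁻¹ = -ζ³ = -ζ i because ζ⁴ = -1.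
  ζ' i' : K.Carrier
  i' = K.- i
  ζ' = K.- (ζ K.* i)

  ii' : i K.* i' K.≈ K.1#
  ii' = linear ((K.- K.1#) ⊙ ii) (solve (i ∷ []) (λ i → i :* (:- i) :- one := (:- one) :* (i :* i :- (:- one))) ≡.refl)

  ζζ' : ζ K.* ζ' K.≈ K.1#
  ζζ' = linear ((K.- i) ⊙ ζζ ⊞ (K.- K.1#) ⊙ ii) (solve (ζ ∷ i ∷ []) (λ z i →
    z :* (:- (z :* i)) :- one := (:- i) :* (z :* z :- i) :+ (:- one) :* (i :* i :- (:- one))) ≡.refl)

  ζ'ζ' : ζ' K.* ζ' K.≈ i'
  ζ'ζ' = linear ((i K.* i) ⊙ ζζ ⊞ i ⊙ ii) (solve (ζ ∷ i ∷ []) (λ z i →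
    (:- (z :* i)) :* (:- (z :* i)) :- (:- i) := i :* i :* (z :* z :- i) :+ i :* (i :* i :- (:- one))) ≡.refl)

  emb-injective : ∀ {x y} → emb x K.≈ emb y → x R.≈ y
  emb-injective {x} {y} e = proj₁ (proj₁ (independent {y = R.0#} {u = R.0#} {v = R.0#} {y' = R.0#} {u' = R.0#} {v' = R.0#}
    (K.+-congʳ (K.+-congʳ (K.+-congʳ e)))))

-- R[√-1][√√-1]
eighthRoots : (R : CommutativeRing 0ℓ 0ℓ) → EighthRootExtension R
eighthRoots R = record
  { K = K ; emb = emb ; emb-cong = λ e → Q₂.lift-cong (Q₁.lift-cong e)
  ; emb-+ = λ x y → K.trans (Q₂.lift-cong (Q₁.lift-+ x y)) (Q₂.lift-+ (Q₁.lift x) (Q₁.lift y))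
  ; emb-* = λ x y → K.trans (Q₂.lift-cong (Q₁.lift-* x y)) (Q₂.lift-* (Q₁.lift x) (Q₁.lift y))
  ; emb-neg = emb-neg ; emb-0 = K.refl ; emb-1 = K.refl ; ζ = ζ ; i = i ; ζζ = Q₂.√d²
  ; ii = K.trans (K.sym (Q₂.lift-* Q₁.√d Q₁.√d)) (K.trans (Q₂.lift-cong Q₁.√d²) (emb-neg R.1#))
  ; independent = λ {x} {y} {u} {v} {x'} {y'} {u'} {v'} e → extract (K.trans (K.sym (basis≈ x y u v)) (K.trans e (basis≈ x' y' u' v'))) }
  where
  module R = CommutativeRing R
  module Q₁ = Quadratic R (R.- R.1#)
  module Q₂ = Quadratic Q₁.quadraticRing Q₁.√d
  K = Q₂.quadraticRing
  module K = CommutativeRing K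
  open IntegerSolver K
  emb : R.Carrier → K.Carrier
  emb x = Q₂.lift (Q₁.lift x)
  ζ i : K.Carrier
  ζ = Q₂.√d
  i = Q₂.lift Q₁.√d
  emb-neg : ∀ x → emb (R.- x) K.≈ K.- emb x
  emb-neg x = K.trans (Q₂.lift-cong (Q₁.lift-neg x)) (Q₂.lift-neg (Q₁.lift x))
  pair : ∀ a b → emb a K.+ i K.* emb b K.≈ Q₂.lift (a , b)
  pair a b = K.trans (K.+-congˡ (K.sym (Q₂.lift-* Q₁.√d (Q₁.lift b))))
    (K.trans (K.sym (Q₂.lift-+ (Q₁.lift a) _)) (Q₂.lift-cong (Q₁.components a b)))
  basis≈ : ∀ x y u v → emb x K.+ ζ K.* emb y K.+ i K.* emb u K.+ ζ K.* i K.* emb v K.≈ ((x , u) , (y , v))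
  basis≈ x y u v = K.trans
    (solve (emb x ∷ emb y ∷ emb u ∷ emb v ∷ ζ ∷ i ∷ []) (λ x y u v z i →
      x :+ z :* y :+ i :* u :+ z :* i :* v := (x :+ i :* u) :+ z :* (y :+ i :* v)) ≡.refl)
    (K.trans (K.+-cong (pair x u) (K.*-congˡ (pair y v))) (Q₂.components (x , u) (y , v)))
  extract : ∀ {x y u v x' y' u' v'} → ((x , u) , (y , v)) K.≈ ((x' , u') , (y' , v')) → (x R.≈ x' × y R.≈ y') × (u R.≈ u' × v R.≈ v')
  extract ((a Q₁.& b) Q₂.& (c Q₁.& d)) = (a , c) , (b , d)

-- The dilation q ↦ q², the two halves of a series, and change of coefficients.

module Dilation (R : CommutativeRing 0ℓ 0ℓ) where
  open CommutativeRing R hiding (zero)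
  open PowerSeries R
  open IntegerSolver R
  module S = Series series

  D : Ser → Ser
  D f zero = f 0
  D f (suc zero) = 0#
  D f (suc (suc n)) = D (tl f) n

  D-cong : ∀ n {f g} → (∀ i → f i ≈ g i) → D f n ≈ D g n
  D-cong zero e = e 0
  D-cong (suc zero) e = refl
  D-cong (suc (suc n)) e = D-cong n (e ∘ suc)

  D-+ : ∀ n f g → D (f +ˢ g) n ≈ D f n + D g n
  D-+ zero f g = refl
  D-+ (suc zero) f g = sym (+-identityˡ 0#)
  D-+ (suc (suc n)) f g = D-+ n (tl f) (tl g)

  D-neg : ∀ n f → D (-ˢ f) n ≈ - D f n
  D-neg zero f = refl
  D-neg (suc zero) f = solve [] (nil := :- nil) ≡.refl
  D-neg (suc (suc n)) f = D-neg n (tl f)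

  D-scale : ∀ n c f → D (c ·ˢ f) n ≈ c * D f n
  D-scale zero c f = refl
  D-scale (suc zero) c f = sym (zeroʳ c)
  D-scale (suc (suc n)) c f = D-scale n c (tl f)

  opaque
    unfolding _*ˢ_

    D-* : ∀ n f g → D (f *ˢ g) n ≈ (D f *ˢ D g) n
    D-* zero f g = refl
    D-* (suc zero) f g = solve (f 0 ∷ g 0 ∷ []) (λ a b → nil := a :* nil :+ nil :* b) ≡.refl
    D-* (suc (suc n)) f g = trans (D-+ n (f 0 ·ˢ tl g) (tl f *ˢ g))
      (trans (+-cong (D-scale n (f 0) (tl g)) (D-* n (tl f) g))
        (solve (f 0 ∷ D (tl g) n ∷ D g (suc n) ∷ (D (tl f) *ˢ D g) n ∷ []) (λ a b c d → a :* b :+ d := a :* b :+ (nil :* c :+ d)) ≡.refl))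

  D-0 : ∀ n → D 0ˢ n ≈ 0#
  D-0 zero = refl
  D-0 (suc zero) = refl
  D-0 (suc (suc n)) = D-0 n

  D-1 : ∀ n → D 1ˢ n ≈ 1ˢ n
  D-1 zero = refl
  D-1 (suc zero) = refl
  D-1 (suc (suc n)) = D-0 n

  D-vanish : ∀ i n f → Vanish n f → i ℕ.< n → D f i ≈ 0#
  D-vanish zero n f v l = below v 0 l
  D-vanish (suc zero) n f v l = refl
  D-vanish (suc (suc i)) (suc n) f v (ℕ.s≤s l) =
    D-vanish i n (tl f) (vanish λ j l' → below v (suc j) (ℕ.s≤s l')) (ℕₚ.<-trans (ℕₚ.n<1+n i) l)

  dilation : ContinuousHom series series
  dilation = record
    { h = D ; h-cong = λ e → pointwise λ n → D-cong n (at e) ; h-+ = λ f g → pointwise λ n → D-+ n f g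
    ; h-* = λ f g → pointwise λ n → D-* n f g ; h-1 = pointwise D-1 ; h-neg = λ f → pointwise λ n → D-neg n f
    ; h-ord = λ {n} {f} v → vanish λ i l → D-vanish i n f v l }

  D-X : D X ≋ X *ˢ X
  D-X = pointwise λ
    { zero → sym (X*-zero X) ; (suc zero) → sym (X*-suc X 0) ; (suc (suc n)) → trans (D-1 n) (sym (X*-suc X (suc n))) }

  double : ℕ → ℕ
  double zero = zero
  double (suc n) = suc (suc (double n))

  D-even : ∀ n f → D f (double n) ≈ f n
  D-even zero f = refl
  D-even (suc n) f = D-even n (tl f)

  D-odd : ∀ n f → D f (suc (double n)) ≈ 0#
  D-odd zero f = refl
  D-odd (suc n) f = D-odd n (tl f)

  even-part : ∀ f g n → (D f +ˢ X *ˢ D g) (double n) ≈ f n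
  even-part f g n = trans (+-cong (D-even n f) (vanishing n)) (+-identityʳ _)
    where
    vanishing : ∀ n → (X *ˢ D g) (double n) ≈ 0#
    vanishing zero = X*-zero (D g)
    vanishing (suc n) = trans (X*-suc (D g) (suc (double n))) (D-odd n g)

  odd-part : ∀ f g n → (D f +ˢ X *ˢ D g) (suc (double n)) ≈ g n
  odd-part f g n = trans (+-cong (D-odd n f) (trans (X*-suc (D g) (double n)) (D-even n g))) (+-identityˡ _)

module CoefficientHom (R K : CommutativeRing 0ℓ 0ℓ) (e : CommutativeRing.Carrier R → CommutativeRing.Carrier K)
  (e-cong : ∀ {x y} → CommutativeRing._≈_ R x y → CommutativeRing._≈_ K (e x) (e y))
  (e-+ : ∀ x y → CommutativeRing._≈_ K (e (CommutativeRing._+_ R x y)) (CommutativeRing._+_ K (e x) (e y)))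
  (e-* : ∀ x y → CommutativeRing._≈_ K (e (CommutativeRing._*_ R x y)) (CommutativeRing._*_ K (e x) (e y)))
  (e-neg : ∀ x → CommutativeRing._≈_ K (e (CommutativeRing.-_ R x)) (CommutativeRing.-_ K (e x)))
  (e-0 : CommutativeRing._≈_ K (e (CommutativeRing.0# R)) (CommutativeRing.0# K))
  (e-1 : CommutativeRing._≈_ K (e (CommutativeRing.1# R)) (CommutativeRing.1# K)) where
  module R = CommutativeRing R
  module K = CommutativeRing K
  module PR = PowerSeries R
  module PK = PowerSeries K

  ι : PR.Ser → PK.Ser
  ι f n = e (f n)

  opaque
    unfolding PowerSeries._*ˢ_

    ι-* : ∀ n f g → ι (f PR.*ˢ g) n K.≈ (ι f PK.*ˢ ι g) n
    ι-* zero f g = e-* _ _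
    ι-* (suc n) f g = K.trans (e-+ _ _) (K.+-cong (e-* _ _) (ι-* n (PR.tl f) g))

  coefficientHom : ContinuousHom PR.series PK.series
  coefficientHom = record
    { h = ι ; h-cong = λ p → PK.pointwise λ n → e-cong (PR.at p n) ; h-+ = λ f g → PK.pointwise λ n → e-+ _ _
    ; h-* = λ f g → PK.pointwise λ n → ι-* n f g ; h-1 = PK.pointwise λ { zero → e-1 ; (suc n) → e-0 }
    ; h-neg = λ f → PK.pointwise λ n → e-neg _
    ; h-ord = λ v → PK.vanish λ i l → K.trans (e-cong (PR.below v i l)) e-0 }

  ι-X : ι PR.X PK.≋ PK.X
  ι-X = PK.pointwise λ { zero → e-0 ; (suc zero) → e-1 ; (suc (suc n)) → e-0 }

-- The identities at the roots of unity with eta quotients.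

module EtaUnits (S : CompleteRing) (q : CompleteRing.Carrier S) (oq : CompleteRing.Ord S 1 q) where
  open Series S
  open MockQuotients S
  open Eta S q oq public
  open Polynomials commutativeRing (integers commutativeRing) public using (Unit; _⟂_by_; zpow; elimᵘ; unit)

  U : ℕ → Unit
  U i = J i ⟂ recip₁ (J i) by recip₁-law (oJ i)

  pattern -1z = -[1+ 0 ]
  pattern -2z = -[1+ 1 ]
  pattern -3z = -[1+ 2 ]
  pattern -4z = -[1+ 3 ]

  divide : ∀ {x u v w} → x * u ≈ v → u * w ≈ 1# → x ≈ v * w
  divide {x} {u} {v} {w} e i = linear (w ⊙ e ⊞ (- x) ⊙ i)
    (solve (x ∷ u ∷ v ∷ w ∷ []) (λ x u v w → x :- v :* w := w :* (x :* u :- v) :+ (:- x) :* (u :* w :- one)) ≡.refl)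

  fD-u : ∀ i → fD (sq i) ≈ zpow (U (suc i)) (+ 1) * zpow (U i) -1z
  fD-u i = trans (divide (fD-J i) (recip₁-law (oJ i)))
    (solve (J (suc i) ∷ recip₁ (J i) ∷ []) (λ a b → a :* b := a :^ 1 :* b :^ 1) ≡.refl)

  ωD-u : ∀ i → ωD (sq i) ≈ zpow (U i) (+ 1) * zpow (U (suc i)) -1z
  ωD-u i = trans (divide (ωD-J i) (recip₁-law (oJ (suc i))))
    (solve (J i ∷ recip₁ (J (suc i)) ∷ []) (λ a b → a :* b := a :^ 1 :* b :^ 1) ≡.refl)

  νD-u : ∀ i → νD (sq i) ≈ zpow (U (suc i)) (+ 2) * zpow (U i) -1z * zpow (U (suc (suc i))) -1z
  νD-u i = trans (divide (νD-J i) (trans (interchange-* _ _ _ _)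
      (trans (*-cong (recip₁-law (oJ i)) (recip₁-law (oJ (suc (suc i))))) (*-identityˡ 1#))))
    (solve (J (suc i) ∷ recip₁ (J i) ∷ recip₁ (J (suc (suc i))) ∷ []) (λ a b c → a :* a :* (b :* c) := a :^ 2 :* b :^ 1 :* c :^ 1) ≡.refl)

  us : Vec Unit 9
  us = U 0 ∷ U 1 ∷ U 2 ∷ U 3 ∷ U 4 ∷ U 5 ∷ U 6 ∷ U 7 ∷ U 8 ∷ []

  pattern 0f = zero
  pattern 1f = suc 0f
  pattern 2f = suc 1f
  pattern 3f = suc 2f
  pattern 4f = suc 3f
  pattern 5f = suc 4f

module RootIdentities (S : CompleteRing) (q : CompleteRing.Carrier S) (oq : CompleteRing.Ord S 1 q) where
  open Series S
  open MockQuotients S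
  open EtaUnits S q oq

  q^2≈ : q ^ 2 ≈ sq 1
  q^2≈ = solve (q ∷ []) (λ q → q :^ 2 := q :* q) ≡.refl
  q^4≈ : q ^ 4 ≈ sq 2
  q^4≈ = solve (q ∷ []) (λ q → q :^ 4 := q :* q :* (q :* q)) ≡.refl
  q^8≈ : q ^ 8 ≈ sq 3
  q^8≈ = solve (q ∷ []) (λ q → let z = q :* q ; y = z :* z in q :^ 8 := y :* y) ≡.refl

  o2 : Ord 1 (q ^ 2)
  o2 = ord-*ˡ _ oq
  o4 : Ord 1 (q ^ 4)
  o4 = ord-*ˡ _ oq
  o8 : Ord 1 (q ^ 8)
  o8 = ord-*ˡ _ oq

  HV : Carrier
  HV = Pr (q ^ 8) (q ^ 8) 0 * (Pr (q ^ 4) (q ^ 8) 0 * Pr (q ^ 4) (q ^ 8) 0) * νD (q ^ 2)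

  HV-u : HV ≈ zpow (U 2) (+ 4) * zpow (U 1) -1z * zpow (U 3) -2z
  HV-u = elimᵘ us (Pr (q ^ 8) (q ^ 8) 0 ∷ Pr (q ^ 4) (q ^ 8) 0 ∷ νD (q ^ 2) ∷ [])
    (λ a b c → (a ⇒ unit 3f (+ 1)) ∷ (b ⇒ unit 2f (+ 1) :* unit 3f -1z) ∷ (c ⇒ unit 2f (+ 2) :* unit 1f -1z :* unit 3f -1z) ∷ [] ,
      (a :* (b :* b) :* c := unit 2f (+ 4) :* unit 1f -1z :* unit 3f -2z))
    ( trans (Pr-cong o8 q^8≈ q^8≈ 0) (sym (*-identityʳ _))
    , trans (Pr-cong o8 q^4≈ q^8≈ 0) (ωD-u 2)
    , trans (Pr-cong (ord-*ˡ _ o2) (-‿cong q^2≈) (*-cong q^2≈ q^2≈) 0) (νD-u 1) , tt) ≡.refl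

  νD≈ωD : ∀ x → Ord 1 x → ωD (- x) ≈ νD x
  νD≈ωD x o = Pr-cong (ord-*ˡ _ (ord-neg o)) refl (solve (x ∷ []) (λ x → (:- x) :* (:- x) := x :* x) ≡.refl) 0

  module Sign (ε : Carrier) (εε : ε * ε ≈ 1#) (hH : AtSign.H q ε oq εε ≈ HV) where
    module A = AtSign q ε oq εε

    -- The comparison of the values of H at z = ε and z = i, divided by the two squared denominators
    -- that are the same for both signs. The one at εq stays until ε is fixed, since it is a
    -- different eta quotient for each sign.
    sign-identity : ((ε * q + ε * q) * ω (ε * q) + f (sq 3) + (ε * q + ε * q) * (q ^ 2 * ω (- sq 2))) * (ωD (ε * q) * ωD (ε * q))
                    ≈ zpow (U 2) (+ 6) * zpow (U 1) -1z * zpow (U 3) -4z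
    sign-identity = linear ((zpow (U 2) (+ 2) * zpow (U 3) -2z) ⊙ trans (sym A.at-sign) hH)
      (elimᵘ us (ε * q ∷ q ∷ ω (ε * q) ∷ f (sq 3) ∷ ω (- sq 2) ∷ ωD (ε * q) ∷ ωS (ε * q) ∷ fD (q ^ 8) ∷ fS (q ^ 8) ∷ ωD (- (q ^ 4)) ∷ ωS (- (q ^ 4)) ∷ HV ∷ [])
        (λ e q w f w₄ a ws g fs d ws₄ h →
          (ws ⇒ w :* (a :* a)) ∷ (fs ⇒ f :* (g :* g)) ∷ (ws₄ ⇒ w₄ :* (d :* d)) ∷ (h ⇒ unit 2f (+ 4) :* unit 1f -1z :* unit 3f -2z)
            ∷ (g ⇒ unit 4f (+ 1) :* unit 3f -1z) ∷ (d ⇒ unit 3f (+ 2) :* unit 2f -1z :* unit 4f -1z) ∷ [] ,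
          (((e :+ e) :* w :+ f :+ (e :+ e) :* (q :^ 2 :* w₄)) :* (a :* a) :- unit 2f (+ 6) :* unit 1f -1z :* unit 3f -4z
            := unit 2f (+ 2) :* unit 3f -2z
               :* (((e :+ e) :* ws :* (g :* g) :* (d :* d) :+ fs :* (d :* d) :* (a :* a) :+ (e :+ e) :* (q :^ 2 :* ws₄) :* (g :* g) :* (a :* a)) :- h)))
        ( sym (ω-law (ord-*ʳ ε oq))
        , trans (sym (f-law o8)) (*-congʳ (f-cong o8 q^8≈))
        , trans (sym (ω-law (ord-neg o4))) (*-congʳ (ω-cong (ord-neg o4) (-‿cong q^4≈)))
        , HV-u
        , trans (Pr-cong o8 (-‿cong q^8≈) q^8≈ 0) (fD-u 3)
        , trans (νD≈ωD (q ^ 4) o4) (trans (Pr-cong (ord-*ˡ _ o4) (-‿cong q^4≈) (*-cong q^4≈ q^4≈) 0) (νD-u 2))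
        , tt) ≡.refl)

  module I (i i' : Carrier) (ii' : i * i' ≈ 1#) (ii : i * i ≈ - 1#) (i'≈ : i' ≈ - i) where
    module A = AtI q i i' oq ii' ii i'≈

    i-identity : ∀ RS → A.al 0 * A.be 0 * RS ≈ q * A.hᵣ 0 → RS ≈ q * ν (sq 1)
    i-identity RS e = trans (cancel-unit {z = 1# - νD (q ^ 2)} (oνD o2)
        (linear (1# ⊙ e ⊞ (- RS) ⊙ A.albe 0 ⊞ q ⊙ A.r-value ⊞ (- q) ⊙ ν-law o2)
          (solve (νD (q ^ 2) ∷ RS ∷ q ∷ ν (q ^ 2) ∷ A.al 0 * A.be 0 ∷ A.hᵣ 0 ∷ νS (q ^ 2) ∷ []) (λ d r q n a h s →
            (one :- (one :- d)) :* r :- (one :- (one :- d)) :* (q :* n)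
              := one :* (a :* r :- q :* h) :+ ((:- r) :* (a :- d) :+ (q :* (h :- s) :+ (:- q) :* (n :* d :- s)))) ≡.refl)))
      (*-congˡ (ν-cong o2 q^2≈))

  module Zeta (ζ ζ' i i' : Carrier) (ζζ' : ζ * ζ' ≈ 1#) (ζζ : ζ * ζ ≈ i) (ζ'ζ' : ζ' * ζ' ≈ i') (ii : i * i ≈ - 1#) (i'≈ : i' ≈ - i)
              (hH : AtZeta.H q ζ ζ' i i' oq ζζ' ζζ ζ'ζ' ii i'≈ ≈ HV) where
    module A = AtZeta q ζ ζ' i i' oq ζζ' ζζ ζ'ζ' ii i'≈

    s : Carrier
    s = ζ + ζ'

    -- The obstacle is the factor `al 0 * be 0` with ζ in it. Multiplication by `J 1 * conj` turns
    -- it into an eta quotient on one side and brings the two theta series of `conj-theta` to the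
    -- other; the second carries s = ζ + ζ', which yields the two terms on the right.
    zeta-identity : ∀ RS → A.al 0 * A.be 0 * RS ≈ q * A.hᵣ 0 →
      s * RS + φ (sq 3) + s * (q ^ 3 * ν (sq 3))
        ≈ zpow (U 2) (+ 5) * zpow (U 4) (+ 2) * zpow (U 1) -2z * zpow (U 3) -3z * zpow (U 5) -1z
          + s * (q * (zpow (U 2) (+ 5) * zpow (U 5) (+ 1) * zpow (U 1) -2z * zpow (U 3) -2z * zpow (U 4) -1z))
    zeta-identity RS e = linear ((zpow (U 2) (+ 1) * zpow (U 1) -1z * zpow (U 3) -1z) ⊙ product)
      (elimᵘ us (q ∷ s ∷ s * RS + φ (sq 3) + s * (q ^ 3 * ν (sq 3)) ∷ J 1 ∷ E ∷ φD (q ^ 8) ∷ νD (q ^ 8) ∷ HV ∷ Φ⁻' ∷ Ψ⁻' ∷ [])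
        (λ q s g j e f n h Φ Ψ →
          (j ⇒ unit 1f (+ 1)) ∷ (e ⇒ unit 3f (+ 2) :* unit 2f -1z :* unit 4f -1z) ∷ (f ⇒ unit 5f (+ 1) :* unit 4f -1z)
            ∷ (n ⇒ unit 4f (+ 2) :* unit 3f -1z :* unit 5f -1z) ∷ (h ⇒ unit 2f (+ 4) :* unit 1f -1z :* unit 3f -2z)
            ∷ (Φ ⇒ unit 5f (+ 1) :* (unit 4f (+ 1) :* unit 5f -1z) :* (unit 4f (+ 1) :* unit 5f -1z))
            ∷ (Ψ ⇒ unit 5f (+ 1) :* (unit 3f (+ 1) :* unit 4f -1z)) ∷ [] ,
          (g :- (unit 2f (+ 5) :* unit 4f (+ 2) :* unit 1f -2z :* unit 3f -3z :* unit 5f -1z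
              :+ s :* (q :* (unit 2f (+ 5) :* unit 5f (+ 1) :* unit 1f -2z :* unit 3f -2z :* unit 4f -1z)))
            := unit 2f (+ 1) :* unit 1f -1z :* unit 3f -1z :* (j :* e :* f :* n :* g :- (Φ :+ s :* q :* Ψ) :* h)))
        ( sym (*-identityʳ _)
        , trans (Pr-cong o8 (-‿cong q^4≈) (trans q^8≈ refl) 0) (νD-u 2)
        , trans (Pr-cong (ord-*ˡ _ o8) (-‿cong (*-cong q^8≈ q^8≈)) (*-cong q^8≈ q^8≈) 0) (fD-u 4)
        , trans (Pr-cong (ord-*ˡ _ o8) (-‿cong q^8≈) (*-cong q^8≈ q^8≈) 0) (νD-u 3)
        , HV-u
        , trans (Φ⁻-J 4) (*-cong (*-cong (sym (*-identityʳ _)) (ωD-u 4)) (ωD-u 4))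
        , trans (Ψ⁻-J 3) (*-cong (sym (*-identityʳ _)) (ωD-u 3))
        , tt) ≡.refl)
      where
      E = Pr (- (q ^ 4)) (q ^ 8) 0
      Φ⁻' = Φ⁻ 4
      Ψ⁻' = Ψ⁻ 3
      a = A.al 0 * A.be 0
      G = s * RS + φ (sq 3) + s * (q ^ 3 * ν (sq 3))
      q^16≈ : - (q ^ 16) ≈ - sq 4
      q^16≈ = -‿cong (solve (q ∷ []) (λ q → let z = q :* q ; y = z :* z ; x = y :* y in q :^ 16 := x :* x) ≡.refl)
      q^32≈ : q ^ 32 ≈ sq 5
      q^32≈ = solve (q ∷ []) (λ q → let z = q :* q ; y = z :* z ; x = y :* y ; t = x :* x in q :^ 32 := t :* t) ≡.refl
      q^24≈ : - (q ^ 24) ≈ - (sq 3 * sq 4)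
      q^24≈ = -‿cong (solve (q ∷ []) (λ q → let z = q :* q ; y = z :* z ; x = y :* y in q :^ 24 := x :* (x :* x)) ≡.refl)
      thetas : J 1 * A.conj ≈ Φ⁻' + s * q * Ψ⁻'
      thetas = trans (*-congʳ (sym (Pr-cong o2 q^2≈ q^2≈ 0))) (trans A.conj-theta
        (+-cong (+-congʳ (+-cong (θ⁺-cong (ord-neg o16) q^16≈ q^32≈ 0) (θ⁺-cong (ord-neg o16) q^16≈ q^32≈ 0)))
          (*-congˡ (+-congʳ (+-cong (θ⁺-cong (ord-neg o8) (-‿cong q^8≈) q^32≈ 0) (θ⁺-cong (ord-neg o24) q^24≈ q^32≈ 0))))))
        where
        o16 : Ord 1 (q ^ 16)
        o16 = ord-*ˡ _ oq
        o24 : Ord 1 (q ^ 24)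
        o24 = ord-*ˡ _ oq
      cleared : φD (q ^ 8) * νD (q ^ 8) * a * G ≈ HV
      cleared = linear ((s * φD (q ^ 8) * νD (q ^ 8)) ⊙ e ⊞ (- 1#) ⊙ A.at-zeta ⊞ 1# ⊙ hH)
        (elim (q ∷ ζ ∷ ζ' ∷ RS ∷ a ∷ A.hᵣ 0 ∷ φD (q ^ 8) ∷ νD (q ^ 8) ∷ φ (sq 3) ∷ ν (sq 3) ∷ φS (q ^ 8) ∷ νS (q ^ 8) ∷ A.H ∷ HV ∷ [])
          (λ q z z' r a h f n φ ν fs ns H V → let s = z :+ z' in
            (fs ⇒ φ :* f) ∷ (ns ⇒ ν :* n) ∷ [] ,
            (f :* n :* a :* (s :* r :+ φ :+ s :* (q :^ 3 :* ν)) :- V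
              := s :* f :* n :* (a :* r :- q :* h)
                 :+ ((:- one) :* (H :- ((z :* q :+ z' :* q) :* h :* f :* n :+ fs :* n :* a :+ (z :* q :+ z' :* q) :* (q :^ 2 :* ns) :* f :* a))
                 :+ one :* (H :- V))))
          ( trans (sym (φ-law o8)) (*-congʳ (φ-cong o8 q^8≈)) , trans (sym (ν-law o8)) (*-congʳ (ν-cong o8 q^8≈)) , tt) ≡.refl)
      product : J 1 * E * φD (q ^ 8) * νD (q ^ 8) * G ≈ (Φ⁻' + s * q * Ψ⁻') * HV
      product = linear ((- (J 1 * φD (q ^ 8) * νD (q ^ 8) * G)) ⊙ A.conj-product ⊞ (J 1 * A.conj) ⊙ cleared ⊞ HV ⊙ thetas)
        (solve (J 1 ∷ E ∷ φD (q ^ 8) ∷ νD (q ^ 8) ∷ G ∷ Φ⁻' + s * q * Ψ⁻' ∷ HV ∷ a ∷ A.conj ∷ []) (λ j e f n g t h a c →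
          j :* e :* f :* n :* g :- t :* h
            := (:- (j :* f :* n :* g)) :* (a :* c :- e) :+ (j :* c :* (f :* n :* a :* g :- h) :+ h :* (j :* c :- t))) ≡.refl)

-- Linear relations between the eight rank classes.

module RankIdentities (R : CommutativeRing 0ℓ 0ℓ) (extension : EighthRootExtension R) where
  open EighthRootExtension extension
  module PR = PowerSeries R
  module PK = PowerSeries K
  module SR = Series PR.series
  module SK = Series PK.series
  module TR = RingTools R
  module TK = RingTools K
  open CoefficientHom R K emb emb-cong emb-+ emb-* emb-neg emb-0 emb-1 using (ι; coefficientHom; ι-X)
  open ContinuousHom coefficientHom using (h-+; h-*; h-^; h-neg; h-recip₁)
  open MockHom coefficientHom using (h-ω; h-f; h-φ; h-ν; h-Pr')
  module MR = MockQuotients PR.series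
  module MK = MockQuotients PK.series
  module ER = EtaUnits PR.series PR.X PR.vanish-X
  module EK = EtaUnits PK.series PK.X PK.vanish-X
  module RI = RootIdentities PK.series PK.X PK.vanish-X

  A : ℕ → PR.Ser
  A a n = TR.nat (𝔻.N⁰ (+ a) 8 n)

  ι-injective : ∀ {f g} → ι f SK.≈ ι g → f SR.≈ g
  ι-injective e = PR.pointwise λ n → emb-injective (PK.at e n)

  ι-sq : ∀ i → ι (ER.sq i) SK.≈ EK.sq i
  ι-sq zero = ι-X
  ι-sq (suc i) = SK.trans (h-* (ER.sq i) (ER.sq i)) (SK.*-cong (ι-sq i) (ι-sq i))

  ι-J : ∀ i → ι (ER.J i) SK.≈ EK.J i
  ι-J i = h-Pr' (ER.osq i) (ι-sq i) (ι-sq i) 0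

  ι-zpow : ∀ i z → ι (ER.zpow (ER.U i) z) SK.≈ EK.zpow (EK.U i) z
  ι-zpow i (+ n) = SK.trans (h-^ _ n) (SK.^-cong n (ι-J i))
  ι-zpow i -[1+ n ] = SK.trans (h-^ _ (suc n)) (SK.^-cong (suc n) (SK.trans (h-recip₁ (ER.oJ i))
    (MK.recip₁-cong (SK.ord-resp (SK.trans (ContinuousHom.h-sub coefficientHom _ _) (SK.+-congʳ (ContinuousHom.h-1 coefficientHom)))
      (ContinuousHom.h-ord coefficientHom (ER.oJ i))) (ι-J i))))

  ι-const : ∀ e → ι (PR.const e) SK.≈ PK.const (emb e)
  ι-const e = PK.pointwise λ { zero → K.refl ; (suc n) → emb-0 }

  emb-nat : ∀ k → emb (TR.nat k) K.≈ TK.nat k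
  emb-nat zero = emb-0
  emb-nat (suc k) = K.trans (emb-+ R.1# (TR.nat k)) (K.+-cong emb-1 (emb-nat k))

  open Sums K using (const-hom; const-one; const-cong)

  module AtSigns (e : R.Carrier) (ee : e R.* e R.≈ R.1#) where
    e⁸ : e TR.^ 8 R.≈ R.1#
    e⁸ = TR.linear (((e TR.^ 4 R.+ R.1#) R.* (e TR.^ 2 R.+ R.1#)) TR.⊙ ee) (I.solve (e ∷ []) (λ e →
      e I.:^ 8 I.:- I.one I.:= (e I.:^ 4 I.:+ I.one) I.:* (e I.:^ 2 I.:+ I.one) I.:* (e I.:* e I.:- I.one)) ≡.refl)
      where module I = IntegerSolver R

    module C = RankClasses R e e ee e⁸
    open RankSeries R e e ee using (RS; rank-series) public

    p : PR.Ser
    p = PR.const e SR.* PR.X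

    op : SR.Ord 1 p
    op = SR.ord-*ʳ _ PR.vanish-X

    RS≈ω : RS SR.≈ PR.X SR.* MR.ω p
    RS≈ω = SR.cancel-square (MR.oωD op) (SR.linear (SR.1# SR.⊙ rank-series SR.⊞ (SR.- PR.X) SR.⊙ MR.ω-law op)
      (SR.solve (MR.ωD p ∷ RS ∷ PR.X ∷ MR.ω p ∷ MR.ωS p ∷ []) (λ d r x w s → let open SR in
        d :* d :* r :- d :* d :* (x :* w) := one :* (d :* d :* r :- x :* s) :+ (:- x) :* (w :* (d :* d) :- s)) ≡.refl))

    e' : K.Carrier
    e' = emb e

    e'e' : e' K.* e' K.≈ K.1#
    e'e' = K.trans (K.sym (emb-* e e)) (K.trans (emb-cong ee) emb-1)

    cc : PK.const e' SK.* PK.const e' SK.≈ SK.1#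
    cc = SK.trans (const-hom e' e') (SK.trans (const-cong e'e') const-one)

  ci ci' cζ cζ' : PK.Ser
  ci = PK.const i
  ci' = PK.const i'
  cζ = PK.const ζ
  cζ' = PK.const ζ'

  cii' : ci SK.* ci' SK.≈ SK.1#
  cii' = SK.trans (const-hom i i') (SK.trans (const-cong ii') const-one)

  c-neg : ∀ x → PK.const (K.- x) SK.≈ SK.- PK.const x
  c-neg x = PK.pointwise λ { zero → K.refl ; (suc n) → K.sym (RingProperties.-0#≈0# K.ring) }

  cii : ci SK.* ci SK.≈ SK.- SK.1#
  cii = SK.trans (const-hom i i) (SK.trans (const-cong ii) (SK.trans (c-neg K.1#) (SK.-‿cong const-one)))

  module AI = RI.I ci ci' cii' cii (c-neg i)

  -- Constancy in z reduces every evaluation to the one at z = i, the only one that is summed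
  -- directly.
  H≈HV : ∀ z z' (e : z K.* z' K.≈ K.1#) → Evaluation.U.H K z z' e SK.≈ RI.HV
  H≈HV z z' e = SK.trans (Constancy.evaluations-agree K z z' e i i' ii') AI.A.H-value

  module SignIdentity (e : R.Carrier) (ee : e R.* e R.≈ R.1#) where
    open AtSigns e ee

    module Σ± = RI.Sign (PK.const e') cc (H≈HV e' e' e'e')

    -- The coefficients lie in R, but the argument passes through z = i; it is carried out over K
    -- and brought back by injectivity of the embedding.
    sign-identity : ((p SR.+ p) SR.* MR.ω p SR.+ MR.f (ER.sq 3) SR.+ (p SR.+ p) SR.* (PR.X SR.^ 2 SR.* MR.ω (SR.- ER.sq 2)))
                      SR.* (MR.ωD p SR.* MR.ωD p)
                    SR.≈ ER.zpow (ER.U 2) (+ 6) SR.* ER.zpow (ER.U 1) ER.-1z SR.* ER.zpow (ER.U 3) ER.-4z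
    sign-identity = ι-injective (SK.trans
      (SK.trans (h-* _ _) (SK.*-cong (SK.trans (h-+ _ _) (SK.+-cong (SK.trans (h-+ _ _) (SK.+-cong (SK.trans (h-* _ _) (SK.*-cong pp ωp)) f8))
          (SK.trans (h-* _ _) (SK.*-cong pp (SK.trans (h-* _ _) (SK.*-cong (SK.trans (h-^ PR.X 2) (SK.^-cong 2 ι-X)) ω4))))))
        (SK.trans (h-* _ _) (SK.*-cong dp dp))))
      (SK.trans Σ±.sign-identity (SK.sym (SK.trans (h-* _ _) (SK.*-cong (SK.trans (h-* _ _) (SK.*-cong (ι-zpow 2 (+ 6)) (ι-zpow 1 ER.-1z))) (ι-zpow 3 ER.-4z))))))
      where
      ιp : ι p SK.≈ PK.const e' SK.* PK.X
      ιp = SK.trans (h-* _ _) (SK.*-cong (ι-const e) ι-X)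
      oιp : SK.Ord 1 (ι p)
      oιp = ContinuousHom.h-ord coefficientHom op
      pp : ι (p SR.+ p) SK.≈ PK.const e' SK.* PK.X SK.+ PK.const e' SK.* PK.X
      pp = SK.trans (h-+ p p) (SK.+-cong ιp ιp)
      ωp : ι (MR.ω p) SK.≈ MK.ω (PK.const e' SK.* PK.X)
      ωp = SK.trans (h-ω op) (MK.ω-cong oιp ιp)
      f8 : ι (MR.f (ER.sq 3)) SK.≈ MK.f (EK.sq 3)
      f8 = SK.trans (h-f (ER.osq 3)) (MK.f-cong (ContinuousHom.h-ord coefficientHom (ER.osq 3)) (ι-sq 3))
      ω4 : ι (MR.ω (SR.- ER.sq 2)) SK.≈ MK.ω (SK.- EK.sq 2)
      ω4 = SK.trans (h-ω (SR.ord-neg (ER.osq 2))) (MK.ω-cong (ContinuousHom.h-ord coefficientHom (SR.ord-neg (ER.osq 2)))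
        (SK.trans (h-neg _) (SK.-‿cong (ι-sq 2))))
      dp : ι (MR.ωD p) SK.≈ MK.ωD (PK.const e' SK.* PK.X)
      dp = h-Pr' (SR.ord-*ˡ _ op) ιp (SK.trans (h-* p p) (SK.*-cong ιp ιp)) 0

  rank-sum : A 0 SR.+ A 1 SR.+ A 2 SR.+ A 3 SR.+ A 4 SR.+ A 5 SR.+ A 6 SR.+ A 7 SR.≈ PR.X SR.* MR.ω (PR.const R.1# SR.* PR.X)
  rank-sum = SR.trans (PR.pointwise λ n → R.sym (R.trans (C.RS-classes n)
      (I.solve (A 0 n ∷ A 1 n ∷ A 2 n ∷ A 3 n ∷ A 4 n ∷ A 5 n ∷ A 6 n ∷ A 7 n ∷ []) (λ a b c d e f g h → let open I ; z = one in
        a :* z :^ 0 :+ (b :* z :^ 1 :+ (c :* z :^ 2 :+ (d :* z :^ 3 :+ (e :* z :^ 4 :+ (f :* z :^ 5 :+ (g :* z :^ 6 :+ (h :* z :^ 7 :+ nil)))))))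
          := a :+ b :+ c :+ d :+ e :+ f :+ g :+ h) ≡.refl))) RS≈ω
    where
    open AtSigns R.1# (R.*-identityˡ R.1#)
    module I = IntegerSolver R

  [-1]² : (R.- R.1#) R.* (R.- R.1#) R.≈ R.1#
  [-1]² = solve [] ((:- one) :* (:- one) := one) ≡.refl
    where open IntegerSolver R

  rank-alternating : A 0 SR.- A 1 SR.+ A 2 SR.- A 3 SR.+ A 4 SR.- A 5 SR.+ A 6 SR.- A 7 SR.≈ PR.X SR.* MR.ω (PR.const (R.- R.1#) SR.* PR.X)
  rank-alternating = SR.trans (PR.pointwise λ n → R.sym (R.trans (C.RS-classes n)
      (I.solve (A 0 n ∷ A 1 n ∷ A 2 n ∷ A 3 n ∷ A 4 n ∷ A 5 n ∷ A 6 n ∷ A 7 n ∷ []) (λ a b c d e f g h → let open I ; z = :- one in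
        a :* z :^ 0 :+ (b :* z :^ 1 :+ (c :* z :^ 2 :+ (d :* z :^ 3 :+ (e :* z :^ 4 :+ (f :* z :^ 5 :+ (g :* z :^ 6 :+ (h :* z :^ 7 :+ nil)))))))
          := a :- b :+ c :- d :+ e :- f :+ g :- h) ≡.refl))) RS≈ω
    where
    open AtSigns (R.- R.1#) [-1]²
    module I = IntegerSolver R

  module IK = IntegerSolver K

  i⁴ : i TK.^ 4 K.≈ K.1#
  i⁴ = TK.linear ((i K.* i K.- K.1#) TK.⊙ ii) (IK.solve (i ∷ []) (λ i → let open IK in
    i :^ 4 :- one := (i :* i :- one) :* (i :* i :- (:- one))) ≡.refl)

  i⁸ : i TK.^ 8 K.≈ K.1#
  i⁸ = TK.linear ((i TK.^ 4 K.+ K.1#) TK.⊙ i⁴) (IK.solve (i ∷ []) (λ i → let open IK in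
    i :^ 8 :- one := (i :^ 4 :+ one) :* (i :^ 4 :- one)) ≡.refl)

  ζ⁴ : ζ TK.^ 4 K.≈ K.- K.1#
  ζ⁴ = TK.linear ((ζ K.* ζ K.+ i) TK.⊙ ζζ TK.⊞ K.1# TK.⊙ ii) (IK.solve (ζ ∷ i ∷ []) (λ z i → let open IK in
    z :^ 4 :- (:- one) := (z :* z :+ i) :* (z :* z :- i) :+ one :* (i :* i :- (:- one))) ≡.refl)

  ζ⁸ : ζ TK.^ 8 K.≈ K.1#
  ζ⁸ = TK.linear ((ζ TK.^ 4 K.- K.1#) TK.⊙ ζ⁴) (IK.solve (ζ ∷ []) (λ z → let open IK in
    z :^ 8 :- one := (z :^ 4 :- one) :* (z :^ 4 :- (:- one))) ≡.refl)

  -- Reduction of a sum of embedded integer combinations; ns are the eight class counts.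
  module Reduce (n : ℕ) where
    a : ℕ → R.Carrier
    a j = A j n
    k : ℕ → K.Carrier
    k j = TK.nat (𝔻.N⁰ (+ j) 8 n)
    emb-sub : ∀ x y → emb (x R.- y) K.≈ emb x K.- emb y
    emb-sub x y = K.trans (emb-+ x (R.- y)) (K.+-congˡ (emb-neg y))
    emb-a : ∀ j → emb (a j) K.≈ k j
    emb-a j = emb-nat (𝔻.N⁰ (+ j) 8 n)
    emb-a- : ∀ j l → emb (a j R.- a l) K.≈ k j K.- k l
    emb-a- j l = K.trans (emb-sub (a j) (a l)) (K.+-cong (emb-a j) (K.-‿cong (emb-a l)))
    emb-a4 : ∀ j l r s → emb (a j R.- a l R.+ a r R.- a s) K.≈ k j K.- k l K.+ k r K.- k s
    emb-a4 j l r s = K.trans (emb-sub (a j R.- a l R.+ a r) (a s)) (K.+-cong (K.trans (emb-+ (a j R.- a l) (a r)) (K.+-cong (emb-a- j l) (emb-a r))) (K.-‿cong (emb-a s)))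

    at-i : RankSeries.RS K i i' ii' n K.≈ basis (a 0 R.- a 2 R.+ a 4 R.- a 6) R.0# (a 1 R.- a 3 R.+ a 5 R.- a 7) R.0#
    at-i = K.trans (RankClasses.RS-classes K i i' ii' i⁸ n)
      (TK.linear ((k 2 K.+ k 3 K.* i K.+ (k 6 K.+ k 7 K.* i) K.* i TK.^ 4) TK.⊙ ii TK.⊞ (k 4 K.+ k 5 K.* i K.- k 6 K.- k 7 K.* i) TK.⊙ i⁴)
        (IK.elim (i ∷ ζ ∷ k 0 ∷ k 1 ∷ k 2 ∷ k 3 ∷ k 4 ∷ k 5 ∷ k 6 ∷ k 7 ∷ emb (a 0 R.- a 2 R.+ a 4 R.- a 6) ∷ emb (a 1 R.- a 3 R.+ a 5 R.- a 7) ∷ emb R.0# ∷ [])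
          (λ i z k₀ k₁ k₂ k₃ k₄ k₅ k₆ k₇ x u o → let open IK in
            (x ⇒ k₀ :- k₂ :+ k₄ :- k₆) ∷ (u ⇒ k₁ :- k₃ :+ k₅ :- k₇) ∷ (o ⇒ nil) ∷ [] ,
            ((k₀ :* i :^ 0 :+ (k₁ :* i :^ 1 :+ (k₂ :* i :^ 2 :+ (k₃ :* i :^ 3 :+ (k₄ :* i :^ 4 :+ (k₅ :* i :^ 5 :+ (k₆ :* i :^ 6 :+ (k₇ :* i :^ 7 :+ nil))))))))
                :- (x :+ z :* o :+ i :* u :+ z :* i :* o)
              := (k₂ :+ k₃ :* i :+ (k₆ :+ k₇ :* i) :* i :^ 4) :* (i :* i :- (:- one)) :+ (k₄ :+ k₅ :* i :- k₆ :- k₇ :* i) :* (i :^ 4 :- one)))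
          (emb-a4 0 2 4 6 , emb-a4 1 3 5 7 , emb-0 , tt) ≡.refl))

    -- The factor ζ + ζ' = ζ - ζ i is the one that stands before the rank series in `zeta-identity`;
    -- the four arguments of `basis` are the coordinates after reduction by ζ⁴ = -1.
    at-ζ : (ζ K.+ ζ') K.* RankSeries.RS K ζ ζ' ζζ' n
           K.≈ basis ((a 1 R.- a 5) R.- (a 3 R.- a 7)) ((a 0 R.- a 4) R.+ (a 2 R.- a 6)) ((a 1 R.- a 5) R.+ (a 3 R.- a 7)) ((a 2 R.- a 6) R.- (a 0 R.- a 4))
    at-ζ = K.trans (K.*-congˡ (RankClasses.RS-classes K ζ ζ' ζζ' ζ⁸ n))
      (TK.linear (((ζ K.- ζ K.* i) K.* (k 4 K.+ k 5 K.* ζ K.+ k 6 K.* ζ K.* ζ K.+ k 7 K.* ζ TK.^ 3)) TK.⊙ ζ⁴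
          TK.⊞ ((K.1# K.- i) K.* ((k 1 K.- k 5) K.+ (k 2 K.- k 6) K.* ζ K.+ (k 3 K.- k 7) K.* (ζ K.* ζ K.+ i))) TK.⊙ ζζ
          TK.⊞ (K.- ((k 1 K.- k 5) K.+ ζ K.* (k 2 K.- k 6) K.- (k 3 K.- k 7) K.+ (k 3 K.- k 7) K.* i)) TK.⊙ ii)
        (IK.elim (i ∷ ζ ∷ k 0 ∷ k 1 ∷ k 2 ∷ k 3 ∷ k 4 ∷ k 5 ∷ k 6 ∷ k 7 ∷ emb ((a 1 R.- a 5) R.- (a 3 R.- a 7)) ∷ emb ((a 0 R.- a 4) R.+ (a 2 R.- a 6))
             ∷ emb ((a 1 R.- a 5) R.+ (a 3 R.- a 7)) ∷ emb ((a 2 R.- a 6) R.- (a 0 R.- a 4)) ∷ [])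
          (λ i z k₀ k₁ k₂ k₃ k₄ k₅ k₆ k₇ x y u v → let open IK in
            (x ⇒ (k₁ :- k₅) :- (k₃ :- k₇)) ∷ (y ⇒ (k₀ :- k₄) :+ (k₂ :- k₆)) ∷ (u ⇒ (k₁ :- k₅) :+ (k₃ :- k₇)) ∷ (v ⇒ (k₂ :- k₆) :- (k₀ :- k₄)) ∷ [] ,
            ((z :+ (:- (z :* i))) :* (k₀ :* z :^ 0 :+ (k₁ :* z :^ 1 :+ (k₂ :* z :^ 2 :+ (k₃ :* z :^ 3 :+ (k₄ :* z :^ 4 :+ (k₅ :* z :^ 5 :+ (k₆ :* z :^ 6 :+ (k₇ :* z :^ 7 :+ nil))))))))
                :- (x :+ z :* y :+ i :* u :+ z :* i :* v)
              := (z :- z :* i) :* (k₄ :+ k₅ :* z :+ k₆ :* z :* z :+ k₇ :* z :^ 3) :* (z :^ 4 :- (:- one))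
                 :+ ((one :- i) :* ((k₁ :- k₅) :+ (k₂ :- k₆) :* z :+ (k₃ :- k₇) :* (z :* z :+ i)) :* (z :* z :- i)
                 :+ (:- ((k₁ :- k₅) :+ z :* (k₂ :- k₆) :- (k₃ :- k₇) :+ (k₃ :- k₇) :* i)) :* (i :* i :- (:- one)))))
          ( K.trans (emb-sub _ _) (K.+-cong (emb-a- 1 5) (K.-‿cong (emb-a- 3 7)))
          , K.trans (emb-+ _ _) (K.+-cong (emb-a- 0 4) (emb-a- 2 6))
          , K.trans (emb-+ _ _) (K.+-cong (emb-a- 1 5) (emb-a- 3 7))
          , K.trans (emb-sub _ _) (K.+-cong (emb-a- 2 6) (K.-‿cong (emb-a- 0 4))) , tt) ≡.refl))

  -- The coordinates along 1 and along i of the identity RS = q ν(q²) at z = i.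
  rank-mod4 : (A 0 SR.- A 2 SR.+ A 4 SR.- A 6 SR.≈ PR.X SR.* MR.ν (ER.sq 1)) × (A 1 SR.- A 3 SR.+ A 5 SR.- A 7 SR.≈ SR.0#)
  rank-mod4 = PR.pointwise (λ n → proj₁ (proj₁ (parts n))) , PR.pointwise (λ n → proj₁ (proj₂ (parts n)))
    where
    ν-value : RankSeries.RS K i i' ii' SK.≈ ι (PR.X SR.* MR.ν (ER.sq 1))
    ν-value = SK.trans (AI.i-identity _ (RankSeries.rank-series K i i' ii')) (SK.sym (SK.trans (h-* _ _) (SK.*-cong ι-X
      (SK.trans (h-ν (ER.osq 1)) (MK.ν-cong (ContinuousHom.h-ord coefficientHom (ER.osq 1)) (ι-sq 1))))))
    parts : ∀ n → _
    parts n = independent {v' = R.0#} (K.trans (K.sym (Reduce.at-i n)) (K.trans (PK.at ν-value n)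
      (IK.elim (emb ((PR.X SR.* MR.ν (ER.sq 1)) n) ∷ ζ ∷ i ∷ emb R.0# ∷ []) (λ x z i o → let open IK in (o ⇒ nil) ∷ [] ,
        (x := x :+ z :* o :+ i :* o :+ z :* i :* o)) (emb-0 , tt) ≡.refl)))

  L₁ L₂ : PR.Ser
  L₁ = ER.zpow (ER.U 2) (+ 5) SR.* ER.zpow (ER.U 4) (+ 2) SR.* ER.zpow (ER.U 1) ER.-2z SR.* ER.zpow (ER.U 3) ER.-3z SR.* ER.zpow (ER.U 5) ER.-1z
  L₂ = ER.zpow (ER.U 2) (+ 5) SR.* ER.zpow (ER.U 5) (+ 1) SR.* ER.zpow (ER.U 1) ER.-2z SR.* ER.zpow (ER.U 3) ER.-2z SR.* ER.zpow (ER.U 4) ER.-1z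

  cζζ' : cζ SK.* cζ' SK.≈ SK.1#
  cζζ' = SK.trans (const-hom ζ ζ') (SK.trans (const-cong ζζ') const-one)

  module AZ = RI.Zeta cζ cζ' ci ci' cζζ' (SK.trans (const-hom ζ ζ) (const-cong ζζ)) (SK.trans (const-hom ζ' ζ') (const-cong ζ'ζ')) cii (c-neg i)
                      (H≈HV ζ ζ' ζζ')

  t₁ t₂ : PR.Ser
  t₁ = PR.X SR.^ 3 SR.* MR.ν (ER.sq 3)
  t₂ = PR.X SR.* L₂

  zeta-coefficients : ∀ n → (ζ K.+ ζ') K.* RankSeries.RS K ζ ζ' ζζ' n K.+ emb (MR.φ (ER.sq 3) n) K.+ (ζ K.+ ζ') K.* emb (t₁ n)
                            K.≈ emb (L₁ n) K.+ (ζ K.+ ζ') K.* emb (t₂ n)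
  zeta-coefficients n = K.trans (K.sym (K.+-cong (K.+-cong (scale _) (PK.at ιφ n)) (K.trans (scale _) (K.*-congˡ (PK.at ιt₁ n)))))
    (K.trans (PK.at (AZ.zeta-identity _ (RankSeries.rank-series K ζ ζ' ζζ')) n) (K.+-cong (PK.at ιL₁ n) (K.trans (scale _) (K.*-congˡ (PK.at ιt₂ n)))))
    where
    scale : ∀ F → ((cζ SK.+ cζ') SK.* F) n K.≈ (ζ K.+ ζ') K.* F n
    scale F = K.trans (PK.at (SK.distribʳ F cζ cζ') n) (K.trans (K.+-cong (PK.const-* ζ F n) (PK.const-* ζ' F n)) (K.sym (K.distribʳ (F n) ζ ζ')))
    osq3 = ContinuousHom.h-ord coefficientHom (ER.osq 3)
    ιφ : MK.φ (EK.sq 3) SK.≈ ι (MR.φ (ER.sq 3))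
    ιφ = SK.sym (SK.trans (h-φ (ER.osq 3)) (MK.φ-cong osq3 (ι-sq 3)))
    ιt₁ : PK.X SK.^ 3 SK.* MK.ν (EK.sq 3) SK.≈ ι t₁
    ιt₁ = SK.sym (SK.trans (h-* _ _) (SK.*-cong (SK.trans (h-^ PR.X 3) (SK.^-cong 3 ι-X)) (SK.trans (h-ν (ER.osq 3)) (MK.ν-cong osq3 (ι-sq 3)))))
    five : ∀ a b c d e → ι (a SR.* b SR.* c SR.* d SR.* e) SK.≈ ι a SK.* ι b SK.* ι c SK.* ι d SK.* ι e
    five a b c d e = SK.trans (h-* _ e) (SK.*-congʳ (SK.trans (h-* _ d) (SK.*-congʳ (SK.trans (h-* _ c) (SK.*-congʳ (h-* a b))))))
    ιL₁ = SK.sym (SK.trans (five (ER.zpow (ER.U 2) (+ 5)) (ER.zpow (ER.U 4) (+ 2)) (ER.zpow (ER.U 1) ER.-2z) (ER.zpow (ER.U 3) ER.-3z) (ER.zpow (ER.U 5) ER.-1z))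
      (SK.*-cong (SK.*-cong (SK.*-cong (SK.*-cong (ι-zpow 2 (+ 5)) (ι-zpow 4 (+ 2))) (ι-zpow 1 ER.-2z)) (ι-zpow 3 ER.-3z)) (ι-zpow 5 ER.-1z)))
    ιL₂ = SK.sym (SK.trans (five (ER.zpow (ER.U 2) (+ 5)) (ER.zpow (ER.U 5) (+ 1)) (ER.zpow (ER.U 1) ER.-2z) (ER.zpow (ER.U 3) ER.-2z) (ER.zpow (ER.U 4) ER.-1z))
      (SK.*-cong (SK.*-cong (SK.*-cong (SK.*-cong (ι-zpow 2 (+ 5)) (ι-zpow 5 (+ 1))) (ι-zpow 1 ER.-2z)) (ι-zpow 3 ER.-2z)) (ι-zpow 4 ER.-1z)))
    ιt₂ = SK.trans (SK.*-cong (SK.sym ι-X) ιL₂) (SK.sym (h-* PR.X L₂))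

  -- The coordinates along 1, ζ, i and ζi of the identity at z = ζ. Adding those along ζ and ζi
  -- leaves 2 (A 2 - A 6) = 0, an instance of the symmetry of the rank under exchange of the rows.
  rank-mod8 : ((A 1 SR.- A 5) SR.- (A 3 SR.- A 7) SR.+ MR.φ (ER.sq 3) SR.≈ L₁ × (A 0 SR.- A 4) SR.+ (A 2 SR.- A 6) SR.+ t₁ SR.≈ t₂)
            × ((A 1 SR.- A 5) SR.+ (A 3 SR.- A 7) SR.≈ SR.0# × (A 2 SR.- A 6) SR.- (A 0 SR.- A 4) SR.- t₁ SR.≈ SR.- t₂)
  rank-mod8 = (PR.pointwise (λ n → proj₁ (proj₁ (parts n))) , PR.pointwise (λ n → proj₂ (proj₁ (parts n))))
            , (PR.pointwise (λ n → proj₁ (proj₂ (parts n))) , PR.pointwise (λ n → proj₂ (proj₂ (parts n))))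
    where
    parts : ∀ n → _
    parts n = independent {x = (a 1 R.- a 5) R.- (a 3 R.- a 7) R.+ MR.φ (ER.sq 3) n} {y = (a 0 R.- a 4) R.+ (a 2 R.- a 6) R.+ t₁ n}
                          {u = (a 1 R.- a 5) R.+ (a 3 R.- a 7)} {v = (a 2 R.- a 6) R.- (a 0 R.- a 4) R.- t₁ n}
                          {x' = L₁ n} {y' = t₂ n} {u' = R.0#} {v' = R.- t₂ n}
      (K.trans (K.sym left) (K.trans (zeta-coefficients n) right))
      where
      open Reduce n
      x = (a 1 R.- a 5) R.- (a 3 R.- a 7)
      y = (a 0 R.- a 4) R.+ (a 2 R.- a 6)
      u = (a 1 R.- a 5) R.+ (a 3 R.- a 7)
      v = (a 2 R.- a 6) R.- (a 0 R.- a 4)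
      left : (ζ K.+ ζ') K.* RankSeries.RS K ζ ζ' ζζ' n K.+ emb (MR.φ (ER.sq 3) n) K.+ (ζ K.+ ζ') K.* emb (t₁ n)
             K.≈ basis (x R.+ MR.φ (ER.sq 3) n) (y R.+ t₁ n) u (v R.- t₁ n)
      left = IK.elim ((ζ K.+ ζ') K.* RankSeries.RS K ζ ζ' ζζ' n ∷ ζ ∷ i ∷ emb x ∷ emb y ∷ emb u ∷ emb v ∷ emb (MR.φ (ER.sq 3) n) ∷ emb (t₁ n)
                        ∷ emb (x R.+ MR.φ (ER.sq 3) n) ∷ emb (y R.+ t₁ n) ∷ emb (v R.- t₁ n) ∷ [])
        (λ r z i x y u v f t x' y' v' → let open IK in
          (r ⇒ x :+ z :* y :+ i :* u :+ z :* i :* v) ∷ (x' ⇒ x :+ f) ∷ (y' ⇒ y :+ t) ∷ (v' ⇒ v :- t) ∷ [] ,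
          (r :+ f :+ (z :+ (:- (z :* i))) :* t := x' :+ z :* y' :+ i :* u :+ z :* i :* v'))
        (at-ζ , emb-+ x (MR.φ (ER.sq 3) n) , emb-+ y (t₁ n) , emb-sub v (t₁ n) , tt) ≡.refl
      right : emb (L₁ n) K.+ (ζ K.+ ζ') K.* emb (t₂ n) K.≈ basis (L₁ n) (t₂ n) R.0# (R.- t₂ n)
      right = IK.elim (ζ ∷ i ∷ emb (L₁ n) ∷ emb (t₂ n) ∷ emb (R.- t₂ n) ∷ emb R.0# ∷ []) (λ z i l t t' o → let open IK in (t' ⇒ :- t) ∷ (o ⇒ nil) ∷ [] ,
        (l :+ (z :+ (:- (z :* i))) :* t := l :+ z :* t :+ i :* o :+ z :* i :* t')) (emb-neg (t₂ n) , emb-0 , tt) ≡.refl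

record RationalAlgebra (R : CommutativeRing 0ℓ 0ℓ) : Set where
  module R = CommutativeRing R
  field
    e : ℚ → R.Carrier
    e-+ : ∀ a b → e (a ℚ.+ b) R.≈ e a R.+ e b
    e-* : ∀ a b → e (a ℚ.* b) R.≈ e a R.* e b
    e-neg : ∀ a → e (ℚ.- a) R.≈ R.- e a
    e-0 : e 0ℚ R.≈ R.0#
    e-1 : e 1ℚ R.≈ R.1#

pattern 0i = zero
pattern 1i = suc 0i
pattern 2i = suc 1i
pattern 3i = suc 2i
pattern 4i = suc 3i
pattern 5i = suc 4i
pattern 6i = suc 5i
pattern 7i = suc 6i

-- Symbolic terms and certified 2-dissection.

-- J i stands for J_{2^i}; at level k the symbols gω, gf, gp stand for g(-q^K; q^{2K}), g(-1; q^K), g(q^K; q^{4K}) with K = 2^k.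
module Terms where
  data Denominator : Set where
    J : Fin 8 → Denominator
    J^ : Fin 8 → ℕ → Denominator
    _⊗_ : Denominator → Denominator → Denominator

  infixl 6 _⊕_ _⊖_
  infixl 7 _⊗_ _⊘_
  data Term : Set where
    ℓ : ℚ → Term
    q^ q⁻ : ℕ → Term
    J : Fin 8 → Term
    J^ : Fin 8 → ℕ → Term
    gω gf gp : Term
    _⊕_ _⊖_ _⊗_ : Term → Term → Term
    _⊘_ : Term → Denominator → Term
    neg : Term → Term

-- position 0 is toℕ; the accumulator follows the recursion of usFrom.
position : ∀ {n} → ℕ → Fin n → ℕ
position k zero = k
position k (suc i) = position (suc k) i

module Formulas (R : CommutativeRing 0ℓ 0ℓ) (extension : EighthRootExtension R) (algebra : RationalAlgebra R) where
  open Terms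
  open RankIdentities R extension using (module ER; module MR; module PR; module SR)
  open RationalAlgebra algebra
  open SR hiding (con)
  open PR using (X; const)
  open Dilation R using (D; dilation; D-X; double; even-part; odd-part)
  open ContinuousHom dilation using (h-+; h-*; h-neg; h-sub; h-1; h-^; h-ord; h-recip₁)
  open MockHom dilation using (h-ω; h-f; h-φ; h-ν; h-Pr')
  open ER using (sq; osq; oJ)

  rationals : Coefficients PR.seriesRing
  rationals = record
    { C = ℚ ; _+ᶜ_ = ℚ._+_ ; _*ᶜ_ = ℚ._*_ ; -ᶜ_ = ℚ.-_ ; 1ᶜ = 1ℚ ; isZero = isZero ; ι = λ c → const (e c)
    ; ι-+ = λ a b → PR.pointwise λ { zero → e-+ a b ; (suc n) → R.sym (R.+-identityˡ _) }
    ; ι-* = λ a b → trans (Sums.const-cong R (e-* a b)) (sym (Sums.const-hom R (e a) (e b)))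
    ; ι-neg = λ a → PR.pointwise λ { zero → e-neg a ; (suc n) → R.sym (RingProperties.-0#≈0# R.ring) }
    ; ι-1 = trans (Sums.const-cong R e-1) (Sums.const-one R)
    ; isZero-sound = λ a z → PR.pointwise λ { zero → R.trans (R.reflexive (≡.cong e (sound a z))) e-0 ; (suc n) → R.refl } }
    where
    isZero : ℚ → Bool
    isZero (mkℚ (+ zero) _ _) = true
    isZero _ = false
    sound : ∀ a → Bool.T (isZero a) → a ≡ 0ℚ
    sound a@(mkℚ (+ zero) _ _) _ = ℚₚ.↥p≡0⇒p≡0 a ≡.refl

  module P = Polynomials PR.seriesRing rationals
  open P using (Expr; con; var; unit; _⟂_by_; zpow)

  U : ℕ → P.Unit
  U i = ER.J i ⟂ recip₁ (ER.J i) by recip₁-law (oJ i)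

  opaque
    usFrom : ℕ → (n : ℕ) → Vec P.Unit n
    usFrom k zero = []
    usFrom k (suc n) = U k ∷ usFrom (suc k) n

    lookup-suc : ∀ k n (i : Fin n) → Vec.lookup (usFrom k (suc n)) (suc i) ≡ Vec.lookup (usFrom (suc k) n) i
    lookup-suc k n i = ≡.refl

    lookup-up : ∀ k n (i : Fin n) → Vec.lookup (usFrom k (suc n)) (inject₁ i) ≡ Vec.lookup (usFrom k n) i
    lookup-up k (suc n) zero = ≡.refl
    lookup-up k (suc n) (suc i) = lookup-up (suc k) n i

  value : ∀ {m} k n → Vec Carrier m → Expr m n → Carrier
  value k n xs = P.Semantics.⟦_⟧ (usFrom k n) xs

  D-sq : ∀ i → D (sq i) ≈ sq (suc i)
  D-sq zero = D-X
  D-sq (suc i) = trans (h-* (sq i) (sq i)) (*-cong (D-sq i) (D-sq i))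

  D-J : ∀ i → D (ER.J i) ≈ ER.J (suc i)
  D-J i = h-Pr' (osq i) (D-sq i) (D-sq i) 0

  D-recip₁ : ∀ {u v} → Ord 1 (1# - u) → D u ≈ v → D (recip₁ u) ≈ recip₁ v
  D-recip₁ o e = trans (h-recip₁ o) (MR.recip₁-cong (ord-resp (trans (h-sub _ _) (+-congʳ h-1)) (h-ord o)) e)

  D-zpow : ∀ i z → D (zpow (U i) z) ≈ zpow (U (suc i)) z
  D-zpow i (+ n) = trans (h-^ _ n) (^-cong n (D-J i))
  D-zpow i -[1+ n ] = trans (h-^ _ (suc n)) (^-cong (suc n) (D-recip₁ (oJ i) (D-J i)))

  D-const : ∀ c → D (const c) ≈ const c
  D-const c = PR.pointwise λ { zero → R.refl ; (suc zero) → R.refl ; (suc (suc n)) → PR.at (D-zero) n }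
    where
    D-zero : D (λ _ → R.0#) ≈ (λ _ → R.0#)
    D-zero = PR.pointwise (Dilation.D-0 R)

  opaque
    unfolding usFrom

    D-lookup : ∀ k n (i : Fin n) z → D (zpow (Vec.lookup (usFrom k n) i) z) ≈ zpow (Vec.lookup (usFrom (suc k) n) i) z
    D-lookup k (suc n) zero z = D-zpow k z
    D-lookup k (suc n) (suc i) z = D-lookup (suc k) n i z

  zpow-U : ∀ {k j} → k ≡ j → ∀ z → zpow (U j) z ≈ zpow (U k) z
  zpow-U {k} ≡.refl z = refl {zpow (U k) z}

  opaque
    unfolding usFrom

    lookup-U : ∀ k n (i : Fin n) {j} → position k i ≡ j → ∀ z → zpow (U j) z ≈ zpow (Vec.lookup (usFrom k n) i) z
    lookup-U k (suc n) zero {j} e z = zpow-U {k} {j} e z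
    lookup-U k (suc n) (suc i) {j} e z = lookup-U (suc k) n i {j} e z

  D-value : ∀ {m} k n (xs : Vec Carrier m) e → D (value k n xs e) ≈ value (suc k) n (Vec.map D xs) e
  D-value k n xs P.nil = PR.pointwise (Dilation.D-0 R)
  D-value k n xs P.one = h-1
  D-value k n xs (con c) = D-const _
  D-value k n xs (var i) = reflexive (≡.sym (Vecₚ.lookup-map i D xs))
  D-value k n xs (unit i z) = D-lookup k n i z
  D-value k n xs (a P.:+ b) = trans (h-+ _ _) (+-cong (D-value k n xs a) (D-value k n xs b))
  D-value k n xs (a P.:* b) = trans (h-* _ _) (*-cong (D-value k n xs a) (D-value k n xs b))
  D-value k n xs (a P.:- b) = trans (h-sub _ _) (+-cong (D-value k n xs a) (-‿cong (D-value k n xs b)))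
  D-value k n xs (P.:- a) = trans (h-neg _) (-‿cong (D-value k n xs a))
  D-value k n xs (a P.:^ j) = trans (h-^ _ j) (^-cong j (D-value k n xs a))

  -- `dil` is q ↦ q² on expressions: the variable q is squared and J_{2^i} becomes J_{2^(i+1)},
  -- hence the additional unit, for which `up` makes room. The mock theta variables keep their
  -- names, since their level is raised in the environment.
  up dil : ∀ {m n} → Expr (suc m) n → Expr (suc m) (suc n)
  up P.nil = P.nil
  up P.one = P.one
  up (con c) = con c
  up (var i) = var i
  up (unit i z) = unit (inject₁ i) z
  up (a P.:+ b) = up a P.:+ up b
  up (a P.:* b) = up a P.:* up b
  up (a P.:- b) = up a P.:- up b
  up (P.:- a) = P.:- up a
  up (a P.:^ j) = up a P.:^ j
  dil P.nil = P.nil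
  dil P.one = P.one
  dil (con c) = con c
  dil (var zero) = var zero P.:* var zero
  dil (var (suc i)) = var (suc i)
  dil (unit i z) = unit (suc i) z
  dil (a P.:+ b) = dil a P.:+ dil b
  dil (a P.:* b) = dil a P.:* dil b
  dil (a P.:- b) = dil a P.:- dil b
  dil (P.:- a) = P.:- dil a
  dil (a P.:^ j) = dil a P.:^ j

  up-value : ∀ {m} k n (xs : Vec Carrier (suc m)) e → value k n xs e ≈ value k (suc n) xs (up e)
  up-value k n xs P.nil = refl
  up-value k n xs P.one = refl
  up-value k n xs (con c) = refl
  up-value k n xs (var i) = refl
  up-value k n xs (unit i z) = reflexive (≡.cong (λ u → zpow u z) (≡.sym (lookup-up k n i)))
  up-value k n xs (a P.:+ b) = +-cong (up-value k n xs a) (up-value k n xs b)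
  up-value k n xs (a P.:* b) = *-cong (up-value k n xs a) (up-value k n xs b)
  up-value k n xs (a P.:- b) = +-cong (up-value k n xs a) (-‿cong (up-value k n xs b))
  up-value k n xs (P.:- a) = -‿cong (up-value k n xs a)
  up-value k n xs (a P.:^ j) = ^-cong j (up-value k n xs a)

  dil-value : ∀ {m} n (xs ys : Vec Carrier m) → (∀ i → Vec.lookup xs i ≈ Vec.lookup ys i) → ∀ e →
              value 1 n (X * X ∷ xs) e ≈ value 0 (suc n) (X ∷ ys) (dil e)
  dil-value n xs ys h P.nil = refl
  dil-value n xs ys h P.one = refl
  dil-value n xs ys h (con c) = refl
  dil-value n xs ys h (var zero) = refl
  dil-value n xs ys h (var (suc i)) = h i
  dil-value n xs ys h (unit i z) = reflexive (≡.cong (λ u → zpow u z) (≡.sym (lookup-suc 0 n i)))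
  dil-value n xs ys h (a P.:+ b) = +-cong (dil-value n xs ys h a) (dil-value n xs ys h b)
  dil-value n xs ys h (a P.:* b) = *-cong (dil-value n xs ys h a) (dil-value n xs ys h b)
  dil-value n xs ys h (a P.:- b) = +-cong (dil-value n xs ys h a) (-‿cong (dil-value n xs ys h b))
  dil-value n xs ys h (P.:- a) = -‿cong (dil-value n xs ys h a)
  dil-value n xs ys h (a P.:^ j) = ^-cong j (dil-value n xs ys h a)

  value-cong : ∀ {m} k n (xs ys : Vec Carrier m) → (∀ i → Vec.lookup xs i ≈ Vec.lookup ys i) → ∀ e →
               value k n xs e ≈ value k n ys e
  value-cong k n xs ys h P.nil = refl
  value-cong k n xs ys h P.one = refl
  value-cong k n xs ys h (con c) = refl
  value-cong k n xs ys h (var i) = h i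
  value-cong k n xs ys h (unit i z) = refl
  value-cong k n xs ys h (a P.:+ b) = +-cong (value-cong k n xs ys h a) (value-cong k n xs ys h b)
  value-cong k n xs ys h (a P.:* b) = *-cong (value-cong k n xs ys h a) (value-cong k n xs ys h b)
  value-cong k n xs ys h (a P.:- b) = +-cong (value-cong k n xs ys h a) (-‿cong (value-cong k n xs ys h b))
  value-cong k n xs ys h (P.:- a) = -‿cong (value-cong k n xs ys h a)
  value-cong k n xs ys h (a P.:^ j) = ^-cong j (value-cong k n xs ys h a)

  -- Universal mock theta functions: Ω⁻ k = g(-x; x²), F k = 2(1 - g(-1; x)), G k = 1 + x g(x; x⁴) at x = q^{2^k}.
  opaque
    Ω⁺ Ω⁻ F N Φ₃ G : ℕ → Carrier
    Ω⁺ k = MR.ω (sq k)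
    Ω⁻ k = MR.ω (- sq k)
    F k = MR.f (sq k)
    N k = MR.ν (sq k)
    Φ₃ k = MR.φ (sq k)
    G k = twin 0 (Pr (sq k) (sq (2 ℕ.+ k)) ∘ suc) (Pr (sq k * sq (suc k)) (sq (2 ℕ.+ k))) (sq (2 ℕ.+ k)) 0 * recip₁ (MR.ωD (sq k))

    D-Ω⁺ : ∀ k → D (Ω⁺ k) ≈ Ω⁺ (suc k)
    D-Ω⁺ k = trans (h-ω (osq k)) (MR.ω-cong (h-ord (osq k)) (D-sq k))

    D-Ω⁻ : ∀ k → D (Ω⁻ k) ≈ Ω⁻ (suc k)
    D-Ω⁻ k = trans (h-ω (ord-neg (osq k))) (MR.ω-cong (h-ord (ord-neg (osq k))) (trans (h-neg _) (-‿cong (D-sq k))))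

    D-F : ∀ k → D (F k) ≈ F (suc k)
    D-F k = trans (h-f (osq k)) (MR.f-cong (h-ord (osq k)) (D-sq k))

    D-N : ∀ k → D (N k) ≈ N (suc k)
    D-N k = trans (h-ν (osq k)) (MR.ν-cong (h-ord (osq k)) (D-sq k))

    D-Φ₃ : ∀ k → D (Φ₃ k) ≈ Φ₃ (suc k)
    D-Φ₃ k = trans (h-φ (osq k)) (MR.φ-cong (h-ord (osq k)) (D-sq k))

    D-G : ∀ k → D (G k) ≈ G (suc k)
    D-G k = trans (h-* _ _) (*-cong
      (trans (ContinuousHom.h-twin dilation 0 (osq (2 ℕ.+ k)) (λ j → h-Pr' (osq (2 ℕ.+ k)) (D-sq k) (D-sq (2 ℕ.+ k)) (suc j))
               (h-Pr' (osq (2 ℕ.+ k)) (trans (h-* _ _) (*-cong (D-sq k) (D-sq (suc k)))) (D-sq (2 ℕ.+ k))) 0)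
        (twin-cong 0 (h-ord (osq (2 ℕ.+ k))) (λ _ → refl) (λ _ → refl) (D-sq (2 ℕ.+ k)) 0))
      (D-recip₁ (MR.oωD (osq k)) (h-Pr' (osq (suc k)) (D-sq k) (D-sq (suc k)) 0)))

  env : ℕ → Vec Carrier 4
  env k = X ∷ Ω⁻ k ∷ F k ∷ G k ∷ []

  D-env : ∀ k i → Vec.lookup (Vec.map D (Ω⁻ k ∷ F k ∷ G k ∷ [])) i ≈ Vec.lookup (Ω⁻ (suc k) ∷ F (suc k) ∷ G (suc k) ∷ []) i
  D-env k zero = D-Ω⁻ k
  D-env k (suc zero) = D-F k
  D-env k (suc (suc zero)) = D-G k

  D-head : ∀ {m} (xs : Vec Carrier m) i → Vec.lookup (Vec.map D (X ∷ xs)) i ≈ Vec.lookup (X * X ∷ Vec.map D xs) i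
  D-head xs zero = D-X
  D-head xs (suc i) = refl

  D-dil : ∀ {m} n (xs ys : Vec Carrier m) → (∀ i → Vec.lookup (Vec.map D xs) i ≈ Vec.lookup ys i) → ∀ e →
          D (value 0 n (X ∷ xs) e) ≈ value 0 (suc n) (X ∷ ys) (dil e)
  D-dil n xs ys h e = trans (D-value 0 n (X ∷ xs) e) (trans
    (value-cong 1 n (Vec.map D (X ∷ xs)) (X * X ∷ Vec.map D xs) (D-head xs) e)
    (dil-value n (Vec.map D xs) ys h e))

  D-level : ∀ k e → D (value 0 8 (env k) e) ≈ value 0 9 (env (suc k)) (dil e)
  D-level k = D-dil 8 (Ω⁻ k ∷ F k ∷ G k ∷ []) (Ω⁻ (suc k) ∷ F (suc k) ∷ G (suc k) ∷ []) (D-env k)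

  -- An identity that holds whatever values the variables other than q take, so that the mock theta
  -- symbols may stand at any level when it is applied.
  record Law : Set where
    field
      lhs rhs : Expr 4 9
      holds : ∀ xs → value 0 9 (X ∷ xs) lhs ≈ value 0 9 (X ∷ xs) rhs
  open Law

  Combination : Set
  Combination = List (Expr 4 9 × Law)

  combine : Combination → Expr 4 9
  combine [] = P.nil
  combine ((c , l) ∷ cs) = c P.:* (lhs l P.:- rhs l) P.:+ combine cs

  combine-zero : ∀ cs xs → value 0 9 (X ∷ xs) (combine cs) ≈ 0#
  combine-zero [] xs = refl
  combine-zero ((c , l) ∷ cs) xs = value 0 9 (X ∷ xs) c ⊙ holds l xs ⊞ combine-zero cs xs

  -- A term as a power of q and a polynomial expression: the term is q^{-u} times the expression.
  denominator : Denominator → Expr 4 8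
  denominator (J i) = unit i (+ 1)
  denominator (J^ i n) = unit i (+ 1) P.:^ n
  denominator (a ⊗ b) = denominator a P.:* denominator b

  inverse : Denominator → Expr 4 8
  inverse (J i) = unit i -[1+ 0 ]
  inverse (J^ i n) = unit i -[1+ 0 ] P.:^ n
  inverse (a ⊗ b) = inverse a P.:* inverse b

  qᵉ : ∀ {n} → Expr 4 n
  qᵉ = var zero

  -- Follows the offsets of the Laurent operations, which add even in a sum. The symbols `gω` and
  -- `gp` carry 2^k, the exponent of q in their argument; for `gf` the argument is -1 and the offset
  -- is 0.
  order : ℕ → Term → ℕ
  order k (q⁻ n) = n
  order k gω = 2 ℕ.^ k
  order k gp = 2 ℕ.^ k
  order k (a ⊕ b) = order k a ℕ.+ order k b
  order k (a ⊖ b) = order k a ℕ.+ order k b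
  order k (a ⊗ b) = order k a ℕ.+ order k b
  order k (a ⊘ d) = order k a
  order k (neg a) = order k a
  order k _ = 0

  expr : ℕ → Term → Expr 4 8
  expr k (ℓ c) = con c
  expr k (q^ n) = qᵉ P.:^ n
  expr k (q⁻ n) = P.one
  expr k (J i) = unit i (+ 1)
  expr k (J^ i n) = unit i (+ 1) P.:^ n
  expr k gω = qᵉ P.:^ (2 ℕ.^ k) P.:* var (suc zero)
  expr k gf = P.one P.:- con ½ P.:* var (suc (suc zero))
  expr k gp = var (suc (suc (suc zero))) P.:- P.one
  expr k (a ⊕ b) = qᵉ P.:^ order k b P.:* expr k a P.:+ qᵉ P.:^ order k a P.:* expr k b
  expr k (a ⊖ b) = qᵉ P.:^ order k b P.:* expr k a P.:- qᵉ P.:^ order k a P.:* expr k b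
  expr k (a ⊗ b) = expr k a P.:* expr k b
  expr k (a ⊘ d) = expr k a P.:* inverse d
  expr k (neg a) = con (ℚ.- 1ℚ) P.:* expr k a

  record _represents[_]_ (t : Term) (k : ℕ) (f : Carrier) : Set where
    constructor represents
    field equation : X ^ order k t * f ≈ value 0 8 (env k) (expr k t)
  open _represents[_]_ public

  X^-cancel : ∀ m {f g} → X ^ m * f ≈ X ^ m * g → f ≈ g
  X^-cancel m {f} {g} h = PR.pointwise λ n → R.trans (R.sym (Sums.X^-high R m f n)) (R.trans (PR.at h (m ℕ.+ n)) (Sums.X^-high R m g n))

  evens odds : Carrier → Carrier
  evens f n = f (double n)
  odds f n = f (suc (double n))

  split : ∀ f → f ≈ D (evens f) + X * D (odds f)
  split f = PR.pointwise λ n → go n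
    where
    halve : ∀ n → (∃ λ m → n ≡ double m) ⊎ (∃ λ m → n ≡ suc (double m))
    halve zero = inj₁ (0 , ≡.refl)
    halve (suc n) with halve n
    ... | inj₁ (m , ≡.refl) = inj₂ (m , ≡.refl)
    ... | inj₂ (m , ≡.refl) = inj₁ (suc m , ≡.refl)
    go : ∀ n → f n R.≈ (D (evens f) + X * D (odds f)) n
    go n with halve n
    ... | inj₁ (m , ≡.refl) = R.sym (even-part (evens f) (odds f) m)
    ... | inj₂ (m , ≡.refl) = R.sym (odd-part (evens f) (odds f) m)

  parts-unique : ∀ {a b c d} → D a + X * D b ≈ D c + X * D d → (a ≈ c) × (b ≈ d)
  parts-unique {a} {b} {c} {d} h =
      PR.pointwise (λ n → R.trans (R.sym (even-part a b n)) (R.trans (PR.at h (double n)) (even-part c d n)))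
    , PR.pointwise (λ n → R.trans (R.sym (odd-part a b n)) (R.trans (PR.at h (suc (double n))) (odd-part c d n)))

  D-X^ : ∀ n f → D (X ^ n * f) ≈ X ^ n * X ^ n * D f
  D-X^ n f = trans (h-* _ _) (*-congʳ (trans (h-^ X n) (trans (^-cong n D-X) (MR.*-^ X n))))

  -- The numbers a, b, c pad the pole orders to 2κ, κ, κ, because q ↦ q² doubles orders. The normal
  -- form check says that the defect of the proposed dissection is q^(2κ) times a combination of
  -- laws, hence 0; the even and odd halves of a series are unique, and this gives both claims at
  -- once.
  dissect : ∀ k t t₀ t₁ κ a b c → a ℕ.+ order (suc k) t ≡ κ ℕ.+ κ → b ℕ.+ order k t₀ ≡ κ → c ℕ.+ order k t₁ ≡ κ →
            (cs : Combination) →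
            P.nf (qᵉ P.:^ a P.:* up (expr (suc k) t) P.:- (dil (qᵉ P.:^ b P.:* expr k t₀) P.:+ qᵉ P.:* dil (qᵉ P.:^ c P.:* expr k t₁)))
              ≡ P.nf (qᵉ P.:^ (κ ℕ.+ κ) P.:* combine cs) →
            ∀ {f} → t represents[ suc k ] f → (t₀ represents[ k ] evens f) × (t₁ represents[ k ] odds f)
  dissect k t t₀ t₁ κ a b c ea eb ec cs check {f} (represents h) =
      represents (X^-cancel b (trans (sym (*-assoc _ _ _)) (trans (*-congʳ (trans (sym (^-+ X b _)) (reflexive (≡.cong (X ^_) eb)))) (proj₁ parts))))
    , represents (X^-cancel c (trans (sym (*-assoc _ _ _)) (trans (*-congʳ (trans (sym (^-+ X c _)) (reflexive (≡.cong (X ^_) ec)))) (proj₂ parts))))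
    where
    e₀ e₁ : Expr 4 8
    e₀ = qᵉ P.:^ b P.:* expr k t₀
    e₁ = qᵉ P.:^ c P.:* expr k t₁
    v₀ = value 0 8 (env k) e₀
    v₁ = value 0 8 (env k) e₁
    whole : X ^ a * value 0 8 (env (suc k)) (expr (suc k) t) ≈ D v₀ + X * D v₁
    whole = minus-zero (trans
      (+-cong (*-congˡ (up-value 0 8 (env (suc k)) (expr (suc k) t)))
        (-‿cong (+-cong (D-level k e₀) (*-congˡ (D-level k e₁)))))
      (trans (sym (P.Semantics.nf-sound (usFrom 0 9) (env (suc k)) (qᵉ P.:^ a P.:* up (expr (suc k) t) P.:- (dil e₀ P.:+ qᵉ P.:* dil e₁))))
        (trans (reflexive (≡.cong (P.Semantics.⟦_⟧ᵖ (usFrom 0 9) (env (suc k))) check))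
          (trans (P.Semantics.nf-sound (usFrom 0 9) (env (suc k)) (qᵉ P.:^ (κ ℕ.+ κ) P.:* combine cs))
            (trans (*-congˡ (combine-zero cs (Ω⁻ (suc k) ∷ F (suc k) ∷ G (suc k) ∷ []))) (zeroʳ _))))))
    parts : (X ^ κ * evens f ≈ v₀) × (X ^ κ * odds f ≈ v₁)
    parts = parts-unique (trans (+-cong (D-X^ κ (evens f)) (*-congˡ (D-X^ κ (odds f))))
      (trans (solve (X ∷ X ^ κ ∷ D (evens f) ∷ D (odds f) ∷ []) (λ x y u v → y :* y :* u :+ x :* (y :* y :* v) := y :* y :* (u :+ x :* v)) ≡.refl)
      (trans (*-cong (trans (sym (^-+ X κ κ)) (trans (reflexive (≡.cong (X ^_) (≡.sym ea))) (^-+ X a _))) (sym (split f)))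
      (trans (*-assoc _ _ _) (trans (*-congˡ h) whole)))))

-- Theta laws, Watson's relations and relations between mock theta functions.

module EtaLaws (R : CommutativeRing 0ℓ 0ℓ) (extension : EighthRootExtension R) (algebra : RationalAlgebra R) where
  open Formulas R extension algebra public
  open RankIdentities R extension
    using (module ER; module MR; module PR; module SR; A; rank-sum; rank-alternating; rank-mod4; rank-mod8; L₁; L₂; t₁; t₂; [-1]²; module SignIdentity) public
  module R = CommutativeRing R
  open SR hiding (solve; elim; con; nil; one; _:+_; _:*_; _:-_; :-_; _:^_; _:=_; _⇒_)
  open P using (Expr; con; var; unit; zpow; elimᵘ; solve; elim; nil; one; _:+_; _:*_; _:-_; :-_; _:^_; _:=_; _⇒_) public
  open ER using (sq; osq; Φ; Φ⁻; Ψ)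
  open PR using (X; const; vanish-X)
  open Dilation R using (D; dilation)
  open Coefficients rationals using (ι)

  infixl 9 _^⁺_ _^⁻_
  _^⁺_ _^⁻_ : ∀ {m n} → Fin n → ℕ → Expr m n
  i ^⁺ n = unit i (+ n)
  i ^⁻ n = unit i (ℤ.- + n)

  2q 4q ¼ : ℚ
  2q = + 2 ℚ./ 1
  4q = + 4 ℚ./ 1
  ¼ = 𝔻.¼

  Φ-u : ∀ i → Φ i ≈ zpow (U (suc i)) (+ 5) * zpow (U i) -[1+ 1 ] * zpow (U (suc (suc i))) -[1+ 1 ]
  Φ-u i = trans (ER.Φ-J i) (elimᵘ (U i ∷ U (suc i) ∷ U (suc (suc i)) ∷ []) (ER.J (suc i) ∷ MR.νD (sq i) ∷ [])
    (λ j n → (j ⇒ 1i ^⁺ 1) ∷ (n ⇒ 1i ^⁺ 2 :* 0i ^⁻ 1 :* 2i ^⁻ 1) ∷ [] , (j :* n :* n := 1i ^⁺ 5 :* 0i ^⁻ 2 :* 2i ^⁻ 2))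
    (sym (*-identityʳ _) , ER.νD-u i , tt) ≡.refl)

  Φ⁻-u : ∀ i → Φ⁻ i ≈ zpow (U i) (+ 2) * zpow (U (suc i)) -[1+ 0 ]
  Φ⁻-u i = trans (ER.Φ⁻-J i) (elimᵘ (U i ∷ U (suc i) ∷ []) (ER.J (suc i) ∷ MR.ωD (sq i) ∷ [])
    (λ j n → (j ⇒ 1i ^⁺ 1) ∷ (n ⇒ 0i ^⁺ 1 :* 1i ^⁻ 1) ∷ [] , (j :* n :* n := 0i ^⁺ 2 :* 1i ^⁻ 1))
    (sym (*-identityʳ _) , ER.ωD-u i , tt) ≡.refl)

  Ψ-u : ∀ i → Ψ i ≈ zpow (U (suc i)) (+ 2) * zpow (U i) -[1+ 0 ]
  Ψ-u i = trans (ER.Ψ-J i) (elimᵘ (U i ∷ U (suc i) ∷ U (suc (suc i)) ∷ []) (ER.J (suc (suc i)) ∷ MR.νD (sq i) ∷ [])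
    (λ j n → (j ⇒ 2i ^⁺ 1) ∷ (n ⇒ 1i ^⁺ 2 :* 0i ^⁻ 1 :* 2i ^⁻ 1) ∷ [] , (j :* n := 1i ^⁺ 2 :* 0i ^⁻ 1))
    (sym (*-identityʳ _) , ER.νD-u i , tt) ≡.refl)

  -- Half the sum of the formulas for φ(q)² + φ(-q)² and φ(q)² - φ(-q)².
  Φ²-split : Φ 0 * Φ 0 ≈ Φ 1 * Φ 1 + ι 4q * X * (Ψ 2 * Ψ 2)
  Φ²-split = linear (ι ½ ⊙ ER.Φ²+Φ⁻² 0 ⊞ ι ½ ⊙ ER.Φ²-Φ⁻² 0)
    (solve (Φ 0 ∷ Φ⁻ 0 ∷ Φ 1 ∷ X ∷ Ψ 2 ∷ []) (λ a b c x p →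
      a :* a :- (c :* c :+ con 4q :* x :* (p :* p))
        := con ½ :* ((a :* a :+ b :* b) :- (one :+ one) :* (c :* c))
           :+ con ½ :* ((a :* a :- b :* b) :- (one :+ one) :^ 3 :* x :* (p :* p))) ≡.refl)

  opaque
    unfolding usFrom
    φ-holds : ∀ (xs : Vec Carrier 3) → value 0 9 (X ∷ xs) (1i ^⁺ 5 :* 0i ^⁻ 2 :* 2i ^⁻ 2) ≈ value 0 9 (X ∷ xs) (3i ^⁺ 5 :* 2i ^⁻ 2 :* 4i ^⁻ 2 :+ con 2q :* qᵉ :* (4i ^⁺ 2 :* 3i ^⁻ 1))
    φ-holds xs = trans (sym (Φ-u 0)) (trans (ER.Φ-split 0) (elimᵘ (usFrom 0 9) (X ∷ Φ 2 ∷ Ψ 3 ∷ [])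
      (λ x a p → (a ⇒ 3i ^⁺ 5 :* 2i ^⁻ 2 :* 4i ^⁻ 2) ∷ (p ⇒ 4i ^⁺ 2 :* 3i ^⁻ 1) ∷ [] ,
        (a :+ (one :+ one) :* x :* p := 3i ^⁺ 5 :* 2i ^⁻ 2 :* 4i ^⁻ 2 :+ con 2q :* x :* (4i ^⁺ 2 :* 3i ^⁻ 1)))
      (Φ-u 2 , Ψ-u 3 , tt) ≡.refl))
    φ²-holds : ∀ (xs : Vec Carrier 3) → value 0 9 (X ∷ xs) (1i ^⁺ 10 :* 0i ^⁻ 4 :* 2i ^⁻ 4) ≈ value 0 9 (X ∷ xs) (2i ^⁺ 10 :* 1i ^⁻ 4 :* 3i ^⁻ 4 :+ con 4q :* qᵉ :* (3i ^⁺ 4 :* 2i ^⁻ 2))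
    φ²-holds xs = linear (1# ⊙ Φ²-split) (elimᵘ (usFrom 0 9) (X ∷ Φ 0 ∷ Φ 1 ∷ Ψ 2 ∷ [])
      (λ x a b p → (a ⇒ 1i ^⁺ 5 :* 0i ^⁻ 2 :* 2i ^⁻ 2) ∷ (b ⇒ 2i ^⁺ 5 :* 1i ^⁻ 2 :* 3i ^⁻ 2) ∷ (p ⇒ 3i ^⁺ 2 :* 2i ^⁻ 1) ∷ [] ,
        (1i ^⁺ 10 :* 0i ^⁻ 4 :* 2i ^⁻ 4 :- (2i ^⁺ 10 :* 1i ^⁻ 4 :* 3i ^⁻ 4 :+ con 4q :* x :* (3i ^⁺ 4 :* 2i ^⁻ 2))
          := one :* (a :* a :- (b :* b :+ con 4q :* x :* (p :* p)))))
      (Φ-u 0 , Φ-u 1 , Ψ-u 2 , tt) ≡.refl)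
    φ²-sum-holds : ∀ (xs : Vec Carrier 3) → value 0 9 (X ∷ xs) (2i ^⁺ 10 :* 1i ^⁻ 4 :* 3i ^⁻ 4 :+ 1i ^⁺ 4 :* 2i ^⁻ 2) ≈ value 0 9 (X ∷ xs) (con 2q :* (3i ^⁺ 10 :* 2i ^⁻ 4 :* 4i ^⁻ 4))
    φ²-sum-holds xs = linear (1# ⊙ ER.Φ²+Φ⁻² 1) (elimᵘ (usFrom 0 9) (Φ 1 ∷ Φ⁻ 1 ∷ Φ 2 ∷ [])
      (λ a b c → (a ⇒ 2i ^⁺ 5 :* 1i ^⁻ 2 :* 3i ^⁻ 2) ∷ (b ⇒ 1i ^⁺ 2 :* 2i ^⁻ 1) ∷ (c ⇒ 3i ^⁺ 5 :* 2i ^⁻ 2 :* 4i ^⁻ 2) ∷ [] ,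
        ((2i ^⁺ 10 :* 1i ^⁻ 4 :* 3i ^⁻ 4 :+ 1i ^⁺ 4 :* 2i ^⁻ 2) :- con 2q :* (3i ^⁺ 10 :* 2i ^⁻ 4 :* 4i ^⁻ 4)
          := one :* ((a :* a :+ b :* b) :- (one :+ one) :* (c :* c))))
      (Φ-u 1 , Φ⁻-u 1 , Φ-u 2 , tt) ≡.refl)
    φ-difference-holds : ∀ (xs : Vec Carrier 3) → value 0 9 (X ∷ xs) (2i ^⁺ 5 :* 1i ^⁻ 2 :* 3i ^⁻ 2 :- 1i ^⁺ 2 :* 2i ^⁻ 1) ≈ value 0 9 (X ∷ xs) (con 4q :* qᵉ :^ 2 :* (5i ^⁺ 2 :* 4i ^⁻ 1))
    φ-difference-holds xs = linear (1# ⊙ ER.Φ-split 1 ⊞ (- 1#) ⊙ ER.Φ⁻-split 1) (elimᵘ (usFrom 0 9) (X ∷ Φ 1 ∷ Φ⁻ 1 ∷ Φ 3 ∷ Ψ 4 ∷ [])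
      (λ x a b c p → (a ⇒ 2i ^⁺ 5 :* 1i ^⁻ 2 :* 3i ^⁻ 2) ∷ (b ⇒ 1i ^⁺ 2 :* 2i ^⁻ 1) ∷ (p ⇒ 5i ^⁺ 2 :* 4i ^⁻ 1) ∷ [] ,
        ((2i ^⁺ 5 :* 1i ^⁻ 2 :* 3i ^⁻ 2 :- 1i ^⁺ 2 :* 2i ^⁻ 1) :- con 4q :* x :^ 2 :* (5i ^⁺ 2 :* 4i ^⁻ 1)
          := one :* (a :- (c :+ (one :+ one) :* (x :* x) :* p)) :+ (:- one) :* (b :- (c :- (one :+ one) :* (x :* x) :* p))))
      (Φ-u 1 , Φ⁻-u 1 , Ψ-u 4 , tt) ≡.refl)
  φ-law φ²-law φ²-sum-law φ-difference-law : Law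
  φ-law = record { lhs = 1i ^⁺ 5 :* 0i ^⁻ 2 :* 2i ^⁻ 2 ; rhs = 3i ^⁺ 5 :* 2i ^⁻ 2 :* 4i ^⁻ 2 :+ con 2q :* qᵉ :* (4i ^⁺ 2 :* 3i ^⁻ 1) ; holds = φ-holds }
  φ²-law = record { lhs = 1i ^⁺ 10 :* 0i ^⁻ 4 :* 2i ^⁻ 4 ; rhs = 2i ^⁺ 10 :* 1i ^⁻ 4 :* 3i ^⁻ 4 :+ con 4q :* qᵉ :* (3i ^⁺ 4 :* 2i ^⁻ 2) ; holds = φ²-holds }
  φ²-sum-law = record { lhs = 2i ^⁺ 10 :* 1i ^⁻ 4 :* 3i ^⁻ 4 :+ 1i ^⁺ 4 :* 2i ^⁻ 2 ; rhs = con 2q :* (3i ^⁺ 10 :* 2i ^⁻ 4 :* 4i ^⁻ 4) ; holds = φ²-sum-holds }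
  φ-difference-law = record { lhs = 2i ^⁺ 5 :* 1i ^⁻ 2 :* 3i ^⁻ 2 :- 1i ^⁺ 2 :* 2i ^⁻ 1 ; rhs = con 4q :* qᵉ :^ 2 :* (5i ^⁺ 2 :* 4i ^⁻ 1) ; holds = φ-difference-holds }

  module Plus = SignIdentity R.1# (R.*-identityˡ R.1#)
  module Minus = SignIdentity (R.- R.1#) [-1]²

  p₊≈ : const R.1# * X ≈ X
  p₊≈ = trans (*-congʳ (Sums.const-one R)) (*-identityˡ X)

  p₋≈ : const (R.- R.1#) * X ≈ - X
  p₋≈ = PR.pointwise λ n → R.trans (PR.const-* (R.- R.1#) X n) (RingProperties.-1*x≈-x R.ring (X n))

  o₊ : Ord 1 (const R.1# * X)
  o₊ = ord-*ʳ _ vanish-X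
  o₋ : Ord 1 (const (R.- R.1#) * X)
  o₋ = ord-*ʳ _ vanish-X

  -- Half of φ(q²)² / J_4². The right sides of `watson₊` and `watson₋` are 2M φ(q) and 2M φ(-q).
  M : Carrier
  M = ι ½ * (zpow (U 2) (+ 8) * zpow (U 1) -[1+ 3 ] * zpow (U 3) -[1+ 3 ])

  eodd : Expr 2 5
  eodd = con 2q :* 4i ^⁺ 2 :* 3i ^⁻ 5 :* 2i ^⁺ 8 :* 1i ^⁻ 4 :- con 2q :* var 0i :^ 2 :* var 1i

  eeven : Expr 1 5
  eeven = 2i ^⁺ 6 :* 3i ^⁺ 1 :* 1i ^⁻ 4 :* 4i ^⁻ 2 :- var 0i

  opaque
    unfolding usFrom Ω⁺

    rank-sum-ω : A 0 + A 1 + A 2 + A 3 + A 4 + A 5 + A 6 + A 7 ≈ X * Ω⁺ 0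
    rank-sum-ω = trans rank-sum (*-congˡ (MR.ω-cong o₊ p₊≈))

    rank-alternating-ω : A 0 - A 1 + A 2 - A 3 + A 4 - A 5 + A 6 - A 7 ≈ X * Ω⁻ 0
    rank-alternating-ω = trans rank-alternating (*-congˡ (MR.ω-cong o₋ p₋≈))

    -- The sign identity at ε = 1 divided by (q; q²)²; Watson's relation between ω(q), f(q⁸) and
    -- ω(-q⁴).
    watson₊ : (X + X) * Ω⁺ 0 + F 3 + (X + X) * (X ^ 2 * Ω⁻ 2)
              ≈ zpow (U 2) (+ 6) * zpow (U 1) (+ 1) * zpow (U 0) -[1+ 1 ] * zpow (U 3) -[1+ 3 ]
    watson₊ = linear ((zpow (U 0) -[1+ 1 ] * zpow (U 1) (+ 2)) ⊙ Plus.sign-identity)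
      (elimᵘ (usFrom 0 9) (X ∷ const R.1# * X ∷ MR.ω (const R.1# * X) ∷ Ω⁺ 0 ∷ F 3 ∷ Ω⁻ 2 ∷ MR.ωD (const R.1# * X) ∷ [])
        (λ x p w w' f v d → (p ⇒ x) ∷ (w ⇒ w') ∷ (d ⇒ 0i ^⁺ 1 :* 1i ^⁻ 1) ∷ [] ,
          (((x :+ x) :* w' :+ f :+ (x :+ x) :* (x :^ 2 :* v)) :- 2i ^⁺ 6 :* 1i ^⁺ 1 :* 0i ^⁻ 2 :* 3i ^⁻ 4
            := 0i ^⁻ 2 :* 1i ^⁺ 2 :* (((p :+ p) :* w :+ f :+ (p :+ p) :* (x :^ 2 :* v)) :* (d :* d) :- 2i ^⁺ 6 :* 1i ^⁻ 1 :* 3i ^⁻ 4)))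
        ( p₊≈ , MR.ω-cong o₊ p₊≈ , trans (Pr-cong (ord-*ˡ _ o₊) p₊≈ (*-cong p₊≈ p₊≈) 0) (ER.ωD-u 0) , tt) ≡.refl)

    watson₋ : - ((X + X) * Ω⁻ 0) + F 3 - (X + X) * (X ^ 2 * Ω⁻ 2)
              ≈ zpow (U 2) (+ 8) * zpow (U 1) -[1+ 4 ] * zpow (U 0) (+ 2) * zpow (U 3) -[1+ 3 ]
    watson₋ = linear ((zpow (U 0) (+ 2) * zpow (U 1) -[1+ 3 ] * zpow (U 2) (+ 2)) ⊙ Minus.sign-identity)
      (elimᵘ (usFrom 0 9) (X ∷ const (R.- R.1#) * X ∷ MR.ω (const (R.- R.1#) * X) ∷ Ω⁻ 0 ∷ F 3 ∷ Ω⁻ 2 ∷ MR.ωD (const (R.- R.1#) * X) ∷ [])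
        (λ x p w w' f v d → (p ⇒ :- x) ∷ (w ⇒ w') ∷ (d ⇒ 1i ^⁺ 2 :* 0i ^⁻ 1 :* 2i ^⁻ 1) ∷ [] ,
          (((:- ((x :+ x) :* w')) :+ f :- (x :+ x) :* (x :^ 2 :* v)) :- 2i ^⁺ 8 :* 1i ^⁻ 5 :* 0i ^⁺ 2 :* 3i ^⁻ 4
            := 0i ^⁺ 2 :* 1i ^⁻ 4 :* 2i ^⁺ 2 :* (((p :+ p) :* w :+ f :+ (p :+ p) :* (x :^ 2 :* v)) :* (d :* d) :- 2i ^⁺ 6 :* 1i ^⁻ 1 :* 3i ^⁻ 4)))
        ( p₋≈ , MR.ω-cong o₋ p₋≈
        , trans (Pr-cong (ord-*ˡ _ o₋) p₋≈ (*-cong p₋≈ p₋≈) 0) (trans (RootIdentities.νD≈ωD PR.series X vanish-X X vanish-X) (ER.νD-u 0)) , tt) ≡.refl)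

    -- Half the sum of the two Watson relations: ω(-q⁴) cancels, and φ(q) + φ(-q) = 2φ(q⁴) leaves
    -- one eta quotient.
    even₀ : X * (Ω⁺ 0 - Ω⁻ 0) ≈ value 0 5 (F 3 ∷ []) eeven
    even₀ = linear (ι ½ ⊙ watson₊ ⊞ ι ½ ⊙ watson₋ ⊞ M ⊙ ER.Φ-split 0 ⊞ M ⊙ ER.Φ⁻-split 0)
      (elimᵘ (usFrom 0 9) (X ∷ Ω⁺ 0 ∷ Ω⁻ 0 ∷ F 3 ∷ Ω⁻ 2 ∷ Φ 0 ∷ Φ⁻ 0 ∷ Φ 2 ∷ Ψ 3 ∷ [])
        (λ x a b f v P P' P₂ p → let m = con ½ :* (2i ^⁺ 8 :* 1i ^⁻ 4 :* 3i ^⁻ 4) in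
          (P ⇒ 1i ^⁺ 5 :* 0i ^⁻ 2 :* 2i ^⁻ 2) ∷ (P' ⇒ 0i ^⁺ 2 :* 1i ^⁻ 1) ∷ (P₂ ⇒ 3i ^⁺ 5 :* 2i ^⁻ 2 :* 4i ^⁻ 2) ∷ [] ,
          (x :* (a :- b) :- (2i ^⁺ 6 :* 3i ^⁺ 1 :* 1i ^⁻ 4 :* 4i ^⁻ 2 :- f)
            := con ½ :* (((x :+ x) :* a :+ f :+ (x :+ x) :* (x :^ 2 :* v)) :- 2i ^⁺ 6 :* 1i ^⁺ 1 :* 0i ^⁻ 2 :* 3i ^⁻ 4)
               :+ (con ½ :* (((:- ((x :+ x) :* b)) :+ f :- (x :+ x) :* (x :^ 2 :* v)) :- 2i ^⁺ 8 :* 1i ^⁻ 5 :* 0i ^⁺ 2 :* 3i ^⁻ 4)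
               :+ (m :* (P :- (P₂ :+ (one :+ one) :* x :* p)) :+ m :* (P' :- (P₂ :- (one :+ one) :* x :* p))))))
        (Φ-u 0 , Φ⁻-u 0 , Φ-u 2 , tt) ≡.refl)

    -- Half the difference of the two Watson relations: f(q⁸) cancels, φ(q) - φ(-q) = 4q ψ(q⁸), and
    -- a common factor q is removed.
    odd₀ : Ω⁺ 0 + Ω⁻ 0 ≈ value 0 5 (X ∷ Ω⁻ 2 ∷ []) eodd
    odd₀ = X^-cancel 1 (linear (ι ½ ⊙ watson₊ ⊞ ι (ℚ.- ½) ⊙ watson₋ ⊞ M ⊙ ER.Φ-split 0 ⊞ (- M) ⊙ ER.Φ⁻-split 0)
      (elimᵘ (usFrom 0 9) (X ∷ Ω⁺ 0 ∷ Ω⁻ 0 ∷ F 3 ∷ Ω⁻ 2 ∷ Φ 0 ∷ Φ⁻ 0 ∷ Φ 2 ∷ Ψ 3 ∷ [])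
        (λ x a b f v P P' P₂ p → let m = con ½ :* (2i ^⁺ 8 :* 1i ^⁻ 4 :* 3i ^⁻ 4) in
          (P ⇒ 1i ^⁺ 5 :* 0i ^⁻ 2 :* 2i ^⁻ 2) ∷ (P' ⇒ 0i ^⁺ 2 :* 1i ^⁻ 1) ∷ (p ⇒ 4i ^⁺ 2 :* 3i ^⁻ 1) ∷ [] ,
          (x :^ 1 :* (a :+ b) :- x :^ 1 :* (con 2q :* 4i ^⁺ 2 :* 3i ^⁻ 5 :* 2i ^⁺ 8 :* 1i ^⁻ 4 :- con 2q :* x :^ 2 :* v)
            := con ½ :* (((x :+ x) :* a :+ f :+ (x :+ x) :* (x :^ 2 :* v)) :- 2i ^⁺ 6 :* 1i ^⁺ 1 :* 0i ^⁻ 2 :* 3i ^⁻ 4)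
               :+ (con (ℚ.- ½) :* (((:- ((x :+ x) :* b)) :+ f :- (x :+ x) :* (x :^ 2 :* v)) :- 2i ^⁺ 8 :* 1i ^⁻ 5 :* 0i ^⁺ 2 :* 3i ^⁻ 4)
               :+ (m :* (P :- (P₂ :+ (one :+ one) :* x :* p)) :+ (:- m) :* (P' :- (P₂ :- (one :+ one) :* x :* p))))))
        (Φ-u 0 , Φ⁻-u 0 , Ψ-u 3 , tt) ≡.refl))

    ν-ω-law : ∀ i → N i ≈ zpow (U (2 ℕ.+ i)) (+ 3) * zpow (U (suc i)) -[1+ 1 ] - sq i * Ω⁺ (suc i)
    ν-ω-law i = linear ((zpow (U (suc i)) -[1+ 1 ] * zpow (U (2 ℕ.+ i)) (+ 2)) ⊙ MR.ν-ω (sq i) (osq i))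
      (elimᵘ (U i ∷ U (suc i) ∷ U (2 ℕ.+ i) ∷ []) (sq i ∷ N i ∷ Ω⁺ (suc i) ∷ MR.ωD (sq (suc i)) ∷ MR.ωD (sq i) ∷ MR.νD (sq i) ∷ MR.νS (sq i) ∷ MR.ωS (sq (suc i)) ∷ Ψ (suc i) ∷ [])
        (λ q n w W o d ns ws p →
          (ns ⇒ n :* d) ∷ (ws ⇒ w :* (W :* W)) ∷ (W ⇒ 1i ^⁺ 1 :* 2i ^⁻ 1) ∷ (o ⇒ 0i ^⁺ 1 :* 1i ^⁻ 1) ∷ (d ⇒ 1i ^⁺ 2 :* 0i ^⁻ 1 :* 2i ^⁻ 1) ∷ (p ⇒ 2i ^⁺ 2 :* 1i ^⁻ 1) ∷ [] ,
          (n :- (2i ^⁺ 3 :* 1i ^⁻ 2 :- q :* w) := 1i ^⁻ 2 :* 2i ^⁺ 2 :* ((W :* o :* ns :+ q :* ws) :- W :* p)))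
        ( sym (MR.ν-law (osq i)) , sym (MR.ω-law (osq (suc i))) , ER.ωD-u (suc i) , ER.ωD-u i , ER.νD-u i , Ψ-u (suc i) , tt) ≡.refl)

    -- By `g≈h`, G - 1 is the third order function ψ, so this is the classical relation expressing φ
    -- + 2ψ as an eta quotient.
    φ-G-law : ∀ i → Φ₃ i ≈ zpow (U (suc i)) (+ 7) * zpow (U i) -[1+ 2 ] * zpow (U (2 ℕ.+ i)) -[1+ 2 ] - ι 2q * (G i - 1#)
    φ-G-law i = linear ((zpow (U (suc i)) (+ 2) * zpow (U i) -[1+ 0 ] * zpow (U (2 ℕ.+ i)) -[1+ 0 ]) ⊙ MR.φ-ψ (sq i) (osq i))
      (elimᵘ (U i ∷ U (suc i) ∷ U (2 ℕ.+ i) ∷ []) (Φ₃ i ∷ G i ∷ MR.ωD (sq i) ∷ MR.φS (sq i) ∷ MR.φD (sq i)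
           ∷ twin 0 (Pr (sq i) (sq (2 ℕ.+ i)) ∘ suc) (Pr (sq i * sq (suc i)) (sq (2 ℕ.+ i))) (sq (2 ℕ.+ i)) 0 ∷ Φ i ∷ [])
        (λ f g o fs d t P →
          (fs ⇒ f :* d) ∷ (t ⇒ g :* o) ∷ (o ⇒ 0i ^⁺ 1 :* 1i ^⁻ 1) ∷ (d ⇒ 2i ^⁺ 1 :* 1i ^⁻ 1) ∷ (P ⇒ 1i ^⁺ 5 :* 0i ^⁻ 2 :* 2i ^⁻ 2) ∷ [] ,
          (f :- (1i ^⁺ 7 :* 0i ^⁻ 3 :* 2i ^⁻ 3 :- con 2q :* (g :- one))
            := 1i ^⁺ 2 :* 0i ^⁻ 1 :* 2i ^⁻ 1 :* ((o :* fs :+ (one :+ one) :* d :* (t :- o)) :- P)))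
        ( sym (MR.φ-law (osq i)) , sym (MR.quotient _ (MR.oωD (osq i))) , ER.ωD-u i , ER.fD-u (suc i) , Φ-u i , tt) ≡.refl)

  odd-law : ∀ i → Ω⁺ i + Ω⁻ i ≈ value i 5 (sq i ∷ Ω⁻ (2 ℕ.+ i) ∷ []) eodd
  odd-law zero = odd₀
  odd-law (suc i) = trans (sym (trans (h-+ _ _) (+-cong (D-Ω⁺ i) (D-Ω⁻ i)))) (trans (h-cong (odd-law i))
    (trans (D-value i 5 (sq i ∷ Ω⁻ (2 ℕ.+ i) ∷ []) eodd)
      (value-cong (suc i) 5 (Vec.map D (sq i ∷ Ω⁻ (2 ℕ.+ i) ∷ [])) (sq (suc i) ∷ Ω⁻ (3 ℕ.+ i) ∷ []) (λ { zero → D-sq i ; (suc zero) → D-Ω⁻ (2 ℕ.+ i) }) eodd)))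
    where open ContinuousHom dilation using (h-+; h-cong)

  even-law : ∀ i → sq i * (Ω⁺ i - Ω⁻ i) ≈ value i 5 (F (3 ℕ.+ i) ∷ []) eeven
  even-law zero = even₀
  even-law (suc i) = trans (sym (trans (h-* _ _) (*-cong (D-sq i) (trans (h-sub _ _) (+-cong (D-Ω⁺ i) (-‿cong (D-Ω⁻ i))))))) (trans (h-cong (even-law i))
    (trans (D-value i 5 (F (3 ℕ.+ i) ∷ []) eeven)
      (value-cong (suc i) 5 (Vec.map D (F (3 ℕ.+ i) ∷ [])) (F (4 ℕ.+ i) ∷ []) (λ { zero → D-F (3 ℕ.+ i) }) eeven)))
    where open ContinuousHom dilation using (h-*; h-sub; h-cong)

-- The right-hand sides as terms.

-- Tₐ-s-r is the right-hand side of the formula for Σ N⁰(a, 8; sn + r) qⁿ.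
module RightHandSides where
  open Terms
  open 𝔻 using (¼; ⅛; 𝟚)

  T0-2-1 : Term
  T0-2-1 = neg (q^ 21 ⊗ gω) ⊕ q^ 5 ⊗ J^ 5i 8 ⊗ J^ 7i 2 ⊘ (J^ 4i 4 ⊗ J^ 6i 5) ⊕ ℓ ¼ ⊗ (J^ 1i 8 ⊗ J^ 3i 2 ⊘ (J^ 0i 4 ⊗ J^ 2i 5)) ⊕ ℓ ¼ ⊗ (J^ 2i 3 ⊘ J^ 1i 2) ⊕ ℓ ½ ⊗ (J^ 1i 5 ⊗ J 4i ⊘ (J^ 0i 2 ⊗ J^ 2i 2 ⊗ J 3i)) ⊖ ℓ ½ ⊗ q^ 1 ⊗ (J^ 3i 8 ⊗ J^ 5i 2 ⊘ (J^ 2i 4 ⊗ J^ 4i 5)) ⊖ ℓ ½ ⊗ q^ 1 ⊗ (J^ 4i 3 ⊘ J^ 3i 2)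

  T0-4-1 : Term
  T0-4-1 = ℓ ¼ ⊗ (J^ 1i 9 ⊘ (J^ 0i 6 ⊗ J^ 2i 2) ⊕ J^ 1i 3 ⊘ J^ 0i 2 ⊕ ℓ 𝟚 ⊗ (J^ 2i 4 ⊘ (J 3i ⊗ J^ 1i 2)))

  T0-4-3 : Term
  T0-4-3 = neg (q^ 10 ⊗ gω) ⊕ q^ 2 ⊗ J^ 4i 8 ⊗ J^ 6i 2 ⊘ (J^ 3i 4 ⊗ J^ 5i 5) ⊕ ℓ ½ ⊗ (J^ 3i 3 ⊘ J^ 2i 2) ⊕ J^ 2i 6 ⊘ (J^ 0i 2 ⊗ J^ 1i 3) ⊖ ℓ ½ ⊗ (J^ 2i 8 ⊗ J^ 4i 2 ⊘ (J^ 1i 4 ⊗ J^ 3i 5))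

  T0-8-1 : Term
  T0-8-1 = ℓ ½ ⊗ (J^ 1i 4 ⊘ (J^ 0i 2 ⊗ J 2i)) ⊕ ℓ ¼ ⊗ (J^ 2i 5 ⊘ (J^ 0i 2 ⊗ J^ 3i 2)) ⊕ ℓ ¼ ⊗ (J^ 1i 12 ⊗ J 2i ⊘ (J^ 0i 10 ⊗ J^ 3i 2)) ⊕ ℓ 𝟚 ⊗ q^ 1 ⊗ (J^ 1i 2 ⊗ J^ 2i 3 ⊗ J^ 3i 2 ⊘ J^ 0i 6)

  T0-8-3 : Term
  T0-8-3 = neg (q^ 5 ⊗ gω) ⊕ q^ 1 ⊗ J^ 3i 8 ⊗ J^ 5i 2 ⊘ (J^ 2i 4 ⊗ J^ 4i 5) ⊕ ℓ ½ ⊗ (J^ 2i 3 ⊘ J^ 1i 2) ⊖ ℓ ½ ⊗ (J^ 1i 8 ⊗ J^ 3i 2 ⊘ (J^ 0i 4 ⊗ J^ 2i 5)) ⊕ J^ 1i 6 ⊗ J^ 2i 5 ⊘ (J^ 0i 8 ⊗ J^ 3i 2)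

  T0-8-5 : Term
  T0-8-5 = ℓ 𝟚 ⊗ (J^ 2i 9 ⊘ (J^ 0i 6 ⊗ J^ 3i 2))

  T0-8-7 : Term
  T0-8-7 = ℓ 𝟚 ⊗ (J^ 1i 8 ⊗ J^ 3i 2 ⊘ (J^ 0i 8 ⊗ J 2i))

  T1-2-0 : Term
  T1-2-0 = ℓ 0ℚ ⊖ ℓ ¼ ⊕ ℓ ¼ ⊗ gf ⊕ ℓ ½ ⊗ q^ 4 ⊗ gp ⊕ ℓ ⅛ ⊗ (J^ 1i 6 ⊗ J 2i ⊘ (J^ 0i 4 ⊗ J^ 3i 2)) ⊖ ℓ ¼ ⊗ (J^ 3i 7 ⊘ (J^ 2i 3 ⊗ J^ 4i 3)) ⊕ ℓ ¼ ⊗ (J^ 1i 5 ⊗ J^ 3i 2 ⊘ (J^ 0i 2 ⊗ J^ 2i 3 ⊗ J 4i))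

  T1-4-0 : Term
  T1-4-0 = ℓ 0ℚ ⊖ ℓ ¼ ⊕ ℓ ¼ ⊗ gf ⊕ ℓ ½ ⊗ q^ 2 ⊗ gp ⊕ ℓ ⅛ ⊗ (J^ 1i 15 ⊘ (J^ 0i 8 ⊗ J^ 2i 6))

  T1-4-2 : Term
  T1-4-2 = ℓ ½ ⊗ (J^ 1i 3 ⊗ J^ 2i 2 ⊘ J^ 0i 4 ⊕ J 2i ⊗ J 3i ⊘ J 1i)

  T1-8-0 : Term
  T1-8-0 = ℓ 0ℚ ⊖ ℓ ¼ ⊕ ℓ ¼ ⊗ gf ⊕ ℓ ½ ⊗ q^ 1 ⊗ gp ⊕ ℓ ⅛ ⊗ (J^ 1i 22 ⊘ (J^ 0i 13 ⊗ J^ 2i 8)) ⊕ ℓ 𝟚 ⊗ q^ 1 ⊗ (J^ 2i 8 ⊘ (J^ 0i 5 ⊗ J^ 1i 2))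

  T1-8-2 : Term
  T1-8-2 = ℓ ½ ⊗ (J^ 1i 16 ⊘ (J^ 0i 11 ⊗ J^ 2i 4) ⊕ J 1i ⊗ J 2i ⊘ J 0i)

  T1-8-4 : Term
  T1-8-4 = J^ 1i 10 ⊘ J^ 0i 9

  T1-8-6 : Term
  T1-8-6 = ℓ 𝟚 ⊗ (J^ 1i 4 ⊗ J^ 2i 4 ⊘ J^ 0i 7)

  T2-2-1 : Term
  T2-2-1 = ℓ 0ℚ ⊖ ℓ ½ ⊗ q⁻ 1 ⊕ ℓ ½ ⊗ q⁻ 1 ⊗ gf ⊕ ℓ ¼ ⊗ q⁻ 1 ⊗ (J^ 3i 6 ⊗ J 4i ⊘ (J^ 2i 4 ⊗ J^ 5i 2)) ⊕ ℓ ¼ ⊗ (J^ 1i 8 ⊗ J^ 3i 2 ⊘ (J^ 2i 5 ⊗ J^ 0i 4)) ⊖ ℓ ¼ ⊗ (J^ 2i 3 ⊘ J^ 1i 2)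

  T2-4-1 : Term
  T2-4-1 = q^ 1 ⊗ J^ 1i 4 ⊗ J^ 4i 2 ⊘ (J^ 0i 4 ⊗ J 3i)

  T2-4-3 : Term
  T2-4-3 = ℓ 0ℚ ⊖ ℓ ½ ⊗ q⁻ 1 ⊕ ℓ ½ ⊗ q⁻ 1 ⊗ gf ⊕ ℓ ¼ ⊗ q⁻ 1 ⊗ (J^ 2i 6 ⊗ J 3i ⊘ (J^ 1i 4 ⊗ J^ 4i 2)) ⊕ J^ 2i 6 ⊘ (J^ 0i 2 ⊗ J^ 1i 3)

  T2-8-1 : Term
  T2-8-1 = ℓ 𝟚 ⊗ ℓ 𝟚 ⊗ q^ 1 ⊗ (J^ 1i 2 ⊗ J^ 2i 3 ⊗ J^ 3i 2 ⊘ J^ 0i 6)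

  T2-8-3 : Term
  T2-8-3 = J^ 1i 6 ⊗ J^ 2i 5 ⊘ (J^ 0i 8 ⊗ J^ 3i 2)

  T2-8-5 : Term
  T2-8-5 = J^ 1i 14 ⊗ J^ 3i 2 ⊘ (J^ 0i 10 ⊗ J^ 2i 5)

  T2-8-7 : Term
  T2-8-7 = ℓ 0ℚ ⊖ ℓ ½ ⊗ q⁻ 1 ⊕ ℓ ½ ⊗ q⁻ 1 ⊗ gf ⊕ ℓ ¼ ⊗ q⁻ 1 ⊗ (J^ 1i 6 ⊗ J 2i ⊘ (J^ 0i 4 ⊗ J^ 3i 2)) ⊕ ℓ 𝟚 ⊗ (J^ 1i 8 ⊗ J^ 3i 2 ⊘ (J^ 0i 8 ⊗ J 2i))

  T3-2-0 : Term
  T3-2-0 = ℓ 0ℚ ⊖ ℓ ¼ ⊕ ℓ ¼ ⊗ gf ⊖ ℓ ½ ⊗ q^ 4 ⊗ gp ⊕ ℓ ¼ ⊗ (J^ 3i 7 ⊘ (J^ 2i 3 ⊗ J^ 4i 3)) ⊖ ℓ ¼ ⊗ (J^ 1i 5 ⊗ J^ 3i 2 ⊘ (J^ 0i 2 ⊗ J^ 2i 3 ⊗ J 4i)) ⊕ ℓ ⅛ ⊗ (J^ 1i 6 ⊗ J 2i ⊘ (J^ 0i 4 ⊗ J^ 3i 2))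

  -- The two equal eta quotients of opposite sign are kept, in agreement with the statement.
  T3-4-0 : Term
  T3-4-0 = ℓ 0ℚ ⊖ ℓ ¼ ⊕ ℓ ¼ ⊗ gf ⊖ ℓ ½ ⊗ q^ 2 ⊗ gp ⊕ ℓ ¼ ⊗ (J^ 2i 7 ⊘ (J^ 1i 3 ⊗ J^ 3i 3)) ⊖ ℓ ¼ ⊗ (J^ 2i 7 ⊘ (J^ 1i 3 ⊗ J^ 3i 3)) ⊕ ℓ ⅛ ⊗ (J^ 1i 15 ⊘ (J^ 2i 6 ⊗ J^ 0i 8))

  T3-4-2 : Term
  T3-4-2 = ℓ ½ ⊗ (J^ 1i 3 ⊗ J^ 2i 2 ⊘ J^ 0i 4 ⊖ J 2i ⊗ J 3i ⊘ J 1i)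

  T3-8-0 : Term
  T3-8-0 = ℓ 0ℚ ⊖ ℓ ¼ ⊕ ℓ ¼ ⊗ gf ⊖ ℓ ½ ⊗ q^ 1 ⊗ gp ⊕ ℓ ⅛ ⊗ (J^ 1i 22 ⊘ (J^ 0i 13 ⊗ J^ 2i 8)) ⊕ ℓ 𝟚 ⊗ q^ 1 ⊗ (J^ 2i 8 ⊘ (J^ 0i 5 ⊗ J^ 1i 2))

  T3-8-2 : Term
  T3-8-2 = ℓ ½ ⊗ (J^ 1i 16 ⊘ (J^ 0i 11 ⊗ J^ 2i 4) ⊖ J 1i ⊗ J 2i ⊘ J 0i)

  T3-8-4 : Term
  T3-8-4 = J^ 1i 10 ⊘ J^ 0i 9

  T3-8-6 : Term
  T3-8-6 = ℓ 𝟚 ⊗ (J^ 1i 4 ⊗ J^ 2i 4 ⊘ J^ 0i 7)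

  T4-2-1 : Term
  T4-2-1 = q⁻ 3 ⊖ q⁻ 3 ⊗ gf ⊖ ℓ ½ ⊗ q⁻ 3 ⊗ (J^ 5i 6 ⊗ J 6i ⊘ (J^ 4i 4 ⊗ J^ 7i 2)) ⊕ ℓ ¼ ⊗ (J^ 1i 8 ⊗ J^ 3i 2 ⊘ (J^ 0i 4 ⊗ J^ 2i 5) ⊖ ℓ 𝟚 ⊗ (J^ 1i 5 ⊗ J 4i ⊘ (J^ 0i 2 ⊗ J^ 2i 2 ⊗ J 3i)) ⊕ J^ 2i 3 ⊘ J^ 1i 2) ⊕ ℓ ½ ⊗ q^ 1 ⊗ (J^ 4i 3 ⊘ J^ 3i 2 ⊖ J^ 3i 8 ⊗ J^ 5i 2 ⊘ (J^ 2i 4 ⊗ J^ 4i 5))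

  T4-4-1 : Term
  T4-4-1 = ℓ ¼ ⊗ (J^ 1i 9 ⊘ (J^ 0i 6 ⊗ J^ 2i 2) ⊖ ℓ 𝟚 ⊗ (J^ 2i 4 ⊘ (J^ 1i 2 ⊗ J 3i)) ⊕ J^ 1i 3 ⊘ J^ 0i 2)

  T4-4-3 : Term
  T4-4-3 = q⁻ 2 ⊖ q⁻ 2 ⊗ gf ⊖ ℓ ½ ⊗ q⁻ 2 ⊗ (J^ 4i 6 ⊗ J 5i ⊘ (J^ 3i 4 ⊗ J^ 6i 2)) ⊖ ℓ ½ ⊗ (J^ 3i 3 ⊘ J^ 2i 2) ⊖ ℓ ½ ⊗ (J^ 2i 8 ⊗ J^ 4i 2 ⊘ (J^ 1i 4 ⊗ J^ 3i 5)) ⊕ J^ 2i 6 ⊘ (J^ 1i 3 ⊗ J^ 0i 2)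

  T4-8-1 : Term
  T4-8-1 = ℓ ¼ ⊗ (J^ 1i 12 ⊗ J 2i ⊘ (J^ 0i 10 ⊗ J^ 3i 2)) ⊕ ℓ 𝟚 ⊗ q^ 1 ⊗ (J^ 1i 2 ⊗ J^ 2i 3 ⊗ J^ 3i 2 ⊘ J^ 0i 6) ⊖ ℓ ½ ⊗ (J^ 1i 4 ⊘ (J^ 0i 2 ⊗ J 2i)) ⊕ ℓ ¼ ⊗ (J^ 2i 5 ⊘ (J^ 0i 2 ⊗ J^ 3i 2))

  T4-8-3 : Term
  T4-8-3 = q⁻ 1 ⊖ q⁻ 1 ⊗ gf ⊖ ℓ ½ ⊗ q⁻ 1 ⊗ (J^ 3i 6 ⊗ J 4i ⊘ (J^ 2i 4 ⊗ J^ 5i 2)) ⊖ ℓ ½ ⊗ (J^ 2i 3 ⊘ J^ 1i 2) ⊖ ℓ ½ ⊗ (J^ 1i 8 ⊗ J^ 3i 2 ⊘ (J^ 0i 4 ⊗ J^ 2i 5)) ⊕ J^ 1i 6 ⊗ J^ 2i 5 ⊘ (J^ 0i 8 ⊗ J^ 3i 2)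

  T4-8-5 : Term
  T4-8-5 = ℓ 𝟚 ⊗ (J^ 2i 9 ⊘ (J^ 0i 6 ⊗ J^ 3i 2))

  T4-8-7 : Term
  T4-8-7 = ℓ 𝟚 ⊗ (J^ 1i 8 ⊗ J^ 3i 2 ⊘ (J^ 0i 8 ⊗ J 2i))

-- Solving for the classes, and the dissections.

module Results (R : CommutativeRing 0ℓ 0ℓ) (extension : EighthRootExtension R) (algebra : RationalAlgebra R) where
  open EtaLaws R extension algebra
  open P using (solveᵘ)
  open RightHandSides
  open SR hiding (solve; elim; con; nil; one; _:+_; _:*_; _:-_; :-_; _:^_; _:=_; _⇒_)
  open ER using (sq)
  open PR using (X)
  open Dilation R using (D; D-even; double)
  open Coefficients rationals using (ι)

  ⅛ : ℚ
  ⅛ = 𝔻.⅛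

  E0 E1 E2 E3 E4 : Carrier
  E0 = odds (A 0)
  E1 = evens (A 1)
  E2 = odds (A 2)
  E3 = evens (A 3)
  E4 = odds (A 4)

  odds-of : ∀ {f g} → f ≈ X * D g → odds f ≈ g
  odds-of {f} {g} h = PR.pointwise λ n → R.trans (PR.at h (suc (double n))) (R.trans (PR.X*-suc (D g) (double n)) (D-even n g))

  evens-of : ∀ {f g} → f ≈ D g → evens f ≈ g
  evens-of {f} {g} h = PR.pointwise λ n → R.trans (PR.at h (double n)) (D-even n g)

  -- With every J_{2m} lowered to J_m, the first four are the eta quotients of `odd₀`, `L₂`, `even₀`
  -- and `L₁`, up to the constant 2 in `odd₀`. `κ₁` and `κ₃` are half the eta quotients of `odd-law`
  -- at levels 1 and 3.
  P₁ᵉ P₂ᵉ P₈ᵉ P₉ᵉ κ₁ κ₃ : ∀ {m} → Expr m 8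
  P₁ᵉ = 1i ^⁺ 8 :* 3i ^⁺ 2 :* 0i ^⁻ 4 :* 2i ^⁻ 5
  P₂ᵉ = 1i ^⁺ 5 :* 4i ^⁺ 1 :* 0i ^⁻ 2 :* 2i ^⁻ 2 :* 3i ^⁻ 1
  P₈ᵉ = 1i ^⁺ 6 :* 2i ^⁺ 1 :* 0i ^⁻ 4 :* 3i ^⁻ 2
  P₉ᵉ = 1i ^⁺ 5 :* 3i ^⁺ 2 :* 0i ^⁻ 2 :* 2i ^⁻ 3 :* 4i ^⁻ 1
  κ₁ = 5i ^⁺ 2 :* 4i ^⁻ 5 :* 3i ^⁺ 8 :* 2i ^⁻ 4
  κ₃ = 7i ^⁺ 2 :* 6i ^⁻ 5 :* 5i ^⁺ 8 :* 4i ^⁻ 4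

  -- The variables stand for q, `Ω⁻ 1`, `N 0`, `N 2`, one level below those of the formulas for
  -- `A 0`, `A 2`, `A 4`: these classes are q times a series in q², and q² is renamed q.
  w0 w2 w4 : Expr 4 8
  w0 = con ¼ :* (P₁ᵉ :- var 0i :* var 1i :+ var 2i) :+ con ½ :* (P₂ᵉ :- var 0i :* var 3i)
  w2 = con ¼ :* (P₁ᵉ :- var 0i :* var 1i :- var 2i)
  w4 = con ¼ :* (P₁ᵉ :- var 0i :* var 1i :+ var 2i) :- con ½ :* (P₂ᵉ :- var 0i :* var 3i)

  -- The variables stand for q, `F 2`, `Φ₃ 2`; the classes 1 and 3 are series in q².
  w1 w3 : Expr 3 8
  w1 = con ⅛ :* (P₈ᵉ :- var 1i) :+ con ¼ :* (P₉ᵉ :- var 2i)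
  w3 = con ⅛ :* (P₈ᵉ :- var 1i) :- con ¼ :* (P₉ᵉ :- var 2i)

  m4a = proj₁ rank-mod4
  m4b = proj₂ rank-mod4
  m8x = proj₁ (proj₁ rank-mod8)
  m8y = proj₂ (proj₁ rank-mod8)
  m8u = proj₁ (proj₂ rank-mod8)
  m8v = proj₂ (proj₂ rank-mod8)

  opaque
    unfolding usFrom Ω⁺

    -- A finite Fourier inversion: ⅛ at each of z = 1 and z = -1, ¼ for the pair ±i, and ¼ for each
    -- of the two coordinates that contain A 0 - A 4. `odd₀` then replaces ω(q) + ω(-q).
    A0-value : A 0 ≈ X * value 0 9 (X ∷ Ω⁻ 2 ∷ N 1 ∷ N 3 ∷ []) (dil w0)
    A0-value = linear (ι ⅛ ⊙ rank-sum-ω ⊞ ι ⅛ ⊙ rank-alternating-ω ⊞ ι ¼ ⊙ m4a ⊞ ι ¼ ⊙ m8y ⊞ ι (ℚ.- ¼) ⊙ m8v ⊞ (ι ⅛ * X) ⊙ odd₀)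
      (solveᵘ (usFrom 0 9) (X ∷ Ω⁻ 2 ∷ N 1 ∷ N 3 ∷ A 0 ∷ A 1 ∷ A 2 ∷ A 3 ∷ A 4 ∷ A 5 ∷ A 6 ∷ A 7 ∷ Ω⁺ 0 ∷ Ω⁻ 0 ∷ [])
        (λ x w n₁ n₃ a b c d e f g h o o' →
          let t₁ = x :^ 3 :* n₃
              t₂ = x :* (2i ^⁺ 5 :* 5i ^⁺ 1 :* 1i ^⁻ 2 :* 3i ^⁻ 2 :* 4i ^⁻ 1)
          in
          a :- x :* (con ¼ :* (2i ^⁺ 8 :* 4i ^⁺ 2 :* 1i ^⁻ 4 :* 3i ^⁻ 5 :- x :* x :* w :+ n₁) :+ con ½ :* (2i ^⁺ 5 :* 5i ^⁺ 1 :* 1i ^⁻ 2 :* 3i ^⁻ 2 :* 4i ^⁻ 1 :- x :* x :* n₃))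
            := con ⅛ :* ((a :+ b :+ c :+ d :+ e :+ f :+ g :+ h) :- x :* o)
               :+ (con ⅛ :* ((a :- b :+ c :- d :+ e :- f :+ g :- h) :- x :* o')
               :+ (con ¼ :* ((a :- c :+ e :- g) :- x :* n₁)
               :+ (con ¼ :* (((a :- e) :+ (c :- g) :+ t₁) :- t₂)
               :+ (con (ℚ.- ¼) :* (((c :- g) :- (a :- e) :- t₁) :- (:- t₂))
               :+ con ⅛ :* x :* ((o :+ o') :- (con 2q :* 4i ^⁺ 2 :* 3i ^⁻ 5 :* 2i ^⁺ 8 :* 1i ^⁻ 4 :- con 2q :* x :^ 2 :* w))))))) ≡.refl)

    A2-value : A 2 ≈ X * value 0 9 (X ∷ Ω⁻ 2 ∷ N 1 ∷ N 3 ∷ []) (dil w2)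
    A2-value = linear (ι ⅛ ⊙ rank-sum-ω ⊞ ι ⅛ ⊙ rank-alternating-ω ⊞ ι (ℚ.- ¼) ⊙ m4a ⊞ ι ¼ ⊙ m8y ⊞ ι ¼ ⊙ m8v ⊞ (ι ⅛ * X) ⊙ odd₀)
      (solveᵘ (usFrom 0 9) (X ∷ Ω⁻ 2 ∷ N 1 ∷ N 3 ∷ A 0 ∷ A 1 ∷ A 2 ∷ A 3 ∷ A 4 ∷ A 5 ∷ A 6 ∷ A 7 ∷ Ω⁺ 0 ∷ Ω⁻ 0 ∷ [])
        (λ x w n₁ n₃ a b c d e f g h o o' →
          let t₁ = x :^ 3 :* n₃
              t₂ = x :* (2i ^⁺ 5 :* 5i ^⁺ 1 :* 1i ^⁻ 2 :* 3i ^⁻ 2 :* 4i ^⁻ 1)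
          in
          c :- x :* (con ¼ :* (2i ^⁺ 8 :* 4i ^⁺ 2 :* 1i ^⁻ 4 :* 3i ^⁻ 5 :- x :* x :* w :- n₁))
            := con ⅛ :* ((a :+ b :+ c :+ d :+ e :+ f :+ g :+ h) :- x :* o)
               :+ (con ⅛ :* ((a :- b :+ c :- d :+ e :- f :+ g :- h) :- x :* o')
               :+ (con (ℚ.- ¼) :* ((a :- c :+ e :- g) :- x :* n₁)
               :+ (con ¼ :* (((a :- e) :+ (c :- g) :+ t₁) :- t₂)
               :+ (con ¼ :* (((c :- g) :- (a :- e) :- t₁) :- (:- t₂))
               :+ con ⅛ :* x :* ((o :+ o') :- (con 2q :* 4i ^⁺ 2 :* 3i ^⁻ 5 :* 2i ^⁺ 8 :* 1i ^⁻ 4 :- con 2q :* x :^ 2 :* w))))))) ≡.refl)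

    A4-value : A 4 ≈ X * value 0 9 (X ∷ Ω⁻ 2 ∷ N 1 ∷ N 3 ∷ []) (dil w4)
    A4-value = linear (ι ⅛ ⊙ rank-sum-ω ⊞ ι ⅛ ⊙ rank-alternating-ω ⊞ ι ¼ ⊙ m4a ⊞ ι (ℚ.- ¼) ⊙ m8y ⊞ ι ¼ ⊙ m8v ⊞ (ι ⅛ * X) ⊙ odd₀)
      (solveᵘ (usFrom 0 9) (X ∷ Ω⁻ 2 ∷ N 1 ∷ N 3 ∷ A 0 ∷ A 1 ∷ A 2 ∷ A 3 ∷ A 4 ∷ A 5 ∷ A 6 ∷ A 7 ∷ Ω⁺ 0 ∷ Ω⁻ 0 ∷ [])
        (λ x w n₁ n₃ a b c d e f g h o o' →
          let t₁ = x :^ 3 :* n₃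
              t₂ = x :* (2i ^⁺ 5 :* 5i ^⁺ 1 :* 1i ^⁻ 2 :* 3i ^⁻ 2 :* 4i ^⁻ 1)
          in
          e :- x :* (con ¼ :* (2i ^⁺ 8 :* 4i ^⁺ 2 :* 1i ^⁻ 4 :* 3i ^⁻ 5 :- x :* x :* w :+ n₁) :- con ½ :* (2i ^⁺ 5 :* 5i ^⁺ 1 :* 1i ^⁻ 2 :* 3i ^⁻ 2 :* 4i ^⁻ 1 :- x :* x :* n₃))
            := con ⅛ :* ((a :+ b :+ c :+ d :+ e :+ f :+ g :+ h) :- x :* o)
               :+ (con ⅛ :* ((a :- b :+ c :- d :+ e :- f :+ g :- h) :- x :* o')
               :+ (con ¼ :* ((a :- c :+ e :- g) :- x :* n₁)
               :+ (con (ℚ.- ¼) :* (((a :- e) :+ (c :- g) :+ t₁) :- t₂)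
               :+ (con ¼ :* (((c :- g) :- (a :- e) :- t₁) :- (:- t₂))
               :+ con ⅛ :* x :* ((o :+ o') :- (con 2q :* 4i ^⁺ 2 :* 3i ^⁻ 5 :* 2i ^⁺ 8 :* 1i ^⁻ 4 :- con 2q :* x :^ 2 :* w))))))) ≡.refl)

    A1-value : A 1 ≈ value 0 9 (X ∷ F 3 ∷ Φ₃ 3 ∷ []) (dil w1)
    A1-value = linear (ι ⅛ ⊙ rank-sum-ω ⊞ ι (ℚ.- ⅛) ⊙ rank-alternating-ω ⊞ ι ¼ ⊙ m4b ⊞ ι ¼ ⊙ m8x ⊞ ι ¼ ⊙ m8u ⊞ ι ⅛ ⊙ even₀)
      (solveᵘ (usFrom 0 9) (X ∷ F 3 ∷ Φ₃ 3 ∷ A 0 ∷ A 1 ∷ A 2 ∷ A 3 ∷ A 4 ∷ A 5 ∷ A 6 ∷ A 7 ∷ Ω⁺ 0 ∷ Ω⁻ 0 ∷ [])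
        (λ x v φ a b c d e f g h o o' →
          b :- (con ⅛ :* (2i ^⁺ 6 :* 3i ^⁺ 1 :* 1i ^⁻ 4 :* 4i ^⁻ 2 :- v) :+ con ¼ :* (2i ^⁺ 5 :* 4i ^⁺ 2 :* 1i ^⁻ 2 :* 3i ^⁻ 3 :* 5i ^⁻ 1 :- φ))
            := con ⅛ :* ((a :+ b :+ c :+ d :+ e :+ f :+ g :+ h) :- x :* o)
               :+ (con (ℚ.- ⅛) :* ((a :- b :+ c :- d :+ e :- f :+ g :- h) :- x :* o')
               :+ (con ¼ :* ((b :- d :+ f :- h) :- nil)
               :+ (con ¼ :* (((b :- f) :- (d :- h) :+ φ) :- 2i ^⁺ 5 :* 4i ^⁺ 2 :* 1i ^⁻ 2 :* 3i ^⁻ 3 :* 5i ^⁻ 1)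
               :+ (con ¼ :* (((b :- f) :+ (d :- h)) :- nil)
               :+ con ⅛ :* (x :* (o :- o') :- (2i ^⁺ 6 :* 3i ^⁺ 1 :* 1i ^⁻ 4 :* 4i ^⁻ 2 :- v))))))) ≡.refl)

    A3-value : A 3 ≈ value 0 9 (X ∷ F 3 ∷ Φ₃ 3 ∷ []) (dil w3)
    A3-value = linear (ι ⅛ ⊙ rank-sum-ω ⊞ ι (ℚ.- ⅛) ⊙ rank-alternating-ω ⊞ ι (ℚ.- ¼) ⊙ m4b ⊞ ι (ℚ.- ¼) ⊙ m8x ⊞ ι ¼ ⊙ m8u ⊞ ι ⅛ ⊙ even₀)
      (solveᵘ (usFrom 0 9) (X ∷ F 3 ∷ Φ₃ 3 ∷ A 0 ∷ A 1 ∷ A 2 ∷ A 3 ∷ A 4 ∷ A 5 ∷ A 6 ∷ A 7 ∷ Ω⁺ 0 ∷ Ω⁻ 0 ∷ [])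
        (λ x v φ a b c d e f g h o o' →
          d :- (con ⅛ :* (2i ^⁺ 6 :* 3i ^⁺ 1 :* 1i ^⁻ 4 :* 4i ^⁻ 2 :- v) :- con ¼ :* (2i ^⁺ 5 :* 4i ^⁺ 2 :* 1i ^⁻ 2 :* 3i ^⁻ 3 :* 5i ^⁻ 1 :- φ))
            := con ⅛ :* ((a :+ b :+ c :+ d :+ e :+ f :+ g :+ h) :- x :* o)
               :+ (con (ℚ.- ⅛) :* ((a :- b :+ c :- d :+ e :- f :+ g :- h) :- x :* o')
               :+ (con (ℚ.- ¼) :* ((b :- d :+ f :- h) :- nil)
               :+ (con (ℚ.- ¼) :* (((b :- f) :- (d :- h) :+ φ) :- 2i ^⁺ 5 :* 4i ^⁺ 2 :* 1i ^⁻ 2 :* 3i ^⁻ 3 :* 5i ^⁻ 1)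
               :+ (con ¼ :* (((b :- f) :+ (d :- h)) :- nil)
               :+ con ⅛ :* (x :* (o :- o') :- (2i ^⁺ 6 :* 3i ^⁺ 1 :* 1i ^⁻ 4 :* 4i ^⁻ 2 :- v))))))) ≡.refl)

  D-ωνν : ∀ i → Vec.lookup (Vec.map D (Ω⁻ 1 ∷ N 0 ∷ N 2 ∷ [])) i ≈ Vec.lookup (Ω⁻ 2 ∷ N 1 ∷ N 3 ∷ []) i
  D-ωνν 0i = D-Ω⁻ 1
  D-ωνν 1i = D-N 0
  D-ωνν 2i = D-N 2

  D-fφ : ∀ i → Vec.lookup (Vec.map D (F 2 ∷ Φ₃ 2 ∷ [])) i ≈ Vec.lookup (F 3 ∷ Φ₃ 3 ∷ []) i
  D-fφ 0i = D-F 2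
  D-fφ 1i = D-Φ₃ 2

  E0-value : E0 ≈ value 0 8 (X ∷ Ω⁻ 1 ∷ N 0 ∷ N 2 ∷ []) w0
  E0-value = odds-of (trans A0-value (*-congˡ (sym (D-dil 8 (Ω⁻ 1 ∷ N 0 ∷ N 2 ∷ []) (Ω⁻ 2 ∷ N 1 ∷ N 3 ∷ []) D-ωνν w0))))
  E2-value : E2 ≈ value 0 8 (X ∷ Ω⁻ 1 ∷ N 0 ∷ N 2 ∷ []) w2
  E2-value = odds-of (trans A2-value (*-congˡ (sym (D-dil 8 (Ω⁻ 1 ∷ N 0 ∷ N 2 ∷ []) (Ω⁻ 2 ∷ N 1 ∷ N 3 ∷ []) D-ωνν w2))))
  E4-value : E4 ≈ value 0 8 (X ∷ Ω⁻ 1 ∷ N 0 ∷ N 2 ∷ []) w4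
  E4-value = odds-of (trans A4-value (*-congˡ (sym (D-dil 8 (Ω⁻ 1 ∷ N 0 ∷ N 2 ∷ []) (Ω⁻ 2 ∷ N 1 ∷ N 3 ∷ []) D-ωνν w4))))
  E1-value : E1 ≈ value 0 8 (X ∷ F 2 ∷ Φ₃ 2 ∷ []) w1
  E1-value = evens-of (trans A1-value (sym (D-dil 8 (F 2 ∷ Φ₃ 2 ∷ []) (F 3 ∷ Φ₃ 3 ∷ []) D-fφ w1)))
  E3-value : E3 ≈ value 0 8 (X ∷ F 2 ∷ Φ₃ 2 ∷ []) w3
  E3-value = evens-of (trans A3-value (sym (D-dil 8 (F 2 ∷ Φ₃ 2 ∷ []) (F 3 ∷ Φ₃ 3 ∷ []) D-fφ w3)))

  f0 f1 f2 f3 f4 : Expr 4 8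
  f0 = con ¼ :* (P₁ᵉ :+ 2i ^⁺ 3 :* 1i ^⁻ 2) :+ con ½ :* (P₂ᵉ :- qᵉ :* (4i ^⁺ 3 :* 3i ^⁻ 2) :- qᵉ :* κ₁) :+ qᵉ :^ 5 :* κ₃ :- qᵉ :^ 21 :* var 1i
  f4 = qᵉ :^ 3 :* (con ¼ :* (P₁ᵉ :+ 2i ^⁺ 3 :* 1i ^⁻ 2) :- con ½ :* (P₂ᵉ :- qᵉ :* (4i ^⁺ 3 :* 3i ^⁻ 2) :+ qᵉ :* κ₁))
       :- con ½ :* (5i ^⁺ 6 :* 6i ^⁺ 1 :* 4i ^⁻ 4 :* 7i ^⁻ 2 :- var 2i)
  f2 = con ¼ :* (qᵉ :* (P₁ᵉ :- 2i ^⁺ 3 :* 1i ^⁻ 2) :+ (3i ^⁺ 6 :* 4i ^⁺ 1 :* 2i ^⁻ 4 :* 5i ^⁻ 2 :- var 2i))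
  f1 = con ⅛ :* (P₈ᵉ :- var 2i) :+ con ¼ :* (P₉ᵉ :- 3i ^⁺ 7 :* 2i ^⁻ 3 :* 4i ^⁻ 3 :+ con 2q :* (var 3i :- one))
  f3 = con ⅛ :* (P₈ᵉ :- var 2i) :- con ¼ :* (P₉ᵉ :- 3i ^⁺ 7 :* 2i ^⁻ 3 :* 4i ^⁻ 3 :+ con 2q :* (var 3i :- one))

  second : ∀ {a b c} → a + b ≈ c → b ≈ c - a
  second {a} {b} {c} h = linear (1# ⊙ h) (solve (a ∷ b ∷ c ∷ []) (λ a b c → b :- (c :- a) := one :* ((a :+ b) :- c)) ≡.refl)

  first : ∀ {a b c} → a + b ≈ c → a ≈ c - b
  first {a} {b} {c} h = linear (1# ⊙ h) (solve (a ∷ b ∷ c ∷ []) (λ a b c → a :- (c :- b) := one :* ((a :+ b) :- c)) ≡.refl)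

  opaque
    unfolding usFrom

    -- The ν are traded for ω by `ν-ω-law`. Then Ω⁺ 1 and Ω⁻ 1 enter as a sum, and after `odd-law`
    -- at level 1 so do Ω⁺ 3 and Ω⁻ 3. The factors q, q⁴ and q¹⁶ met on the way multiply to the q²¹
    -- before g(-q³²; q⁶⁴).
    E0-formula : E0 ≈ value 0 8 (env 5) f0
    E0-formula = trans E0-value (elimᵘ (usFrom 0 8) (X ∷ Ω⁻ 1 ∷ N 0 ∷ N 2 ∷ Ω⁺ 1 ∷ Ω⁺ 3 ∷ Ω⁻ 3 ∷ Ω⁻ 5 ∷ [])
      (λ x v₁ n₀ n₂ u₁ u₃ v₃ v₅ → let x₁ = x :* x ; x₂ = x₁ :* x₁ ; x₃ = x₂ :* x₂ in
        (n₀ ⇒ 2i ^⁺ 3 :* 1i ^⁻ 2 :- x :* u₁) ∷ (n₂ ⇒ 4i ^⁺ 3 :* 3i ^⁻ 2 :- x₂ :* u₃)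
          ∷ (v₁ ⇒ (con 2q :* 5i ^⁺ 2 :* 4i ^⁻ 5 :* 3i ^⁺ 8 :* 2i ^⁻ 4 :- con 2q :* x₁ :^ 2 :* v₃) :- u₁)
          ∷ (u₃ ⇒ (con 2q :* 7i ^⁺ 2 :* 6i ^⁻ 5 :* 5i ^⁺ 8 :* 4i ^⁻ 4 :- con 2q :* x₃ :^ 2 :* v₅) :- v₃) ∷ [] ,
        (con ¼ :* (P₁ᵉ :- x :* v₁ :+ n₀) :+ con ½ :* (P₂ᵉ :- x :* n₂)
          := con ¼ :* (P₁ᵉ :+ 2i ^⁺ 3 :* 1i ^⁻ 2) :+ con ½ :* (P₂ᵉ :- x :* (4i ^⁺ 3 :* 3i ^⁻ 2) :- x :* κ₁) :+ x :^ 5 :* κ₃ :- x :^ 21 :* v₅))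
      (ν-ω-law 0 , ν-ω-law 2 , second (odd-law 1) , first (odd-law 3) , tt) ≡.refl)

    -- The sign is now opposite at the second stage: what remains is Ω⁺ 3 - Ω⁻ 3 with the factor q⁵,
    -- whereas `even-law` determines q⁸ times this difference. The missing q³ is the pole in the
    -- formula, and f(q⁶⁴) appears instead of ω.
    E4-formula : X ^ 3 * E4 ≈ value 0 8 (env 6) f4
    E4-formula = trans (*-congˡ E4-value) (linear (ι (ℚ.- ½) ⊙ even-law 3) (elimᵘ (usFrom 0 8) (X ∷ Ω⁻ 1 ∷ N 0 ∷ N 2 ∷ Ω⁺ 1 ∷ Ω⁺ 3 ∷ Ω⁻ 3 ∷ F 6 ∷ [])
      (λ x v₁ n₀ n₂ u₁ u₃ v₃ f → let x₁ = x :* x ; x₂ = x₁ :* x₁ ; x₃ = x₂ :* x₂ in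
        (n₀ ⇒ 2i ^⁺ 3 :* 1i ^⁻ 2 :- x :* u₁) ∷ (n₂ ⇒ 4i ^⁺ 3 :* 3i ^⁻ 2 :- x₂ :* u₃)
          ∷ (v₁ ⇒ (con 2q :* 5i ^⁺ 2 :* 4i ^⁻ 5 :* 3i ^⁺ 8 :* 2i ^⁻ 4 :- con 2q :* x₁ :^ 2 :* v₃) :- u₁) ∷ [] ,
        (x :^ 3 :* (con ¼ :* (P₁ᵉ :- x :* v₁ :+ n₀) :- con ½ :* (P₂ᵉ :- x :* n₂))
            :- (x :^ 3 :* (con ¼ :* (P₁ᵉ :+ 2i ^⁺ 3 :* 1i ^⁻ 2) :- con ½ :* (P₂ᵉ :- x :* (4i ^⁺ 3 :* 3i ^⁻ 2) :+ x :* κ₁))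
                 :- con ½ :* (5i ^⁺ 6 :* 6i ^⁺ 1 :* 4i ^⁻ 4 :* 7i ^⁻ 2 :- f))
          := con (ℚ.- ½) :* (x₃ :* (u₃ :- v₃) :- (5i ^⁺ 6 :* 6i ^⁺ 1 :* 4i ^⁻ 4 :* 7i ^⁻ 2 :- f))))
      (ν-ω-law 0 , ν-ω-law 2 , second (odd-law 1) , tt) ≡.refl))

    -- Ω⁺ 1 - Ω⁻ 1 occurs with the factor q, and `even-law` determines q² times it; hence the simple
    -- pole and f(q¹⁶).
    E2-formula : X ^ 1 * E2 ≈ value 0 8 (env 4) f2
    E2-formula = trans (*-congˡ E2-value) (linear (ι ¼ ⊙ even-law 1) (elimᵘ (usFrom 0 8) (X ∷ Ω⁻ 1 ∷ N 0 ∷ Ω⁺ 1 ∷ F 4 ∷ [])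
      (λ x v₁ n₀ u₁ f → (n₀ ⇒ 2i ^⁺ 3 :* 1i ^⁻ 2 :- x :* u₁) ∷ [] ,
        (x :^ 1 :* (con ¼ :* (P₁ᵉ :- x :* v₁ :- n₀)) :- con ¼ :* (x :* (P₁ᵉ :- 2i ^⁺ 3 :* 1i ^⁻ 2) :+ (3i ^⁺ 6 :* 4i ^⁺ 1 :* 2i ^⁻ 4 :* 5i ^⁻ 2 :- f))
          := con ¼ :* (x :* x :* (u₁ :- v₁) :- (3i ^⁺ 6 :* 4i ^⁺ 1 :* 2i ^⁻ 4 :* 5i ^⁻ 2 :- f))))
      (ν-ω-law 0 , tt) ≡.refl))

    E1-formula : E1 ≈ value 0 8 (env 2) f1
    E1-formula = trans E1-value (elimᵘ (usFrom 0 8) (X ∷ F 2 ∷ Φ₃ 2 ∷ G 2 ∷ [])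
      (λ x f φ g → (φ ⇒ 3i ^⁺ 7 :* 2i ^⁻ 3 :* 4i ^⁻ 3 :- con 2q :* (g :- one)) ∷ [] ,
        (con ⅛ :* (P₈ᵉ :- f) :+ con ¼ :* (P₉ᵉ :- φ)
          := con ⅛ :* (P₈ᵉ :- f) :+ con ¼ :* (P₉ᵉ :- 3i ^⁺ 7 :* 2i ^⁻ 3 :* 4i ^⁻ 3 :+ con 2q :* (g :- one))))
      (φ-G-law 2 , tt) ≡.refl)

    E3-formula : E3 ≈ value 0 8 (env 2) f3
    E3-formula = trans E3-value (elimᵘ (usFrom 0 8) (X ∷ F 2 ∷ Φ₃ 2 ∷ G 2 ∷ [])
      (λ x f φ g → (φ ⇒ 3i ^⁺ 7 :* 2i ^⁻ 3 :* 4i ^⁻ 3 :- con 2q :* (g :- one)) ∷ [] ,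
        (con ⅛ :* (P₈ᵉ :- f) :- con ¼ :* (P₉ᵉ :- φ)
          := con ⅛ :* (P₈ᵉ :- f) :- con ¼ :* (P₉ᵉ :- 3i ^⁺ 7 :* 2i ^⁻ 3 :* 4i ^⁻ 3 :+ con 2q :* (g :- one))))
      (φ-G-law 2 , tt) ≡.refl)

  -- Here c is the pole order of the formula that has been derived, and b is the surplus of the
  -- offset that the term accumulates from its operations.
  represent : ∀ k t c b (w : Expr 4 8) {f} → X ^ c * f ≈ value 0 8 (env k) w → b ℕ.+ c ≡ order k t →
              P.nf (qᵉ :^ b :* w) ≡ P.nf (expr k t) → t represents[ k ] f
  represent k t c b w {f} h e check = represents (trans (*-congʳ (trans (reflexive (≡.cong (X ^_) (≡.sym e))) (^-+ X b c)))
    (trans (*-assoc _ _ _) (trans (*-congˡ h) (trans (sym (P.Semantics.nf-sound (usFrom 0 8) (env k) (qᵉ :^ b :* w)))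
      (trans (reflexive (≡.cong (P.Semantics.⟦_⟧ᵖ (usFrom 0 8) (env k)) check)) (P.Semantics.nf-sound (usFrom 0 8) (env k) (expr k t)))))))

  -- The level is read off from the mock theta argument: g(-q³²; q⁶⁴) is at level 5 here, and g(-1;
  -- q⁴), g(-1; q¹⁶), g(-1; q⁶⁴) below are at levels 2, 4, 6. Each dissection lowers the level by
  -- one.
  base0 : T0-2-1 represents[ 5 ] E0
  base0 = represent 5 T0-2-1 0 32 f0 (trans (*-identityˡ E0) E0-formula) ≡.refl ≡.refl
  base1 : T1-2-0 represents[ 2 ] E1
  base1 = represent 2 T1-2-0 0 4 f1 (trans (*-identityˡ E1) E1-formula) ≡.refl ≡.refl
  base2 : T2-2-1 represents[ 4 ] E2
  base2 = represent 4 T2-2-1 1 2 f2 E2-formula ≡.refl ≡.refl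
  base3 : T3-2-0 represents[ 2 ] E3
  base3 = represent 2 T3-2-0 0 4 f3 (trans (*-identityˡ E3) E3-formula) ≡.refl ≡.refl
  base4 : T4-2-1 represents[ 6 ] E4
  base4 = represent 6 T4-2-1 3 6 f4 E4-formula ≡.refl ≡.refl

  -- Only the two terms that contain J_1 mix parities. They are φ(q)² and φ(q) times eta quotients
  -- in q², and these quotients are the multipliers of the two laws.
  dissect0-2-1 : (T0-4-1 represents[ 4 ] evens E0) × (T0-4-3 represents[ 4 ] odds E0)
  dissect0-2-1 = dissect 4 T0-2-1 T0-4-1 T0-4-3 16 0 16 0 ≡.refl ≡.refl ≡.refl
    ((con ¼ :* (1i ^⁻ 2 :* 2i ^⁻ 1 :* 3i ^⁺ 2) , φ²-law) ∷ (con ½ :* (3i ^⁻ 1 :* 4i ^⁺ 1) , φ-law) ∷ [])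
    ≡.refl base0

  -- J_2⁹ / (J_1⁶ J_4²) is φ(q)³ times a quotient in q²; the cube is split as a square and then a
  -- single factor. In the odd half φ(q²)² from the cube meets φ(-q²)² from J_2³ / J_1², and
  -- `φ²-sum-law` joins them.
  dissect0-4-1 : (T0-8-1 represents[ 3 ] evens (evens E0)) × (T0-8-5 represents[ 3 ] odds (evens E0))
  dissect0-4-1 = dissect 3 T0-4-1 T0-8-1 T0-8-5 0 0 0 0 ≡.refl ≡.refl ≡.refl
    ((con ¼ :* (2i ^⁺ 4 :* 1i ^⁻ 6) :* Law.lhs φ-law , φ²-law) ∷ (con ¼ :* (2i ^⁺ 4 :* 1i ^⁻ 6) :* Law.rhs φ²-law , φ-law)
      ∷ (con ¼ :* (2i ^⁺ 2 :* 1i ^⁻ 2) , φ-law) ∷ (qᵉ :* (con ½ :* (2i ^⁺ 4 :* 4i ^⁺ 2 :* 1i ^⁻ 6 :* 3i ^⁻ 1)) , φ²-sum-law) ∷ [])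
    ≡.refl (proj₁ dissect0-2-1)

  dissect0-4-3 : (T0-8-3 represents[ 3 ] evens (odds E0)) × (T0-8-7 represents[ 3 ] odds (odds E0))
  dissect0-4-3 = dissect 3 T0-4-3 T0-8-3 T0-8-7 8 0 0 8 ≡.refl ≡.refl ≡.refl
    ((2i ^⁺ 8 :* 1i ^⁻ 8 , φ-law) ∷ [])
    ≡.refl (proj₂ dissect0-2-1)

  dissect1-2-0 : (T1-4-0 represents[ 1 ] evens E1) × (T1-4-2 represents[ 1 ] odds E1)
  dissect1-2-0 = dissect 1 T1-2-0 T1-4-0 T1-4-2 2 0 0 2 ≡.refl ≡.refl ≡.refl
    ((con ⅛ :* (1i ^⁻ 4 :* 2i ^⁺ 5 :* 3i ^⁻ 2) , φ²-law) ∷ (con ¼ :* (3i ^⁺ 2 :* 2i ^⁻ 1 :* 4i ^⁻ 1) , φ-law) ∷ [])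
    ≡.refl base1

  -- J_2¹⁵ / (J_1⁸ J_4⁶) is φ(q)⁴ times a quotient in q². The difference of the squares of the two
  -- sides of `φ²-law` is their difference times their sum, whence the multiplier.
  dissect1-4-0 : (T1-8-0 represents[ 0 ] evens (evens E1)) × (T1-8-4 represents[ 0 ] odds (evens E1))
  dissect1-4-0 = dissect 0 T1-4-0 T1-8-0 T1-8-4 1 0 0 1 ≡.refl ≡.refl ≡.refl
    ((con ⅛ :* (1i ^⁻ 5 :* 2i ^⁺ 2) :* (Law.lhs φ²-law :+ Law.rhs φ²-law) , φ²-law) ∷ [])
    ≡.refl (proj₁ dissect1-2-0)

  dissect1-4-2 : (T1-8-2 represents[ 0 ] evens (odds E1)) × (T1-8-6 represents[ 0 ] odds (odds E1))
  dissect1-4-2 = dissect 0 T1-4-2 T1-8-2 T1-8-6 0 0 0 0 ≡.refl ≡.refl ≡.refl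
    ((con ½ :* (1i ^⁻ 7 :* 2i ^⁺ 6) , φ²-law) ∷ [])
    ≡.refl (proj₂ dissect1-2-0)

  -- The even half is a quotient in q² times φ(q²) - φ(-q²), and `φ-difference-law` collapses it to
  -- a single eta quotient.
  dissect2-2-1 : (T2-4-1 represents[ 3 ] evens E2) × (T2-4-3 represents[ 3 ] odds E2)
  dissect2-2-1 = dissect 3 T2-2-1 T2-4-1 T2-4-3 3 3 3 0 ≡.refl ≡.refl ≡.refl
    ((con ¼ :* (1i ^⁻ 2 :* 2i ^⁻ 1 :* 3i ^⁺ 2) , φ²-law) ∷ (con ¼ :* (2i ^⁺ 4 :* 1i ^⁻ 4) , φ-difference-law) ∷ [])
    ≡.refl base2

  dissect2-4-1 : (T2-8-1 represents[ 2 ] evens (evens E2)) × (T2-8-5 represents[ 2 ] odds (evens E2))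
  dissect2-4-1 = dissect 2 T2-4-1 T2-8-1 T2-8-5 0 0 0 0 ≡.refl ≡.refl ≡.refl
    ((qᵉ :* (1i ^⁻ 6 :* 2i ^⁺ 4 :* 3i ^⁻ 1 :* 4i ^⁺ 2) , φ²-law) ∷ [])
    ≡.refl (proj₁ dissect2-2-1)

  dissect2-4-3 : (T2-8-3 represents[ 2 ] evens (odds E2)) × (T2-8-7 represents[ 2 ] odds (odds E2))
  dissect2-4-3 = dissect 2 T2-4-3 T2-8-3 T2-8-7 3 3 3 0 ≡.refl ≡.refl ≡.refl
    ((2i ^⁺ 8 :* 1i ^⁻ 8 , φ-law) ∷ [])
    ≡.refl (proj₂ dissect2-2-1)

  dissect3-2-0 : (T3-4-0 represents[ 1 ] evens E3) × (T3-4-2 represents[ 1 ] odds E3)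
  dissect3-2-0 = dissect 1 T3-2-0 T3-4-0 T3-4-2 2 0 0 2 ≡.refl ≡.refl ≡.refl
    ((con ⅛ :* (1i ^⁻ 4 :* 2i ^⁺ 5 :* 3i ^⁻ 2) , φ²-law) ∷ (con (ℚ.- ¼) :* (3i ^⁺ 2 :* 2i ^⁻ 1 :* 4i ^⁻ 1) , φ-law) ∷ [])
    ≡.refl base3

  dissect3-4-0 : (T3-8-0 represents[ 0 ] evens (evens E3)) × (T3-8-4 represents[ 0 ] odds (evens E3))
  dissect3-4-0 = dissect 0 T3-4-0 T3-8-0 T3-8-4 1 0 0 1 ≡.refl ≡.refl ≡.refl
    ((con ⅛ :* (1i ^⁻ 5 :* 2i ^⁺ 2) :* (Law.lhs φ²-law :+ Law.rhs φ²-law) , φ²-law) ∷ [])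
    ≡.refl (proj₁ dissect3-2-0)

  dissect3-4-2 : (T3-8-2 represents[ 0 ] evens (odds E3)) × (T3-8-6 represents[ 0 ] odds (odds E3))
  dissect3-4-2 = dissect 0 T3-4-2 T3-8-2 T3-8-6 0 0 0 0 ≡.refl ≡.refl ≡.refl
    ((con ½ :* (1i ^⁻ 7 :* 2i ^⁺ 6) , φ²-law) ∷ [])
    ≡.refl (proj₂ dissect3-2-0)

  dissect4-2-1 : (T4-4-1 represents[ 5 ] evens E4) × (T4-4-3 represents[ 5 ] odds E4)
  dissect4-2-1 = dissect 5 T4-2-1 T4-4-1 T4-4-3 6 3 6 0 ≡.refl ≡.refl ≡.refl
    ((con ¼ :* (1i ^⁻ 2 :* 2i ^⁻ 1 :* 3i ^⁺ 2) , φ²-law) ∷ (con (ℚ.- ½) :* (3i ^⁻ 1 :* 4i ^⁺ 1) , φ-law) ∷ [])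
    ≡.refl base4

  dissect4-4-1 : (T4-8-1 represents[ 4 ] evens (evens E4)) × (T4-8-5 represents[ 4 ] odds (evens E4))
  dissect4-4-1 = dissect 4 T4-4-1 T4-8-1 T4-8-5 0 0 0 0 ≡.refl ≡.refl ≡.refl
    ((con ¼ :* (2i ^⁺ 4 :* 1i ^⁻ 6) :* Law.lhs φ-law , φ²-law) ∷ (con ¼ :* (2i ^⁺ 4 :* 1i ^⁻ 6) :* Law.rhs φ²-law , φ-law)
      ∷ (con ¼ :* (2i ^⁺ 2 :* 1i ^⁻ 2) , φ-law) ∷ (qᵉ :* (con ½ :* (2i ^⁺ 4 :* 4i ^⁺ 2 :* 1i ^⁻ 6 :* 3i ^⁻ 1)) , φ²-sum-law) ∷ [])
    ≡.refl (proj₁ dissect4-2-1)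

  dissect4-4-3 : (T4-8-3 represents[ 4 ] evens (odds E4)) × (T4-8-7 represents[ 4 ] odds (odds E4))
  dissect4-4-3 = dissect 4 T4-4-3 T4-8-3 T4-8-7 3 0 0 3 ≡.refl ≡.refl ≡.refl
    ((2i ^⁺ 8 :* 1i ^⁻ 8 , φ-law) ∷ [])
    ≡.refl (proj₂ dissect4-2-1)

ℚ-ring : CommutativeRing 0ℓ 0ℓ
ℚ-ring = ℚₚ.+-*-commutativeRing

opaque
  ℚ-extension : EighthRootExtension ℚ-ring
  ℚ-extension = eighthRoots ℚ-ring

ℚ-algebra : RationalAlgebra ℚ-ring
ℚ-algebra = record { e = λ c → c ; e-+ = λ _ _ → ≡.refl ; e-* = λ _ _ → ≡.refl ; e-neg = λ _ → ≡.refl ; e-0 = ≡.refl ; e-1 = ≡.refl }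

-- Agreement with the concrete series and their inverses.

module SeriesOperations where
  open PowerSeries ℚ-ring public
  open Sums ℚ-ring hiding (module S) public
  module S = Series series

  sumℚ-map : {A : Set} (h : A → ℚ) → ∀ xs → 𝔻.sumℚ (List.map h xs) ≡ sumL h xs
  sumℚ-map h [] = ≡.refl
  sumℚ-map h (x ∷ xs) = ≡.cong (h x ℚ.+_) (sumℚ-map h xs)

  *ₚ≋ : ∀ f g → f 𝔻.*ₚ g ≋ f *ˢ g
  *ₚ≋ f g = pointwise λ n → ≡.trans (sumℚ-map (λ k → f k ℚ.* g (n ℕ.∸ k)) (List.upTo (suc n))) (≡.trans (sumL-applyUpTo (λ k → f k ℚ.* g (n ℕ.∸ k)) id (suc n)) (≡.sym (*ˢ-sumN n f g)))

  one≋ : 𝔻.oneₚ ≋ 1ˢ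
  one≋ = pointwise λ { zero → ≡.refl ; (suc n) → ≡.refl }

  mono≋ : ∀ k → 𝔻.mono k ≋ X S.^ k
  mono≋ zero = pointwise λ { zero → ≡.refl ; (suc n) → ≡.refl }
  mono≋ (suc k) = pointwise λ { zero → ≡.sym (X*-zero _) ; (suc n) → ≡.trans (at (mono≋ k) n) (≡.sym (X*-suc _ n)) }

  shift≋ : ∀ k f → 𝔻.shift k f ≋ X S.^ k S.* f
  shift≋ zero f = pointwise λ n → ≡.sym (1*ˢ n f)
  shift≋ (suc k) f = S.trans (pointwise λ { zero → ≡.sym (X*-zero _) ; (suc n) → ≡.sym (X*-suc (𝔻.shift k f) n) })
    (S.trans (S.*-congˡ (shift≋ k f)) (S.sym (S.*-assoc X (X S.^ k) f)))

  scale≋ : ∀ c f → 𝔻.scaleₚ c f ≋ const c S.* f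
  scale≋ c f = pointwise λ n → ≡.sym (const-* c f n)

  recip-law : ∀ p → (p ≡ 0ℚ → ⊥) → p ℚ.* 𝔻.recip p ≡ 1ℚ
  recip-law p ne with p ℚₚ.≟ 0ℚ
  ... | yes e = ⊥-elim (ne e)
  ... | no ne' = ℚₚ.*-inverseʳ p {{ℚ.≢-nonZero ne'}}

  -- `invAux` lists the coefficients from the n-th down to the 0-th, so zipping it with increasing
  -- indices is a convolution. The index map φ is arbitrary because the induction passes to φ ∘ suc.
  inverse-sum : ∀ n (c : ℕ → ℚ) (φ : ℕ → ℕ) g →
    𝔻.sumℚ (List.zipWith (λ j b → c j ℚ.* b) (List.applyUpTo φ (suc n)) (𝔻.invAux g n)) ≡ ((c ∘ φ) *ˢ 𝔻.invₚ g) n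
  inverse-sum zero c φ g = ≡.trans (ℚₚ.+-identityʳ _) (≡.sym (*ˢ-head (c ∘ φ) (𝔻.invₚ g)))
  inverse-sum (suc n) c φ g = ≡.trans (≡.cong (c (φ 0) ℚ.* 𝔻.invₚ g (suc n) ℚ.+_) (inverse-sum n c (φ ∘ suc) g))
    (≡.sym (*ˢ-tail (c ∘ φ) (𝔻.invₚ g) n))

  invₚ-law : ∀ g → (g 0 ≡ 0ℚ → ⊥) → g S.* 𝔻.invₚ g ≋ 1ˢ
  invₚ-law g ne = pointwise λ
    { zero → ≡.trans (*ˢ-head g (𝔻.invₚ g)) (recip-law (g 0) ne)
    ; (suc n) → ≡.trans (*ˢ-tail g (𝔻.invₚ g) n) (≡.trans
        (≡.cong (λ s → g 0 ℚ.* (ℚ.- (𝔻.recip (g 0) ℚ.* s)) ℚ.+ (tl g *ˢ 𝔻.invₚ g) n) (inverse-sum n (g ∘ suc) id g))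
        (cancel (g 0) (𝔻.recip (g 0)) ((tl g *ˢ 𝔻.invₚ g) n) (recip-law (g 0) ne))) }
    where
    open IntegerSolver ℚ-ring
    open RingTools ℚ-ring using (linear; _⊙_)
    cancel : ∀ a r s → a ℚ.* r ≡ 1ℚ → a ℚ.* (ℚ.- (r ℚ.* s)) ℚ.+ s ≡ 0ℚ
    cancel a r s h = linear (ℚ.- s ⊙ h) (solve (a ∷ r ∷ s ∷ []) (λ a r s →
      (a :* (:- (r :* s)) :+ s) :- nil := (:- s) :* (a :* r :- one)) ≡.refl)

  invₚ-unique : ∀ g h → g S.* h ≋ 1ˢ → 𝔻.invₚ g ≋ h
  invₚ-unique g h e = S.linear (S.- 𝔻.invₚ g S.⊙ e S.⊞ h S.⊙ invₚ-law g nonzero)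
    (S.solve (g ∷ h ∷ 𝔻.invₚ g ∷ []) (λ g h i → let open S in
      i :- h := (:- i) :* (g :* h :- one) :+ h :* (g :* i :- one)) ≡.refl)
    where
    nonzero : g 0 ≡ 0ℚ → ⊥
    nonzero z with ≡.trans (≡.sym (≡.trans (≡.sym (*ˢ-head g h)) (at e 0))) (≡.trans (≡.cong (ℚ._* h 0) z) (ℚₚ.*-zeroˡ (h 0)))
    ... | ()

  prod≋ : ∀ (F : ℕ → 𝔻.PS) (φ : ℕ → ℕ) (y : ℕ → Ser) N k → (∀ j → F (φ j) ≋ S.1# S.- y (j ℕ.+ k)) →
          𝔻.prodₚ (List.map F (List.applyUpTo φ N)) ≋ S.partialProd y N k
  prod≋ F φ y zero k h = one≋
  prod≋ F φ y (suc N) k h = S.trans (*ₚ≋ _ _) (S.*-cong (h 0)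
    (prod≋ F (φ ∘ suc) y N (suc k) (λ j → S.trans (h (suc j)) (S.reflexive (≡.cong (λ i → S.1# S.- y i) (≡.sym (ℕₚ.+-suc j k)))))))

  X^-* : ∀ m k → (X S.^ m) S.^ k S.≈ X S.^ (m ℕ.* k)
  X^-* m zero = S.reflexive (≡.cong (X S.^_) (≡.sym (ℕₚ.*-zeroʳ m)))
  X^-* m (suc k) = S.trans (S.*-congˡ (X^-* m k)) (S.trans (S.sym (S.^-+ X m (m ℕ.* k))) (S.reflexive (≡.cong (X S.^_) (≡.sym (ℕₚ.*-suc m k)))))

  Prod-split : ∀ y → S.Small y → ∀ N k → S.Prod y k S.≈ S.partialProd y N k S.* S.Prod y (N ℕ.+ k)
  Prod-split y o zero k = S.sym (S.*-identityˡ _)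
  Prod-split y o (suc N) k = S.trans (S.Prod-step y o k) (S.trans (S.*-congˡ (S.trans (Prod-split y o N (suc k))
    (S.*-congˡ (S.reflexive (≡.cong (S.Prod y) (ℕₚ.+-suc N k)))))) (S.sym (S.*-assoc _ _ _)))

  oX^ : ∀ m → S.Ord 1 (X S.^ suc m)
  oX^ m = S.ord-*ˡ _ vanish-X

  module Eta-product (m-1 : ℕ) where
    m = suc m-1
    y : ℕ → Ser
    y l = X S.^ m S.* (X S.^ m) S.^ l

    small : ∀ l → S.Ord (suc l) (y l)
    small l = S.ord-* (oX^ m-1) (S.ord-^ l (oX^ m-1))

    -- The factor with index N + k differs from 1 by a term of order N + k + 1, one more than the
    -- index. So n factors already settle the coefficient of q^n, and that is exactly where `J` is
    -- truncated.
    diff : ∀ N k → S.Ord (suc (N ℕ.+ k)) (S.partialProd y (suc N) k S.- S.partialProd y N k)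
    diff zero k = S.ord-resp (S.solve (y k ∷ []) (λ y → let open S in :- y := (one :- y) :* one :- one) ≡.refl) (S.ord-neg (small k))
    diff (suc N) k = S.ord-resp
      (S.solve (y k ∷ S.partialProd y (suc N) (suc k) ∷ S.partialProd y N (suc k) ∷ []) (λ y u v → let open S in
        (one :- y) :* (u :- v) := (one :- y) :* u :- (one :- y) :* v) ≡.refl)
      (S.ord-*ʳ (S.1# S.- y k) (≡.subst (λ i → S.Ord (suc i) (S.partialProd y (suc N) (suc k) S.- S.partialProd y N (suc k)))
                                         (ℕₚ.+-suc N k) (diff N (suc k))))

    J≋ : 𝔻.LS.ser (𝔻.J m) ≋ S.Pr (X S.^ m) (X S.^ m) 0
    J≋ = pointwise λ n → ≡.trans (at (prod≋ _ id y n 0 (λ j → S.+-cong one≋ (S.-‿cong (factor j)))) n)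
      (≡.sym (RingTools.minus-zero ℚ-ring (below (diff n 0) n (ℕ.s≤s (ℕₚ.m≤m+n n 0)))))
      where
      factor : ∀ j → 𝔻.mono (m ℕ.* suc j) S.≈ y (j ℕ.+ 0)
      factor j = S.trans (mono≋ (m ℕ.* suc j)) (S.trans (S.sym (X^-* m (suc j))) (S.reflexive (≡.cong y (≡.sym (ℕₚ.+-identityʳ j)))))

  -- Here x = ε q^a, Q = q^m and x' = ε q^{m-a}.
  module Gsum (ε : ℚ) (a m-1 : ℕ) (nonzero : 1ℚ ℚ.- (const ε S.* X S.^ a) 0 ≡ 0ℚ → ⊥)
              (x'0 : (const ε S.* X S.^ (suc m-1 ℕ.∸ a)) 0 ≡ 0ℚ) where
    m = suc m-1
    x x' Q : Ser
    x = const ε S.* X S.^ a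
    x' = const ε S.* X S.^ (m ℕ.∸ a)
    Q = X S.^ m

    oQ : S.Ord 1 Q
    oQ = oX^ m-1

    poch≋ : ∀ b N → 𝔻.poch ε b m N ≋ S.partialProd (λ l → const ε S.* X S.^ b S.* Q S.^ l) N 0
    poch≋ b N = prod≋ _ id (λ l → const ε S.* X S.^ b S.* Q S.^ l) N 0 (λ j → S.+-cong one≋ (S.-‿cong (factor j)))
      where
      factor : ∀ j → 𝔻.scaleₚ ε (𝔻.mono (b ℕ.+ m ℕ.* j)) S.≈ const ε S.* X S.^ b S.* Q S.^ (j ℕ.+ 0)
      factor j = S.trans (scale≋ ε _) (S.trans (S.*-congˡ (S.trans (mono≋ (b ℕ.+ m ℕ.* j)) (S.trans (S.^-+ X b (m ℕ.* j)) (S.*-congˡ (S.sym (X^-* m j))))))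
        (S.trans (S.sym (S.*-assoc _ _ _)) (S.reflexive (≡.cong (λ i → const ε S.* X S.^ b S.* Q S.^ i) (≡.sym (ℕₚ.+-identityʳ j))))))

    head-later : ∀ b N k → S.partialProd (λ l → const ε S.* X S.^ b S.* Q S.^ l) N (suc k) 0 ≡ 1ℚ
    head-later b zero k = ≡.refl
    head-later b (suc N) k = ≡.trans (*ˢ-head _ _) (≡.trans (≡.cong₂ ℚ._*_
      (≡.cong (λ c → 1ℚ ℚ.+ ℚ.- c) (below (S.ord-*ʳ (const ε S.* X S.^ b) (S.ord-*ˡ (Q S.^ k) oQ)) 0 (ℕ.s≤s ℕ.z≤n))) (head-later b N (suc k))) ≡.refl)

    head-all : ∀ b N → S.partialProd (λ l → const ε S.* X S.^ b S.* Q S.^ l) (suc N) 0 0 ≡ 1ℚ ℚ.- (const ε S.* X S.^ b) 0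
    head-all b N = ≡.trans (*ˢ-head _ _) (≡.trans (≡.cong₂ ℚ._*_ (≡.cong (λ c → 1ℚ ℚ.+ ℚ.- c) (at (S.*-identityʳ (const ε S.* X S.^ b)) 0)) (head-later b N 0))
      (ℚₚ.*-identityʳ _))

    head' : ∀ N → S.partialProd (λ l → x' S.* Q S.^ l) N 0 0 ≡ 1ℚ
    head' zero = ≡.refl
    head' (suc N) = ≡.trans (head-all (m ℕ.∸ a) N) (≡.cong (λ c → 1ℚ ℚ.+ ℚ.- c) x'0)

    p p' : ℕ → Ser
    p N = S.partialProd (λ l → x S.* Q S.^ l) N 0
    p' N = S.partialProd (λ l → x' S.* Q S.^ l) N 0

    den : ℕ → Ser
    den n = 𝔻.poch ε a m (suc n) 𝔻.*ₚ 𝔻.poch ε (m ℕ.∸ a) m n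

    den≋ : ∀ n → den n ≋ p (suc n) S.* p' n
    den≋ n = S.trans (*ₚ≋ _ _) (S.*-cong (poch≋ a (suc n)) (poch≋ (m ℕ.∸ a) n))

    -- The constant term of the denominator is 1 - x(0). It is 1 when a > 0, and 2 for the functions
    -- g(-1; q^m), so it is invertible over the rationals in both cases.
    den-inverse : ∀ n → p (suc n) S.* p' n S.* 𝔻.invₚ (den n) ≋ 1ˢ
    den-inverse n = S.trans (S.*-congʳ (S.sym (den≋ n))) (invₚ-law (den n) (λ z → nonzero
      (≡.trans (≡.sym (≡.trans (≡.trans (at (den≋ n) 0) (≡.trans (*ˢ-head _ _) (≡.cong₂ ℚ._*_ (head-all a n) (head' n)))) (ℚₚ.*-identityʳ _))) z)))

    t : ℕ → Ser
    t n = 𝔻.gTerm ε a m n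

    t≋ : ∀ n → t n ≋ X S.^ (m ℕ.* n ℕ.* n) S.* 𝔻.invₚ (den n)
    t≋ n = shift≋ (m ℕ.* n ℕ.* n) (𝔻.invₚ (den n))

    P P' tw : ℕ → Ser
    P = S.Pr x Q
    P' = S.Pr x' Q
    tw = S.twin 0 (P ∘ suc) P' Q

    square-large : ∀ n → n ℕ.≤ m ℕ.* n ℕ.* n
    square-large zero = ℕ.z≤n
    square-large (suc n) = ℕₚ.≤-trans (ℕₚ.m≤n*m (suc n) m) (ℕₚ.m≤m*n (m ℕ.* suc n) (suc n))

    oX : ∀ n → S.Ord n (X S.^ (m ℕ.* n ℕ.* n))
    oX n = S.ord-≤ (square-large n) (S.ord-^ _ vanish-X)

    square-step : ∀ k → X S.^ (m ℕ.* suc k ℕ.* suc k) S.≈ X S.^ (m ℕ.* k ℕ.* k) S.* (Q S.^ 1 S.* (Q S.^ k) S.^ 2)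
    square-step k = S.trans (S.reflexive (≡.cong (X S.^_) (expanded m k))) (S.trans (S.^-+ X (m ℕ.* k ℕ.* k) _) (S.*-congˡ
      (S.trans (S.^-+ X m (m ℕ.* k ℕ.+ m ℕ.* k)) (S.trans (S.*-congˡ (S.^-+ X (m ℕ.* k) (m ℕ.* k)))
        (S.elim (Q ∷ X S.^ (m ℕ.* k) ∷ Q S.^ k ∷ []) (λ Q a b → let open S in (a ⇒ b) ∷ [] , (Q :* (a :* a) := Q :^ 1 :* b :^ 2))
          (S.sym (X^-* m k) , tt) ≡.refl)))))
      where
      expanded : ∀ m k → m ℕ.* suc k ℕ.* suc k ≡ m ℕ.* k ℕ.* k ℕ.+ (m ℕ.+ (m ℕ.* k ℕ.+ m ℕ.* k))
      expanded = solve-∀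

    -- Telescoping as for the rank series: the two infinite products clear the denominators of all
    -- terms at once, and the quotient of consecutive powers of q is the coefficient in the twin
    -- recursion.
    gSum-law : P 0 S.* P' 0 S.* 𝔻.gSum ε a m S.≈ tw 0
    gSum-law = S.trans (S.*-congˡ gSum≋) (S.trans (S.*-sum∞ (P 0 S.* P' 0) U t (λ k → S.ord-resp (S.sym (t≋ k)) (S.ord-*ˡ _ (oX k))) (λ k → S.ord-*ˡ _ (oX k)) step)
        (S.trans (S.*-congʳ (S.reflexive (≡.cong (X S.^_) (ℕₚ.*-zeroʳ (m ℕ.* 0))))) (S.*-identityˡ _)))
      where
      gSum≋ : 𝔻.gSum ε a m S.≈ S.sum∞ t
      gSum≋ = pointwise λ n → ≡.trans (sumℚ-map (λ k → t k n) (List.upTo (suc n))) (≡.trans (sumL-applyUpTo (λ k → t k n) id (suc n)) (≡.sym (sum∞-coeff t n)))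
      U : ℕ → Ser
      U k = X S.^ (m ℕ.* k ℕ.* k) S.* tw k
      tail-index : ∀ {x} k → S.Pr x Q (k ℕ.+ 0) S.≈ S.Pr x Q k
      tail-index {x} k = S.reflexive (≡.cong (S.Pr x Q) (ℕₚ.+-identityʳ k))
      step : ∀ k → U k S.≈ P 0 S.* P' 0 S.* t k S.+ U (suc k)
      step k = S.linear ((S.- (c S.* P (suc k) S.* P' k)) S.⊙ den-inverse k)
        (S.elim (c ∷ X S.^ (m ℕ.* suc k ℕ.* suc k) ∷ tw k ∷ tw (suc k) ∷ P 0 ∷ P' 0 ∷ P (suc k) ∷ P' k ∷ t k ∷ 𝔻.invₚ (den k) ∷ p (suc k) ∷ p' k ∷ Q ∷ Q S.^ k ∷ [])
          (λ c c₁ w w₁ P P' P₁ P'ₖ t i p p' Q K → let open S in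
            (t ⇒ c :* i) ∷ (c₁ ⇒ c :* (Q :^ 1 :* K :^ 2)) ∷ (w ⇒ P₁ :* P'ₖ :+ Q :^ 1 :* K :^ 2 :* w₁) ∷ (P ⇒ p :* P₁) ∷ (P' ⇒ p' :* P'ₖ) ∷ [] ,
            (c :* w :- (P :* P' :* t :+ c₁ :* w₁) := (:- (c :* P₁ :* P'ₖ)) :* (p :* p' :* i :- one)))
          ( t≋ k , square-step k , S.twin-step 0 _ _ oQ k
          , S.trans (Prod-split _ (λ l → S.ord-geo x l oQ) (suc k) 0) (S.*-congˡ (tail-index (suc k)))
          , S.trans (Prod-split _ (λ l → S.ord-geo x' l oQ) k 0) (S.*-congˡ (tail-index k)) , tt) ≡.refl)
        where c = X S.^ (m ℕ.* k ℕ.* k)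

index : Fin 8 → ℕ
index = position 0

-- The operations on Laurent series are parameters here: neutral operations let the right-hand sides be compared with the
-- values of the terms symbol by symbol, whereas the concrete operations would be unfolded into coefficients.
module TermEvaluation {L : Set} (ℓ : ℚ → L) (q^ q⁻ J : ℕ → L) (g⁻ g⁺ : ℕ → ℕ → L)
                      (_⊕_ _⊖_ _⊗_ _⊘_ : L → L → L) (_^_ : L → ℕ → L) (neg : L → L) where
  open Terms using (Denominator; Term)

  eval-denominator : Denominator → L
  eval-denominator (Terms.J i) = J (2 ℕ.^ index i)
  eval-denominator (Terms.J^ i n) = J (2 ℕ.^ index i) ^ n
  eval-denominator (a Terms.⊗ b) = eval-denominator a ⊗ eval-denominator b

  eval : ℕ → Term → L
  eval k (Terms.ℓ c) = ℓ c
  eval k (Terms.q^ n) = q^ n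
  eval k (Terms.q⁻ n) = q⁻ n
  eval k (Terms.J i) = J (2 ℕ.^ index i)
  eval k (Terms.J^ i n) = J (2 ℕ.^ index i) ^ n
  eval k Terms.gω = g⁻ (2 ℕ.^ k) (2 ℕ.* 2 ℕ.^ k)
  eval k Terms.gf = g⁻ 0 (2 ℕ.^ k)
  eval k Terms.gp = g⁺ (2 ℕ.^ k) (4 ℕ.* 2 ℕ.^ k)
  eval k (a Terms.⊕ b) = eval k a ⊕ eval k b
  eval k (a Terms.⊖ b) = eval k a ⊖ eval k b
  eval k (a Terms.⊗ b) = eval k a ⊗ eval k b
  eval k (a Terms.⊘ d) = eval k a ⊘ eval-denominator d
  eval k (Terms.neg a) = neg (eval k a)

module Interpretation where
  open Terms
  open SeriesOperations
  open RankIdentities ℚ-ring ℚ-extension using (module ER; module MR)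
  open Formulas ℚ-ring ℚ-extension ℚ-algebra
  open S using (Carrier; _≈_; refl; sym; trans; reflexive; _+_; _*_; _-_; -_; 1#; _^_; Pr; twin; Ord; +-cong; +-congˡ; *-cong; *-congˡ; *-congʳ; -‿cong)
  open ER using (sq; osq)

  sq≈ : ∀ k → sq k ≈ X ^ (2 ℕ.^ k)
  sq≈ zero = sym (S.*-identityʳ X)
  sq≈ (suc k) = trans (*-cong (sq≈ k) (sq≈ k)) (trans (sym (S.^-+ X (2 ℕ.^ k) (2 ℕ.^ k)))
    (reflexive (≡.cong (λ i → X ^ (2 ℕ.^ k ℕ.+ i)) (≡.sym (ℕₚ.+-identityʳ (2 ℕ.^ k))))))

  oX^2^ : ∀ k → Ord 1 (X ^ (2 ℕ.^ k))
  oX^2^ k = S.ord-resp (sq≈ k) (osq k)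

  J-level : ∀ k → 𝔻.LS.ser (𝔻.J (2 ℕ.^ k)) ≈ ER.J k
  J-level k = trans
    (≡.subst (λ m → 𝔻.LS.ser (𝔻.J m) ≈ Pr (X ^ m) (X ^ m) 0) (ℕₚ.suc-pred (2 ℕ.^ k) {{ℕₚ.m^n≢0 2 k}}) (Eta-product.J≋ (ℕ.pred (2 ℕ.^ k))))
    (S.Pr-cong (oX^2^ k) (sym (sq≈ k)) (sym (sq≈ k)) 0)

  X^-head : ∀ n → .{{ℕ.NonZero n}} → (X ^ n) 0 ≡ 0ℚ
  X^-head (suc n) = X*-zero _

  minus-one : ∀ f → const (ℚ.- 1ℚ) * f ≈ - f
  minus-one f = pointwise λ n → ≡.trans (const-* (ℚ.- 1ℚ) f n) (RingProperties.-1*x≈-x (CommutativeRing.ring ℚ-ring) (f n))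

  gSum-product : ∀ ε a m → .{{ℕ.NonZero m}} → .{{ℕ.NonZero (m ℕ.∸ a)}} → (1ℚ ℚ.- ε ℚ.* (X ^ a) 0 ≡ 0ℚ → ⊥) →
    ∀ {x x' Q} → const ε * X ^ a ≈ x → const ε * X ^ (m ℕ.∸ a) ≈ x' → X ^ m ≈ Q →
    Pr x Q 0 * Pr x' Q 0 * 𝔻.gSum ε a m ≈ twin 0 (Pr x Q ∘ suc) (Pr x' Q) Q 0
  gSum-product ε a m@(suc m-1) nonzero ex ex' eQ = trans
    (*-congʳ (*-cong (sym (S.Pr-cong G.oQ ex eQ 0)) (sym (S.Pr-cong G.oQ ex' eQ 0))))
    (trans G.gSum-law (S.twin-cong 0 G.oQ (λ k → S.Pr-cong G.oQ ex eQ (suc k)) (S.Pr-cong G.oQ ex' eQ) eQ 0))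
    where
    module G = Gsum ε a m-1 (λ z → nonzero (≡.trans (≡.cong (λ c → 1ℚ ℚ.- c) (≡.sym (const-* ε (X ^ a) 0))) z))
      (≡.trans (const-* ε (X ^ (m ℕ.∸ a)) 0) (≡.trans (≡.cong (ε ℚ.*_) (X^-head (m ℕ.∸ a))) (ℚₚ.*-zeroʳ ε)))

  scaled-difference : ∀ ε h → 𝔻.scaleₚ ε (h 𝔻.-ₚ 𝔻.oneₚ) ≈ const ε * (h - 1#)
  scaled-difference ε h = trans (scale≋ ε (h 𝔻.-ₚ 𝔻.oneₚ)) (*-congˡ {const ε} (+-congˡ {h} (-‿cong one≋)))

  2^-nonZero : ∀ k → ℕ.NonZero (2 ℕ.^ k)
  2^-nonZero k = ℕₚ.m^n≢0 2 k

  head-nonzero : ∀ ε k → 1ℚ ℚ.- ε ℚ.* (X ^ (2 ℕ.^ k)) 0 ≡ 0ℚ → ⊥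
  head-nonzero ε k z with ≡.trans (≡.sym (≡.cong (λ c → 1ℚ ℚ.- c) (≡.trans (≡.cong (ε ℚ.*_) (X^-head (2 ℕ.^ k) {{2^-nonZero k}})) (ℚₚ.*-zeroʳ ε)))) z
  ... | ()

  opaque
    unfolding Ω⁺

    Ω⁻-law : ∀ k → Ω⁻ k * (MR.ωD (- sq k) * MR.ωD (- sq k)) ≈ MR.ωS (- sq k)
    Ω⁻-law k = MR.ω-law (S.ord-neg (osq k))

    F-law : ∀ k → F k * (MR.fD (sq k) * MR.fD (sq k)) ≈ MR.fS (sq k)
    F-law k = MR.f-law (osq k)

    G-quotient : ∀ k → twin 0 (Pr (sq k) (sq (2 ℕ.+ k)) ∘ suc) (Pr (sq k * sq (suc k)) (sq (2 ℕ.+ k))) (sq (2 ℕ.+ k)) 0 * S.recip₁ (MR.ωD (sq k)) ≈ G k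
    G-quotient k = refl

  -- By `ω-shift` the sum in g(-x; x²) equals 1 - x ω(-x). Subtracting 1 and changing the sign
  -- leaves x ω(-x), and the offset 2^k of g removes the factor x.
  gω-value : ∀ k → 𝔻.LS.ser (𝔻.g⁻ (2 ℕ.^ k) (2 ℕ.* 2 ℕ.^ k)) ≈ X ^ (2 ℕ.^ k) * Ω⁻ k
  gω-value k = trans (scaled-difference (ℚ.- 1ℚ) g) (trans (minus-one (g - 1#)) (S.elim (g ∷ X ^ a ∷ q ∷ Ω⁻ k ∷ [])
      (λ g x q w → let open S in (g ⇒ one :- q :* w) ∷ (q ⇒ x) ∷ [] , (:- (g :- one) := x :* w)) (gSum≈ , sq≈ k , tt) ≡.refl))
    where
    a = 2 ℕ.^ k
    q = sq k
    g = 𝔻.gSum (ℚ.- 1ℚ) a (2 ℕ.* a)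
    difference : 2 ℕ.* a ℕ.∸ a ≡ a
    difference = ≡.trans (≡.cong (ℕ._∸ a) (≡.cong (a ℕ.+_) (ℕₚ.+-identityʳ a))) (ℕₚ.m+n∸n≡m a a)
    x≈ : const (ℚ.- 1ℚ) * X ^ a ≈ - q
    x≈ = trans (minus-one _) (-‿cong (sym (sq≈ k)))
    law : MR.νD q * MR.νD q * g ≈ MR.νD q * MR.νD q - q * twin 1 (Pr (- q) (q * q) ∘ suc) (Pr (- q) (q * q) ∘ suc) (q * q) 0
    law = trans (gSum-product (ℚ.- 1ℚ) a (2 ℕ.* a) {{2^-nonZero (suc k)}} {{≡.subst ℕ.NonZero (≡.sym difference) (2^-nonZero k)}} (head-nonzero (ℚ.- 1ℚ) k)
        x≈ (trans (reflexive (≡.cong (λ i → const (ℚ.- 1ℚ) * X ^ i) difference)) x≈) (sym (sq≈ (suc k))))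
      (MR.ω-shift q (osq k))
    square : (- q) * (- q) ≈ q * q
    square = S.solve (q ∷ []) (λ q → let open S in (:- q) :* (:- q) := q :* q) ≡.refl
    o² : Ord 1 ((- q) * (- q))
    o² = S.ord-*ˡ _ (S.ord-neg (osq k))
    gSum≈ : g ≈ 1# - q * Ω⁻ k
    gSum≈ = S.cancel-square (MR.oνD (osq k)) (S.linear (1# S.⊙ law S.⊞ q S.⊙ Ω⁻-law k)
      (S.elim (MR.νD q ∷ g ∷ q ∷ twin 1 (Pr (- q) (q * q) ∘ suc) (Pr (- q) (q * q) ∘ suc) (q * q) 0 ∷ MR.ωS (- q) ∷ MR.ωD (- q) ∷ Ω⁻ k ∷ [])
        (λ n g q T w d Ω → let open S in (w ⇒ T) ∷ (d ⇒ n) ∷ [] ,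
          (n :* n :* g :- n :* n :* (one :- q :* Ω) := one :* (n :* n :* g :- (n :* n :- q :* T)) :+ q :* (Ω :* (d :* d) :- w)))
        ( S.twin-cong 1 o² (λ j → S.Pr-cong o² refl square (suc j)) (λ j → S.Pr-cong o² refl square (suc j)) square 0
        , S.Pr-cong o² refl square 0 , tt) ≡.refl))

  -- (-1; x)_∞ is 2 (-x; x)_∞, so twice the sum in g(-1; x) is f(x).
  gf-value : ∀ k → 𝔻.LS.ser (𝔻.g⁻ 0 (2 ℕ.^ k)) ≈ 1# - const ½ * F k
  gf-value k = trans (scaled-difference (ℚ.- 1ℚ) g) (trans (minus-one (g - 1#)) (S.linear ((- const ½) S.⊙ doubled S.⊞ g S.⊙ half)
      (S.solve (g ∷ const ½ ∷ F k ∷ []) (λ g c f → let open S in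
        (:- (g :- one)) :- (one :- c :* f) := (:- c) :* ((one :+ one) :* g :- f) :+ g :* (c :* (one :+ one) :- one)) ≡.refl)))
    where
    m = 2 ℕ.^ k
    q = sq k
    g = 𝔻.gSum (ℚ.- 1ℚ) 0 m
    half : const ½ * (1# + 1#) ≈ 1#
    half = pointwise λ { zero → const-* ½ _ 0 ; (suc n) → const-* ½ _ (suc n) }
    law : Pr (- 1#) q 0 * Pr (- q) q 0 * g ≈ twin 0 (Pr (- 1#) q ∘ suc) (Pr (- q) q) q 0
    law = gSum-product (ℚ.- 1ℚ) 0 m {{2^-nonZero k}} {{2^-nonZero k}} (λ ()) (minus-one _)
      (trans (minus-one _) (-‿cong (sym (sq≈ k)))) (sym (sq≈ k))
    Pr-suc : ∀ j → Pr (- 1#) q (suc j) ≈ Pr (- q) q j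
    Pr-suc = S.Prod-unique _ (Pr (- 1#) q ∘ suc) (λ l → S.ord-geo (- q) l (osq k)) (λ j → S.ord-≤ (ℕₚ.n≤1+n j) (S.Pr-one (- 1#) (osq k) (suc j)))
      (λ j → trans (S.Pr-step (- 1#) (osq k) (suc j)) (*-congʳ
        (S.solve (q ∷ q ^ j ∷ []) (λ q a → let open S in one :- (:- one) :* (q :* a) := one :- (:- q) :* a) ≡.refl)))
    doubled : (1# + 1#) * g ≈ F k
    doubled = S.cancel-square (MR.ofD (osq k)) (S.linear (1# S.⊙ law S.⊞ (- 1#) S.⊙ F-law k)
      (S.elim (MR.fD q ∷ g ∷ F k ∷ Pr (- 1#) q 0 ∷ Pr (- 1#) q 1 ∷ MR.fS q ∷ twin 0 (Pr (- 1#) q ∘ suc) (Pr (- q) q) q 0 ∷ [])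
        (λ d g f p p₁ s t → let open S in (t ⇒ s) ∷ (p ⇒ (one :+ one) :* p₁) ∷ (p₁ ⇒ d) ∷ [] ,
          (d :* d :* ((one :+ one) :* g) :- d :* d :* f := one :* (p :* d :* g :- t) :+ (:- one) :* (f :* (d :* d) :- s)))
        ( S.twin-cong 0 (osq k) Pr-suc (λ _ → refl) refl 0
        , trans (S.Pr-step (- 1#) (osq k) 0) (*-congʳ (S.solve [] (let open S in one :- (:- one) :* one := one :+ one) ≡.refl))
        , Pr-suc 0 , tt) ≡.refl))

  -- The products of x and of x³ in base x⁴ merge into (x; x²)_∞, which is the denominator in `G`.
  gp-value : ∀ k → 𝔻.LS.ser (𝔻.g⁺ (2 ℕ.^ k) (4 ℕ.* 2 ℕ.^ k)) ≈ G k - 1#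
  gp-value k = trans (scaled-difference 1ℚ g) (trans (trans (*-congʳ const-one) (S.*-identityˡ _)) (S.+-congʳ gSum≈))
    where
    a = 2 ℕ.^ k
    q = sq k
    Q = sq (2 ℕ.+ k)
    g = 𝔻.gSum 1ℚ a (4 ℕ.* a)
    tw = twin 0 (Pr q Q ∘ suc) (Pr (q * sq (suc k)) Q) Q 0
    quadruple : ∀ a → 4 ℕ.* a ≡ a ℕ.+ 2 ℕ.* a ℕ.+ a
    quadruple = solve-∀
    difference : 4 ℕ.* a ℕ.∸ a ≡ a ℕ.+ 2 ℕ.* a
    difference = ≡.trans (≡.cong (ℕ._∸ a) (quadruple a)) (ℕₚ.m+n∸n≡m (a ℕ.+ 2 ℕ.* a) a)
    one* : ∀ {f h} → h ≈ f → const 1ℚ * f ≈ h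
    one* e = trans (*-congʳ const-one) (trans (S.*-identityˡ _) (sym e))
    4a : 4 ℕ.* a ≡ 2 ℕ.^ (2 ℕ.+ k)
    4a = ℕₚ.*-assoc 2 2 a
    law : Pr q Q 0 * Pr (q * sq (suc k)) Q 0 * g ≈ tw
    law = gSum-product 1ℚ a (4 ℕ.* a) {{≡.subst ℕ.NonZero (≡.sym 4a) (2^-nonZero (2 ℕ.+ k))}}
      {{≡.subst ℕ.NonZero (≡.sym difference) (ℕ.>-nonZero (ℕₚ.≤-trans (ℕ.>-nonZero⁻¹ a {{2^-nonZero k}}) (ℕₚ.m≤m+n a _)))}} (head-nonzero 1ℚ k)
      (one* (sq≈ k)) (trans (reflexive (≡.cong (λ i → const 1ℚ * X ^ i) difference)) (one* (trans (*-cong (sq≈ k) (sq≈ (suc k))) (sym (S.^-+ X a _)))))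
      (trans (reflexive (≡.cong (X ^_) 4a)) (sym (sq≈ (2 ℕ.+ k))))
    gSum≈ : g ≈ G k
    gSum≈ = trans (S.linear (S.recip₁ (MR.ωD q) S.⊙ law S.⊞ (- g) S.⊙ S.recip₁-law (MR.oωD (osq k)))
      (S.elim (g ∷ tw ∷ S.recip₁ (MR.ωD q) ∷ MR.ωD q ∷ Pr q Q 0 ∷ Pr (q * sq (suc k)) Q 0 ∷ [])
        (λ g t r d p p' → let open S in (d ⇒ p :* p') ∷ [] ,
          (g :- t :* r := r :* (p :* p' :* g :- t) :+ (:- g) :* (d :* r :- one)))
        (Classical.Pr-split series q (osq (suc k)) 0 , tt) ≡.refl)) (G-quotient k)

  open TermEvaluation 𝔻.ℓ 𝔻.q^ 𝔻.q⁻ 𝔻.J 𝔻.g⁻ 𝔻.g⁺ 𝔻._⊕_ 𝔻._⊖_ 𝔻._⊗_ 𝔻._⊘_ 𝔻._^_ 𝔻.neg public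

  shifted-value : ∀ {u v f g} → u ≡ v → f ≈ g → 𝔻.shift u f ≈ X ^ v * g
  shifted-value {u} {f = f} ≡.refl e = trans (shift≋ u f) (*-congˡ e)

  ⊗-value : ∀ x y {f g} → 𝔻.LS.ser x ≈ f → 𝔻.LS.ser y ≈ g → 𝔻.LS.ser (x 𝔻.⊗ y) ≈ f * g
  ⊗-value 𝔻.⟨ _ , f ⟩ 𝔻.⟨ _ , g ⟩ e e' = trans (*ₚ≋ f g) (*-cong e e')

  ^-off : ∀ x → 𝔻.LS.off x ≡ 0 → ∀ n → 𝔻.LS.off (x 𝔻.^ n) ≡ 0
  ^-off x e zero = ≡.refl
  ^-off x e (suc n) = ≡.cong₂ ℕ._+_ e (^-off x e n)

  ^-value : ∀ x {f} → 𝔻.LS.ser x ≈ f → ∀ n → 𝔻.LS.ser (x 𝔻.^ n) ≈ f ^ n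
  ^-value x e zero = one≋
  ^-value x e (suc n) = ⊗-value x (x 𝔻.^ n) e (^-value x e n)

  ⊘-value : ∀ x y {f g h} → 𝔻.LS.off y ≡ 0 → 𝔻.LS.ser x ≈ f → 𝔻.LS.ser y ≈ g → g * h ≈ 1# → 𝔻.LS.ser (x 𝔻.⊘ y) ≈ f * h
  ⊘-value 𝔻.⟨ _ , f ⟩ 𝔻.⟨ _ , g ⟩ z e e' inv = trans (shifted-value z refl) (trans (S.*-identityˡ _) (trans (*ₚ≋ f (𝔻.invₚ g))
    (*-cong e (invₚ-unique g _ (trans (*-congʳ e') inv)))))

  module _ (k : ℕ) where
    ⟦_⟧ : P.Expr 4 8 → Carrier
    ⟦_⟧ = value 0 8 (env k)

    unit-value : ∀ i z → P.zpow (U (index i)) z ≈ ⟦ P.unit i z ⟧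
    unit-value i z = lookup-U 0 8 i {index i} ≡.refl z

    J-value : ∀ i → 𝔻.LS.ser (𝔻.J (2 ℕ.^ index i)) ≈ ⟦ P.unit i (+ 1) ⟧
    J-value i = trans (J-level (index i)) (trans (sym (S.*-identityʳ _)) (unit-value i (+ 1)))

    J^-off : ∀ i n → 𝔻.LS.off (𝔻.J (2 ℕ.^ index i) 𝔻.^ n) ≡ 0
    J^-off i = ^-off (𝔻.J (2 ℕ.^ index i)) ≡.refl

    J^-value : ∀ i n → 𝔻.LS.ser (𝔻.J (2 ℕ.^ index i) 𝔻.^ n) ≈ ⟦ P.unit i (+ 1) ⟧ ^ n
    J^-value i = ^-value (𝔻.J (2 ℕ.^ index i)) (J-value i)

    denominator-off : ∀ d → 𝔻.LS.off (eval-denominator d) ≡ 0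
    denominator-off (J i) = ≡.refl
    denominator-off (J^ i n) = J^-off i n
    denominator-off (a ⊗ b) = ≡.cong₂ ℕ._+_ (denominator-off a) (denominator-off b)

    denominator-value : ∀ d → 𝔻.LS.ser (eval-denominator d) ≈ ⟦ denominator d ⟧
    denominator-value (J i) = J-value i
    denominator-value (J^ i n) = J^-value i n
    denominator-value (a ⊗ b) = ⊗-value (eval-denominator a) (eval-denominator b) (denominator-value a) (denominator-value b)

    power-inverse : ∀ {u v} n → u * v ≈ 1# → u ^ n * v ^ n ≈ 1#
    power-inverse zero e = S.*-identityˡ 1#
    power-inverse (suc n) e = trans (S.interchange-* _ _ _ _) (trans (*-cong e (power-inverse n e)) (S.*-identityˡ 1#))

    denominator-inverse : ∀ d → ⟦ denominator d ⟧ * ⟦ inverse d ⟧ ≈ 1#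
    denominator-inverse (J i) = trans (*-cong (sym (unit-value i (+ 1))) (sym (unit-value i -[1+ 0 ])))
      (trans (*-cong (S.*-identityʳ _) (S.*-identityʳ _)) (P.Unit.elt*inv (U (index i))))
    denominator-inverse (J^ i n) = power-inverse n (denominator-inverse (J i))
    denominator-inverse (a ⊗ b) = trans (S.interchange-* _ _ _ _) (trans (*-cong (denominator-inverse a) (denominator-inverse b)) (S.*-identityˡ 1#))

    order-sound : ∀ t → 𝔻.LS.off (eval k t) ≡ order k t
    order-sound (ℓ c) = ≡.refl
    order-sound (q^ n) = ≡.refl
    order-sound (q⁻ n) = ≡.refl
    order-sound (J i) = ≡.refl
    order-sound (J^ i n) = J^-off i n
    order-sound gω = ≡.refl
    order-sound gf = ≡.refl
    order-sound gp = ≡.refl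
    order-sound (a ⊕ b) = ≡.cong₂ ℕ._+_ (order-sound a) (order-sound b)
    order-sound (a ⊖ b) = ≡.cong₂ ℕ._+_ (order-sound a) (order-sound b)
    order-sound (a ⊗ b) = ≡.cong₂ ℕ._+_ (order-sound a) (order-sound b)
    order-sound (a ⊘ d) = order-sound a
    order-sound (neg a) = order-sound a

    value-sound : ∀ t → 𝔻.LS.ser (eval k t) ≈ ⟦ expr k t ⟧
    value-sound (ℓ c) = trans (scale≋ c 𝔻.oneₚ) (trans (*-congˡ one≋) (S.*-identityʳ _))
    value-sound (q^ n) = mono≋ n
    value-sound (q⁻ n) = one≋
    value-sound (J i) = J-value i
    value-sound (J^ i n) = J^-value i n
    value-sound gω = gω-value k
    value-sound gf = gf-value k
    value-sound gp = gp-value k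
    value-sound (a ⊕ b) = +-cong (shifted-value (order-sound b) (value-sound a)) (shifted-value (order-sound a) (value-sound b))
    value-sound (a ⊖ b) = +-cong (shifted-value (order-sound b) (value-sound a)) (-‿cong (shifted-value (order-sound a) (value-sound b)))
    value-sound (a ⊗ b) = ⊗-value (eval k a) (eval k b) (value-sound a) (value-sound b)
    value-sound (a ⊘ d) = ⊘-value (eval k a) (eval-denominator d) (denominator-off d) (value-sound a) (denominator-value d) (denominator-inverse d)
    value-sound (neg a) = ⊗-value (𝔻.ℓ (ℚ.- 1ℚ)) (eval k a) (value-sound (ℓ (ℚ.- 1ℚ))) (value-sound a)

    -- The left side has offset 0, so the equality of Laurent series is the cleared equation stored
    -- in `represents`.
    sound : ∀ t {f g} → t represents[ k ] f → (∀ n → g n ≡ f n) → 𝔻.↑ g 𝔻.≈ eval k t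
    sound t {f} {g} (represents h) e n = at (trans (shifted-value (order-sound t) (pointwise e)) (trans h (sym (value-sound t)))) n

  nat≡ : ∀ k → + k ℚ./ 1 ≡ RingTools.nat ℚ-ring k
  nat≡ zero = ≡.refl
  nat≡ (suc k) = ≡.trans (ℚₚ.toℚᵘ-injective (ℚᵘₚ.≃-trans (ℚₚ.toℚᵘ-fromℚᵘ (mkℚᵘ (+ suc k) 0)) (ℚᵘₚ.≃-trans
      (*≡* (≡.cong (λ i → (+ 1 ℤ.+ i) ℤ.* + 1) (≡.sym (ℤₚ.*-identityʳ (+ k)))))
      (ℚᵘₚ.≃-sym (ℚᵘₚ.≃-trans (ℚₚ.toℚᵘ-homo-+ 1ℚ (+ k ℚ./ 1)) (ℚᵘₚ.+-cong {ℚ.toℚᵘ 1ℚ} ℚᵘₚ.≃-refl (ℚₚ.toℚᵘ-fromℚᵘ (mkℚᵘ (+ k) 0))))))))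
    (≡.cong (1ℚ ℚ.+_) (nat≡ k))

-- Arithmetic progressions and assembly of the formulas.

module Generating where
  open Dilation ℚ-ring using (double)
  open RankIdentities ℚ-ring ℚ-extension using (A)
  open Formulas ℚ-ring ℚ-extension ℚ-algebra using (_represents[_]_)
  open Interpretation

  double≡ : ∀ n → double n ≡ n ℕ.+ n
  double≡ zero = ≡.refl
  double≡ (suc n) = ≡.cong suc (≡.trans (≡.cong suc (double≡ n)) (≡.sym (ℕₚ.+-suc n n)))

  Progression : ℕ → ℕ → (ℕ → ℕ) → Set
  Progression s r φ = ∀ n → s ℕ.* n ℕ.+ r ≡ φ n

  identity : Progression 1 0 (λ n → n)
  identity n = ≡.trans (ℕₚ.+-identityʳ _) (ℕₚ.*-identityˡ n)

  evenly : ∀ s r φ → Progression s r φ → Progression (s ℕ.+ s) r (λ n → φ (double n))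
  evenly s r φ h n = ≡.trans (rearrange s r n) (≡.trans (≡.cong (λ i → s ℕ.* i ℕ.+ r) (≡.sym (double≡ n))) (h (double n)))
    where
    rearrange : ∀ s r n → (s ℕ.+ s) ℕ.* n ℕ.+ r ≡ s ℕ.* (n ℕ.+ n) ℕ.+ r
    rearrange = solve-∀

  oddly : ∀ s r φ → Progression s r φ → Progression (s ℕ.+ s) (s ℕ.+ r) (λ n → φ (suc (double n)))
  oddly s r φ h n = ≡.trans (rearrange s r n) (≡.trans (≡.cong (λ i → s ℕ.* suc i ℕ.+ r) (≡.sym (double≡ n))) (h (suc (double n))))
    where
    rearrange : ∀ s r n → (s ℕ.+ s) ℕ.* n ℕ.+ (s ℕ.+ r) ≡ s ℕ.* suc (n ℕ.+ n) ℕ.+ r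
    rearrange = solve-∀

  generating : ∀ a s r φ → Progression s r φ → ∀ k t → t represents[ k ] (λ n → A a (φ n)) → 𝔻.GF (+ a) s r 𝔻.≈ eval k t
  generating a s r φ h k t rep = sound k t {λ n → A a (φ n)} {λ n → + 𝔻.N⁰ (+ a) 8 (s ℕ.* n ℕ.+ r) ℚ./ 1} rep
    (λ n → ≡.trans (nat≡ (𝔻.N⁰ (+ a) 8 (s ℕ.* n ℕ.+ r))) (≡.cong (A a) (h n)))


  2n+0 : Progression 2 0 (λ n → double n)
  2n+0 = evenly 1 0 (λ n → n) identity

  2n+1 : Progression 2 1 (λ n → suc (double n))
  2n+1 = oddly 1 0 (λ n → n) identity

  4n+0 : Progression 4 0 (λ n → double (double n))
  4n+0 = evenly 2 0 (λ n → double n) 2n+0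

  4n+1 : Progression 4 1 (λ n → suc (double (double n)))
  4n+1 = evenly 2 1 (λ n → suc (double n)) 2n+1

  4n+2 : Progression 4 2 (λ n → double (suc (double n)))
  4n+2 = oddly 2 0 (λ n → double n) 2n+0

  4n+3 : Progression 4 3 (λ n → suc (double (suc (double n))))
  4n+3 = oddly 2 1 (λ n → suc (double n)) 2n+1

  8n+0 : Progression 8 0 (λ n → double (double (double n)))
  8n+0 = evenly 4 0 (λ n → double (double n)) 4n+0

  8n+1 : Progression 8 1 (λ n → suc (double (double (double n))))
  8n+1 = evenly 4 1 (λ n → suc (double (double n))) 4n+1

  8n+2 : Progression 8 2 (λ n → double (suc (double (double n))))
  8n+2 = evenly 4 2 (λ n → double (suc (double n))) 4n+2

  8n+3 : Progression 8 3 (λ n → suc (double (suc (double (double n)))))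
  8n+3 = evenly 4 3 (λ n → suc (double (suc (double n)))) 4n+3

  8n+4 : Progression 8 4 (λ n → double (double (suc (double n))))
  8n+4 = oddly 4 0 (λ n → double (double n)) 4n+0

  8n+5 : Progression 8 5 (λ n → suc (double (double (suc (double n)))))
  8n+5 = oddly 4 1 (λ n → suc (double (double n))) 4n+1

  8n+6 : Progression 8 6 (λ n → double (suc (double (suc (double n)))))
  8n+6 = oddly 4 2 (λ n → double (suc (double n))) 4n+2

  8n+7 : Progression 8 7 (λ n → suc (double (suc (double (suc (double n))))))
  8n+7 = oddly 4 3 (λ n → suc (double (suc (double n)))) 4n+3

module Formulae {L : Set} (ℓ : ℚ → L) (q^ q⁻ J : ℕ → L) (g⁻ g⁺ : ℕ → ℕ → L)
                (_⊕_ _⊖_ _⊗_ _⊘_ : L → L → L) (_^_ : L → ℕ → L) (neg : L → L)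
                (GF : ℤ → ℕ → ℕ → L) (_≈_ : L → L → Set) where
  open 𝔻 using (¼; ⅛; 𝟚)
  open Generating using (Progression; 2n+0; 2n+1; 4n+0; 4n+1; 4n+2; 4n+3; 8n+0; 8n+1; 8n+2; 8n+3; 8n+4; 8n+5; 8n+6; 8n+7)
  open Dilation ℚ-ring using (double)
  open TermEvaluation ℓ q^ q⁻ J g⁻ g⁺ _⊕_ _⊖_ _⊗_ _⊘_ _^_ neg
  open RightHandSides
  open Results ℚ-ring ℚ-extension ℚ-algebra hiding (⅛)
  open Formulas ℚ-ring ℚ-extension ℚ-algebra using (_represents[_]_)
  open RankIdentities ℚ-ring ℚ-extension using (A)

  formulae :
    (∀ a s r φ → Progression s r φ → ∀ k t → t represents[ k ] (λ n → A a (φ n)) → GF (+ a) s r ≈ eval k t) →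
    (GF (+ 0) 2 1 ≈ ((((((neg (q^ 21 ⊗ g⁻ 32 64) ⊕ (((q^ 5 ⊗ (J 32 ^ 8)) ⊗ (J 128 ^ 2)) ⊘ ((J 16 ^ 4) ⊗ (J 64 ^ 5)))) ⊕ (ℓ ¼ ⊗ (((J 2 ^ 8) ⊗ (J 8 ^ 2)) ⊘ ((J 1 ^ 4) ⊗ (J 4 ^ 5))))) ⊕ (ℓ ¼ ⊗ ((J 4 ^ 3) ⊘ (J 2 ^ 2)))) ⊕ (ℓ ½ ⊗ (((J 2 ^ 5) ⊗ J 16) ⊘ (((J 1 ^ 2) ⊗ (J 4 ^ 2)) ⊗ J 8)))) ⊖ ((ℓ ½ ⊗ q^ 1) ⊗ (((J 8 ^ 8) ⊗ (J 32 ^ 2)) ⊘ ((J 4 ^ 4) ⊗ (J 16 ^ 5))))) ⊖ ((ℓ ½ ⊗ q^ 1) ⊗ ((J 16 ^ 3) ⊘ (J 8 ^ 2)))))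
    × (GF (+ 0) 4 1 ≈ (ℓ ¼ ⊗ ((((J 2 ^ 9) ⊘ ((J 1 ^ 6) ⊗ (J 4 ^ 2))) ⊕ ((J 2 ^ 3) ⊘ (J 1 ^ 2))) ⊕ (ℓ 𝟚 ⊗ ((J 4 ^ 4) ⊘ (J 8 ⊗ (J 2 ^ 2)))))))
    × (GF (+ 0) 4 3 ≈ ((((neg (q^ 10 ⊗ g⁻ 16 32) ⊕ (((q^ 2 ⊗ (J 16 ^ 8)) ⊗ (J 64 ^ 2)) ⊘ ((J 8 ^ 4) ⊗ (J 32 ^ 5)))) ⊕ (ℓ ½ ⊗ ((J 8 ^ 3) ⊘ (J 4 ^ 2)))) ⊕ ((J 4 ^ 6) ⊘ ((J 1 ^ 2) ⊗ (J 2 ^ 3)))) ⊖ (ℓ ½ ⊗ (((J 4 ^ 8) ⊗ (J 16 ^ 2)) ⊘ ((J 2 ^ 4) ⊗ (J 8 ^ 5))))))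
    × (GF (+ 0) 8 1 ≈ ((((ℓ ½ ⊗ ((J 2 ^ 4) ⊘ ((J 1 ^ 2) ⊗ J 4))) ⊕ (ℓ ¼ ⊗ ((J 4 ^ 5) ⊘ ((J 1 ^ 2) ⊗ (J 8 ^ 2))))) ⊕ (ℓ ¼ ⊗ (((J 2 ^ 12) ⊗ J 4) ⊘ ((J 1 ^ 10) ⊗ (J 8 ^ 2))))) ⊕ ((ℓ 𝟚 ⊗ q^ 1) ⊗ ((((J 2 ^ 2) ⊗ (J 4 ^ 3)) ⊗ (J 8 ^ 2)) ⊘ (J 1 ^ 6)))))
    × (GF (+ 0) 8 3 ≈ ((((neg (q^ 5 ⊗ g⁻ 8 16) ⊕ (((q^ 1 ⊗ (J 8 ^ 8)) ⊗ (J 32 ^ 2)) ⊘ ((J 4 ^ 4) ⊗ (J 16 ^ 5)))) ⊕ (ℓ ½ ⊗ ((J 4 ^ 3) ⊘ (J 2 ^ 2)))) ⊖ (ℓ ½ ⊗ (((J 2 ^ 8) ⊗ (J 8 ^ 2)) ⊘ ((J 1 ^ 4) ⊗ (J 4 ^ 5))))) ⊕ (((J 2 ^ 6) ⊗ (J 4 ^ 5)) ⊘ ((J 1 ^ 8) ⊗ (J 8 ^ 2)))))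
    × (GF (+ 0) 8 5 ≈ (ℓ 𝟚 ⊗ ((J 4 ^ 9) ⊘ ((J 1 ^ 6) ⊗ (J 8 ^ 2)))))
    × (GF (+ 0) 8 7 ≈ (ℓ 𝟚 ⊗ (((J 2 ^ 8) ⊗ (J 8 ^ 2)) ⊘ ((J 1 ^ 8) ⊗ J 4))))
    × (GF (+ 1) 2 0 ≈ ((((((ℓ 0ℚ ⊖ ℓ ¼) ⊕ (ℓ ¼ ⊗ g⁻ 0 4)) ⊕ ((ℓ ½ ⊗ q^ 4) ⊗ g⁺ 4 16)) ⊕ (ℓ ⅛ ⊗ (((J 2 ^ 6) ⊗ J 4) ⊘ ((J 1 ^ 4) ⊗ (J 8 ^ 2))))) ⊖ (ℓ ¼ ⊗ ((J 8 ^ 7) ⊘ ((J 4 ^ 3) ⊗ (J 16 ^ 3))))) ⊕ (ℓ ¼ ⊗ (((J 2 ^ 5) ⊗ (J 8 ^ 2)) ⊘ (((J 1 ^ 2) ⊗ (J 4 ^ 3)) ⊗ J 16)))))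
    × (GF (+ 1) 4 0 ≈ ((((ℓ 0ℚ ⊖ ℓ ¼) ⊕ (ℓ ¼ ⊗ g⁻ 0 2)) ⊕ ((ℓ ½ ⊗ q^ 2) ⊗ g⁺ 2 8)) ⊕ (ℓ ⅛ ⊗ ((J 2 ^ 15) ⊘ ((J 1 ^ 8) ⊗ (J 4 ^ 6))))))
    × (GF (+ 1) 4 2 ≈ (ℓ ½ ⊗ ((((J 2 ^ 3) ⊗ (J 4 ^ 2)) ⊘ (J 1 ^ 4)) ⊕ ((J 4 ⊗ J 8) ⊘ J 2))))
    × (GF (+ 1) 8 0 ≈ (((((ℓ 0ℚ ⊖ ℓ ¼) ⊕ (ℓ ¼ ⊗ g⁻ 0 1)) ⊕ ((ℓ ½ ⊗ q^ 1) ⊗ g⁺ 1 4)) ⊕ (ℓ ⅛ ⊗ ((J 2 ^ 22) ⊘ ((J 1 ^ 13) ⊗ (J 4 ^ 8))))) ⊕ ((ℓ 𝟚 ⊗ q^ 1) ⊗ ((J 4 ^ 8) ⊘ ((J 1 ^ 5) ⊗ (J 2 ^ 2))))))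
    × (GF (+ 1) 8 2 ≈ (ℓ ½ ⊗ (((J 2 ^ 16) ⊘ ((J 1 ^ 11) ⊗ (J 4 ^ 4))) ⊕ ((J 2 ⊗ J 4) ⊘ J 1))))
    × (GF (+ 1) 8 4 ≈ ((J 2 ^ 10) ⊘ (J 1 ^ 9)))
    × (GF (+ 1) 8 6 ≈ (ℓ 𝟚 ⊗ (((J 2 ^ 4) ⊗ (J 4 ^ 4)) ⊘ (J 1 ^ 7))))
    × (GF (+ 2) 2 1 ≈ (((((ℓ 0ℚ ⊖ (ℓ ½ ⊗ q⁻ 1)) ⊕ ((ℓ ½ ⊗ q⁻ 1) ⊗ g⁻ 0 16)) ⊕ ((ℓ ¼ ⊗ q⁻ 1) ⊗ (((J 8 ^ 6) ⊗ J 16) ⊘ ((J 4 ^ 4) ⊗ (J 32 ^ 2))))) ⊕ (ℓ ¼ ⊗ (((J 2 ^ 8) ⊗ (J 8 ^ 2)) ⊘ ((J 4 ^ 5) ⊗ (J 1 ^ 4))))) ⊖ (ℓ ¼ ⊗ ((J 4 ^ 3) ⊘ (J 2 ^ 2)))))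
    × (GF (+ 2) 4 1 ≈ (((q^ 1 ⊗ (J 2 ^ 4)) ⊗ (J 16 ^ 2)) ⊘ ((J 1 ^ 4) ⊗ J 8)))
    × (GF (+ 2) 4 3 ≈ ((((ℓ 0ℚ ⊖ (ℓ ½ ⊗ q⁻ 1)) ⊕ ((ℓ ½ ⊗ q⁻ 1) ⊗ g⁻ 0 8)) ⊕ ((ℓ ¼ ⊗ q⁻ 1) ⊗ (((J 4 ^ 6) ⊗ J 8) ⊘ ((J 2 ^ 4) ⊗ (J 16 ^ 2))))) ⊕ ((J 4 ^ 6) ⊘ ((J 1 ^ 2) ⊗ (J 2 ^ 3)))))
    × (GF (+ 2) 8 1 ≈ (((ℓ 𝟚 ⊗ ℓ 𝟚) ⊗ q^ 1) ⊗ ((((J 2 ^ 2) ⊗ (J 4 ^ 3)) ⊗ (J 8 ^ 2)) ⊘ (J 1 ^ 6))))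
    × (GF (+ 2) 8 3 ≈ (((J 2 ^ 6) ⊗ (J 4 ^ 5)) ⊘ ((J 1 ^ 8) ⊗ (J 8 ^ 2))))
    × (GF (+ 2) 8 5 ≈ (((J 2 ^ 14) ⊗ (J 8 ^ 2)) ⊘ ((J 1 ^ 10) ⊗ (J 4 ^ 5))))
    × (GF (+ 2) 8 7 ≈ ((((ℓ 0ℚ ⊖ (ℓ ½ ⊗ q⁻ 1)) ⊕ ((ℓ ½ ⊗ q⁻ 1) ⊗ g⁻ 0 4)) ⊕ ((ℓ ¼ ⊗ q⁻ 1) ⊗ (((J 2 ^ 6) ⊗ J 4) ⊘ ((J 1 ^ 4) ⊗ (J 8 ^ 2))))) ⊕ (ℓ 𝟚 ⊗ (((J 2 ^ 8) ⊗ (J 8 ^ 2)) ⊘ ((J 1 ^ 8) ⊗ J 4)))))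
    × (GF (+ 3) 2 0 ≈ ((((((ℓ 0ℚ ⊖ ℓ ¼) ⊕ (ℓ ¼ ⊗ g⁻ 0 4)) ⊖ ((ℓ ½ ⊗ q^ 4) ⊗ g⁺ 4 16)) ⊕ (ℓ ¼ ⊗ ((J 8 ^ 7) ⊘ ((J 4 ^ 3) ⊗ (J 16 ^ 3))))) ⊖ (ℓ ¼ ⊗ (((J 2 ^ 5) ⊗ (J 8 ^ 2)) ⊘ (((J 1 ^ 2) ⊗ (J 4 ^ 3)) ⊗ J 16)))) ⊕ (ℓ ⅛ ⊗ (((J 2 ^ 6) ⊗ J 4) ⊘ ((J 1 ^ 4) ⊗ (J 8 ^ 2))))))
    × (GF (+ 3) 4 0 ≈ ((((((ℓ 0ℚ ⊖ ℓ ¼) ⊕ (ℓ ¼ ⊗ g⁻ 0 2)) ⊖ ((ℓ ½ ⊗ q^ 2) ⊗ g⁺ 2 8)) ⊕ (ℓ ¼ ⊗ ((J 4 ^ 7) ⊘ ((J 2 ^ 3) ⊗ (J 8 ^ 3))))) ⊖ (ℓ ¼ ⊗ ((J 4 ^ 7) ⊘ ((J 2 ^ 3) ⊗ (J 8 ^ 3))))) ⊕ (ℓ ⅛ ⊗ ((J 2 ^ 15) ⊘ ((J 4 ^ 6) ⊗ (J 1 ^ 8))))))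
    × (GF (+ 3) 4 2 ≈ (ℓ ½ ⊗ ((((J 2 ^ 3) ⊗ (J 4 ^ 2)) ⊘ (J 1 ^ 4)) ⊖ ((J 4 ⊗ J 8) ⊘ J 2))))
    × (GF (+ 3) 8 0 ≈ (((((ℓ 0ℚ ⊖ ℓ ¼) ⊕ (ℓ ¼ ⊗ g⁻ 0 1)) ⊖ ((ℓ ½ ⊗ q^ 1) ⊗ g⁺ 1 4)) ⊕ (ℓ ⅛ ⊗ ((J 2 ^ 22) ⊘ ((J 1 ^ 13) ⊗ (J 4 ^ 8))))) ⊕ ((ℓ 𝟚 ⊗ q^ 1) ⊗ ((J 4 ^ 8) ⊘ ((J 1 ^ 5) ⊗ (J 2 ^ 2))))))
    × (GF (+ 3) 8 2 ≈ (ℓ ½ ⊗ (((J 2 ^ 16) ⊘ ((J 1 ^ 11) ⊗ (J 4 ^ 4))) ⊖ ((J 2 ⊗ J 4) ⊘ J 1))))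
    × (GF (+ 3) 8 4 ≈ ((J 2 ^ 10) ⊘ (J 1 ^ 9)))
    × (GF (+ 3) 8 6 ≈ (ℓ 𝟚 ⊗ (((J 2 ^ 4) ⊗ (J 4 ^ 4)) ⊘ (J 1 ^ 7))))
    × (GF (+ 4) 2 1 ≈ ((((q⁻ 3 ⊖ (q⁻ 3 ⊗ g⁻ 0 64)) ⊖ ((ℓ ½ ⊗ q⁻ 3) ⊗ (((J 32 ^ 6) ⊗ J 64) ⊘ ((J 16 ^ 4) ⊗ (J 128 ^ 2))))) ⊕ (ℓ ¼ ⊗ (((((J 2 ^ 8) ⊗ (J 8 ^ 2)) ⊘ ((J 1 ^ 4) ⊗ (J 4 ^ 5))) ⊖ (ℓ 𝟚 ⊗ (((J 2 ^ 5) ⊗ J 16) ⊘ (((J 1 ^ 2) ⊗ (J 4 ^ 2)) ⊗ J 8)))) ⊕ ((J 4 ^ 3) ⊘ (J 2 ^ 2))))) ⊕ ((ℓ ½ ⊗ q^ 1) ⊗ (((J 16 ^ 3) ⊘ (J 8 ^ 2)) ⊖ (((J 8 ^ 8) ⊗ (J 32 ^ 2)) ⊘ ((J 4 ^ 4) ⊗ (J 16 ^ 5)))))))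
    × (GF (+ 4) 4 1 ≈ (ℓ ¼ ⊗ ((((J 2 ^ 9) ⊘ ((J 1 ^ 6) ⊗ (J 4 ^ 2))) ⊖ (ℓ 𝟚 ⊗ ((J 4 ^ 4) ⊘ ((J 2 ^ 2) ⊗ J 8)))) ⊕ ((J 2 ^ 3) ⊘ (J 1 ^ 2)))))
    × (GF (+ 4) 4 3 ≈ (((((q⁻ 2 ⊖ (q⁻ 2 ⊗ g⁻ 0 32)) ⊖ ((ℓ ½ ⊗ q⁻ 2) ⊗ (((J 16 ^ 6) ⊗ J 32) ⊘ ((J 8 ^ 4) ⊗ (J 64 ^ 2))))) ⊖ (ℓ ½ ⊗ ((J 8 ^ 3) ⊘ (J 4 ^ 2)))) ⊖ (ℓ ½ ⊗ (((J 4 ^ 8) ⊗ (J 16 ^ 2)) ⊘ ((J 2 ^ 4) ⊗ (J 8 ^ 5))))) ⊕ ((J 4 ^ 6) ⊘ ((J 2 ^ 3) ⊗ (J 1 ^ 2)))))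
    × (GF (+ 4) 8 1 ≈ ((((ℓ ¼ ⊗ (((J 2 ^ 12) ⊗ J 4) ⊘ ((J 1 ^ 10) ⊗ (J 8 ^ 2)))) ⊕ ((ℓ 𝟚 ⊗ q^ 1) ⊗ ((((J 2 ^ 2) ⊗ (J 4 ^ 3)) ⊗ (J 8 ^ 2)) ⊘ (J 1 ^ 6)))) ⊖ (ℓ ½ ⊗ ((J 2 ^ 4) ⊘ ((J 1 ^ 2) ⊗ J 4)))) ⊕ (ℓ ¼ ⊗ ((J 4 ^ 5) ⊘ ((J 1 ^ 2) ⊗ (J 8 ^ 2))))))
    × (GF (+ 4) 8 3 ≈ (((((q⁻ 1 ⊖ (q⁻ 1 ⊗ g⁻ 0 16)) ⊖ ((ℓ ½ ⊗ q⁻ 1) ⊗ (((J 8 ^ 6) ⊗ J 16) ⊘ ((J 4 ^ 4) ⊗ (J 32 ^ 2))))) ⊖ (ℓ ½ ⊗ ((J 4 ^ 3) ⊘ (J 2 ^ 2)))) ⊖ (ℓ ½ ⊗ (((J 2 ^ 8) ⊗ (J 8 ^ 2)) ⊘ ((J 1 ^ 4) ⊗ (J 4 ^ 5))))) ⊕ (((J 2 ^ 6) ⊗ (J 4 ^ 5)) ⊘ ((J 1 ^ 8) ⊗ (J 8 ^ 2)))))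
    × (GF (+ 4) 8 5 ≈ (ℓ 𝟚 ⊗ ((J 4 ^ 9) ⊘ ((J 1 ^ 6) ⊗ (J 8 ^ 2)))))
    × (GF (+ 4) 8 7 ≈ (ℓ 𝟚 ⊗ (((J 2 ^ 8) ⊗ (J 8 ^ 2)) ⊘ ((J 1 ^ 8) ⊗ J 4))))
  formulae generating =
      generating 0 2 1 (λ n → suc (double n)) 2n+1 5 T0-2-1 base0
    , generating 0 4 1 (λ n → suc (double (double n))) 4n+1 4 T0-4-1 (proj₁ dissect0-2-1)
    , generating 0 4 3 (λ n → suc (double (suc (double n)))) 4n+3 4 T0-4-3 (proj₂ dissect0-2-1)
    , generating 0 8 1 (λ n → suc (double (double (double n)))) 8n+1 3 T0-8-1 (proj₁ dissect0-4-1)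
    , generating 0 8 3 (λ n → suc (double (suc (double (double n))))) 8n+3 3 T0-8-3 (proj₁ dissect0-4-3)
    , generating 0 8 5 (λ n → suc (double (double (suc (double n))))) 8n+5 3 T0-8-5 (proj₂ dissect0-4-1)
    , generating 0 8 7 (λ n → suc (double (suc (double (suc (double n)))))) 8n+7 3 T0-8-7 (proj₂ dissect0-4-3)
    , generating 1 2 0 (λ n → double n) 2n+0 2 T1-2-0 base1
    , generating 1 4 0 (λ n → double (double n)) 4n+0 1 T1-4-0 (proj₁ dissect1-2-0)
    , generating 1 4 2 (λ n → double (suc (double n))) 4n+2 1 T1-4-2 (proj₂ dissect1-2-0)
    , generating 1 8 0 (λ n → double (double (double n))) 8n+0 0 T1-8-0 (proj₁ dissect1-4-0)
    , generating 1 8 2 (λ n → double (suc (double (double n)))) 8n+2 0 T1-8-2 (proj₁ dissect1-4-2)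
    , generating 1 8 4 (λ n → double (double (suc (double n)))) 8n+4 0 T1-8-4 (proj₂ dissect1-4-0)
    , generating 1 8 6 (λ n → double (suc (double (suc (double n))))) 8n+6 0 T1-8-6 (proj₂ dissect1-4-2)
    , generating 2 2 1 (λ n → suc (double n)) 2n+1 4 T2-2-1 base2
    , generating 2 4 1 (λ n → suc (double (double n))) 4n+1 3 T2-4-1 (proj₁ dissect2-2-1)
    , generating 2 4 3 (λ n → suc (double (suc (double n)))) 4n+3 3 T2-4-3 (proj₂ dissect2-2-1)
    , generating 2 8 1 (λ n → suc (double (double (double n)))) 8n+1 2 T2-8-1 (proj₁ dissect2-4-1)
    , generating 2 8 3 (λ n → suc (double (suc (double (double n))))) 8n+3 2 T2-8-3 (proj₁ dissect2-4-3)
    , generating 2 8 5 (λ n → suc (double (double (suc (double n))))) 8n+5 2 T2-8-5 (proj₂ dissect2-4-1)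
    , generating 2 8 7 (λ n → suc (double (suc (double (suc (double n)))))) 8n+7 2 T2-8-7 (proj₂ dissect2-4-3)
    , generating 3 2 0 (λ n → double n) 2n+0 2 T3-2-0 base3
    , generating 3 4 0 (λ n → double (double n)) 4n+0 1 T3-4-0 (proj₁ dissect3-2-0)
    , generating 3 4 2 (λ n → double (suc (double n))) 4n+2 1 T3-4-2 (proj₂ dissect3-2-0)
    , generating 3 8 0 (λ n → double (double (double n))) 8n+0 0 T3-8-0 (proj₁ dissect3-4-0)
    , generating 3 8 2 (λ n → double (suc (double (double n)))) 8n+2 0 T3-8-2 (proj₁ dissect3-4-2)
    , generating 3 8 4 (λ n → double (double (suc (double n)))) 8n+4 0 T3-8-4 (proj₂ dissect3-4-0)
    , generating 3 8 6 (λ n → double (suc (double (suc (double n))))) 8n+6 0 T3-8-6 (proj₂ dissect3-4-2)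
    , generating 4 2 1 (λ n → suc (double n)) 2n+1 6 T4-2-1 base4
    , generating 4 4 1 (λ n → suc (double (double n))) 4n+1 5 T4-4-1 (proj₁ dissect4-2-1)
    , generating 4 4 3 (λ n → suc (double (suc (double n)))) 4n+3 5 T4-4-3 (proj₂ dissect4-2-1)
    , generating 4 8 1 (λ n → suc (double (double (double n)))) 8n+1 4 T4-8-1 (proj₁ dissect4-4-1)
    , generating 4 8 3 (λ n → suc (double (suc (double (double n))))) 8n+3 4 T4-8-3 (proj₁ dissect4-4-3)
    , generating 4 8 5 (λ n → suc (double (double (suc (double n))))) 8n+5 4 T4-8-5 (proj₂ dissect4-4-1)
    , generating 4 8 7 (λ n → suc (double (suc (double (suc (double n)))))) 8n+7 4 T4-8-7 (proj₂ dissect4-4-3)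

open import Defs
open import Data.Rational using (½; 0ℚ)
open import Data.Integer using (+_)
open import Data.Product using (_×_)

theorem3p3 : (GF (+ 0) 2 1 ≈ neg (q^ 21 ⊗ g⁻ 32 64) ⊕ q^ 5 ⊗ J 32 ^ 8 ⊗ J 128 ^ 2 ⊘ (J 16 ^ 4 ⊗ J 64 ^ 5)
    ⊕ ℓ ¼ ⊗ (J 2 ^ 8 ⊗ J 8 ^ 2 ⊘ (J 1 ^ 4 ⊗ J 4 ^ 5)) ⊕ ℓ ¼ ⊗ (J 4 ^ 3 ⊘ J 2 ^ 2)
    ⊕ ℓ ½ ⊗ (J 2 ^ 5 ⊗ J 16 ⊘ (J 1 ^ 2 ⊗ J 4 ^ 2 ⊗ J 8))
    ⊖ ℓ ½ ⊗ q^ 1 ⊗ (J 8 ^ 8 ⊗ J 32 ^ 2 ⊘ (J 4 ^ 4 ⊗ J 16 ^ 5)) ⊖ ℓ ½ ⊗ q^ 1 ⊗ (J 16 ^ 3 ⊘ J 8 ^ 2))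
    × (GF (+ 0) 4 1 ≈ ℓ ¼ ⊗ (J 2 ^ 9 ⊘ (J 1 ^ 6 ⊗ J 4 ^ 2) ⊕ J 2 ^ 3 ⊘ J 1 ^ 2
    ⊕ ℓ 𝟚 ⊗ (J 4 ^ 4 ⊘ (J 8 ⊗ J 2 ^ 2))))
    × (GF (+ 0) 4 3 ≈ neg (q^ 10 ⊗ g⁻ 16 32) ⊕ q^ 2 ⊗ J 16 ^ 8 ⊗ J 64 ^ 2 ⊘ (J 8 ^ 4 ⊗ J 32 ^ 5)
    ⊕ ℓ ½ ⊗ (J 8 ^ 3 ⊘ J 4 ^ 2) ⊕ J 4 ^ 6 ⊘ (J 1 ^ 2 ⊗ J 2 ^ 3)
    ⊖ ℓ ½ ⊗ (J 4 ^ 8 ⊗ J 16 ^ 2 ⊘ (J 2 ^ 4 ⊗ J 8 ^ 5)))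
    × (GF (+ 0) 8 1 ≈ ℓ ½ ⊗ (J 2 ^ 4 ⊘ (J 1 ^ 2 ⊗ J 4)) ⊕ ℓ ¼ ⊗ (J 4 ^ 5 ⊘ (J 1 ^ 2 ⊗ J 8 ^ 2))
    ⊕ ℓ ¼ ⊗ (J 2 ^ 12 ⊗ J 4 ⊘ (J 1 ^ 10 ⊗ J 8 ^ 2))
    ⊕ ℓ 𝟚 ⊗ q^ 1 ⊗ (J 2 ^ 2 ⊗ J 4 ^ 3 ⊗ J 8 ^ 2 ⊘ J 1 ^ 6))
    × (GF (+ 0) 8 3 ≈ neg (q^ 5 ⊗ g⁻ 8 16) ⊕ q^ 1 ⊗ J 8 ^ 8 ⊗ J 32 ^ 2 ⊘ (J 4 ^ 4 ⊗ J 16 ^ 5)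
    ⊕ ℓ ½ ⊗ (J 4 ^ 3 ⊘ J 2 ^ 2) ⊖ ℓ ½ ⊗ (J 2 ^ 8 ⊗ J 8 ^ 2 ⊘ (J 1 ^ 4 ⊗ J 4 ^ 5))
    ⊕ J 2 ^ 6 ⊗ J 4 ^ 5 ⊘ (J 1 ^ 8 ⊗ J 8 ^ 2))
    × (GF (+ 0) 8 5 ≈ ℓ 𝟚 ⊗ (J 4 ^ 9 ⊘ (J 1 ^ 6 ⊗ J 8 ^ 2)))
    × (GF (+ 0) 8 7 ≈ ℓ 𝟚 ⊗ (J 2 ^ 8 ⊗ J 8 ^ 2 ⊘ (J 1 ^ 8 ⊗ J 4)))
    × (GF (+ 1) 2 0 ≈ ℓ 0ℚ ⊖ ℓ ¼ ⊕ ℓ ¼ ⊗ g⁻ 0 4 ⊕ ℓ ½ ⊗ q^ 4 ⊗ g⁺ 4 16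
    ⊕ ℓ ⅛ ⊗ (J 2 ^ 6 ⊗ J 4 ⊘ (J 1 ^ 4 ⊗ J 8 ^ 2)) ⊖ ℓ ¼ ⊗ (J 8 ^ 7 ⊘ (J 4 ^ 3 ⊗ J 16 ^ 3))
    ⊕ ℓ ¼ ⊗ (J 2 ^ 5 ⊗ J 8 ^ 2 ⊘ (J 1 ^ 2 ⊗ J 4 ^ 3 ⊗ J 16)))
    × (GF (+ 1) 4 0 ≈ ℓ 0ℚ ⊖ ℓ ¼ ⊕ ℓ ¼ ⊗ g⁻ 0 2 ⊕ ℓ ½ ⊗ q^ 2 ⊗ g⁺ 2 8
    ⊕ ℓ ⅛ ⊗ (J 2 ^ 15 ⊘ (J 1 ^ 8 ⊗ J 4 ^ 6)))
    × (GF (+ 1) 4 2 ≈ ℓ ½ ⊗ (J 2 ^ 3 ⊗ J 4 ^ 2 ⊘ J 1 ^ 4 ⊕ J 4 ⊗ J 8 ⊘ J 2))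
    × (GF (+ 1) 8 0 ≈ ℓ 0ℚ ⊖ ℓ ¼ ⊕ ℓ ¼ ⊗ g⁻ 0 1 ⊕ ℓ ½ ⊗ q^ 1 ⊗ g⁺ 1 4
    ⊕ ℓ ⅛ ⊗ (J 2 ^ 22 ⊘ (J 1 ^ 13 ⊗ J 4 ^ 8)) ⊕ ℓ 𝟚 ⊗ q^ 1 ⊗ (J 4 ^ 8 ⊘ (J 1 ^ 5 ⊗ J 2 ^ 2)))
    × (GF (+ 1) 8 2 ≈ ℓ ½ ⊗ (J 2 ^ 16 ⊘ (J 1 ^ 11 ⊗ J 4 ^ 4) ⊕ J 2 ⊗ J 4 ⊘ J 1))
    × (GF (+ 1) 8 4 ≈ J 2 ^ 10 ⊘ J 1 ^ 9)
    × (GF (+ 1) 8 6 ≈ ℓ 𝟚 ⊗ (J 2 ^ 4 ⊗ J 4 ^ 4 ⊘ J 1 ^ 7))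
    × (GF (+ 2) 2 1 ≈ ℓ 0ℚ ⊖ ℓ ½ ⊗ q⁻ 1 ⊕ ℓ ½ ⊗ q⁻ 1 ⊗ g⁻ 0 16
    ⊕ ℓ ¼ ⊗ q⁻ 1 ⊗ (J 8 ^ 6 ⊗ J 16 ⊘ (J 4 ^ 4 ⊗ J 32 ^ 2))
    ⊕ ℓ ¼ ⊗ (J 2 ^ 8 ⊗ J 8 ^ 2 ⊘ (J 4 ^ 5 ⊗ J 1 ^ 4)) ⊖ ℓ ¼ ⊗ (J 4 ^ 3 ⊘ J 2 ^ 2))
    × (GF (+ 2) 4 1 ≈ q^ 1 ⊗ J 2 ^ 4 ⊗ J 16 ^ 2 ⊘ (J 1 ^ 4 ⊗ J 8))
    × (GF (+ 2) 4 3 ≈ ℓ 0ℚ ⊖ ℓ ½ ⊗ q⁻ 1 ⊕ ℓ ½ ⊗ q⁻ 1 ⊗ g⁻ 0 8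
    ⊕ ℓ ¼ ⊗ q⁻ 1 ⊗ (J 4 ^ 6 ⊗ J 8 ⊘ (J 2 ^ 4 ⊗ J 16 ^ 2)) ⊕ J 4 ^ 6 ⊘ (J 1 ^ 2 ⊗ J 2 ^ 3))
    × (GF (+ 2) 8 1 ≈ ℓ 𝟚 ⊗ ℓ 𝟚 ⊗ q^ 1 ⊗ (J 2 ^ 2 ⊗ J 4 ^ 3 ⊗ J 8 ^ 2 ⊘ J 1 ^ 6))
    × (GF (+ 2) 8 3 ≈ J 2 ^ 6 ⊗ J 4 ^ 5 ⊘ (J 1 ^ 8 ⊗ J 8 ^ 2))
    × (GF (+ 2) 8 5 ≈ J 2 ^ 14 ⊗ J 8 ^ 2 ⊘ (J 1 ^ 10 ⊗ J 4 ^ 5))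
    × (GF (+ 2) 8 7 ≈ ℓ 0ℚ ⊖ ℓ ½ ⊗ q⁻ 1 ⊕ ℓ ½ ⊗ q⁻ 1 ⊗ g⁻ 0 4
    ⊕ ℓ ¼ ⊗ q⁻ 1 ⊗ (J 2 ^ 6 ⊗ J 4 ⊘ (J 1 ^ 4 ⊗ J 8 ^ 2)) ⊕ ℓ 𝟚 ⊗ (J 2 ^ 8 ⊗ J 8 ^ 2 ⊘ (J 1 ^ 8 ⊗ J 4)))
    × (GF (+ 3) 2 0 ≈ ℓ 0ℚ ⊖ ℓ ¼ ⊕ ℓ ¼ ⊗ g⁻ 0 4 ⊖ ℓ ½ ⊗ q^ 4 ⊗ g⁺ 4 16
    ⊕ ℓ ¼ ⊗ (J 8 ^ 7 ⊘ (J 4 ^ 3 ⊗ J 16 ^ 3)) ⊖ ℓ ¼ ⊗ (J 2 ^ 5 ⊗ J 8 ^ 2 ⊘ (J 1 ^ 2 ⊗ J 4 ^ 3 ⊗ J 16))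
    ⊕ ℓ ⅛ ⊗ (J 2 ^ 6 ⊗ J 4 ⊘ (J 1 ^ 4 ⊗ J 8 ^ 2)))
    × (GF (+ 3) 4 0 ≈ ℓ 0ℚ ⊖ ℓ ¼ ⊕ ℓ ¼ ⊗ g⁻ 0 2 ⊖ ℓ ½ ⊗ q^ 2 ⊗ g⁺ 2 8
    ⊕ ℓ ¼ ⊗ (J 4 ^ 7 ⊘ (J 2 ^ 3 ⊗ J 8 ^ 3)) ⊖ ℓ ¼ ⊗ (J 4 ^ 7 ⊘ (J 2 ^ 3 ⊗ J 8 ^ 3))
    ⊕ ℓ ⅛ ⊗ (J 2 ^ 15 ⊘ (J 4 ^ 6 ⊗ J 1 ^ 8)))
    × (GF (+ 3) 4 2 ≈ ℓ ½ ⊗ (J 2 ^ 3 ⊗ J 4 ^ 2 ⊘ J 1 ^ 4 ⊖ J 4 ⊗ J 8 ⊘ J 2))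
    × (GF (+ 3) 8 0 ≈ ℓ 0ℚ ⊖ ℓ ¼ ⊕ ℓ ¼ ⊗ g⁻ 0 1 ⊖ ℓ ½ ⊗ q^ 1 ⊗ g⁺ 1 4
    ⊕ ℓ ⅛ ⊗ (J 2 ^ 22 ⊘ (J 1 ^ 13 ⊗ J 4 ^ 8)) ⊕ ℓ 𝟚 ⊗ q^ 1 ⊗ (J 4 ^ 8 ⊘ (J 1 ^ 5 ⊗ J 2 ^ 2)))
    × (GF (+ 3) 8 2 ≈ ℓ ½ ⊗ (J 2 ^ 16 ⊘ (J 1 ^ 11 ⊗ J 4 ^ 4) ⊖ J 2 ⊗ J 4 ⊘ J 1))
    × (GF (+ 3) 8 4 ≈ J 2 ^ 10 ⊘ J 1 ^ 9)
    × (GF (+ 3) 8 6 ≈ ℓ 𝟚 ⊗ (J 2 ^ 4 ⊗ J 4 ^ 4 ⊘ J 1 ^ 7))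
    × (GF (+ 4) 2 1 ≈ q⁻ 3 ⊖ q⁻ 3 ⊗ g⁻ 0 64 ⊖ ℓ ½ ⊗ q⁻ 3 ⊗ (J 32 ^ 6 ⊗ J 64 ⊘ (J 16 ^ 4 ⊗ J 128 ^ 2))
    ⊕ ℓ ¼ ⊗ (J 2 ^ 8 ⊗ J 8 ^ 2 ⊘ (J 1 ^ 4 ⊗ J 4 ^ 5)
    ⊖ ℓ 𝟚 ⊗ (J 2 ^ 5 ⊗ J 16 ⊘ (J 1 ^ 2 ⊗ J 4 ^ 2 ⊗ J 8)) ⊕ J 4 ^ 3 ⊘ J 2 ^ 2)
    ⊕ ℓ ½ ⊗ q^ 1 ⊗ (J 16 ^ 3 ⊘ J 8 ^ 2 ⊖ J 8 ^ 8 ⊗ J 32 ^ 2 ⊘ (J 4 ^ 4 ⊗ J 16 ^ 5)))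
    × (GF (+ 4) 4 1 ≈ ℓ ¼ ⊗ (J 2 ^ 9 ⊘ (J 1 ^ 6 ⊗ J 4 ^ 2) ⊖ ℓ 𝟚 ⊗ (J 4 ^ 4 ⊘ (J 2 ^ 2 ⊗ J 8))
    ⊕ J 2 ^ 3 ⊘ J 1 ^ 2))
    × (GF (+ 4) 4 3 ≈ q⁻ 2 ⊖ q⁻ 2 ⊗ g⁻ 0 32 ⊖ ℓ ½ ⊗ q⁻ 2 ⊗ (J 16 ^ 6 ⊗ J 32 ⊘ (J 8 ^ 4 ⊗ J 64 ^ 2))
    ⊖ ℓ ½ ⊗ (J 8 ^ 3 ⊘ J 4 ^ 2) ⊖ ℓ ½ ⊗ (J 4 ^ 8 ⊗ J 16 ^ 2 ⊘ (J 2 ^ 4 ⊗ J 8 ^ 5))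
    ⊕ J 4 ^ 6 ⊘ (J 2 ^ 3 ⊗ J 1 ^ 2))
    × (GF (+ 4) 8 1 ≈ ℓ ¼ ⊗ (J 2 ^ 12 ⊗ J 4 ⊘ (J 1 ^ 10 ⊗ J 8 ^ 2))
    ⊕ ℓ 𝟚 ⊗ q^ 1 ⊗ (J 2 ^ 2 ⊗ J 4 ^ 3 ⊗ J 8 ^ 2 ⊘ J 1 ^ 6)
    ⊖ ℓ ½ ⊗ (J 2 ^ 4 ⊘ (J 1 ^ 2 ⊗ J 4)) ⊕ ℓ ¼ ⊗ (J 4 ^ 5 ⊘ (J 1 ^ 2 ⊗ J 8 ^ 2)))
    × (GF (+ 4) 8 3 ≈ q⁻ 1 ⊖ q⁻ 1 ⊗ g⁻ 0 16 ⊖ ℓ ½ ⊗ q⁻ 1 ⊗ (J 8 ^ 6 ⊗ J 16 ⊘ (J 4 ^ 4 ⊗ J 32 ^ 2))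
    ⊖ ℓ ½ ⊗ (J 4 ^ 3 ⊘ J 2 ^ 2) ⊖ ℓ ½ ⊗ (J 2 ^ 8 ⊗ J 8 ^ 2 ⊘ (J 1 ^ 4 ⊗ J 4 ^ 5))
    ⊕ J 2 ^ 6 ⊗ J 4 ^ 5 ⊘ (J 1 ^ 8 ⊗ J 8 ^ 2))
    × (GF (+ 4) 8 5 ≈ ℓ 𝟚 ⊗ (J 4 ^ 9 ⊘ (J 1 ^ 6 ⊗ J 8 ^ 2)))
    × (GF (+ 4) 8 7 ≈ ℓ 𝟚 ⊗ (J 2 ^ 8 ⊗ J 8 ^ 2 ⊘ (J 1 ^ 8 ⊗ J 4)))
theorem3p3 = Formulae.formulae ℓ q^ q⁻ J g⁻ g⁺ _⊕_ _⊖_ _⊗_ _⊘_ _^_ neg GF _≈_ Generating.generating
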